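{- There is a randomized algorithm that, given cut-query access to a simple graph $G$ on $n$ vertices, makes $O(n)$ cut queries and outputs the edge connectivity $\lambda(G)$ with probability at least $2/3$.
   Context: A simple graph is an undirected, unweighted graph $G=(V,E)$ with no loops and at most one edge between any pair of vertices; $n=|V|$. For $S\subseteq V$, $\mathrm{cut}_G(S)$ is the set of edges with exactly one endpoint in $S$. A cut query specifies a set $S\subseteq V$ and returns $|\mathrm{cut}_G(S)|$. The edge connectivity is $\lambda(G)=\min_{\emptyset\neq S\subsetneq V}|\mathrm{cut}_G(S)|$. Complexity is measured only by the number of cut queries. -}

module Defs where

open import Data.Nat using (ℕ; zero; suc; _≤_)
open import Data.Bool using (Bool; true; false; _∧_; not; if_then_else_)
open import Data.Fin using (Fin)
open import Data.List using (List; map; allFin)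
open import Data.Nat.ListAction using (sum)
open import Data.Vec using (lookup)
open import Data.Fin.Subset using (Subset; Nonempty; _∈_; _∉_)
open import Data.Product using (∃; _×_)
open import Relation.Binary.PropositionalEquality using (_≡_)

record SimpleGraph (n : ℕ) : Set where
  field
    adj    : Fin n → Fin n → Bool
    sym    : ∀ i j → adj i j ≡ adj j i
    irrefl : ∀ i → adj i i ≡ false
open SimpleGraph public

-- |cut_G(S)| : number of edges {i,j} with i ∈ S and j ∉ S
-- (each crossing edge is counted exactly once, via its endpoint in S).
cutSize : ∀ {n} → SimpleGraph n → Subset n → ℕ
cutSize {n} G S =
  sum (map (λ i → sum (map (λ j →
        if adj G i j ∧ lookup S i ∧ not (lookup S j) then 1 else 0)
      (allFin n))) (allFin n))

NonemptyProper : ∀ {n} → Subset n → Set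
NonemptyProper S = Nonempty S × ∃ (λ x → x ∉ S)

IsEdgeConnectivity : ∀ {n} → SimpleGraph n → ℕ → Set
IsEdgeConnectivity G k =
  ∃ (λ S → NonemptyProper S × cutSize G S ≡ k)
  × (∀ S → NonemptyProper S → k ≤ cutSize G S)

-- Deterministic adaptive cut-query algorithm (decision tree): either output
-- a number, or ask a cut query S and continue depending on the answer.
data QTree (n : ℕ) : Set where
  leaf  : ℕ → QTree n
  query : Subset n → (ℕ → QTree n) → QTree n

data DepthAtMost {n : ℕ} : QTree n → ℕ → Set where
  leaf≤  : ∀ {x d} → DepthAtMost (leaf x) d
  query≤ : ∀ {S k d} → (∀ a → DepthAtMost (k a) d) → DepthAtMost (query S k) (suc d)

run : ∀ {n} → SimpleGraph n → QTree n → ℕ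
run G (leaf x)    = x
run G (query S k) = run G (k (cutSize G S))

{-# OPTIONS --safe #-}
-- The minimum degree δ is known after n queries. If it is not the edge connectivity, fix a
-- minimum cut: its size is less than δ, and every vertex has at least half of its neighbours
-- on its own side, since otherwise moving that vertex would give a smaller cut.
--
-- Contract at random: in each step a uniform vertex w absorbs a uniform random half H of the
-- clusters adjacent to it. First w only absorbs vertices that are still untouched; after about n
-- steps this leaves O(n/δ) clusters. Then w absorbs arbitrary clusters; after about n/δ further
-- steps only O(n) pairs (vertex, adjacent cluster) remain, and these are learned, so that the
-- smallest cut among the unions of clusters is found without further queries.
--
-- The analysis conditions each H to avoid the clusters that w reaches across the fixed cut. The
-- conditioned walk never merges across the cut, and the likelihood ratio 2^(number of avoided
-- clusters) has a constant expected exponent: the cut has at most 2δ edge ends, each of which is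
-- met in a 1/n fraction of the steps and, in the first phase, only while its end is untouched.
-- Potential functions give an O(n) bound on the expected number of pairs to be learned, so Markov's
-- inequality yields a constant success probability for the original walk. Independent repetitions,
-- of which the smallest cut value queried is returned, raise it to 2/3.
--
-- Steps are processed in batches of doubling length, and the rows of a batch are learned together
-- from the clusters at its start. A nonnegative n × n matrix with M nonzero entries is learned
-- from O(M + b³) rectangle sums, where b = O(n^(1/16)), by queries that detect every difference of
-- two candidates: their existence follows from the Littlewood–Offord inequality, conditional
-- expectations and a union bound. A rectangle sum costs four cut queries.

module Submission where

open import Defs using (SimpleGraph; cutSize; NonemptyProper; IsEdgeConnectivity; QTree; leaf; query; DepthAtMost; leaf≤; query≤; run)
open import Data.Bool using (Bool; true; false; not; T; if_then_else_; _∧_; _∨_; _xor_)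
import Data.Bool.Properties as Bool
open import Data.Empty using (⊥; ⊥-elim)
open import Data.Fin using (Fin; zero; suc; fromℕ<; combine; remQuot; _↑ˡ_; _↑ʳ_)
open import Data.Fin.Properties using (all?; any?)
import Data.Fin.Properties as Fin
open import Data.Fin.Subset using (Subset; ∣_∣; _∈_)
open import Data.Integer using (ℤ; 0ℤ; 1ℤ; -[1+_]; +0; +[1+_]) renaming (∣_∣ to ∣_∣ᶻ)
import Data.Integer as ℤ
import Data.Integer.DivMod as ℤ
import Data.Integer.Properties as ℤ
import Data.Integer.Tactic.RingSolver as ℤR
open import Data.List using (List; []; _∷_; map; _++_; length; allFin; upTo; concatMap) renaming (lookup to lookupˡ)
open import Data.List.Extrema.Nat using (argmin; f[argmin]≤f[xs])
open import Data.List.Membership.Propositional using () renaming (_∈_ to _∈ˡ_)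
open import Data.List.Membership.Propositional.Properties using (∈-++⁺ˡ; ∈-++⁺ʳ; ∈-map⁺; ∈-upTo⁺; ∈-concatMap⁺; ∈-allFin)
import Data.List.Properties as List
open import Data.List.Relation.Unary.All using (All) renaming ([] to []ᴬ; _∷_ to _∷ᴬ_)
import Data.List.Relation.Unary.All as All
import Data.List.Relation.Unary.All.Properties as All
open import Data.List.Relation.Unary.AllPairs using (AllPairs) renaming ([] to []ᴾ; _∷_ to _∷ᴾ_)
import Data.List.Relation.Unary.AllPairs as AP
import Data.List.Relation.Unary.AllPairs.Properties as AP
open import Data.List.Relation.Unary.Any using (here; there)
import Data.List.Relation.Unary.Any as Any
open import Data.Maybe using (Maybe; just; nothing)
open import Data.Nat
open import Data.Nat.Base using (_!)
open import Data.Nat.Combinatorics using (nCk+nC[k+1]≡[n+1]C[k+1]; k>n⇒nCk≡0; nCk≡n!/k![n-k]!; k![n∸k]!∣n!) renaming (_C_ to _choose_)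
open import Data.Nat.DivMod using (_/_; _%_; m/n*n≡m; m*n/n≡m; m≡m%n+[m/n]*n; m%n<n; m/n*n≤m)
open import Data.Nat.ListAction using (sum)
open import Data.Nat.Properties
open import Data.Nat.Tactic.RingSolver using (solve-∀)
open import Data.Product using (Σ; ∃; ∃-syntax; _×_; _,_; proj₁; proj₂; swap)
open import Data.Sum using (_⊎_; inj₁; inj₂)
open import Data.Vec using (Vec; lookup; tabulate; replicate) renaming ([] to []ᵛ; _∷_ to _∷ᵛ_)
open import Data.Vec.Properties using (lookup∘tabulate; lookup-replicate; tabulate-cong; []=⇒lookup; lookup⇒[]=)
open import Function using (_∘_; id)
open import Relation.Binary.PropositionalEquality hiding (J)
open import Relation.Nullary using (¬_; Dec; yes; no; does)
open import Relation.Nullary.Decidable using (_×-dec_; _→-dec_)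

-- Finite sums

-- No logarithm may be lost, yet every call of the matrix learner costs an additive `b³` besides its
-- output. Hence rows are not learned step by step: `2^e` steps take only `e + 1` calls, whose
-- overhead sums to `O(n)`. A batch is charged to the state at its start; the bound on this charge
-- never increases along the conditioned walk, so a batch as long as all its predecessors together
-- costs only a constant factor. Since each adjacent cluster enters `H` with probability 1/2,
-- avoiding `k` given clusters costs exactly a factor `2^k`, while all others are still absorbed
-- with probability 1/2. One Markov bound, for the support plus `n` times the exponent, controls
-- cost and likelihood ratio together. Expectations are unnormalized sums of natural numbers: powers
-- replace roots, and factors such as `δ` and `2^n` are carried along instead of being divided by.
-- Successful trials stay within a linear budget, so truncation yields a worst-case bound. Every
-- value returned is the size of an actual cut, so errors are one-sided.

⟦_⟧ : Bool → ℕ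
⟦ b ⟧ = if b then 1 else 0

∑ : {A : Set} → List A → (A → ℕ) → ℕ
∑ []       f = 0
∑ (x ∷ xs) f = f x + ∑ xs f

sum-map : {A : Set} (xs : List A) (f : A → ℕ) → sum (map f xs) ≡ ∑ xs f
sum-map []       f = refl
sum-map (x ∷ xs) f = cong (f x +_) (sum-map xs f)

module _ {A : Set} where

  ∑-cong : (xs : List A) {f g : A → ℕ} → (∀ x → f x ≡ g x) → ∑ xs f ≡ ∑ xs g
  ∑-cong []       e = refl
  ∑-cong (x ∷ xs) e = cong₂ _+_ (e x) (∑-cong xs e)

  ∑-mono : (xs : List A) {f g : A → ℕ} → (∀ x → f x ≤ g x) → ∑ xs f ≤ ∑ xs g
  ∑-mono []       e = z≤n
  ∑-mono (x ∷ xs) e = +-mono-≤ (e x) (∑-mono xs e)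

  ∑-+ : (xs : List A) (f g : A → ℕ) → ∑ xs (λ x → f x + g x) ≡ ∑ xs f + ∑ xs g
  ∑-+ []       f g = refl
  ∑-+ (x ∷ xs) f g rewrite ∑-+ xs f g = arr (f x) (g x) (∑ xs f) (∑ xs g)
    where
    arr : ∀ a b c d → a + b + (c + d) ≡ a + c + (b + d)
    arr = solve-∀

  ∑-*ˡ : (xs : List A) (c : ℕ) (f : A → ℕ) → ∑ xs (λ x → c * f x) ≡ c * ∑ xs f
  ∑-*ˡ []       c f = sym (*-zeroʳ c)
  ∑-*ˡ (x ∷ xs) c f rewrite ∑-*ˡ xs c f = sym (*-distribˡ-+ c (f x) _)

  ∑-*ʳ : (xs : List A) (c : ℕ) (f : A → ℕ) → ∑ xs (λ x → f x * c) ≡ ∑ xs f * c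
  ∑-*ʳ xs c f = trans (∑-cong xs (λ x → *-comm (f x) c)) (trans (∑-*ˡ xs c f) (*-comm c _))

  ∑-const : (xs : List A) (c : ℕ) → ∑ xs (λ _ → c) ≡ length xs * c
  ∑-const []       c = refl
  ∑-const (x ∷ xs) c = cong (c +_) (∑-const xs c)

  ∑-zero : (xs : List A) → ∑ xs (λ _ → 0) ≡ 0
  ∑-zero xs = trans (∑-const xs 0) (*-zeroʳ (length xs))

  ∑-++ : (xs ys : List A) (f : A → ℕ) → ∑ (xs ++ ys) f ≡ ∑ xs f + ∑ ys f
  ∑-++ []       ys f = refl
  ∑-++ (x ∷ xs) ys f rewrite ∑-++ xs ys f = sym (+-assoc (f x) _ _)

  ∑-pick : {xs : List A} {x : A} (f : A → ℕ) → x ∈ˡ xs → f x ≤ ∑ xs f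
  ∑-pick f (here refl) = m≤m+n _ _
  ∑-pick f (there m)   = ≤-trans (∑-pick f m) (m≤n+m _ _)

  ∑-∃ : (xs : List A) (f g : A → ℕ) → ∑ xs f < ∑ xs g → ∃ λ x → x ∈ˡ xs × f x < g x
  ∑-∃ []       f g ()
  ∑-∃ (x ∷ xs) f g lt with f x <? g x
  ... | yes p = x , here refl , p
  ... | no ¬p with ∑-∃ xs f g (+-cancelˡ-< (f x) _ _ (<-≤-trans lt (+-monoˡ-≤ _ (≮⇒≥ ¬p))))
  ...   | y , m , p = y , there m , p

  ∑-∃≤ : (xs : List A) (f g : A → ℕ) → 0 < length xs → ∑ xs f ≤ ∑ xs g → ∃ λ x → x ∈ˡ xs × f x ≤ g x
  ∑-∃≤ xs f g ne le with ∑-∃ xs f (λ x → suc (g x)) lt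
    where
    lt : ∑ xs f < ∑ xs (λ x → suc (g x))
    lt = <-≤-trans (s≤s le) (≤-trans (+-monoˡ-≤ (∑ xs g) (≤-trans ne (≤-reflexive (sym (trans (∑-const xs 1) (*-identityʳ _))))))
           (≤-reflexive (sym (∑-+ xs (λ _ → 1) g))))
  ... | x , m , p = x , m , s≤s⁻¹ p

  ∑-mono∈ : (xs : List A) {f g : A → ℕ} → (∀ {x} → x ∈ˡ xs → f x ≤ g x) → ∑ xs f ≤ ∑ xs g
  ∑-mono∈ []       e = z≤n
  ∑-mono∈ (x ∷ xs) e = +-mono-≤ (e (here refl)) (∑-mono∈ xs (e ∘ there))

  ∑≡0 : {xs : List A} {x : A} (f : A → ℕ) → ∑ xs f ≡ 0 → x ∈ˡ xs → f x ≡ 0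
  ∑≡0 f e m = n≤0⇒n≡0 (≤-trans (∑-pick f m) (≤-reflexive e))

∑-map : {A B : Set} (h : A → B) (xs : List A) (f : B → ℕ) → ∑ (map h xs) f ≡ ∑ xs (f ∘ h)
∑-map h []       f = refl
∑-map h (x ∷ xs) f = cong (f (h x) +_) (∑-map h xs f)

∑-concatMap : {A B : Set} (h : A → List B) (xs : List A) (f : B → ℕ) →
              ∑ (concatMap h xs) f ≡ ∑ xs (λ x → ∑ (h x) f)
∑-concatMap h []       f = refl
∑-concatMap h (x ∷ xs) f = trans (∑-++ (h x) _ f) (cong (∑ (h x) f +_) (∑-concatMap h xs f))

∑-swap : {A B : Set} (xs : List A) (ys : List B) (f : A → B → ℕ) →
         ∑ xs (λ x → ∑ ys (f x)) ≡ ∑ ys (λ y → ∑ xs (λ x → f x y))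
∑-swap []       ys f = sym (∑-zero ys)
∑-swap (x ∷ xs) ys f rewrite ∑-swap xs ys f = sym (∑-+ ys (f x) _)

fins : ∀ n → List (Fin n)
fins = allFin

∑-suc : ∀ n (f : Fin (suc n) → ℕ) → ∑ (fins (suc n)) f ≡ f zero + ∑ (fins n) (f ∘ suc)
∑-suc n f = cong (f zero +_) (trans (cong (λ l → ∑ l f) (sym (List.map-tabulate id suc))) (∑-map suc (fins n) f))

length-fins : ∀ n → length (fins n) ≡ n
length-fins n = List.length-tabulate id

∑ᶠ-const : ∀ n c → ∑ (fins n) (λ _ → c) ≡ n * c
∑ᶠ-const n c = trans (∑-const (fins n) c) (cong (_* c) (length-fins n))

∑-pickᶠ : ∀ {n} (f : Fin n → ℕ) i → f i ≤ ∑ (fins n) f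
∑-pickᶠ f i = ∑-pick f (∈-allFin i)

_==_ : ∀ {n} → Fin n → Fin n → Bool
i == j = does (i Fin.≟ j)

==-refl : ∀ {n} (i : Fin n) → (i == i) ≡ true
==-refl i with i Fin.≟ i
... | yes _ = refl
... | no ¬p = ⊥-elim (¬p refl)

==⇒≡ : ∀ {n} {i j : Fin n} → (i == j) ≡ true → i ≡ j
==⇒≡ {i = i} {j} e with i Fin.≟ j
... | yes p = p
==⇒≡ () | no _

≢⇒== : ∀ {n} {i j : Fin n} → i ≢ j → (i == j) ≡ false
≢⇒== {i = i} {j} ne with i Fin.≟ j
... | yes p = ⊥-elim (ne p)
... | no _  = refl

suc-== : ∀ {n} (i j : Fin n) → (suc i == suc j) ≡ (i == j)
suc-== i j with i Fin.≟ j
... | yes p = refl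
... | no  p = refl

∑-δ : ∀ {n} (i : Fin n) (f : Fin n → ℕ) → ∑ (fins n) (λ j → ⟦ i == j ⟧ * f j) ≡ f i
∑-δ {suc n} zero f = trans (∑-suc n (λ j → ⟦ zero == j ⟧ * f j)) (trans (cong₂ _+_ (+-identityʳ (f zero)) (∑-zero (fins n))) (+-identityʳ _))
∑-δ {suc n} (suc i) f = trans (∑-suc n (λ j → ⟦ suc i == j ⟧ * f j)) (trans (∑-cong (fins n) (λ j → cong (λ b → ⟦ b ⟧ * f (suc j)) (suc-== i j))) (∑-δ i (f ∘ suc)))

subsets : ∀ n → List (Subset n)
subsets zero    = []ᵛ ∷ []
subsets (suc n) = map (true ∷ᵛ_) (subsets n) ++ map (false ∷ᵛ_) (subsets n)

∑-subsets : ∀ n (f : Subset (suc n) → ℕ) →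
            ∑ (subsets (suc n)) f ≡ ∑ (subsets n) (f ∘ (true ∷ᵛ_)) + ∑ (subsets n) (f ∘ (false ∷ᵛ_))
∑-subsets n f = trans (∑-++ (map (true ∷ᵛ_) (subsets n)) _ f)
                      (cong₂ _+_ (∑-map (true ∷ᵛ_) (subsets n) f) (∑-map (false ∷ᵛ_) (subsets n) f))

length-subsets : ∀ n → length (subsets n) ≡ 2 ^ n
length-subsets zero    = refl
length-subsets (suc n) rewrite List.length-++ (map (true ∷ᵛ_) (subsets n)) {map (false ∷ᵛ_) (subsets n)}
  | List.length-map (true ∷ᵛ_) (subsets n) | List.length-map (false ∷ᵛ_) (subsets n)
  | length-subsets n | +-identityʳ (2 ^ n) = refl

∈-subsets : ∀ {n} (S : Subset n) → S ∈ˡ subsets n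
∈-subsets []ᵛ          = here refl
∈-subsets (true ∷ᵛ S)  = ∈-++⁺ˡ (∈-map⁺ (true ∷ᵛ_) (∈-subsets S))
∈-subsets (false ∷ᵛ S) = ∈-++⁺ʳ _ (∈-map⁺ (false ∷ᵛ_) (∈-subsets S))

⟦⟧≤1 : ∀ b → ⟦ b ⟧ ≤ 1
⟦⟧≤1 true  = ≤-refl
⟦⟧≤1 false = z≤n

⟦∧⟧ : ∀ a b → ⟦ a ∧ b ⟧ ≡ ⟦ a ⟧ * ⟦ b ⟧
⟦∧⟧ true  b = sym (+-identityʳ _)
⟦∧⟧ false b = refl

-- The Littlewood–Offord inequality

_≡ᶻ_ : ℤ → ℤ → Bool
x ≡ᶻ y = does (x ℤ.≟ y)

≡ᶻ-cong⇔ : ∀ {x y u v} → (x ≡ y → u ≡ v) → (u ≡ v → x ≡ y) → (x ≡ᶻ y) ≡ (u ≡ᶻ v)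
≡ᶻ-cong⇔ {x} {y} {u} {v} f g with x ℤ.≟ y | u ℤ.≟ v
... | yes _ | yes _ = refl
... | no _  | no _  = refl
... | yes p | no q  = ⊥-elim (q (f p))
... | no p  | yes q = ⊥-elim (p (g q))

dot : ∀ {r} → (Fin r → ℤ) → Subset r → ℤ
dot a []ᵛ      = 0ℤ
dot a (b ∷ᵛ A) = (if b then a zero else 0ℤ) ℤ.+ dot (a ∘ suc) A

cnt : ∀ {r} → (Fin r → ℤ) → ℤ → ℕ
cnt {r} a v = ∑ (subsets r) (λ A → ⟦ dot a A ≡ᶻ v ⟧)

isNZ : ℤ → Bool
isNZ z = not (z ≡ᶻ 0ℤ)

nz : ∀ {r} → (Fin r → ℤ) → ℕ
nz {r} a = ∑ (fins r) (λ i → ⟦ isNZ (a i) ⟧)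

cnt-suc : ∀ {r} (a : Fin (suc r) → ℤ) v → cnt a v ≡ cnt (a ∘ suc) (v ℤ.- a zero) + cnt (a ∘ suc) v
cnt-suc {r} a v = trans (∑-subsets r _)
  (cong₂ _+_ (∑-cong (subsets r) (λ A → cong ⟦_⟧ (≡ᶻ-cong⇔ (λ e → trans (sym (r₁ (a zero) (dot (a ∘ suc) A))) (cong (ℤ._- a zero) e))
                                                    (λ e → trans (cong (λ x → a zero ℤ.+ x) e) (r₂ (a zero) v)))))
             (∑-cong (subsets r) (λ A → cong (λ x → ⟦ x ≡ᶻ v ⟧) (ℤ.+-identityˡ (dot (a ∘ suc) A)))))
  where
  r₁ : ∀ x y → x ℤ.+ y ℤ.- x ≡ y
  r₁ = ℤR.solve-∀
  r₂ : ∀ x y → x ℤ.+ (y ℤ.- x) ≡ y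
  r₂ = ℤR.solve-∀

Increasing : List ℤ → Set
Increasing = AllPairs ℤ._<_

-- The numbers of the k largest binomial coefficients C(t,·) satisfy this recursion.
largest : ℕ → ℕ → ℕ
largest zero    zero    = 0
largest zero    (suc k) = 1
largest (suc t) zero    = 0
largest (suc t) (suc k) = largest t (suc (suc k)) + largest t k

hits≤1 : ∀ x {V} → Increasing V → ∑ V (λ v → ⟦ x ≡ᶻ v ⟧) ≤ 1
hits≤1 x []ᴾ = z≤n
hits≤1 x {v ∷ V} (v< ∷ᴾ inc) with x ℤ.≟ v
... | no _ = hits≤1 x inc
... | yes refl = ≤-reflexive (cong suc (none v<))
  where
  none : ∀ {W} → All (x ℤ.<_) W → ∑ W (λ v → ⟦ x ≡ᶻ v ⟧) ≡ 0
  none []ᴬ = refl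
  none {w ∷ W} (p ∷ᴬ ps) with x ℤ.≟ w
  ... | yes refl = ⊥-elim (ℤ.<-irrefl refl p)
  ... | no _ = none ps

total≤ : ∀ {r} (a : Fin r → ℤ) {V} → Increasing V → ∑ V (cnt a) ≤ 2 ^ r * largest 0 (length V)
total≤ {r} a []ᴾ = z≤n
total≤ {r} a {v ∷ V} inc = begin
  ∑ (v ∷ V) (cnt a)                                             ≡⟨ ∑-swap (v ∷ V) (subsets r) _ ⟩
  ∑ (subsets r) (λ A → ∑ (v ∷ V) (λ w → ⟦ dot a A ≡ᶻ w ⟧))      ≤⟨ ∑-mono (subsets r) (λ A → hits≤1 (dot a A) inc) ⟩
  ∑ (subsets r) (λ _ → 1)                                       ≡⟨ ∑-const (subsets r) 1 ⟩
  length (subsets r) * 1                                        ≡⟨ cong (_* 1) (length-subsets r) ⟩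
  2 ^ r * 1 ∎
  where open ≤-Reasoning

shift : ℤ → List ℤ → List ℤ
shift c = map (ℤ._- c)

shift-inc : ∀ c {V} → Increasing V → Increasing (shift c V)
shift-inc c inc = AP.map⁺ (AP.map (λ {x} {y} → ℤ.+-monoˡ-< (ℤ.- c)) inc)

below : ∀ v c → 0ℤ ℤ.< c → v ℤ.- c ℤ.< v
below v c p = subst (v ℤ.- c ℤ.<_) (ℤ.+-identityʳ v) (ℤ.+-monoʳ-< v (ℤ.neg-mono-< p))

module _ (r : ℕ) (g : ℤ → ℕ) (c : ℤ) (c>0 : 0ℤ ℤ.< c) (t : ℕ)
         (ih : ∀ {V} → Increasing V → 2 ^ t * ∑ V g ≤ 2 ^ r * largest t (length V)) where

  -- Of the targets V and V - c, the least element of V - c is moved over to V.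
  exchange : ∀ {V} → Increasing V → 2 ^ suc t * (∑ (shift c V) g + ∑ V g) ≤ 2 ^ suc r * largest (suc t) (length V)
  exchange []ᴾ = ≤-reflexive (trans (*-zeroʳ (2 ^ suc t)) (sym (*-zeroʳ (2 ^ suc r))))
  exchange {v ∷ V} (v< ∷ᴾ inc) = begin
    2 ^ suc t * (g (v ℤ.- c) + ∑ (shift c V) g + ∑ (v ∷ V) g)
      ≡⟨ arr (2 ^ t) (g (v ℤ.- c)) (∑ (shift c V) g) (∑ (v ∷ V) g) ⟩
    2 * (2 ^ t * ∑ (v ℤ.- c ∷ v ∷ V) g + 2 ^ t * ∑ (shift c V) g)
      ≤⟨ *-monoʳ-≤ 2 (+-mono-≤ (ih ((below v c c>0 ∷ᴬ All.map (ℤ.<-trans (below v c c>0)) v<) ∷ᴾ v< ∷ᴾ inc)) (ih (shift-inc c inc))) ⟩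
    2 * (2 ^ r * largest t (suc (suc (length V))) + 2 ^ r * largest t (length (shift c V)))
      ≡⟨ cong (λ l → 2 * (2 ^ r * largest t (suc (suc (length V))) + 2 ^ r * largest t l)) (List.length-map _ V) ⟩
    2 * (2 ^ r * largest t (suc (suc (length V))) + 2 ^ r * largest t (length V))
      ≡⟨ arr′ (2 ^ r) (largest t (suc (suc (length V)))) (largest t (length V)) ⟩
    2 ^ suc r * largest (suc t) (length (v ∷ V)) ∎
    where
    open ≤-Reasoning
    arr : ∀ p x y z → (p + (p + 0)) * (x + y + z) ≡ 2 * (p * (x + z) + p * y)
    arr = solve-∀
    arr′ : ∀ p x y → 2 * (p * x + p * y) ≡ (p + (p + 0)) * (x + y)
    arr′ = solve-∀

-- Induction on the coefficients. A zero coefficient doubles the count. A nonzero one splits the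
-- count for `V` into counts for `V` and a shifted copy, which `exchange` turns into target lists of
-- lengths one more and one less, as in the recursion of `largest`. The applications have the single
-- target 0; lists are there because the induction does not stay with a single target.
littlewood-offord : ∀ {r} (a : Fin r → ℤ) t {V} → t ≤ nz a → Increasing V →
                    2 ^ t * ∑ V (cnt a) ≤ 2 ^ r * largest t (length V)
littlewood-offord a zero le inc = ≤-trans (≤-reflexive (+-identityʳ _)) (total≤ a inc)
littlewood-offord {suc r} a (suc t) {V} le inc = go (a zero) refl
  where
  open ≤-Reasoning
  a′ = a ∘ suc
  split : ∑ V (cnt a) ≡ ∑ (shift (a zero) V) (cnt a′) + ∑ V (cnt a′)
  split = trans (∑-cong V (cnt-suc a)) (trans (∑-+ V _ _) (cong (_+ ∑ V (cnt a′)) (sym (∑-map _ V (cnt a′)))))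
  nzs : nz a ≡ ⟦ isNZ (a zero) ⟧ + nz a′
  nzs = ∑-suc r _
  t≤ : t ≤ nz a′
  t≤ = s≤s⁻¹ (≤-trans le (≤-trans (≤-reflexive nzs) (+-monoˡ-≤ (nz a′) (⟦⟧≤1 _))))
  shift0 : shift 0ℤ V ≡ V
  shift0 = trans (List.map-cong (λ x → ℤ.+-identityʳ x) V) (List.map-id V)
  ih = λ {V} → littlewood-offord a′ t {V} t≤
  go : ∀ z → a zero ≡ z → 2 ^ suc t * ∑ V (cnt a) ≤ 2 ^ suc r * largest (suc t) (length V)
  go +0 e = begin
    2 ^ suc t * ∑ V (cnt a)                            ≡⟨ cong (2 ^ suc t *_) (trans split (cong (λ l → ∑ l (cnt a′) + ∑ V (cnt a′)) (trans (cong (λ z → shift z V) e) shift0))) ⟩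
    2 ^ suc t * (∑ V (cnt a′) + ∑ V (cnt a′))          ≡⟨ arr (2 ^ suc t) _ ⟩
    2 * (2 ^ suc t * ∑ V (cnt a′))                     ≤⟨ *-monoʳ-≤ 2 (littlewood-offord a′ (suc t) le′ inc) ⟩
    2 * (2 ^ r * largest (suc t) (length V))                 ≡⟨ sym (*-assoc 2 (2 ^ r) _) ⟩
    2 ^ suc r * largest (suc t) (length V) ∎
    where
    arr : ∀ p x → p * (x + x) ≡ 2 * (p * x)
    arr = solve-∀
    le′ : suc t ≤ nz a′
    le′ = ≤-trans le (≤-reflexive (trans nzs (cong (λ z → ⟦ isNZ z ⟧ + nz a′) e)))
  go +[1+ n ] e = subst (λ x → 2 ^ suc t * x ≤ _) (sym (trans split (cong (λ z → ∑ (shift z V) (cnt a′) + ∑ V (cnt a′)) e)))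
    (exchange r (cnt a′) +[1+ n ] (ℤ.+<+ z<s) t ih inc)
  -- For a negative coefficient the shifted list plays the part of `V`: shifting it by the positive
  -- number `+[1+ n ]` gives `V` back.
  go -[1+ n ] e = subst₂ (λ x l → 2 ^ suc t * x ≤ 2 ^ suc r * largest (suc t) l) eq (List.length-map (ℤ._- -[1+ n ]) V)
    (exchange r (cnt a′) +[1+ n ] (ℤ.+<+ z<s) t ih (shift-inc -[1+ n ] inc))
    where
    back : shift +[1+ n ] (shift -[1+ n ] V) ≡ V
    back = trans (sym (List.map-∘ V)) (trans (List.map-cong (λ x → r₃ x +[1+ n ]) V) (List.map-id V))
      where
      r₃ : ∀ x y → x ℤ.- (ℤ.- y) ℤ.- y ≡ x
      r₃ = ℤR.solve-∀
    eq : ∑ (shift +[1+ n ] (shift -[1+ n ] V)) (cnt a′) + ∑ (shift -[1+ n ] V) (cnt a′) ≡ ∑ V (cnt a)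
    eq = trans (cong (λ l → ∑ l (cnt a′) + ∑ (shift -[1+ n ] V) (cnt a′)) back)
         (trans (+-comm (∑ V (cnt a′)) (∑ (shift -[1+ n ] V) (cnt a′))) (sym (trans split (cong (λ z → ∑ (shift z V) (cnt a′) + ∑ V (cnt a′)) e))))

largest≤2^ : ∀ t k → largest t k ≤ 2 ^ t
largest≤2^ zero    zero    = z≤n
largest≤2^ zero    (suc k) = ≤-refl
largest≤2^ (suc t) zero    = z≤n
largest≤2^ (suc t) (suc k) = +-mono-≤ (largest≤2^ t _) (≤-trans (largest≤2^ t k) (≤-reflexive (sym (+-identityʳ _))))

-- C(t,lo) + … + C(t,lo+k-1)
window : ℕ → ℕ → ℕ → ℕ
window t lo zero    = 0
window t lo (suc k) = (t choose lo) + window t (suc lo) k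

window-snoc : ∀ t lo k → window t lo (suc k) ≡ window t lo k + (t choose (lo + k))
window-snoc t lo zero    rewrite +-identityʳ lo = +-comm (t choose lo) 0
window-snoc t lo (suc k) rewrite window-snoc t (suc lo) k | +-suc lo k = sym (+-assoc (t choose lo) _ _)

window-pascal : ∀ t lo k → window (suc t) (suc lo) k ≡ window t lo k + window t (suc lo) k
window-pascal t lo zero    = refl
window-pascal t lo (suc k) rewrite window-pascal t (suc lo) k | sym (nCk+nC[k+1]≡[n+1]C[k+1] t lo) =
  arr (t choose lo) (t choose suc lo) (window t (suc lo) k) (window t (suc (suc lo)) k)
  where
  arr : ∀ a b c d → a + b + (c + d) ≡ a + c + (b + d)
  arr = solve-∀

window-row : ∀ t → window t 0 (suc t) ≡ 2 ^ t
window-row zero    = refl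
window-row (suc t) = begin
  1 + window (suc t) 1 (suc t)                     ≡⟨ cong suc (window-pascal t 0 (suc t)) ⟩
  1 + (window t 0 (suc t) + window t 1 (suc t))         ≡⟨ arr (window t 0 (suc t)) (window t 1 (suc t)) ⟩
  window t 0 (suc t) + window t 0 (suc (suc t))         ≡⟨ cong (window t 0 (suc t) +_) (trans (window-snoc t 0 (suc t)) (cong (window t 0 (suc t) +_) (k>n⇒nCk≡0 (n<1+n t)))) ⟩
  window t 0 (suc t) + (window t 0 (suc t) + 0)         ≡⟨ cong (λ x → x + (x + 0)) (window-row t) ⟩
  2 ^ suc t ∎
  where
  open ≡-Reasoning
  arr : ∀ a b → 1 + (a + b) ≡ a + (1 + b)
  arr = solve-∀

-- The equation on `lo` centres the window in row `t` of Pascal's triangle. By `window-pascal` a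
-- centred window splits into two of the previous row; moving one term between them leaves two
-- centred windows whose lengths differ by two, which matches the recursion of `largest`.
largest≤window : ∀ t lo k → lo + lo + k ≡ suc t → largest t k ≤ window t lo k
largest≤window t       zero     k       refl = ≤-trans (largest≤2^ t k) (≤-reflexive (sym (window-row t)))
largest≤window t       (suc lo) zero    e    = ≤-trans (≤-reflexive (largest-none t)) z≤n
  where
  largest-none : ∀ t → largest t 0 ≡ 0
  largest-none zero = refl
  largest-none (suc t) = refl
largest≤window zero    (suc lo) (suc k) e    = ⊥-elim (contra (trans (sym (cong suc (trans (cong (_+ suc k) (+-suc lo lo)) refl))) e))
  where
  contra : ∀ {x} → suc (suc x) ≡ 1 → ⊥
  contra ()
largest≤window (suc t) (suc lo) (suc k) e    = begin
  largest t (suc (suc k)) + largest t k                            ≤⟨ +-mono-≤ (largest≤window t lo (suc (suc k)) e₁) (largest≤window t (suc lo) k e₂) ⟩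
  window t lo (suc (suc k)) + window t (suc lo) k                ≡⟨ cong (_+ window t (suc lo) k) (window-snoc t lo (suc k)) ⟩
  window t lo (suc k) + (t choose (lo + suc k)) + window t (suc lo) k ≡⟨ arr (window t lo (suc k)) _ _ ⟩
  window t lo (suc k) + (window t (suc lo) k + (t choose (lo + suc k))) ≡⟨ cong (λ x → window t lo (suc k) + (window t (suc lo) k + (t choose x))) (+-suc lo k) ⟩
  window t lo (suc k) + (window t (suc lo) k + (t choose (suc lo + k))) ≡⟨ cong (window t lo (suc k) +_) (sym (window-snoc t (suc lo) k)) ⟩
  window t lo (suc k) + window t (suc lo) (suc k)                ≡⟨ sym (window-pascal t lo (suc k)) ⟩
  window (suc t) (suc lo) (suc k) ∎
  where
  open ≤-Reasoning
  arr : ∀ a b c → a + b + c ≡ a + (c + b)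
  arr = solve-∀
  a₁ : ∀ lo k → suc lo + suc lo + suc k ≡ suc (lo + lo + suc (suc k))
  a₁ = solve-∀
  a₂ : ∀ lo k → suc lo + suc lo + suc k ≡ suc (suc lo + suc lo + k)
  a₂ = solve-∀
  e₁ = suc-injective (trans (sym (a₁ lo k)) e)
  e₂ = suc-injective (trans (sym (a₂ lo k)) e)

-- This is `central` cleared of its denominators. The inductive step comes down to (2m+1)(2m+3) ≤
-- (2m+2)².
factorials : ∀ m → ((m + m) !) * ((m + m) !) * suc (m + m) ≤ 16 ^ m * ((m ! * m !) * (m ! * m !))
factorials zero    = ≤-refl
factorials (suc m) = begin
  ((suc m + suc m) !) * ((suc m + suc m) !) * suc (suc m + suc m)
    ≡⟨ cong (λ x → ((x !) * (x !) * suc x)) (cong suc (+-suc m m)) ⟩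
  (suc (suc (m + m)) * (suc (m + m) * D)) * (suc (suc (m + m)) * (suc (m + m) * D)) * suc (suc (suc (m + m)))
    ≡⟨ arr₁ m D ⟩
  (D * D * suc (m + m)) * (4 * (suc m * suc m) * (suc (m + m) * suc (suc (suc (m + m)))))
    ≤⟨ *-mono-≤ (factorials m) (*-monoʳ-≤ (4 * (suc m * suc m)) (≤-trans (m≤m+n _ 1) (≤-reflexive (arr₂ m)))) ⟩
  (16 ^ m * ((m ! * m !) * (m ! * m !))) * (4 * (suc m * suc m) * (4 * (suc m * suc m)))
    ≡⟨ arr₃ (16 ^ m) (m !) (suc m) ⟩
  16 ^ suc m * ((suc m ! * suc m !) * (suc m ! * suc m !)) ∎
  where
  open ≤-Reasoning
  D = (m + m) !
  arr₁ : ∀ m D → (suc (suc (m + m)) * (suc (m + m) * D)) * (suc (suc (m + m)) * (suc (m + m) * D)) * suc (suc (suc (m + m)))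
       ≡ (D * D * suc (m + m)) * (4 * (suc m * suc m) * (suc (m + m) * suc (suc (suc (m + m)))))
  arr₁ = solve-∀
  arr₂ : ∀ m → suc (m + m) * suc (suc (suc (m + m))) + 1 ≡ 4 * (suc m * suc m)
  arr₂ = solve-∀
  arr₃ : ∀ p f s → (p * ((f * f) * (f * f))) * (4 * (s * s) * (4 * (s * s))) ≡ 16 * p * ((s * f * (s * f)) * (s * f * (s * f)))
  arr₃ = solve-∀

central : ∀ m → ((m + m) choose m) * ((m + m) choose m) * suc (m + m) ≤ 16 ^ m
central m = *-cancelʳ-≤ _ _ ((m ! * m !) * (m ! * m !)) {{m*n≢0 (m ! * m !) (m ! * m !) {{nz!}} {{nz!}}}} (begin
  (c * c * suc (m + m)) * ((m ! * m !) * (m ! * m !))   ≡⟨ arr c (m ! * m !) (suc (m + m)) ⟩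
  (c * (m ! * m !)) * (c * (m ! * m !)) * suc (m + m)   ≡⟨ cong (λ x → x * x * suc (m + m)) e ⟩
  ((m + m) !) * ((m + m) !) * suc (m + m)               ≤⟨ factorials m ⟩
  16 ^ m * ((m ! * m !) * (m ! * m !)) ∎)
  where
  open ≤-Reasoning
  c = (m + m) choose m
  nz! = m*n≢0 (m !) (m !) {{m !≢0}} {{m !≢0}}
  arr : ∀ c f s → (c * c * s) * (f * f) ≡ (c * f) * (c * f) * s
  arr = solve-∀
  e : c * (m ! * m !) ≡ (m + m) !
  e = trans (cong₂ _*_ (nCk≡n!/k![n-k]! (m≤m+n m m)) (cong (λ x → m ! * x !) (sym (m+n∸m≡n m m))))
      (m/n*n≡m {{_}} (k![n∸k]!∣n! (m≤m+n m m)))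

-- With at least `2m` nonzero coefficients a random subset sum vanishes with probability at most
-- 1/√(2m+1); squaring avoids the root.
zeros² : ∀ {r} (a : Fin r → ℤ) m → m + m ≤ nz a → cnt a 0ℤ * cnt a 0ℤ * suc (m + m) ≤ 2 ^ r * 2 ^ r
zeros² {r} a m le = *-cancelˡ-≤ (2 ^ (m + m) * 2 ^ (m + m)) {{m*n≢0 (2 ^ (m + m)) (2 ^ (m + m)) {{m^n≢0 2 (m + m)}} {{m^n≢0 2 (m + m)}}}} (begin
  2 ^ (m + m) * 2 ^ (m + m) * (Z * Z * suc (m + m))    ≡⟨ arr (2 ^ (m + m)) Z (suc (m + m)) ⟩
  (2 ^ (m + m) * Z) * (2 ^ (m + m) * Z) * suc (m + m)  ≤⟨ *-monoˡ-≤ (suc (m + m)) (*-mono-≤ b b) ⟩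
  (2 ^ r * c) * (2 ^ r * c) * suc (m + m)              ≡⟨ arr′ (2 ^ r) c (suc (m + m)) ⟩
  2 ^ r * 2 ^ r * (c * c * suc (m + m))                ≤⟨ *-monoʳ-≤ (2 ^ r * 2 ^ r) (central m) ⟩
  2 ^ r * 2 ^ r * 16 ^ m                               ≡⟨ cong (2 ^ r * 2 ^ r *_) (trans (^-*-assoc 2 4 m) (trans (cong (2 ^_) (arr″ m)) (^-distribˡ-+-* 2 (m + m) (m + m)))) ⟩
  2 ^ r * 2 ^ r * (2 ^ (m + m) * 2 ^ (m + m))          ≡⟨ *-comm (2 ^ r * 2 ^ r) _ ⟩
  2 ^ (m + m) * 2 ^ (m + m) * (2 ^ r * 2 ^ r) ∎)
  where
  open ≤-Reasoning
  Z = cnt a 0ℤ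
  c = (m + m) choose m
  arr : ∀ p z s → p * p * (z * z * s) ≡ (p * z) * (p * z) * s
  arr = solve-∀
  arr′ : ∀ p z s → (p * z) * (p * z) * s ≡ p * p * (z * z * s)
  arr′ = solve-∀
  arr″ : ∀ m → 4 * m ≡ m + m + (m + m)
  arr″ = solve-∀
  b : 2 ^ (m + m) * Z ≤ 2 ^ r * c
  b = begin
    2 ^ (m + m) * Z                       ≡⟨ cong (2 ^ (m + m) *_) (sym (+-identityʳ Z)) ⟩
    2 ^ (m + m) * ∑ (0ℤ ∷ []) (cnt a)     ≤⟨ littlewood-offord a (m + m) le ([]ᴬ ∷ᴾ []ᴾ) ⟩
    2 ^ r * largest (m + m) 1                   ≤⟨ *-monoʳ-≤ (2 ^ r) (largest≤window (m + m) m 1 (+-comm (m + m) 1)) ⟩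
    2 ^ r * window (m + m) m 1                 ≡⟨ cong (2 ^ r *_) (+-identityʳ c) ⟩
    2 ^ r * c ∎

zeros½ : ∀ {r} (a : Fin r → ℤ) → 1 ≤ nz a → 2 * cnt a 0ℤ ≤ 2 ^ r
zeros½ {r} a le = begin
  2 * cnt a 0ℤ                ≡⟨ cong (2 *_) (sym (+-identityʳ (cnt a 0ℤ))) ⟩
  2 ^ 1 * ∑ (0ℤ ∷ []) (cnt a) ≤⟨ littlewood-offord a 1 le ([]ᴬ ∷ᴾ []ᴾ) ⟩
  2 ^ r * 1                   ≡⟨ *-identityʳ _ ⟩
  2 ^ r ∎
  where open ≤-Reasoning

-- Detecting sparse integer matrices

-- The inner product over the two-element field. Parities reduce the infinitely many integer vectors
-- supported in `J` to at most `2^|J|` patterns, few enough for a union bound.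
par : ∀ {n} → Subset n → Subset n → Bool
par []ᵛ      []ᵛ      = false
par (p ∷ᵛ P) (b ∷ᵛ B) = (p ∧ b) xor par P B

card : ∀ {n} → Subset n → ℕ
card []ᵛ      = 0
card (b ∷ᵛ S) = ⟦ b ⟧ + card S

_⊑_ : ∀ {n} → Subset n → Subset n → Set
P ⊑ J = ∀ j → lookup J j ≡ false → lookup P j ≡ false

powerset : ∀ {n} → Subset n → List (Subset n)
powerset []ᵛ          = []ᵛ ∷ []
powerset (true ∷ᵛ J)  = map (true ∷ᵛ_) (powerset J) ++ map (false ∷ᵛ_) (powerset J)
powerset (false ∷ᵛ J) = map (false ∷ᵛ_) (powerset J)

length-powerset : ∀ {n} (J : Subset n) → length (powerset J) ≡ 2 ^ card J
length-powerset []ᵛ          = refl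
length-powerset (true ∷ᵛ J)  rewrite List.length-++ (map (true ∷ᵛ_) (powerset J)) {map (false ∷ᵛ_) (powerset J)}
  | List.length-map (true ∷ᵛ_) (powerset J) | List.length-map (false ∷ᵛ_) (powerset J)
  | length-powerset J | +-identityʳ (2 ^ card J) = refl
length-powerset (false ∷ᵛ J) = trans (List.length-map (false ∷ᵛ_) (powerset J)) (length-powerset J)

∈-powerset : ∀ {n} (P J : Subset n) → P ⊑ J → P ∈ˡ powerset J
∈-powerset []ᵛ          []ᵛ          s = here refl
∈-powerset (true ∷ᵛ P)  (true ∷ᵛ J)  s = ∈-++⁺ˡ (∈-map⁺ (true ∷ᵛ_) (∈-powerset P J (s ∘ suc)))
∈-powerset (false ∷ᵛ P) (true ∷ᵛ J)  s = ∈-++⁺ʳ _ (∈-map⁺ (false ∷ᵛ_) (∈-powerset P J (s ∘ suc)))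
∈-powerset (true ∷ᵛ P)  (false ∷ᵛ J) s with s zero refl
... | ()
∈-powerset (false ∷ᵛ P) (false ∷ᵛ J) s = ∈-map⁺ (false ∷ᵛ_) (∈-powerset P J (s ∘ suc))

double-even : ∀ x → ∣ (x ℤ.+ x) ∣ᶻ ≡ ∣ x ∣ᶻ + ∣ x ∣ᶻ
double-even (ℤ.+ n)  = refl
double-even -[1+ n ] = cong suc (sym (+-suc n n))

odd≢0 : ∀ x → x ℤ.+ x ℤ.+ 1ℤ ≢ 0ℤ
odd≢0 x e = even (∣ x ∣ᶻ) (trans (sym (double-even x)) (cong ∣_∣ᶻ (trans (r x) (cong (ℤ._- 1ℤ) e))))
  where
  r : ∀ x → x ℤ.+ x ≡ x ℤ.+ x ℤ.+ 1ℤ ℤ.- 1ℤ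
  r = ℤR.solve-∀
  even : ∀ m → m + m ≡ 1 → ⊥
  even (suc m) e with trans (sym (+-suc m m)) (suc-injective e)
  ... | ()

-- v = q + q + ⟦P⟧ entrywise gives dot v B ≡ par P B (mod 2).
dot-parity : ∀ {n} (v q : Fin n → ℤ) (P B : Subset n) →
             (∀ j → v j ≡ q j ℤ.+ q j ℤ.+ (ℤ.+ ⟦ lookup P j ⟧)) →
             ∃ λ h → dot v B ≡ h ℤ.+ h ℤ.+ (ℤ.+ ⟦ par P B ⟧)
dot-parity v q []ᵛ []ᵛ e = 0ℤ , refl
dot-parity v q (p ∷ᵛ P) (b ∷ᵛ B) e with dot-parity (v ∘ suc) (q ∘ suc) P B (e ∘ suc)
... | h , eh = go p b (par P B) (e zero) eh
  where
  r₀ : ∀ x h → 0ℤ ℤ.+ (h ℤ.+ h ℤ.+ x) ≡ h ℤ.+ h ℤ.+ x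
  r₀ = ℤR.solve-∀
  r₁ : ∀ a h x y → a ℤ.+ a ℤ.+ x ℤ.+ (h ℤ.+ h ℤ.+ y) ≡ (a ℤ.+ h) ℤ.+ (a ℤ.+ h) ℤ.+ (x ℤ.+ y)
  r₁ = ℤR.solve-∀
  r₂ : ∀ a h → a ℤ.+ a ℤ.+ 1ℤ ℤ.+ (h ℤ.+ h ℤ.+ 1ℤ) ≡ (a ℤ.+ h ℤ.+ 1ℤ) ℤ.+ (a ℤ.+ h ℤ.+ 1ℤ) ℤ.+ 0ℤ
  r₂ = ℤR.solve-∀
  go : ∀ p b c → v zero ≡ q zero ℤ.+ q zero ℤ.+ (ℤ.+ ⟦ p ⟧) → dot (v ∘ suc) B ≡ h ℤ.+ h ℤ.+ (ℤ.+ ⟦ c ⟧) →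
       ∃ λ g → (if b then v zero else 0ℤ) ℤ.+ dot (v ∘ suc) B ≡ g ℤ.+ g ℤ.+ (ℤ.+ ⟦ (p ∧ b) xor c ⟧)
  go false false c e₀ e₁ = h , trans (cong (λ z → 0ℤ ℤ.+ z) e₁) (r₀ _ h)
  go true  false c e₀ e₁ = h , trans (cong (λ z → 0ℤ ℤ.+ z) e₁) (r₀ _ h)
  go false true  c e₀ e₁ = q zero ℤ.+ h , trans (cong₂ ℤ._+_ e₀ e₁) (trans (r₁ (q zero) h 0ℤ _) (cong (λ z → q zero ℤ.+ h ℤ.+ (q zero ℤ.+ h) ℤ.+ z) (ℤ.+-identityˡ _)))
  go true  true false e₀ e₁ = q zero ℤ.+ h , trans (cong₂ ℤ._+_ e₀ e₁) (r₁ (q zero) h 1ℤ 0ℤ)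
  go true  true true  e₀ e₁ = q zero ℤ.+ h ℤ.+ 1ℤ , trans (cong₂ ℤ._+_ e₀ e₁) (r₂ (q zero) h)

par≡true⇒dot≢0 : ∀ {n} (v q : Fin n → ℤ) (P B : Subset n) →
                  (∀ j → v j ≡ q j ℤ.+ q j ℤ.+ (ℤ.+ ⟦ lookup P j ⟧)) → par P B ≡ true → dot v B ≢ 0ℤ
par≡true⇒dot≢0 v q P B e p d with dot-parity v q P B e
... | h , eh = odd≢0 h (trans (sym (trans eh (cong (λ b → h ℤ.+ h ℤ.+ (ℤ.+ ⟦ b ⟧)) p))) d)

dot-cong : ∀ {n} {v w : Fin n → ℤ} (B : Subset n) → (∀ j → v j ≡ w j) → dot v B ≡ dot w B
dot-cong []ᵛ e = refl
dot-cong (b ∷ᵛ B) e = cong₂ (λ x y → (if b then x else 0ℤ) ℤ.+ y) (e zero) (dot-cong B (e ∘ suc))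

dot-double : ∀ {n} (v q : Fin n → ℤ) (B : Subset n) → (∀ j → v j ≡ q j ℤ.+ q j) → dot v B ≡ dot q B ℤ.+ dot q B
dot-double v q []ᵛ e = refl
dot-double v q (false ∷ᵛ B) e = trans (cong (λ z → 0ℤ ℤ.+ z) (dot-double (v ∘ suc) (q ∘ suc) B (e ∘ suc))) (r (dot (q ∘ suc) B))
  where
  r : ∀ x → 0ℤ ℤ.+ (x ℤ.+ x) ≡ (0ℤ ℤ.+ x) ℤ.+ (0ℤ ℤ.+ x)
  r = ℤR.solve-∀
dot-double v q (true ∷ᵛ B) e = trans (cong₂ ℤ._+_ (e zero) (dot-double (v ∘ suc) (q ∘ suc) B (e ∘ suc))) (r (q zero) _)
  where
  r : ∀ y x → y ℤ.+ y ℤ.+ (x ℤ.+ x) ≡ (y ℤ.+ x) ℤ.+ (y ℤ.+ x)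
  r = ℤR.solve-∀

halve : ∀ z → ∃ λ q → ∃ λ b → z ≡ q ℤ.+ q ℤ.+ (ℤ.+ ⟦ b ⟧)
halve z with z ℤ.% (ℤ.+ 2) | ℤ.n%d<d z (ℤ.+ 2) | ℤ.a≡a%n+[a/n]*n z (ℤ.+ 2)
... | 0 | _ | e = z ℤ./ (ℤ.+ 2) , false , trans e (r (z ℤ./ (ℤ.+ 2)))
  where
  r : ∀ x → 0ℤ ℤ.+ x ℤ.* (ℤ.+ 2) ≡ x ℤ.+ x ℤ.+ 0ℤ
  r = ℤR.solve-∀
... | 1 | _ | e = z ℤ./ (ℤ.+ 2) , true , trans e (r (z ℤ./ (ℤ.+ 2)))
  where
  r : ∀ x → 1ℤ ℤ.+ x ℤ.* (ℤ.+ 2) ≡ x ℤ.+ x ℤ.+ 1ℤ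
  r = ℤR.solve-∀
... | suc (suc _) | s≤s (s≤s ()) | _

-- Halve v until an odd entry appears; the positions of the odd entries form P.
odd-pattern : ∀ {n} (J : Subset n) fuel (v : Fin n → ℤ) → (∀ j → lookup J j ≡ false → v j ≡ 0ℤ) →
              ∀ i → v i ≢ 0ℤ → ∣ v i ∣ᶻ ≤ fuel →
              ∃ λ P → P ⊑ J × (∃ λ j → lookup P j ≡ true) × (∀ B → par P B ≡ true → dot v B ≢ 0ℤ)
odd-pattern J zero v vJ i ne le = ⊥-elim (ne (ℤ.∣i∣≡0⇒i≡0 (n≤0⇒n≡0 le)))
odd-pattern {n} J (suc fuel) v vJ i ne le = go (find P)
  where
  q : Fin n → ℤ
  q j = proj₁ (halve (v j))
  P : Subset n
  P = Data.Vec.tabulate (λ j → proj₁ (proj₂ (halve (v j))))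
    where import Data.Vec
  lP : ∀ j → lookup P j ≡ proj₁ (proj₂ (halve (v j)))
  lP j = lookup∘tabulate _ j
    where open import Data.Vec.Properties using (lookup∘tabulate)
  e : ∀ j → v j ≡ q j ℤ.+ q j ℤ.+ (ℤ.+ ⟦ lookup P j ⟧)
  e j = trans (proj₂ (proj₂ (halve (v j)))) (cong (λ b → q j ℤ.+ q j ℤ.+ (ℤ.+ ⟦ b ⟧)) (sym (lP j)))
  find : ∀ {m} (Q : Subset m) → (∃ λ j → lookup Q j ≡ true) ⊎ (∀ j → lookup Q j ≡ false)
  find []ᵛ = inj₂ (λ ())
  find (true ∷ᵛ Q) = inj₁ (zero , refl)
  find (false ∷ᵛ Q) with find Q
  ... | inj₁ (j , p) = inj₁ (suc j , p)
  ... | inj₂ f = inj₂ λ { zero → refl ; (suc j) → f j }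
  even : ∀ j → lookup P j ≡ false → v j ≡ q j ℤ.+ q j
  even j p = trans (e j) (trans (cong (λ b → q j ℤ.+ q j ℤ.+ (ℤ.+ ⟦ b ⟧)) p) (ℤ.+-identityʳ _))
  dbl0 : ∀ x → x ℤ.+ x ≡ 0ℤ → x ≡ 0ℤ
  dbl0 x z = ℤ.∣i∣≡0⇒i≡0 (m+n≡0⇒m≡0 ∣ x ∣ᶻ (trans (sym (double-even x)) (cong ∣_∣ᶻ z)))
  P⊑J : P ⊑ J
  P⊑J j jJ with lookup P j | e j
  ... | false | _ = refl
  ... | true | ej = ⊥-elim (odd≢0 (q j) (trans (sym ej) (vJ j jJ)))
  go : (∃ λ j → lookup P j ≡ true) ⊎ (∀ j → lookup P j ≡ false) → _
  go (inj₁ jp) = P , P⊑J , jp , λ B → par≡true⇒dot≢0 v q P B e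
  go (inj₂ f) with odd-pattern J fuel q (λ j jJ → dbl0 (q j) (trans (sym (even j (f j))) (vJ j jJ))) i qi≢0 qi≤
    where
    qi≢0 : q i ≢ 0ℤ
    qi≢0 z = ne (trans (even i (f i)) (cong (λ x → x ℤ.+ x) z))
    qi≤ : ∣ q i ∣ᶻ ≤ fuel
    qi≤ = s≤s⁻¹ (≤-trans (+-monoˡ-≤ ∣ q i ∣ᶻ (n≢0⇒n>0 (λ z → qi≢0 (ℤ.∣i∣≡0⇒i≡0 z))))
            (≤-trans (≤-reflexive (trans (sym (double-even (q i))) (cong ∣_∣ᶻ (sym (even i (f i)))))) le))
  ... | P′ , s , ne′ , d = P′ , s , ne′ , λ B p z → d B p (dbl0 _ (trans (sym (dot-double v q B (λ j → even j (f j)))) z))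

-- Over a list of sets these weights multiply to 2 to the number of sets with even parity. For a
-- nonempty pattern the mean of one weight is 3/2, by `∑-evenWt`.
evenWt : Bool → ℕ
evenWt b = if b then 1 else 2

∑-evenWt : ∀ {n} (P : Subset n) j → lookup P j ≡ true → 2 * ∑ (subsets n) (λ B → evenWt (par P B)) ≡ 3 * 2 ^ n
∑-evenWt {suc n} (true ∷ᵛ P) j p = begin
  2 * ∑ (subsets (suc n)) (λ B → evenWt (par (true ∷ᵛ P) B))
    ≡⟨ cong (2 *_) (trans (∑-subsets n (λ B → evenWt (par (true ∷ᵛ P) B))) (sym (∑-+ (subsets n) _ _))) ⟩
  2 * ∑ (subsets n) (λ B → evenWt (true xor par P B) + evenWt (par P B))
    ≡⟨ cong (2 *_) (trans (∑-cong (subsets n) (λ B → flip (par P B))) (trans (∑-const (subsets n) 3) (cong (_* 3) (length-subsets n)))) ⟩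
  2 * (2 ^ n * 3) ≡⟨ arr (2 ^ n) ⟩
  3 * 2 ^ suc n ∎
  where
  open ≡-Reasoning
  flip : ∀ b → evenWt (true xor b) + evenWt b ≡ 3
  flip true  = refl
  flip false = refl
  arr : ∀ x → 2 * (x * 3) ≡ 3 * (x + (x + 0))
  arr = solve-∀
∑-evenWt {suc n} (false ∷ᵛ P) zero ()
∑-evenWt {suc n} (false ∷ᵛ P) (suc j) p = begin
  2 * ∑ (subsets (suc n)) (λ B → evenWt (par (false ∷ᵛ P) B))
    ≡⟨ cong (2 *_) (∑-subsets n (λ B → evenWt (par (false ∷ᵛ P) B))) ⟩
  2 * (X + X) ≡⟨ arr X ⟩
  2 * X + 2 * X ≡⟨ cong (λ x → x + x) (∑-evenWt P j p) ⟩
  3 * 2 ^ n + 3 * 2 ^ n ≡⟨ arr′ (2 ^ n) ⟩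
  3 * 2 ^ suc n ∎
  where
  open ≡-Reasoning
  X = ∑ (subsets n) (λ B → evenWt (par P B))
  arr : ∀ x → 2 * (x + x) ≡ 2 * x + 2 * x
  arr = solve-∀
  arr′ : ∀ x → 3 * x + 3 * x ≡ 3 * (x + (x + 0))
  arr′ = solve-∀

∏ : {A : Set} → List A → (A → ℕ) → ℕ
∏ []       f = 1
∏ (x ∷ xs) f = f x * ∏ xs f

module _ {n} (Ps : List (Subset n)) (ne : ∀ {P} → P ∈ˡ Ps → ∃ λ j → lookup P j ≡ true) where

  -- Method of conditional expectations for the potential ∑_P w(P) 2^{#even}.
  greedy-code : ∀ L (w : Subset n → ℕ) → ∃ λ Bs → length Bs ≡ L ×
                2 ^ L * ∑ Ps (λ P → w P * ∏ Bs (λ B → evenWt (par P B))) ≤ 3 ^ L * ∑ Ps w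
  greedy-code zero w = [] , refl , +-monoˡ-≤ 0 (≤-reflexive (∑-cong Ps (λ P → *-identityʳ (w P))))
  greedy-code (suc L) w with ∑-∃≤ (subsets n) (λ B → 2 * ∑ Ps (λ P → w P * evenWt (par P B))) (λ _ → 3 * ∑ Ps w)
                             (subst (0 <_) (sym (length-subsets n)) (m^n>0 2 n)) avg
    where
    open ≤-Reasoning
    avg : ∑ (subsets n) (λ B → 2 * ∑ Ps (λ P → w P * evenWt (par P B))) ≤ ∑ (subsets n) (λ _ → 3 * ∑ Ps w)
    avg = begin
      ∑ (subsets n) (λ B → 2 * ∑ Ps (λ P → w P * evenWt (par P B)))   ≡⟨ ∑-*ˡ (subsets n) 2 _ ⟩
      2 * ∑ (subsets n) (λ B → ∑ Ps (λ P → w P * evenWt (par P B)))   ≡⟨ cong (2 *_) (∑-swap (subsets n) Ps _) ⟩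
      2 * ∑ Ps (λ P → ∑ (subsets n) (λ B → w P * evenWt (par P B)))   ≡⟨ sym (∑-*ˡ Ps 2 _) ⟩
      ∑ Ps (λ P → 2 * ∑ (subsets n) (λ B → w P * evenWt (par P B)))   ≤⟨ ∑-mono∈ Ps (λ {P} m → ≤-reflexive (trans (cong (2 *_) (∑-*ˡ (subsets n) (w P) _))
                                                                            (trans (arr (w P) _) (cong (w P *_) (∑-evenWt P (proj₁ (ne m)) (proj₂ (ne m))))))) ⟩
      ∑ Ps (λ P → w P * (3 * 2 ^ n))                                  ≡⟨ ∑-*ʳ Ps (3 * 2 ^ n) w ⟩
      ∑ Ps w * (3 * 2 ^ n)                                            ≡⟨ arr′ (∑ Ps w) (2 ^ n) ⟩
      2 ^ n * (3 * ∑ Ps w)                                            ≡⟨ cong (_* (3 * ∑ Ps w)) (sym (length-subsets n)) ⟩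
      length (subsets n) * (3 * ∑ Ps w)                               ≡⟨ sym (∑-const (subsets n) _) ⟩
      ∑ (subsets n) (λ _ → 3 * ∑ Ps w) ∎
      where
      arr : ∀ w s → 2 * (w * s) ≡ w * (2 * s)
      arr = solve-∀
      arr′ : ∀ s p → s * (3 * p) ≡ p * (3 * s)
      arr′ = solve-∀
  ... | B , _ , leB with greedy-code L (λ P → w P * evenWt (par P B))
  ...   | Bs , len , le = B ∷ Bs , cong suc len , (begin
    2 ^ suc L * ∑ Ps (λ P → w P * (evenWt (par P B) * ∏ Bs (λ B → evenWt (par P B))))
      ≡⟨ cong (2 ^ suc L *_) (∑-cong Ps (λ P → sym (*-assoc (w P) _ _))) ⟩
    2 ^ suc L * ∑ Ps (λ P → w P * evenWt (par P B) * ∏ Bs (λ B → evenWt (par P B)))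
      ≡⟨ *-assoc 2 (2 ^ L) _ ⟩
    2 * (2 ^ L * ∑ Ps (λ P → w P * evenWt (par P B) * ∏ Bs (λ B → evenWt (par P B))))
      ≤⟨ *-monoʳ-≤ 2 le ⟩
    2 * (3 ^ L * ∑ Ps (λ P → w P * evenWt (par P B)))
      ≡⟨ arr (3 ^ L) _ ⟩
    3 ^ L * (2 * ∑ Ps (λ P → w P * evenWt (par P B)))
      ≤⟨ *-monoʳ-≤ (3 ^ L) leB ⟩
    3 ^ L * (3 * ∑ Ps w)
      ≡⟨ arr′ (3 ^ L) _ ⟩
    3 ^ suc L * ∑ Ps w ∎)
    where
    open ≤-Reasoning
    arr : ∀ x y → 2 * (x * y) ≡ x * (2 * y)
    arr = solve-∀
    arr′ : ∀ x y → x * (3 * y) ≡ 3 * x * y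
    arr′ = solve-∀

isNZ-true : ∀ {z} → z ≢ 0ℤ → isNZ z ≡ true
isNZ-true {z} ne with z ℤ.≟ 0ℤ
... | yes e = ⊥-elim (ne e)
... | no _  = refl

isNZ⇒≢ : ∀ {z} → isNZ z ≡ true → z ≢ 0ℤ
isNZ⇒≢ {z} e with z ℤ.≟ 0ℤ
isNZ⇒≢ () | yes _
... | no ne = ne

isNZ-false : ∀ {z} → isNZ z ≡ false → z ≡ 0ℤ
isNZ-false {z} e with z ℤ.≟ 0ℤ
... | yes p = p
isNZ-false () | no _

∏-evenWt : ∀ {n} (P : Subset n) Bs → ∃ λ ev → ∏ Bs (λ B → evenWt (par P B)) ≡ 2 ^ ev × ev + ∑ Bs (λ B → ⟦ par P B ⟧) ≡ length Bs
∏-evenWt P [] = 0 , refl , refl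
∏-evenWt P (B ∷ Bs) with par P B | ∏-evenWt P Bs
... | true  | ev , e , l = ev , trans (+-identityʳ _) e , trans (+-suc ev _) (cong suc l)
... | false | ev , e , l = suc ev , cong (2 *_) e , cong suc l

-- Why `5k`: the greedy choice keeps the sum of `2^ev` over the at most `2^k` nonempty patterns,
-- where `ev` counts the even outcomes, at or below `(3/2)^(5k) * 2^k`. As 3^5 = 243 ≤ 256 = 2^8,
-- this gives `ev ≤ 4k`, so at least `k` sets see an odd sum. Entries may be of any size, since only
-- the pattern left after halving matters.
code : ∀ {n} (J : Subset n) k → card J ≤ k →
       ∃ λ Bs → length Bs ≡ 5 * k × (∀ (v : Fin n → ℤ) → (∀ j → lookup J j ≡ false → v j ≡ 0ℤ) → 1 ≤ nz v →
                                      k ≤ ∑ Bs (λ B → ⟦ isNZ (dot v B) ⟧))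
code {n} J k Jk = Bs , len , good
  where
  open ≤-Reasoning
  nonempty : ∀ {m} → Subset m → Bool
  nonempty []ᵛ = false
  nonempty (b ∷ᵛ P) = if b then true else nonempty P
  nonempty⇒ : ∀ {m} (P : Subset m) → nonempty P ≡ true → ∃ λ j → lookup P j ≡ true
  nonempty⇒ (true ∷ᵛ P) e = zero , refl
  nonempty⇒ (false ∷ᵛ P) e with nonempty⇒ P e
  ... | j , p = suc j , p
  nonempty⇐ : ∀ {m} (P : Subset m) j → lookup P j ≡ true → nonempty P ≡ true
  nonempty⇐ (true ∷ᵛ P) j e = refl
  nonempty⇐ (false ∷ᵛ P) (suc j) e = nonempty⇐ P j e
  -- The empty pattern is even on every set, so it is removed before averaging.
  keep : List (Subset n) → List (Subset n)
  keep [] = []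
  keep (P ∷ Ps) = if nonempty P then P ∷ keep Ps else keep Ps
  keep⇒ : ∀ Ps {P} → P ∈ˡ keep Ps → ∃ λ j → lookup P j ≡ true
  keep⇒ (P ∷ Ps) m with nonempty P in eq
  keep⇒ (P ∷ Ps) (here refl) | true = nonempty⇒ P eq
  keep⇒ (P ∷ Ps) (there m)   | true = keep⇒ Ps m
  ... | false = keep⇒ Ps m
  keep⇐ : ∀ Ps {P} → P ∈ˡ Ps → nonempty P ≡ true → P ∈ˡ keep Ps
  keep⇐ (P ∷ Ps) (here refl) e rewrite e = here refl
  keep⇐ (P ∷ Ps) (there m) e with nonempty P
  ... | true  = there (keep⇐ Ps m e)
  ... | false = keep⇐ Ps m e
  len-keep : ∀ Ps → length (keep Ps) ≤ length Ps
  len-keep [] = z≤n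
  len-keep (P ∷ Ps) with nonempty P
  ... | true  = s≤s (len-keep Ps)
  ... | false = m≤n⇒m≤1+n (len-keep Ps)
  Ps = keep (powerset J)
  gc = greedy-code Ps (keep⇒ (powerset J)) (5 * k) (λ _ → 1)
  Bs = proj₁ gc
  len = proj₁ (proj₂ gc)
  good : ∀ (v : Fin n → ℤ) → (∀ j → lookup J j ≡ false → v j ≡ 0ℤ) → 1 ≤ nz v → k ≤ ∑ Bs (λ B → ⟦ isNZ (dot v B) ⟧)
  good v vJ nzv with ∑-∃ (fins n) (λ _ → 0) (λ i → ⟦ isNZ (v i) ⟧) (subst (_< nz v) (sym (∑-zero (fins n))) nzv)
  ... | i , _ , pi with isNZ (v i) in eqi
  good v vJ nzv | i , _ , () | false
  ... | true with odd-pattern J ∣ v i ∣ᶻ v vJ i (isNZ⇒≢ eqi) ≤-refl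
  ...   | P , P⊑J , (j , pj) , det with ∏-evenWt P Bs
  ...     | ev , e , l = ≤-trans odd≥k (∑-mono Bs (λ B → mono B))
    where
    mono : ∀ B → ⟦ par P B ⟧ ≤ ⟦ isNZ (dot v B) ⟧
    mono B with par P B in eq
    ... | false = z≤n
    ... | true = ≤-reflexive (cong ⟦_⟧ (sym (isNZ-true (det B eq))))
    P∈ : P ∈ˡ Ps
    P∈ = keep⇐ (powerset J) (∈-powerset P J P⊑J) (nonempty⇐ P j pj)
    bound : 2 ^ (5 * k + ev) ≤ 2 ^ (8 * k + k)
    bound = begin
      2 ^ (5 * k + ev)           ≡⟨ ^-distribˡ-+-* 2 (5 * k) ev ⟩
      2 ^ (5 * k) * 2 ^ ev       ≡⟨ cong (2 ^ (5 * k) *_) (trans (sym e) (sym (+-identityʳ _))) ⟩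
      2 ^ (5 * k) * (1 * ∏ Bs (λ B → evenWt (par P B)))
                                 ≤⟨ *-monoʳ-≤ (2 ^ (5 * k)) (∑-pick (λ P → 1 * ∏ Bs (λ B → evenWt (par P B))) P∈) ⟩
      2 ^ (5 * k) * ∑ Ps (λ P → 1 * ∏ Bs (λ B → evenWt (par P B))) ≤⟨ proj₂ (proj₂ gc) ⟩
      3 ^ (5 * k) * ∑ Ps (λ _ → 1)  ≡⟨ cong (3 ^ (5 * k) *_) (trans (∑-const Ps 1) (*-identityʳ _)) ⟩
      3 ^ (5 * k) * length Ps    ≤⟨ *-mono-≤ (≤-trans (≤-reflexive (sym (^-*-assoc 3 5 k))) (^-monoˡ-≤ k (≤ᵇ⇒≤ 243 256 _)))
                                     (≤-trans (len-keep (powerset J)) (≤-trans (≤-reflexive (length-powerset J)) (^-monoʳ-≤ 2 Jk))) ⟩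
      256 ^ k * 2 ^ k            ≡⟨ cong (_* 2 ^ k) (^-*-assoc 2 8 k) ⟩
      2 ^ (8 * k) * 2 ^ k        ≡⟨ sym (^-distribˡ-+-* 2 (8 * k) k) ⟩
      2 ^ (8 * k + k) ∎
    ev≤ : ev ≤ 4 * k
    ev≤ = +-cancelˡ-≤ (5 * k) _ _ (≤-trans (≮⇒≥ (λ lt → <-irrefl refl (<-≤-trans (^-monoʳ-< 2 (s≤s (s≤s z≤n)) lt) bound))) (≤-reflexive (arr k)))
      where
      arr : ∀ k → 8 * k + k ≡ 5 * k + 4 * k
      arr = solve-∀
    odd≥k : k ≤ ∑ Bs (λ B → ⟦ par P B ⟧)
    odd≥k = +-cancelˡ-≤ (4 * k) _ _ (begin
      4 * k + k                        ≡⟨ arr k ⟩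
      5 * k                            ≡⟨ sym (trans l len) ⟩
      ev + ∑ Bs (λ B → ⟦ par P B ⟧)    ≤⟨ +-monoˡ-≤ _ ev≤ ⟩
      4 * k + ∑ Bs (λ B → ⟦ par P B ⟧) ∎)
      where
      arr : ∀ k → 4 * k + k ≡ 5 * k
      arr = solve-∀

-- Row sets chosen against a union bound

^-distribʳ-* : ∀ p x y → (x * y) ^ p ≡ x ^ p * y ^ p
^-distribʳ-* zero    x y = refl
^-distribʳ-* (suc p) x y rewrite ^-distribʳ-* p x y = arr x y (x ^ p) (y ^ p)
  where
  arr : ∀ a b c d → a * b * (c * d) ≡ a * c * (b * d)
  arr = solve-∀

^-cancel-< : ∀ p {x y} → x ^ p < y ^ p → x < y
^-cancel-< p {x} {y} lt = ≰⇒> (λ le → <-irrefl refl (<-≤-trans lt (^-monoˡ-≤ p le)))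

∑-<-uniform : {A : Set} (xs : List A) (f : A → ℕ) (X : ℕ) → 0 < X → (∀ {x} → x ∈ˡ xs → f x * length xs < X) → ∑ xs f < X
∑-<-uniform [] f X X>0 h = X>0
∑-<-uniform {A} xs@(_ ∷ _) f (suc X) X>0 h = *-cancelʳ-< (length xs) (∑ xs f) (suc X) (begin-strict
  ∑ xs f * length xs            ≡⟨ sym (∑-*ʳ xs (length xs) f) ⟩
  ∑ xs (λ x → f x * length xs)  ≤⟨ ∑-mono∈ xs (λ m → s≤s⁻¹ (h m)) ⟩
  ∑ xs (λ _ → X)                ≡⟨ ∑-const xs X ⟩
  length xs * X                 <⟨ *-monoʳ-< (length xs) (n<1+n X) ⟩
  length xs * suc X             ≡⟨ *-comm (length xs) (suc X) ⟩
  suc X * length xs ∎)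
  where open ≤-Reasoning

-- Each set with `γ` saves a factor `c^(1/p)` over the trivial bound `N`; raising everything to the
-- power `p` keeps the estimate in the natural numbers.
∏-bound : {B : Set} (Bs : List B) (Z : B → ℕ) (γ : B → Bool) (p c N : ℕ) → 1 ≤ c → (∀ B → Z B ≤ N) →
          (∀ B → γ B ≡ true → Z B ^ p * c ≤ N ^ p) →
          ∏ Bs Z ^ p * c ^ ∑ Bs (λ B → ⟦ γ B ⟧) ≤ (N ^ length Bs) ^ p
∏-bound []       Z γ p c N c≥1 zN zc = ≤-reflexive (*-identityʳ _)
∏-bound (B ∷ Bs) Z γ p c N c≥1 zN zc with γ B in eq
... | true = begin
  (Z B * ∏ Bs Z) ^ p * (c * c ^ g)             ≡⟨ cong (_* (c * c ^ g)) (^-distribʳ-* p (Z B) _) ⟩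
  Z B ^ p * ∏ Bs Z ^ p * (c * c ^ g)           ≡⟨ arr (Z B ^ p) _ c _ ⟩
  (Z B ^ p * c) * (∏ Bs Z ^ p * c ^ g)         ≤⟨ *-mono-≤ (zc B eq) (∏-bound Bs Z γ p c N c≥1 zN zc) ⟩
  N ^ p * (N ^ length Bs) ^ p                  ≡⟨ sym (^-distribʳ-* p N _) ⟩
  (N * N ^ length Bs) ^ p ∎
  where
  open ≤-Reasoning
  g = ∑ Bs (λ B → ⟦ γ B ⟧)
  arr : ∀ a b c d → a * b * (c * d) ≡ (a * c) * (b * d)
  arr = solve-∀
... | false = begin
  (Z B * ∏ Bs Z) ^ p * c ^ g                   ≡⟨ cong (_* c ^ g) (^-distribʳ-* p (Z B) _) ⟩
  Z B ^ p * ∏ Bs Z ^ p * c ^ g                 ≡⟨ *-assoc (Z B ^ p) _ _ ⟩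
  Z B ^ p * (∏ Bs Z ^ p * c ^ g)               ≤⟨ *-mono-≤ (^-monoˡ-≤ p (zN B)) (∏-bound Bs Z γ p c N c≥1 zN zc) ⟩
  N ^ p * (N ^ length Bs) ^ p                  ≡⟨ sym (^-distribʳ-* p N _) ⟩
  (N * N ^ length Bs) ^ p ∎
  where
  open ≤-Reasoning
  g = ∑ Bs (λ B → ⟦ γ B ⟧)

cnt≤ : ∀ {r} (a : Fin r → ℤ) v → cnt a v ≤ 2 ^ r
cnt≤ {r} a v = ≤-trans (∑-mono (subsets r) (λ A → ⟦⟧≤1 (dot a A ≡ᶻ v))) (≤-reflexive (trans (∑-const (subsets r) 1) (trans (*-identityʳ _) (length-subsets r))))

module _ {Y : Set} {n : ℕ} (vec : Y → Subset n → Fin n → ℤ) where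

  private
    Z : Y → Subset n → ℕ
    Z y B = cnt (vec y B) 0ℤ

  -- Choose the A's one after the other by conditional expectations.
  greedy-select : (ys : List Y) (Bs : List (Subset n)) (w : Y → ℕ) →
                  ∑ ys (λ y → w y * ∏ Bs (Z y)) < (2 ^ n) ^ length Bs →
                  ∃ λ Qs → length Qs ≡ length Bs × (∀ {y} → y ∈ˡ ys → w y ≢ 0 →
                    ¬ (∀ {A B} → (A , B) ∈ˡ Qs → dot (vec y B) A ≡ 0ℤ))
  greedy-select ys [] w lt = [] , refl , λ {y} m ne _ → ne (n≤0⇒n≡0 (≤-trans (≤-reflexive (sym (*-identityʳ (w y))))
    (≤-trans (∑-pick (λ y → w y * 1) m) (s≤s⁻¹ lt))))
  greedy-select ys (B ∷ Bs) w lt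
    with ∑-∃ (subsets n) (λ A → ∑ ys (λ y → w y * ⟦ dot (vec y B) A ≡ᶻ 0ℤ ⟧ * ∏ Bs (Z y))) (λ _ → (2 ^ n) ^ length Bs) avg
    where
    open ≤-Reasoning
    avg : ∑ (subsets n) (λ A → ∑ ys (λ y → w y * ⟦ dot (vec y B) A ≡ᶻ 0ℤ ⟧ * ∏ Bs (Z y))) < ∑ (subsets n) (λ _ → (2 ^ n) ^ length Bs)
    avg = begin-strict
      ∑ (subsets n) (λ A → ∑ ys (λ y → w y * ⟦ dot (vec y B) A ≡ᶻ 0ℤ ⟧ * ∏ Bs (Z y)))
        ≡⟨ ∑-swap (subsets n) ys _ ⟩
      ∑ ys (λ y → ∑ (subsets n) (λ A → w y * ⟦ dot (vec y B) A ≡ᶻ 0ℤ ⟧ * ∏ Bs (Z y)))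
        ≡⟨ ∑-cong ys (λ y → trans (∑-*ʳ (subsets n) (∏ Bs (Z y)) _) (trans (cong (_* ∏ Bs (Z y)) (∑-*ˡ (subsets n) (w y) _)) (*-assoc (w y) (Z y B) _))) ⟩
      ∑ ys (λ y → w y * (Z y B * ∏ Bs (Z y)))  <⟨ lt ⟩
      2 ^ n * (2 ^ n) ^ length Bs              ≡⟨ cong (_* (2 ^ n) ^ length Bs) (sym (length-subsets n)) ⟩
      length (subsets n) * (2 ^ n) ^ length Bs ≡⟨ sym (∑-const (subsets n) _) ⟩
      ∑ (subsets n) (λ _ → (2 ^ n) ^ length Bs) ∎
  ... | A , _ , ltA with greedy-select ys Bs (λ y → w y * ⟦ dot (vec y B) A ≡ᶻ 0ℤ ⟧) ltA
  ...   | Qs , len , sep = (A , B) ∷ Qs , cong suc len , λ {y} m ne allz →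
          sep m (λ e → ne (trans (sym (trans (cong (λ z → w y * ⟦ z ≡ᶻ 0ℤ ⟧) (allz (here refl))) (*-identityʳ (w y)))) e))
                (λ q → allz (there q))

  -- A family killed by the given sets B, up to a union bound over len(ys) members.
  select : (ys : List Y) (Bs : List (Subset n)) (Good : Y → Set) (p c : ℕ) →
           (∀ y → Good y → ∏ Bs (Z y) ^ p * c ≤ ((2 ^ n) ^ length Bs) ^ p) → length ys ^ p < c →
           (∀ y → Dec (Good y)) →
           ∃ λ Qs → length Qs ≡ length Bs × (∀ {y} → y ∈ˡ ys → Good y → ¬ (∀ {A B} → (A , B) ∈ˡ Qs → dot (vec y B) A ≡ 0ℤ))
  select ys Bs Good p c bnd len good? with greedy-select ys Bs (λ y → ⟦ does (good? y) ⟧) small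
    where
    open ≤-Reasoning
    X = (2 ^ n) ^ length Bs
    X>0 : 0 < X
    X>0 = m^n>0 (2 ^ n) {{m^n≢0 2 n}} (length Bs)
    each : ∀ y → ⟦ does (good? y) ⟧ * ∏ Bs (Z y) * length ys < X
    each y with good? y
    ... | no _ = X>0
    ... | yes g = ^-cancel-< p (begin-strict
      ((∏ Bs (Z y) + 0) * length ys) ^ p        ≡⟨ cong (λ x → (x * length ys) ^ p) (+-identityʳ (∏ Bs (Z y))) ⟩
      (∏ Bs (Z y) * length ys) ^ p              ≡⟨ ^-distribʳ-* p (∏ Bs (Z y)) _ ⟩
      ∏ Bs (Z y) ^ p * length ys ^ p            <⟨ strictly (∏ Bs (Z y) ^ p) refl ⟩
      X ^ p ∎)
      where
      strictly : ∀ q → q ≡ ∏ Bs (Z y) ^ p → q * length ys ^ p < X ^ p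
      strictly zero    e = m^n>0 X {{>-nonZero X>0}} p
      strictly (suc q) e = <-≤-trans (*-monoʳ-< (suc q) len) (≤-trans (≤-reflexive (cong (_* c) e)) (bnd y g))
    small : ∑ ys (λ y → ⟦ does (good? y) ⟧ * ∏ Bs (Z y)) < X
    small = ∑-<-uniform ys _ X X>0 (λ {y} _ → each y)
  ... | Qs , l , sep = Qs , l , λ {y} m g → sep m (ne y g)
    where
    ne : ∀ y → Good y → ⟦ does (good? y) ⟧ ≢ 0
    ne y g e with good? y
    ne y g () | yes _
    ... | no ¬g = ¬g g

Matrix : ℕ → Set
Matrix n = Fin n → Fin n → ℤ

rows : ∀ {n} → Matrix n → ℕ
rows {n} y = ∑ (fins n) (λ i → ⟦ 0 <ᵇ nz (y i) ⟧)

-- A rectangle sum is `dot (y · B) A`: the column sets `B` come from the code, and only the row sets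
-- `A` are then left to be chosen.
_·_ : ∀ {n} → Matrix n → Subset n → Fin n → ℤ
(y · B) i = dot (y i) B

Within : ∀ {n} → Subset n → Matrix n → Set
Within J y = ∀ i j → lookup J j ≡ false → y i j ≡ 0ℤ

dot-zero : ∀ {n} (v : Fin n → ℤ) B → nz v ≡ 0 → dot v B ≡ 0ℤ
dot-zero v B e = trans (dot-cong B (λ j → isNZ-false (b0 (∑≡0 (λ i → ⟦ isNZ (v i) ⟧) e (∈-allFin j))))) (z B)
  where
  b0 : ∀ {b} → ⟦ b ⟧ ≡ 0 → b ≡ false
  b0 {false} _ = refl
  b0 {true} ()
  z : ∀ {n} (B : Subset n) → dot (λ _ → 0ℤ) B ≡ 0ℤ
  z Data.Vec.[] = refl
  z (false Data.Vec.∷ B) = cong (λ x → 0ℤ ℤ.+ x) (z B)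
  z (true Data.Vec.∷ B) = cong (λ x → 0ℤ ℤ.+ x) (z B)

module _ {n} (J : Subset n) (k : ℕ) (Jk : card J ≤ k) where

  private
    Bs = proj₁ (code J k Jk)
    len : length Bs ≡ 5 * k
    len = proj₁ (proj₂ (code J k Jk))
    detect = proj₂ (proj₂ (code J k Jk))

  many : ∀ y → Within J y → rows y * k ≤ ∑ Bs (λ B → nz (y · B))
  many y yJ = begin
    rows y * k                                               ≡⟨ sym (∑-*ʳ (fins n) k _) ⟩
    ∑ (fins n) (λ i → ⟦ 0 <ᵇ nz (y i) ⟧ * k)                 ≤⟨ ∑-mono (fins n) each ⟩
    ∑ (fins n) (λ i → ∑ Bs (λ B → ⟦ isNZ (dot (y i) B) ⟧))   ≡⟨ ∑-swap (fins n) Bs _ ⟩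
    ∑ Bs (λ B → nz (y · B)) ∎
    where
    open ≤-Reasoning
    each : ∀ i → ⟦ 0 <ᵇ nz (y i) ⟧ * k ≤ ∑ Bs (λ B → ⟦ isNZ (dot (y i) B) ⟧)
    each i with nz (y i) in eq
    ... | zero  = z≤n
    ... | suc m = ≤-trans (≤-reflexive (+-identityʳ k)) (detect (y i) (yJ i) (≤-trans (s≤s z≤n) (≤-reflexive (sym eq))))

  few : ∀ y B → nz (y · B) ≤ rows y
  few y B = ∑-mono (fins n) each
    where
    each : ∀ i → ⟦ isNZ (dot (y i) B) ⟧ ≤ ⟦ 0 <ᵇ nz (y i) ⟧
    each i with nz (y i) in eq
    ... | suc m = ⟦⟧≤1 _
    ... | zero rewrite dot-zero (y i) B eq = z≤n

  -- By double counting, for half of the k guaranteed sets a tenth of the rows survive.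
  often : ∀ y → Within J y → 1 ≤ rows y → k ≤ 2 * ∑ Bs (λ B → ⟦ rows y ≤ᵇ 10 * nz (y · B) ⟧)
  often y yJ pos = *-cancelˡ-≤ (5 * ρ) {{m*n≢0 5 ρ {{_}} {{>-nonZero pos}}}} (+-cancelʳ-≤ (5 * k * ρ) _ _ (begin
    5 * ρ * k + 5 * k * ρ                    ≡⟨ arr ρ k ⟩
    10 * (ρ * k)                             ≤⟨ *-monoʳ-≤ 10 (many y yJ) ⟩
    10 * ∑ Bs (λ B → nz (y · B))             ≡⟨ sym (∑-*ˡ Bs 10 _) ⟩
    ∑ Bs (λ B → 10 * nz (y · B))             ≤⟨ ∑-mono Bs each ⟩
    ∑ Bs (λ B → 10 * ρ * g B + ρ)            ≡⟨ trans (∑-+ Bs _ _) (cong₂ _+_ (∑-*ˡ Bs (10 * ρ) g) (trans (∑-const Bs ρ) (cong (_* ρ) len))) ⟩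
    10 * ρ * ∑ Bs g + 5 * k * ρ              ≡⟨ cong (_+ 5 * k * ρ) (arr′ ρ (∑ Bs g)) ⟩
    5 * ρ * (2 * ∑ Bs g) + 5 * k * ρ ∎))
    where
    open ≤-Reasoning
    ρ = rows y
    g : Subset n → ℕ
    g B = ⟦ ρ ≤ᵇ 10 * nz (y · B) ⟧
    arr : ∀ ρ k → 5 * ρ * k + 5 * k * ρ ≡ 10 * (ρ * k)
    arr = solve-∀
    arr′ : ∀ ρ k → 10 * ρ * k ≡ 5 * ρ * (2 * k)
    arr′ = solve-∀
    each : ∀ B → 10 * nz (y · B) ≤ 10 * ρ * g B + ρ
    each B with ρ ≤ᵇ 10 * nz (y · B) in eq
    ... | true  = ≤-trans (*-monoʳ-≤ 10 (few y B)) (≤-trans (≤-reflexive (sym (*-identityʳ _))) (m≤m+n (10 * ρ * 1) ρ))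
    ... | false = ≤-trans (<⇒≤ (≰⇒> (λ le → subst Data.Bool.T eq (≤⇒≤ᵇ le)))) (m≤n+m ρ _)

  -- A matrix with `20 b` nonzero rows keeps `2 b` nonzero entries in `y · B` for at least `k / 2`
  -- of the sets `B`. Each of these yields 0 with probability at most `b^(-1/2)`, all together with
  -- probability at most `b^(-k/4)`; hence the fourth power in the bound on the number of matrices.
  separate-big : ∀ b → 1 ≤ b → (ys : List (Matrix n)) → length ys ^ 4 < b ^ k →
                 ∃ λ Qs → length Qs ≡ 5 * k × (∀ {y} → y ∈ˡ ys → Within J y → 20 * b ≤ rows y →
                   ¬ (∀ {A B} → (A , B) ∈ˡ Qs → dot (y · B) A ≡ 0ℤ))
  separate-big b b≥1 ys lt with select _·_ ys Bs Good 4 (b ^ k) bnd lt good?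
    where
    open ≤-Reasoning
    Good : Matrix n → Set
    Good y = Within J y × 20 * b ≤ rows y
    good? : ∀ y → Dec (Good y)
    good? y = all? (λ i → all? (λ j → (lookup J j Bool.≟ false) →-dec (y i j ℤ.≟ 0ℤ))) ×-dec (20 * b ≤? rows y)
    bnd : ∀ y → Good y → ∏ Bs (λ B → cnt (y · B) 0ℤ) ^ 4 * b ^ k ≤ ((2 ^ n) ^ length Bs) ^ 4
    bnd y (yJ , big) = begin
      P ^ 4 * b ^ k                ≤⟨ *-monoʳ-≤ (P ^ 4) (^-monoʳ-≤ b {{>-nonZero b≥1}} (often y yJ (≤-trans (pos20 b≥1) big))) ⟩
      P ^ 4 * b ^ (2 * g)          ≡⟨ cong₂ _*_ (sym (^-*-assoc P 2 2)) (trans (cong (b ^_) (*-comm 2 g)) (sym (^-*-assoc b g 2))) ⟩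
      (P ^ 2) ^ 2 * (b ^ g) ^ 2    ≡⟨ sym (^-distribʳ-* 2 (P ^ 2) (b ^ g)) ⟩
      (P ^ 2 * b ^ g) ^ 2          ≤⟨ ^-monoˡ-≤ 2 (∏-bound Bs (λ B → cnt (y · B) 0ℤ) γ 2 b (2 ^ n) b≥1 (λ B → cnt≤ (y · B) 0ℤ) sq) ⟩
      (((2 ^ n) ^ length Bs) ^ 2) ^ 2 ≡⟨ ^-*-assoc ((2 ^ n) ^ length Bs) 2 2 ⟩
      ((2 ^ n) ^ length Bs) ^ 4 ∎
      where
      P = ∏ Bs (λ B → cnt (y · B) 0ℤ)
      γ : Subset n → Bool
      γ B = rows y ≤ᵇ 10 * nz (y · B)
      g = ∑ Bs (λ B → ⟦ γ B ⟧)
      pos20 : ∀ {m} → 1 ≤ m → 1 ≤ 20 * m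
      pos20 p = ≤-trans p (m≤m+n _ _)
      sq : ∀ B → γ B ≡ true → cnt (y · B) 0ℤ ^ 2 * b ≤ (2 ^ n) ^ 2
      sq B e = begin
        cnt (y · B) 0ℤ ^ 2 * b                                 ≤⟨ *-mono-≤ (≤-reflexive (cong (cnt (y · B) 0ℤ *_) (*-identityʳ _))) (≤-trans (m≤m+n b b) (n≤1+n _)) ⟩
        cnt (y · B) 0ℤ * cnt (y · B) 0ℤ * suc (b + b)          ≤⟨ zeros² (y · B) b (*-cancelˡ-≤ 10 (≤-trans (≤-reflexive (arr b)) (≤-trans big (≤ᵇ⇒≤ _ _ (subst Data.Bool.T (sym e) _))))) ⟩
        2 ^ n * 2 ^ n                                          ≡⟨ cong (2 ^ n *_) (sym (*-identityʳ _)) ⟩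
        (2 ^ n) ^ 2 ∎
        where
        arr : ∀ b → 10 * (b + b) ≡ 20 * b
        arr = solve-∀
  ... | Qs , l , sep = Qs , trans l len , λ m yJ big → sep m (yJ , big)

  -- Here a single nonzero row must do: at least `k` sets of the code detect it, and each of them
  -- halves the chance of seeing only zeros. The gain per set is only 2 instead of a power of `b`,
  -- so this is reserved for differences with at most `D₀` entries.
  separate-small : (ys : List (Matrix n)) → length ys < 2 ^ k →
                   ∃ λ Qs → length Qs ≡ 5 * k × (∀ {y} → y ∈ˡ ys → Within J y → 1 ≤ rows y →
                     ¬ (∀ {A B} → (A , B) ∈ˡ Qs → dot (y · B) A ≡ 0ℤ))
  separate-small ys lt with select _·_ ys Bs Good 1 (2 ^ k) bnd (subst (_< 2 ^ k) (sym (*-identityʳ _)) lt) good?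
    where
    open ≤-Reasoning
    Good : Matrix n → Set
    Good y = Within J y × 1 ≤ rows y
    good? : ∀ y → Dec (Good y)
    good? y = all? (λ i → all? (λ j → (lookup J j Bool.≟ false) →-dec (y i j ℤ.≟ 0ℤ))) ×-dec (1 ≤? rows y)
    bnd : ∀ y → Good y → ∏ Bs (λ B → cnt (y · B) 0ℤ) ^ 1 * 2 ^ k ≤ ((2 ^ n) ^ length Bs) ^ 1
    bnd y (yJ , pos) with ∑-∃ (fins n) (λ _ → 0) (λ i → ⟦ 0 <ᵇ nz (y i) ⟧) (subst (_< rows y) (sym (∑-zero (fins n))) pos)
    ... | i , i∈ , p = begin
      P ^ 1 * 2 ^ k                          ≤⟨ *-monoʳ-≤ (P ^ 1) (^-monoʳ-≤ 2 (detect (y i) (yJ i) (<ᵇ⇒< 0 _ (T1 p)))) ⟩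
      P ^ 1 * 2 ^ ∑ Bs (λ B → ⟦ γ B ⟧)       ≤⟨ ∏-bound Bs (λ B → cnt (y · B) 0ℤ) γ 1 2 (2 ^ n) (s≤s z≤n) (λ B → cnt≤ (y · B) 0ℤ) half ⟩
      ((2 ^ n) ^ length Bs) ^ 1 ∎
      where
      P = ∏ Bs (λ B → cnt (y · B) 0ℤ)
      γ : Subset n → Bool
      γ B = isNZ (dot (y i) B)
      T1 : ∀ {b} → 0 < ⟦ b ⟧ → Data.Bool.T b
      T1 {true} _ = _
      half : ∀ B → γ B ≡ true → cnt (y · B) 0ℤ ^ 1 * 2 ≤ (2 ^ n) ^ 1
      half B e = begin
        cnt (y · B) 0ℤ ^ 1 * 2   ≡⟨ trans (cong (_* 2) (*-identityʳ (cnt (y · B) 0ℤ))) (*-comm (cnt (y · B) 0ℤ) 2) ⟩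
        2 * cnt (y · B) 0ℤ       ≤⟨ zeros½ (y · B) (≤-trans (≤-reflexive (cong ⟦_⟧ (sym e))) (∑-pick (λ i → ⟦ isNZ ((y · B) i) ⟧) i∈)) ⟩
        2 ^ n                    ≡⟨ sym (*-identityʳ _) ⟩
        (2 ^ n) ^ 1 ∎
  ... | Qs , l , sep = Qs , trans l len , λ m yJ pos → sep m (yJ , pos)

-- Enumeration of sparse matrices

∑-fins-+ : ∀ a b (f : Fin (a + b) → ℕ) → ∑ (fins (a + b)) f ≡ ∑ (fins a) (λ i → f (i ↑ˡ b)) + ∑ (fins b) (λ j → f (a ↑ʳ j))
∑-fins-+ zero    b f = refl
∑-fins-+ (suc a) b f = trans (∑-suc (a + b) f) (trans (cong (f zero +_) (∑-fins-+ a b (f ∘ suc)))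
  (trans (sym (+-assoc (f zero) _ _)) (cong (_+ ∑ (fins b) (λ j → f (suc a ↑ʳ j))) (sym (∑-suc a (λ i → f (i ↑ˡ b)))))))

∑-fins-* : ∀ a b (f : Fin (a * b) → ℕ) → ∑ (fins (a * b)) f ≡ ∑ (fins a) (λ i → ∑ (fins b) (λ j → f (combine i j)))
∑-fins-* zero    b f = refl
∑-fins-* (suc a) b f = trans (∑-fins-+ b (a * b) f) (trans (cong (∑ (fins b) (λ i → f (i ↑ˡ (a * b))) +_) (∑-fins-* a b (λ j → f (b ↑ʳ j))))
  (sym (∑-suc a (λ i → ∑ (fins b) (λ j → f (combine i j))))))

-- Generic in the values, as it lists both the integer differences to be detected and the
-- nonnegative candidates of the decoder.
module Sparse {A : Set} (z : A) (nonzero : A → Bool) (vals : List A) (nonzero⇒ : ∀ {x} → nonzero x ≡ false → x ≡ z) where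

  count : ∀ {D} → Vec A D → ℕ
  count []ᵛ       = 0
  count (x ∷ᵛ xs) = ⟦ nonzero x ⟧ + count xs

  sparse : ∀ D → ℕ → List (Vec A D)
  sparse zero    k       = []ᵛ ∷ []
  sparse (suc D) zero    = map (z ∷ᵛ_) (sparse D 0)
  sparse (suc D) (suc k) = map (z ∷ᵛ_) (sparse D (suc k)) ++ concatMap (λ v → map (v ∷ᵛ_) (sparse D k)) vals

  private
    length-concatMap : ∀ {B C : Set} (h : B → List C) xs m → (∀ x → length (h x) ≡ m) → length (concatMap h xs) ≡ length xs * m
    length-concatMap h [] m e = refl
    length-concatMap h (x ∷ xs) m e = trans (List.length-++ (h x)) (cong₂ _+_ (e x) (length-concatMap h xs m e))

  length-sparse : ∀ D k → length (sparse D k) ≤ (1 + D * length vals) ^ k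
  length-sparse zero    k       = ≤-reflexive (sym (^-zeroˡ k))
  length-sparse (suc D) zero    = ≤-trans (≤-reflexive (List.length-map _ (sparse D 0))) (length-sparse D 0)
  length-sparse (suc D) (suc k) = begin
    length (map (z ∷ᵛ_) (sparse D (suc k)) ++ concatMap (λ v → map (v ∷ᵛ_) (sparse D k)) vals)
      ≡⟨ trans (List.length-++ (map (z ∷ᵛ_) (sparse D (suc k)))) (cong₂ _+_ (List.length-map _ (sparse D (suc k)))
           (length-concatMap _ vals _ (λ v → List.length-map (v ∷ᵛ_) (sparse D k)))) ⟩
    length (sparse D (suc k)) + V * length (sparse D k)   ≤⟨ +-mono-≤ (length-sparse D (suc k)) (*-monoʳ-≤ V (length-sparse D k)) ⟩
    (1 + D * V) * (1 + D * V) ^ k + V * (1 + D * V) ^ k   ≡⟨ sym (*-distribʳ-+ ((1 + D * V) ^ k) (1 + D * V) V) ⟩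
    (1 + D * V + V) * (1 + D * V) ^ k                     ≤⟨ *-mono-≤ (≤-reflexive (arr D V)) (^-monoˡ-≤ k (s≤s (m≤n+m (D * V) V))) ⟩
    (1 + suc D * V) * (1 + suc D * V) ^ k ∎
    where
    open ≤-Reasoning
    V = length vals
    arr : ∀ D V → 1 + D * V + V ≡ 1 + suc D * V
    arr = solve-∀

  ∈-sparse : ∀ {D k} (xs : Vec A D) → count xs ≤ k → (∀ i → nonzero (lookup xs i) ≡ true → lookup xs i ∈ˡ vals) → xs ∈ˡ sparse D k
  ∈-sparse []ᵛ le v = here refl
  ∈-sparse {suc D} {k} (x ∷ᵛ xs) le v with nonzero x in eq
  ∈-sparse {suc D} {zero}  (x ∷ᵛ xs) le v | false rewrite nonzero⇒ eq = ∈-map⁺ (z ∷ᵛ_) (∈-sparse xs le (v ∘ suc))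
  ∈-sparse {suc D} {suc k} (x ∷ᵛ xs) le v | false rewrite nonzero⇒ eq = ∈-++⁺ˡ (∈-map⁺ (z ∷ᵛ_) (∈-sparse xs le (v ∘ suc)))
  ∈-sparse {suc D} {suc k} (x ∷ᵛ xs) (s≤s le) v | true =
    ∈-++⁺ʳ (map (z ∷ᵛ_) (sparse D (suc k))) (∈-concatMap⁺ _ (Any.map (λ { refl → ∈-map⁺ (x ∷ᵛ_) (∈-sparse xs le (v ∘ suc)) }) (v zero eq)))

  count-tabulate : ∀ {D} (f : Fin D → A) → count (tabulate f) ≡ ∑ (fins D) (λ i → ⟦ nonzero (f i) ⟧)
  count-tabulate {zero}  f = refl
  count-tabulate {suc D} f = trans (cong (⟦ nonzero (f zero) ⟧ +_) (count-tabulate (f ∘ suc))) (sym (∑-suc D (λ i → ⟦ nonzero (f i) ⟧)))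

  unflatten : ∀ {n} → Vec A (n * n) → Fin n → Fin n → A
  unflatten xs i j = lookup xs (combine i j)

  sparse-complete : ∀ {n} k (y : Fin n → Fin n → A) → ∑ (fins n) (λ i → ∑ (fins n) (λ j → ⟦ nonzero (y i j) ⟧)) ≤ k →
                    (∀ i j → nonzero (y i j) ≡ true → y i j ∈ˡ vals) →
                    ∃ λ xs → xs ∈ˡ sparse (n * n) k × (∀ i j → unflatten xs i j ≡ y i j)
  sparse-complete {n} k y le v = xs , ∈-sparse xs cle vle , pt
    where
    g : Fin (n * n) → A
    g d = y (proj₁ (remQuot {n} n d)) (proj₂ (remQuot {n} n d))
    xs = tabulate g
    gc : ∀ i j → g (combine i j) ≡ y i j
    gc i j = cong (λ p → y (proj₁ p) (proj₂ p)) (Fin.remQuot-combine {n} {n} i j)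
    pt : ∀ i j → unflatten xs i j ≡ y i j
    pt i j = trans (lookup∘tabulate g (combine i j)) (gc i j)
    cle : count xs ≤ k
    cle = ≤-trans (≤-reflexive (trans (count-tabulate g) (trans (∑-fins-* n n _)
            (∑-cong (fins n) (λ i → ∑-cong (fins n) (λ j → cong (⟦_⟧ ∘ nonzero) (gc i j))))))) le
    vle : ∀ d → nonzero (lookup xs d) ≡ true → lookup xs d ∈ˡ vals
    vle d e = subst (_∈ˡ vals) (sym (lookup∘tabulate g d)) (v (proj₁ (remQuot {n} n d)) (proj₂ (remQuot {n} n d)) (trans (cong nonzero (sym (lookup∘tabulate g d))) e))

smallInts : ℕ → List ℤ
smallInts K = map +[1+_] (upTo K) ++ map -[1+_] (upTo K)

length-smallInts : ∀ K → length (smallInts K) ≡ K + K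
length-smallInts K rewrite List.length-++ (map +[1+_] (upTo K)) {map -[1+_] (upTo K)}
  | List.length-map +[1+_] (upTo K) | List.length-map -[1+_] (upTo K) | List.length-upTo K = refl

∈-smallInts : ∀ {K z} → ∣ z ∣ᶻ ≤ K → isNZ z ≡ true → z ∈ˡ smallInts K
∈-smallInts {K} {+[1+ m ]} le e = ∈-++⁺ˡ (∈-map⁺ +[1+_] (∈-upTo⁺ le))
∈-smallInts {K} { -[1+ m ]} le e = ∈-++⁺ʳ (map +[1+_] (upTo K)) (∈-map⁺ -[1+_] (∈-upTo⁺ le))

nnz : ∀ {n} → Matrix n → ℕ
nnz {n} y = ∑ (fins n) (λ i → nz (y i))

rows-cong : ∀ {n} {x y : Matrix n} → (∀ i j → x i j ≡ y i j) → rows x ≡ rows y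
rows-cong {n} e = ∑-cong (fins n) (λ i → cong (λ m → ⟦ 0 <ᵇ m ⟧) (∑-cong (fins n) (λ j → cong (⟦_⟧ ∘ isNZ) (e i j))))

·-cong : ∀ {n} {x y : Matrix n} → (∀ i j → x i j ≡ y i j) → ∀ A B → dot (x · B) A ≡ dot (y · B) A
·-cong e A B = dot-cong A (λ i → dot-cong B (e i))

abstract
  -- There are at most `b^(96 * (2 * M))` differences with `2M` nonzero entries, and `separate-big`
  -- wants the fourth power of their number below `b^k`: 768 = 96 · 2 · 4.
  bigSize : ℕ → ℕ
  bigSize M = 768 * M + 1

  bigSize≡ : ∀ M → bigSize M ≡ 768 * M + 1
  bigSize≡ M = refl

  M≤bigSize : ∀ M → M ≤ bigSize M
  M≤bigSize M = ≤-trans (m≤m+n M (767 * M)) (m≤m+n (768 * M) 1)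

  bigSize-exponent : ∀ M → 96 * (2 * M) * 4 < bigSize M
  bigSize-exponent M = ≤-reflexive (trans (cong suc arr) (+-comm 1 (768 * M)))
    where
    arr : 96 * (2 * M) * 4 ≡ 768 * M
    arr = trans (*-comm (96 * (2 * M)) 4) (trans (sym (*-assoc 4 96 (2 * M))) (sym (*-assoc 384 2 M)))

  -- With `x = a * D₀` there are at most `2^(96 * x)` differences with `D₀` nonzero entries. The
  -- summand `M` makes the code long enough for supports of size `M`.
  smallSize : ℕ → ℕ → ℕ
  smallSize M x = M + (96 * x + 1)

  smallSize≡ : ∀ M x → smallSize M x ≡ M + (96 * x + 1)
  smallSize≡ M x = refl

  M≤smallSize : ∀ M x → M ≤ smallSize M x
  M≤smallSize M x = m≤m+n M _

  smallSize-exponent : ∀ M a D → a * (96 * D) < smallSize M (a * D)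
  smallSize-exponent M a D = ≤-trans (≤-reflexive (trans (cong suc arr) (+-comm 1 (96 * (a * D))))) (m≤n+m (96 * (a * D) + 1) M)
    where
    arr : a * (96 * D) ≡ 96 * (a * D)
    arr = trans (sym (*-assoc a 96 D)) (trans (cong (_* D) (*-comm a 96)) (*-assoc 96 a D))

-- A power of two b with n ≤ b^16 fixes the scale of all logarithmic factors.
record Scale (n : ℕ) : Set where
  field
    a      : ℕ
    1≤a    : 1 ≤ a
    n≤b^16 : n ≤ (2 ^ a) ^ 16
    2≤n    : 2 ≤ n

  b : ℕ
  b = 2 ^ a

  2≤b : 2 ≤ b
  2≤b = ^-monoʳ-≤ 2 1≤a

  -- A matrix with more than `D₀` nonzero entries has at least `20 b` nonzero rows or at least
  -- `20 b` nonzero columns, so that `separate-big` applies to it or to its transpose. The others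
  -- are left to `separate-small`.
  D₀ : ℕ
  D₀ = (20 * b) * (20 * b)

  kBig kSmall : ℕ → ℕ
  kBig M   = bigSize M
  kSmall M = smallSize M (a * D₀)

  -- The exponent 96 is 6 · 16: the base is at most `n^6` for `n ≥ 2`, and `n ≤ b^16`.
  sparse-length : ∀ {ys k} → ys ≤ (1 + n * n * (n * n + n * n)) ^ k → ys ≤ b ^ (96 * k)
  sparse-length {ys} {k} le = begin
    ys                                   ≤⟨ le ⟩
    (1 + n * n * (n * n + n * n)) ^ k    ≤⟨ ^-monoˡ-≤ k (p n 2≤n) ⟩
    (n ^ 6) ^ k                          ≤⟨ ^-monoˡ-≤ k (^-monoˡ-≤ 6 n≤b^16) ⟩
    ((b ^ 16) ^ 6) ^ k                   ≡⟨ cong (_^ k) (^-*-assoc b 16 6) ⟩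
    (b ^ 96) ^ k                         ≡⟨ ^-*-assoc b 96 k ⟩
    b ^ (96 * k) ∎
    where
    open ≤-Reasoning
    p : ∀ n → 2 ≤ n → 1 + n * n * (n * n + n * n) ≤ n ^ 6
    p n h = begin
      1 + n * n * (n * n + n * n)                     ≤⟨ +-monoˡ-≤ _ (*-mono-≤ {1} {n * n * (n * n)} {1} {1} one ≤-refl) ⟩
      n * n * (n * n) * 1 + n * n * (n * n + n * n)   ≡⟨ arr n ⟩
      n * n * (n * n) * 3                             ≤⟨ *-monoʳ-≤ (n * n * (n * n)) (≤-trans (s≤s (s≤s (s≤s z≤n))) (*-mono-≤ h h)) ⟩
      n * n * (n * n) * (n * n)                       ≡⟨ arr′ n ⟩
      n ^ 6 ∎
      where
      one : 1 ≤ n * n * (n * n)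
      one = *-mono-≤ {1} {n * n} {1} (*-mono-≤ 1≤n 1≤n) (*-mono-≤ {1} {n} {1} 1≤n 1≤n)
        where 1≤n = ≤-trans (s≤s z≤n) h
      arr : ∀ n → n * n * (n * n) * 1 + n * n * (n * n + n * n) ≡ n * n * (n * n) * 3
      arr = solve-∀
      arr′ : ∀ n → n * n * (n * n) * (n * n) ≡ n * (n * (n * (n * (n * (n * 1)))))
      arr′ = solve-∀

  open Sparse 0ℤ isNZ (smallInts (n * n)) isNZ-false

  private
    ys : ℕ → List (Matrix n)
    ys k = map (unflatten {n}) (sparse (n * n) k)

    len-ys : ∀ k → length (ys k) ≤ b ^ (96 * k)
    len-ys k = sparse-length {k = k} (≤-trans (≤-reflexive (List.length-map (unflatten {n}) (sparse (n * n) k)))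
                 (subst (λ v → length (sparse (n * n) k) ≤ (1 + n * n * v) ^ k) (length-smallInts (n * n)) (length-sparse (n * n) k)))

  module _ where
    -- The length is `O(M + a * D₀)`, and `a * D₀` is at most `400 b³` because `a ≤ 2^a = b`; this
    -- is the origin of the additive cubic term. The two lists of queries handle the two
    -- alternatives on `d`.
    killer : ∀ (J : Subset n) M → card J ≤ M → ∃ λ Qs → length Qs ≡ 5 * kBig M + 5 * kSmall M ×
             (∀ (d : Matrix n) → Within J d → (∀ i j → ∣ d i j ∣ᶻ ≤ n * n) → nnz d ≤ 2 * M →
              (1 ≤ rows d × nnz d ≤ D₀) ⊎ 20 * b ≤ rows d → ¬ (∀ {A B} → (A , B) ∈ˡ Qs → dot (d · B) A ≡ 0ℤ))
    killer J M JM = Q₁ ++ Q₂ , trans (List.length-++ Q₁) (cong₂ _+_ (proj₁ (proj₂ sb)) (proj₁ (proj₂ ss))) , go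
      where
      open ≤-Reasoning
      1≤b = ≤-trans (s≤s z≤n) 2≤b
      big : length (ys (2 * M)) ^ 4 < b ^ kBig M
      big = begin-strict
        length (ys (2 * M)) ^ 4    ≤⟨ ^-monoˡ-≤ 4 (len-ys (2 * M)) ⟩
        (b ^ (96 * (2 * M))) ^ 4   ≡⟨ ^-*-assoc b (96 * (2 * M)) 4 ⟩
        b ^ (96 * (2 * M) * 4)     <⟨ ^-monoʳ-< b 2≤b (bigSize-exponent M) ⟩
        b ^ kBig M ∎
      small : length (ys D₀) < 2 ^ kSmall M
      small = begin-strict
        length (ys D₀)       ≤⟨ len-ys D₀ ⟩
        (2 ^ a) ^ (96 * D₀)  ≡⟨ ^-*-assoc 2 a (96 * D₀) ⟩
        2 ^ (a * (96 * D₀))  <⟨ ^-monoʳ-< 2 ≤-refl (smallSize-exponent M a D₀) ⟩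
        2 ^ kSmall M ∎
      sb = separate-big J (kBig M) (≤-trans JM (M≤bigSize M)) b 1≤b (ys (2 * M)) big
      ss = separate-small J (kSmall M) (≤-trans JM (M≤smallSize M _)) (ys D₀) small
      Q₁ = proj₁ sb
      Q₂ = proj₁ ss
      go : ∀ (d : Matrix n) → Within J d → (∀ i j → ∣ d i j ∣ᶻ ≤ n * n) → nnz d ≤ 2 * M →
           (1 ≤ rows d × nnz d ≤ D₀) ⊎ 20 * b ≤ rows d → ¬ (∀ {A B} → (A , B) ∈ˡ (Q₁ ++ Q₂) → dot (d · B) A ≡ 0ℤ)
      go d dJ bd le (inj₁ (pos , sm)) allz = use (sparse-complete D₀ d sm (λ i j → ∈-smallInts (bd i j)))
        where
        use : (∃ λ xs → xs ∈ˡ sparse (n * n) D₀ × (∀ i j → unflatten xs i j ≡ d i j)) → ⊥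
        use (xs , m , pt) = proj₂ (proj₂ ss) (∈-map⁺ (unflatten {n}) m) (λ i j e → trans (pt i j) (dJ i j e)) (subst (1 ≤_) (sym (rows-cong pt)) pos)
                             (λ {A} {B} q → trans (·-cong pt A B) (allz (∈-++⁺ʳ Q₁ q)))
      go d dJ bd le (inj₂ bg) allz = use (sparse-complete (2 * M) d le (λ i j → ∈-smallInts (bd i j)))
        where
        use : (∃ λ xs → xs ∈ˡ sparse (n * n) (2 * M) × (∀ i j → unflatten xs i j ≡ d i j)) → ⊥
        use (xs , m , pt) = proj₂ (proj₂ sb) (∈-map⁺ (unflatten {n}) m) (λ i j e → trans (pt i j) (dJ i j e)) (subst (20 * b ≤_) (sym (rows-cong pt)) bg)
                             (λ {A} {B} q → trans (·-cong pt A B) (allz (∈-++⁺ˡ q)))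

-- Nonnegative matrices determined by their rectangle sums

NMat : ℕ → Set
NMat n = Fin n → Fin n → ℕ

sumOver : ∀ {n} → (Fin n → ℕ) → Subset n → ℕ
sumOver {n} f B = ∑ (fins n) (λ j → ⟦ lookup B j ⟧ * f j)

rect : ∀ {n} → NMat n → Subset n → Subset n → ℕ
rect X A B = sumOver (λ i → sumOver (X i) B) A

supp : ∀ {n} → NMat n → ℕ
supp {n} X = ∑ (fins n) (λ i → ∑ (fins n) (λ j → ⟦ 0 <ᵇ X i j ⟧))

diff : ∀ {n} → NMat n → NMat n → Matrix n
diff X X′ i j = (ℤ.+ X i j) ℤ.- (ℤ.+ X′ i j)

dot-diff : ∀ {n} (f g : Fin n → ℕ) B → dot (λ j → (ℤ.+ f j) ℤ.- (ℤ.+ g j)) B ≡ (ℤ.+ sumOver f B) ℤ.- (ℤ.+ sumOver g B)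
dot-diff f g []ᵛ = refl
dot-diff {suc n} f g (b ∷ᵛ B) = trans (cong (λ z → (if b then (ℤ.+ f zero) ℤ.- (ℤ.+ g zero) else 0ℤ) ℤ.+ z) (dot-diff (f ∘ suc) (g ∘ suc) B))
  (trans (go b) (sym (cong₂ (λ x y → (ℤ.+ x) ℤ.- (ℤ.+ y)) (∑-suc n (λ j → ⟦ lookup (b ∷ᵛ B) j ⟧ * f j)) (∑-suc n (λ j → ⟦ lookup (b ∷ᵛ B) j ⟧ * g j)))))
  where
  F′ = sumOver (f ∘ suc) B
  G′ = sumOver (g ∘ suc) B
  r : ∀ x y u v → x ℤ.- y ℤ.+ (u ℤ.- v) ≡ (x ℤ.+ u) ℤ.- (y ℤ.+ v)
  r = ℤR.solve-∀
  go : ∀ b → (if b then (ℤ.+ f zero) ℤ.- (ℤ.+ g zero) else 0ℤ) ℤ.+ ((ℤ.+ F′) ℤ.- (ℤ.+ G′))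
           ≡ (ℤ.+ (⟦ b ⟧ * f zero + F′)) ℤ.- (ℤ.+ (⟦ b ⟧ * g zero + G′))
  go true  = trans (r (ℤ.+ f zero) (ℤ.+ g zero) (ℤ.+ F′) (ℤ.+ G′))
               (cong₂ (λ x y → (ℤ.+ (x + F′)) ℤ.- (ℤ.+ (y + G′))) (sym (+-identityʳ (f zero))) (sym (+-identityʳ (g zero))))
  go false = ℤ.+-identityˡ _

-- A query that fails to tell two matrices apart annihilates their difference, so identification
-- reduces to detecting every sparse difference.
rect-diff : ∀ {n} (X X′ : NMat n) A B → rect X A B ≡ rect X′ A B → dot (diff X X′ · B) A ≡ 0ℤ
rect-diff X X′ A B e = trans (dot-cong A (λ i → dot-diff (X i) (X′ i) B))
  (trans (dot-diff (λ i → sumOver (X i) B) (λ i → sumOver (X′ i) B) A)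
  (trans (cong (λ x → (ℤ.+ x) ℤ.- (ℤ.+ rect X′ A B)) e) (ℤ.+-inverseʳ (ℤ.+ rect X′ A B))))

rect-transpose : ∀ {n} (X : NMat n) A B → rect (λ i j → X j i) A B ≡ rect X B A
rect-transpose {n} X A B = begin
  ∑ (fins n) (λ i → ⟦ lookup A i ⟧ * ∑ (fins n) (λ j → ⟦ lookup B j ⟧ * X j i))
    ≡⟨ ∑-cong (fins n) (λ i → sym (∑-*ˡ (fins n) ⟦ lookup A i ⟧ _)) ⟩
  ∑ (fins n) (λ i → ∑ (fins n) (λ j → ⟦ lookup A i ⟧ * (⟦ lookup B j ⟧ * X j i)))
    ≡⟨ ∑-swap (fins n) (fins n) _ ⟩
  ∑ (fins n) (λ j → ∑ (fins n) (λ i → ⟦ lookup A i ⟧ * (⟦ lookup B j ⟧ * X j i)))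
    ≡⟨ ∑-cong (fins n) (λ j → trans (∑-cong (fins n) (λ i → arr ⟦ lookup A i ⟧ ⟦ lookup B j ⟧ (X j i))) (∑-*ˡ (fins n) ⟦ lookup B j ⟧ _)) ⟩
  rect X B A ∎
  where
  open ≡-Reasoning
  arr : ∀ a b c → a * (b * c) ≡ b * (a * c)
  arr = solve-∀

isNZ-diff : ∀ x y → ⟦ isNZ ((ℤ.+ x) ℤ.- (ℤ.+ y)) ⟧ ≤ ⟦ 0 <ᵇ x ⟧ + ⟦ 0 <ᵇ y ⟧
isNZ-diff zero    zero    = z≤n
isNZ-diff (suc x) y       = ≤-trans (⟦⟧≤1 _) (s≤s z≤n)
isNZ-diff zero    (suc y) = ⟦⟧≤1 (isNZ (0ℤ ℤ.- (ℤ.+ suc y)))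

nnz-diff : ∀ {n} (X X′ : NMat n) → nnz (diff X X′) ≤ supp X + supp X′
nnz-diff {n} X X′ = ≤-trans
  (∑-mono (fins n) (λ i → ≤-trans (∑-mono (fins n) (λ j → isNZ-diff (X i j) (X′ i j))) (≤-reflexive (∑-+ (fins n) _ _))))
  (≤-reflexive (∑-+ (fins n) _ _))

nnz≤rows*cols : ∀ {n} (d : Matrix n) → nnz d ≤ rows d * rows (λ i j → d j i)
nnz≤rows*cols {n} d = begin
  ∑ (fins n) (λ i → ∑ (fins n) (λ j → ⟦ isNZ (d i j) ⟧))  ≤⟨ ∑-mono (fins n) (λ i → ∑-mono (fins n) (λ j → each i j)) ⟩
  ∑ (fins n) (λ i → ∑ (fins n) (λ j → r i * c j))         ≡⟨ ∑-cong (fins n) (λ i → ∑-*ˡ (fins n) (r i) c) ⟩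
  ∑ (fins n) (λ i → r i * ∑ (fins n) c)                   ≡⟨ ∑-*ʳ (fins n) (∑ (fins n) c) r ⟩
  rows d * rows (λ i j → d j i) ∎
  where
  open ≤-Reasoning
  r c : Fin n → ℕ
  r i = ⟦ 0 <ᵇ nz (d i) ⟧
  c j = ⟦ 0 <ᵇ nz (λ i → d i j) ⟧
  one : ∀ {m} → 1 ≤ m → ⟦ 0 <ᵇ m ⟧ ≡ 1
  one (s≤s _) = refl
  each : ∀ i j → ⟦ isNZ (d i j) ⟧ ≤ r i * c j
  each i j with isNZ (d i j) in e
  ... | false = z≤n
  ... | true = ≤-reflexive (sym (cong₂ _*_ (one (≤-trans (≤-reflexive (cong ⟦_⟧ (sym e))) (∑-pickᶠ (λ j → ⟦ isNZ (d i j) ⟧) j)))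
                                            (one (≤-trans (≤-reflexive (cong ⟦_⟧ (sym e))) (∑-pickᶠ (λ i → ⟦ isNZ (d i j) ⟧) i)))))

card-∑ : ∀ {n} (J : Subset n) → card J ≡ ∑ (fins n) (λ j → ⟦ lookup J j ⟧)
card-∑ []ᵛ      = refl
card-∑ {suc n} (b ∷ᵛ J) = trans (cong (⟦ b ⟧ +_) (card-∑ J)) (sym (∑-suc n (λ j → ⟦ lookup (b ∷ᵛ J) j ⟧)))

cols≤card : ∀ {n} (J : Subset n) (d : Matrix n) → Within J d → rows (λ i j → d j i) ≤ card J
cols≤card {n} J d dJ = ≤-trans (∑-mono (fins n) each) (≤-reflexive (sym (card-∑ J)))
  where
  each : ∀ j → ⟦ 0 <ᵇ nz (λ i → d i j) ⟧ ≤ ⟦ lookup J j ⟧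
  each j with lookup J j in e
  ... | true = ⟦⟧≤1 _
  ... | false rewrite trans (∑-cong (fins n) (λ i → cong (⟦_⟧ ∘ isNZ) (dJ i j e))) (∑-zero (fins n)) = z≤n

Bounded′ : ∀ {n} → ℕ → NMat n → Set
Bounded′ V X = ∀ i j → X i j ≤ V

∣diff∣≤ : ∀ {n V} (X X′ : NMat n) → Bounded′ V X → Bounded′ V X′ → ∀ i j → ∣ diff X X′ i j ∣ᶻ ≤ V
∣diff∣≤ {n} {V} X X′ b b′ i j = ≤-trans (≤-reflexive (cong ∣_∣ᶻ (ℤ.[+m]-[+n]≡m⊖n (X i j) (X′ i j))))
  (≤-trans (ℤ.∣m⊝n∣≤m⊔n (X i j) (X′ i j)) (⊔-lub (b i j) (b′ i j)))

diff-zero : ∀ {n} (X X′ : NMat n) → nnz (diff X X′) ≡ 0 → ∀ i j → X i j ≡ X′ i j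
diff-zero {n} X X′ e i j = ℤ.+-injective (ℤ.i-j≡0⇒i≡j _ _ (isNZ-false (b0 (∑≡0 (λ j → ⟦ isNZ (diff X X′ i j) ⟧) (∑≡0 (λ i → nz (diff X X′ i)) e (∈-allFin i)) (∈-allFin j)))))
  where
  b0 : ∀ {b} → ⟦ b ⟧ ≡ 0 → b ≡ false
  b0 {false} _ = refl
  b0 {true} ()

ZeroOutside : ∀ {n} → Subset n → NMat n → Set
ZeroOutside J X = ∀ i j → lookup J j ≡ false → X i j ≡ 0

within-diff : ∀ {n} (J : Subset n) (X X′ : NMat n) → ZeroOutside J X → ZeroOutside J X′ → Within J (diff X X′)
within-diff J X X′ z z′ i j e = cong₂ (λ x y → (ℤ.+ x) ℤ.- (ℤ.+ y)) (z i j e) (z′ i j e)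

Queries : ℕ → Set
Queries n = List (Subset n × Subset n)

Agree : ∀ {n} → Queries n → NMat n → NMat n → Set
Agree Qs X X′ = ∀ {A B} → (A , B) ∈ˡ Qs → rect X A B ≡ rect X′ A B

module Identify {n} (sc : Scale n) where
  open Scale sc

  abstract
    killers : (J : Subset n) (M : ℕ) → card J ≤ M → Queries n
    killers J M JM = proj₁ (killer J M JM)

    killers-length : ∀ J M JM → length (killers J M JM) ≡ 5 * kBig M + 5 * kSmall M
    killers-length J M JM = proj₁ (proj₂ (killer J M JM))

    killers-kill : ∀ J M JM (d : Matrix n) → Within J d → (∀ i j → ∣ d i j ∣ᶻ ≤ n * n) → nnz d ≤ 2 * M →
                   (1 ≤ rows d × nnz d ≤ D₀) ⊎ 20 * b ≤ rows d → ¬ (∀ {A B} → (A , B) ∈ˡ killers J M JM → dot (d · B) A ≡ 0ℤ)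
    killers-kill J M JM = proj₂ (proj₂ (killer J M JM))

  nnz≤2M : ∀ {M} (X X′ : NMat n) → supp X ≤ M → supp X′ ≤ M → nnz (diff X X′) ≤ 2 * M
  nnz≤2M {M} X X′ s s′ = ≤-trans (nnz-diff X X′) (≤-trans (+-mono-≤ s s′) (≤-reflexive (cong (M +_) (sym (+-identityʳ M)))))

  pos-rows : ∀ (d : Matrix n) → 1 ≤ nnz d → 1 ≤ rows d
  pos-rows d pos = n≢0⇒n>0 (λ e → <-irrefl refl (<-≤-trans pos (≤-trans (nnz≤rows*cols d) (≤-reflexive (cong (_* rows (λ i j → d j i)) e)))))

  -- In a single column there are as many nonzero rows as nonzero entries, so a difference with more
  -- than `D₀` entries has `20 b` nonzero rows, and queries of one orientation suffice.
  identify-column : ∀ J M JM → card J ≤ 1 → (X X′ : NMat n) → ZeroOutside J X → ZeroOutside J X′ →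
                    Bounded′ (n * n) X → Bounded′ (n * n) X′ → supp X ≤ M → supp X′ ≤ M →
                    Agree (killers J M JM) X X′ → ∀ i j → X i j ≡ X′ i j
  identify-column J M JM J1 X X′ z z′ b b′ s s′ ag = diff-zero X X′ (n<1⇒n≡0 (≰⇒> no-diff))
    where
    d = diff X X′
    dJ = within-diff J X X′ z z′
    nnz≤rows : nnz d ≤ rows d
    nnz≤rows = ≤-trans (nnz≤rows*cols d) (≤-trans (*-monoʳ-≤ (rows d) (≤-trans (cols≤card J d dJ) J1)) (≤-reflexive (*-identityʳ _)))
    no-diff : ¬ 1 ≤ nnz d
    no-diff pos = killers-kill J M JM d dJ (∣diff∣≤ X X′ b b′) (nnz≤2M X X′ s s′) cases (λ {A} {B} q → rect-diff X X′ A B (ag q))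
      where
      cases : (1 ≤ rows d × nnz d ≤ D₀) ⊎ 20 * Scale.b sc ≤ rows d
      cases with nnz d ≤? D₀
      ... | yes le = inj₁ (pos-rows d pos , le)
      ... | no gt = inj₂ (≤-trans (≤-trans (≤-reflexive (sym (*-identityʳ _))) (*-monoʳ-≤ (20 * Scale.b sc) (≤-trans (≤-trans (s≤s z≤n) 2≤b) (m≤m+n (Scale.b sc) _)))) (≤-trans (<⇒≤ (≰⇒> gt)) nnz≤rows))

  -- A difference with more than `D₀` entries may be concentrated in few rows; then it has `20 b`
  -- nonzero columns, and the transposed queries for `I` catch it.
  identify : ∀ I J M IM JM → (X X′ : NMat n) → ZeroOutside J X → ZeroOutside J X′ →
             ZeroOutside I (λ i j → X j i) → ZeroOutside I (λ i j → X′ j i) →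
             Bounded′ (n * n) X → Bounded′ (n * n) X′ → supp X ≤ M → supp X′ ≤ M →
             Agree (killers J M JM ++ map swap (killers I M IM)) X X′ → ∀ i j → X i j ≡ X′ i j
  identify I J M IM JM X X′ z z′ w w′ b b′ s s′ ag = diff-zero X X′ (n<1⇒n≡0 (≰⇒> no-diff))
    where
    d = diff X X′
    dᵀ : Matrix n
    dᵀ i j = d j i
    nnzᵀ : nnz dᵀ ≡ nnz d
    nnzᵀ = ∑-swap (fins n) (fins n) _
    kill : (1 ≤ rows d × nnz d ≤ D₀) ⊎ 20 * Scale.b sc ≤ rows d → ⊥
    kill c = killers-kill J M JM d (within-diff J X X′ z z′) (∣diff∣≤ X X′ b b′) (nnz≤2M X X′ s s′) c
               (λ {A} {B} q → rect-diff X X′ A B (ag (∈-++⁺ˡ q)))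
    killᵀ : 20 * Scale.b sc ≤ rows dᵀ → ⊥
    killᵀ c = killers-kill I M IM dᵀ (within-diff I (λ i j → X j i) (λ i j → X′ j i) w w′) (λ i j → ∣diff∣≤ X X′ b b′ j i)
               (≤-trans (≤-reflexive nnzᵀ) (nnz≤2M X X′ s s′)) (inj₂ c)
               (λ {A} {B} q → rect-diff (λ i j → X j i) (λ i j → X′ j i) A B
                  (trans (rect-transpose X A B) (trans (ag (∈-++⁺ʳ (killers J M JM) (∈-map⁺ swap q))) (sym (rect-transpose X′ A B)))))
    no-diff : ¬ 1 ≤ nnz d
    no-diff pos with nnz d ≤? D₀
    ... | yes le = kill (inj₁ (pos-rows d pos , le))
    ... | no gt with 20 * Scale.b sc ≤? rows d
    ...   | yes r = kill (inj₂ r)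
    ...   | no ¬r with 20 * Scale.b sc ≤? rows dᵀ
    ...     | yes r = killᵀ r
    ...     | no ¬r′ = gt (≤-trans (nnz≤rows*cols d) (*-mono-≤ (<⇒≤ (≰⇒> ¬r)) (<⇒≤ (≰⇒> ¬r′))))

-- Query programs and learning a nonnegative matrix from rectangle sums

-- Decision trees with leaves of any type, so that they can be composed; `compile` turns those with
-- numbers at the leaves into a `QTree`.
data Prog (n : ℕ) (A : Set) : Set where
  ret : A → Prog n A
  ask : Subset n → (ℕ → Prog n A) → Prog n A

infixl 1 _>>=_
_>>=_ : ∀ {n A B} → Prog n A → (A → Prog n B) → Prog n B
ret x   >>= f = f x
ask S k >>= f = ask S (λ a → k a >>= f)

module _ {n} (G : SimpleGraph n) where

  val : ∀ {A} → Prog n A → A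
  val (ret x)   = x
  val (ask S k) = val (k (cutSize G S))

  cost : ∀ {A} → Prog n A → ℕ
  cost (ret x)   = 0
  cost (ask S k) = suc (cost (k (cutSize G S)))

  val->>= : ∀ {A B} (p : Prog n A) (f : A → Prog n B) → val (p >>= f) ≡ val (f (val p))
  val->>= (ret x)   f = refl
  val->>= (ask S k) f = val->>= (k (cutSize G S)) f

  cost->>= : ∀ {A B} (p : Prog n A) (f : A → Prog n B) → cost (p >>= f) ≡ cost p + cost (f (val p))
  cost->>= (ret x)   f = refl
  cost->>= (ask S k) f = cong suc (cost->>= (k (cutSize G S)) f)

fmap : ∀ {n A B} → (A → B) → Prog n A → Prog n B
fmap h p = p >>= λ x → ret (h x)

mapP : ∀ {n} {A B : Set} → (A → Prog n B) → List A → Prog n (List B)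
mapP f []       = ret []
mapP f (x ∷ xs) = f x >>= λ y → fmap (y ∷_) (mapP f xs)

module _ {n} (G : SimpleGraph n) where

  val-fmap : ∀ {A B} (h : A → B) (p : Prog n A) → val G (fmap h p) ≡ h (val G p)
  val-fmap h p = val->>= G p (λ x → ret (h x))

  cost-fmap : ∀ {A B} (h : A → B) (p : Prog n A) → cost G (fmap h p) ≡ cost G p
  cost-fmap h p = trans (cost->>= G p (λ x → ret (h x))) (+-identityʳ (cost G p))

  val-mapP : ∀ {A B : Set} (f : A → Prog n B) (g : A → B) → (∀ x → val G (f x) ≡ g x) → ∀ xs → val G (mapP f xs) ≡ map g xs
  val-mapP f g e []       = refl
  val-mapP f g e (x ∷ xs) rewrite val->>= G (f x) (λ y → fmap (y ∷_) (mapP f xs))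
    | val-fmap (val G (f x) ∷_) (mapP f xs) | e x | val-mapP f g e xs = refl

  cost-mapP : ∀ {A B : Set} (f : A → Prog n B) κ → (∀ x → cost G (f x) ≤ κ) → ∀ xs → cost G (mapP f xs) ≤ length xs * κ
  cost-mapP f κ e []       = z≤n
  cost-mapP f κ e (x ∷ xs) rewrite cost->>= G (f x) (λ y → fmap (y ∷_) (mapP f xs))
    | cost-fmap (val G (f x) ∷_) (mapP f xs) = +-mono-≤ (e x) (cost-mapP f κ e xs)

-- Learning a matrix under a guessed bound on its support

search : {A : Set} {P : A → Set} → (∀ x → Dec (P x)) → List A → A → A
search P? []       d = d
search P? (x ∷ xs) d with P? x
... | yes _ = x
... | no _  = search P? xs d

search-spec : ∀ {A : Set} {P : A → Set} (P? : ∀ x → Dec (P x)) {xs x} d → x ∈ˡ xs → P x → P (search P? xs d)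
search-spec P? {y ∷ xs} d m p with P? y
... | yes q = q
search-spec P? {y ∷ xs} d (here refl) p | no ¬q = ⊥-elim (¬q p)
search-spec P? {y ∷ xs} d (there m)   p | no ¬q = search-spec P? d m p

full : ∀ {n} → Subset n
full = replicate _ true

single : ∀ {n} → Fin n → Subset n
single i = tabulate (i ==_)

sumOver-single : ∀ {n} (f : Fin n → ℕ) i → sumOver f (single i) ≡ f i
sumOver-single {n} f i = trans (∑-cong (fins n) (λ j → cong (λ b → ⟦ b ⟧ * f j) (lookup∘tabulate (i ==_) j))) (∑-δ i f)

sumOver-full : ∀ {n} (f : Fin n → ℕ) → sumOver f full ≡ ∑ (fins n) f
sumOver-full {n} f = ∑-cong (fins n) (λ j → trans (cong (λ b → ⟦ b ⟧ * f j) (lookup-replicate j true)) (+-identityʳ _))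

rect-single : ∀ {n} (X : NMat n) i j → rect X (single i) (single j) ≡ X i j
rect-single X i j = trans (sumOver-single _ i) (sumOver-single (X i) j)

sumOver-cong : ∀ {n} {f g : Fin n → ℕ} → (∀ i → f i ≡ g i) → ∀ A → sumOver f A ≡ sumOver g A
sumOver-cong {n} e A = ∑-cong (fins n) (λ j → cong (⟦ lookup A j ⟧ *_) (e j))

rect-cong : ∀ {n} {X Y : NMat n} → (∀ i j → X i j ≡ Y i j) → ∀ A B → rect X A B ≡ rect Y A B
rect-cong e A B = sumOver-cong (λ i → sumOver-cong (e i) B) A

supp-cong : ∀ {n} {X Y : NMat n} → (∀ i j → X i j ≡ Y i j) → supp X ≡ supp Y
supp-cong {n} e = ∑-cong (fins n) (λ i → ∑-cong (fins n) (λ j → cong (λ m → ⟦ 0 <ᵇ m ⟧) (e i j)))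

card-empty : ∀ n → card (replicate n false) ≡ 0
card-empty zero    = refl
card-empty (suc n) = card-empty n

card-single : ∀ {n} (i : Fin n) → card (single i) ≤ 1
card-single {n} i = ≤-reflexive (trans (card-∑ (single i)) (trans (∑-cong (fins n) (λ j → trans (cong ⟦_⟧ (lookup∘tabulate (i ==_) j)) (sym (*-identityʳ _)))) (∑-δ i (λ _ → 1))))

-- If the guess `M` is below the true support, the decoded matrix means nothing. The empty set as
-- fallback keeps the later queries defined and their number bounded; a wrong result is rejected by
-- `check`.
clamp : ∀ {n} M → Subset n → Σ (Subset n) (λ I → card I ≤ M)
clamp {n} M I with card I ≤? M
... | yes le = I , le
... | no _   = replicate n false , subst (_≤ M) (sym (card-empty n)) z≤n

clamp-id : ∀ {n} M (I : Subset n) → card I ≤ M → proj₁ (clamp M I) ≡ I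
clamp-id M I le with card I ≤? M
... | yes _ = refl
... | no ¬p = ⊥-elim (¬p le)

∑-tight : ∀ {A : Set} (xs : List A) (f g : A → ℕ) → (∀ x → f x ≤ g x) → ∑ xs g ≤ ∑ xs f → ∀ {x} → x ∈ˡ xs → f x ≡ g x
∑-tight (y ∷ xs) f g le tot (here refl) = ≤-antisym (le y) (+-cancelʳ-≤ (∑ xs f) _ _ (≤-trans (+-monoʳ-≤ (g y) (∑-mono xs le)) tot))
∑-tight (y ∷ xs) f g le tot (there m) = ∑-tight xs f g le (+-cancelˡ-≤ (f y) _ _ (≤-trans (+-monoˡ-≤ (∑ xs g) (le y)) tot)) m

pairs : ∀ {n} → NMat n → List (Fin n × Fin n)
pairs {n} c = concatMap (λ i → concatMap (λ j → if 0 <ᵇ c i j then (i , j) ∷ [] else []) (fins n)) (fins n)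

length-pairs : ∀ {n} (c : NMat n) → length (pairs c) ≡ supp c
length-pairs {n} c = trans (len (fins n) _) (∑-cong (fins n) (λ i → trans (len (fins n) _) (∑-cong (fins n) (λ j → one (0 <ᵇ c i j)))))
  where
  len : ∀ {A B : Set} (xs : List A) (h : A → List B) → length (concatMap h xs) ≡ ∑ xs (length ∘ h)
  len []       h = refl
  len (x ∷ xs) h = trans (List.length-++ (h x)) (cong (length (h x) +_) (len xs h))
  one : ∀ {A : Set} {x : A} b → length (if b then x ∷ [] else []) ≡ ⟦ b ⟧
  one true  = refl
  one false = refl

∈-pairs : ∀ {n} (c : NMat n) i j → 1 ≤ c i j → (i , j) ∈ˡ pairs c
∈-pairs {n} c i j pos = ∈-concat (∈-allFin i) (∈-concat (∈-allFin j) (it (c i j) pos))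
  where
  ∈-concat : ∀ {A B : Set} {h : A → List B} {xs x y} → x ∈ˡ xs → y ∈ˡ h x → y ∈ˡ concatMap h xs
  ∈-concat {h = h} {x′ ∷ xs} (here refl) m′ = ∈-++⁺ˡ m′
  ∈-concat {h = h} {x′ ∷ xs} (there m) m′ = ∈-++⁺ʳ (h x′) (∈-concat m m′)
  it : ∀ m → 1 ≤ m → (i , j) ∈ˡ (if 0 <ᵇ m then (i , j) ∷ [] else [])
  it (suc m) _ = here refl

map-≡ : ∀ {A B : Set} (f g : A → B) {xs x} → map f xs ≡ map g xs → x ∈ˡ xs → f x ≡ g x
map-≡ f g {y ∷ xs} e (here refl) = List.∷-injectiveˡ e
map-≡ f g {y ∷ xs} e (there m)   = map-≡ f g (List.∷-injectiveʳ e) m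

abstract
  learnFactor : ℕ
  learnFactor = 4000000

  -- 2·(5·kBig + 5·kSmall) queries for the rows and columns, as many for the entries, and M + 1 for the check.
  learnFactor-bound : ∀ M x → 1 ≤ M → x ≤ 400 * M → let q = 5 * bigSize M + 5 * smallSize M x in
                      q * 4 + (q * 4 + ((q + q) * 4 + (M * 4 + 4))) ≤ learnFactor * M
  learnFactor-bound M x 1≤M xM = begin
    q * 4 + (q * 4 + ((q + q) * 4 + (M * 4 + 4)))
      ≤⟨ +-mono-≤ (*-monoˡ-≤ 4 q≤) (+-mono-≤ (*-monoˡ-≤ 4 q≤) (+-mono-≤ (*-monoˡ-≤ 4 (+-mono-≤ q≤ q≤)) (+-mono-≤ (≤-reflexive (*-comm M 4)) (m≤m*n' 4)))) ⟩
    c * M * 4 + (c * M * 4 + ((c * M + c * M) * 4 + (4 * M + 4 * M)))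
      ≡⟨ arr (c * M) (4 * M) ⟩
    16 * (c * M) + 2 * (4 * M)
      ≡⟨ cong₂ _+_ (sym (*-assoc 16 c M)) (sym (*-assoc 2 4 M)) ⟩
    16 * c * M + 8 * M
      ≡⟨ sym (*-distribʳ-+ M (16 * c) 8) ⟩
    (16 * c + 8) * M
      ≤⟨ *-monoˡ-≤ M (≤ᵇ⇒≤ (16 * c + 8) 4000000 _) ⟩
    learnFactor * M ∎
    where
    open ≤-Reasoning
    q c : ℕ
    q = 5 * bigSize M + 5 * smallSize M x
    c = 200000
    m≤m*n' : ∀ k → k ≤ k * M
    m≤m*n' k = ≤-trans (≤-reflexive (sym (*-identityʳ k))) (*-monoʳ-≤ k 1≤M)
    arr : ∀ y z → y * 4 + (y * 4 + ((y + y) * 4 + (z + z))) ≡ 16 * y + 2 * z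
    arr = solve-∀
    bs : bigSize M ≤ 769 * M
    bs = begin
      bigSize M          ≡⟨ bigSize≡ M ⟩
      768 * M + 1        ≤⟨ +-monoʳ-≤ (768 * M) 1≤M ⟩
      768 * M + M        ≡⟨ +-comm (768 * M) M ⟩
      769 * M ∎
    ss : smallSize M x ≤ 38402 * M
    ss = begin
      smallSize M x             ≡⟨ smallSize≡ M x ⟩
      M + (96 * x + 1)          ≤⟨ +-monoʳ-≤ M (+-mono-≤ (*-monoʳ-≤ 96 xM) 1≤M) ⟩
      M + (96 * (400 * M) + M)  ≡⟨ cong (M +_) (trans (cong (_+ M) (sym (*-assoc 96 400 M))) (+-comm (96 * 400 * M) M)) ⟩
      M + (M + 38400 * M) ∎
    q≤ : q ≤ c * M
    q≤ = begin
      5 * bigSize M + 5 * smallSize M x      ≤⟨ +-mono-≤ (*-monoʳ-≤ 5 bs) (*-monoʳ-≤ 5 ss) ⟩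
      5 * (769 * M) + 5 * (38402 * M)        ≡⟨ cong₂ _+_ (sym (*-assoc 5 769 M)) (sym (*-assoc 5 38402 M)) ⟩
      5 * 769 * M + 5 * 38402 * M            ≡⟨ sym (*-distribʳ-+ M (5 * 769) (5 * 38402)) ⟩
      (5 * 769 + 5 * 38402) * M              ≤⟨ *-monoˡ-≤ M (≤ᵇ⇒≤ (5 * 769 + 5 * 38402) 200000 _) ⟩
      c * M ∎

<ᵇ0 : ∀ {x} → (0 <ᵇ x) ≡ false → x ≡ 0
<ᵇ0 {zero} _ = refl

module Learn {n} (sc : Scale n) (j₀ : Fin n) where
  open Scale sc
  open Identify sc
  open Sparse 0 (0 <ᵇ_) (map suc (upTo (n * n))) <ᵇ0

  rectOf : NMat n → Subset n × Subset n → ℕ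
  rectOf c q = rect c (proj₁ q) (proj₂ q)

  Fits : (I J : Subset n) (M : ℕ) (Qs : Queries n) (answers : List ℕ) → NMat n → Set
  Fits I J M Qs as c = ZeroOutside J c × ZeroOutside I (λ i j → c j i) × Bounded′ (n * n) c × supp c ≤ M × map (rectOf c) Qs ≡ as

  fits? : ∀ I J M Qs as c → Dec (Fits I J M Qs as c)
  fits? I J M Qs as c = zo? J c ×-dec zo? I (λ i j → c j i) ×-dec all? (λ i → all? (λ j → c i j ≤? n * n)) ×-dec (supp c ≤? M) ×-dec List.≡-dec _≟_ (map (rectOf c) Qs) as
    where
    zo? : ∀ J c → Dec (ZeroOutside J c)
    zo? J c = all? (λ i → all? (λ j → (lookup J j Bool.≟ false) →-dec (c i j ≟ 0)))

  candidates : ℕ → List (NMat n)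
  candidates M = map (unflatten {n}) (sparse (n * n) M)

  -- Exhaustive search is free, as only queries count. The zero matrix is the answer when no
  -- candidate fits, which for true answers can happen only if the guess `M` or one of the supports
  -- `I` and `J` is wrong.
  decode : (I J : Subset n) (M : ℕ) (Qs : Queries n) (answers : List ℕ) → NMat n
  decode I J M Qs as = search (fits? I J M Qs as) (candidates M) (λ _ _ → 0)

  decode-fits : ∀ I J M Qs X → ZeroOutside J X → ZeroOutside I (λ i j → X j i) → Bounded′ (n * n) X → supp X ≤ M →
                Fits I J M Qs (map (rectOf X) Qs) (decode I J M Qs (map (rectOf X) Qs))
  decode-fits I J M Qs X z w bd s = fromX (sparse-complete M X s (λ i j → val∈ (X i j) (bd i j)))
    where
    val∈ : ∀ x → x ≤ n * n → (0 <ᵇ x) ≡ true → x ∈ˡ map suc (upTo (n * n))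
    val∈ (suc x) le _ = ∈-map⁺ suc (∈-upTo⁺ le)
    fromX : (∃ λ xs → xs ∈ˡ sparse (n * n) M × (∀ i j → unflatten xs i j ≡ X i j)) → _
    fromX (xs , m , pt) = search-spec (fits? I J M Qs (map (rectOf X) Qs)) (λ _ _ → 0) (∈-map⁺ (unflatten {n}) m)
      ((λ i j e → trans (pt i j) (z i j e)) , (λ i j e → trans (pt j i) (w i j e)) , (λ i j → subst (_≤ n * n) (sym (pt i j)) (bd i j)) ,
       subst (_≤ M) (sym (supp-cong pt)) s , List.map-cong (λ q → rect-cong pt (proj₁ q) (proj₂ q)) Qs)

  entry : NMat n → Fin n × Fin n → ℕ
  entry c p = c (proj₁ p) (proj₂ p)

  total : NMat n → ℕ
  total c = ∑ (fins n) (λ i → ∑ (fins n) (c i))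

  readEntry : (Subset n → Subset n → Prog n ℕ) → Fin n × Fin n → Prog n ℕ
  readEntry rq p = rq (single (proj₁ p)) (single (proj₂ p))

  J₀ : Subset n
  J₀ = single j₀

  module _ (M : ℕ) (1≤M : 1 ≤ M) where

    J₀≤M : card J₀ ≤ M
    J₀≤M = ≤-trans (card-single j₀) 1≤M

    colQs : Queries n
    colQs = killers J₀ M J₀≤M

    rowSum : (Subset n → Subset n → Prog n ℕ) → Subset n × Subset n → Prog n ℕ
    rowSum rq q = if lookup (proj₂ q) j₀ then rq (proj₁ q) full else ret 0

    activeOf : NMat n → Subset n
    activeOf c = tabulate (λ i → 0 <ᵇ c i j₀)

    -- The code is built for at most `2^M` parity patterns, so the nonzero rows and columns must be
    -- known before the entries are learned. They are found by learning the row sums, placed in the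
    -- single column `j₀`; by nonnegativity a row sum vanishes only if its row does.
    active : (Subset n → Subset n → Prog n ℕ) → Prog n (Σ (Subset n) (λ I → card I ≤ M))
    active rq = fmap (λ as → clamp M (activeOf (decode full J₀ M colQs as))) (mapP (rowSum rq) colQs)

    entryQs : Σ (Subset n) (λ I → card I ≤ M) → Σ (Subset n) (λ I → card I ≤ M) → Queries n
    entryQs (I , IM) (J , JM) = killers J M JM ++ map swap (killers I M IM)

    accept : NMat n → List ℕ → ℕ → Maybe (NMat n)
    accept c es t with List.≡-dec _≟_ es (map (entry c) (pairs c)) | t ≟ total c
    ... | yes _ | yes _ = just c
    ... | yes _ | no _  = nothing
    ... | no _  | _     = nothing

    accept⇒ : ∀ c es t c′ → accept c es t ≡ just c′ → c ≡ c′ × es ≡ map (entry c) (pairs c) × t ≡ total c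
    accept⇒ c es t c′ e with List.≡-dec _≟_ es (map (entry c) (pairs c)) | t ≟ total c
    accept⇒ c es t .c refl | yes p | yes q = refl , p , q

    accept⇐ : ∀ c es t → es ≡ map (entry c) (pairs c) → t ≡ total c → accept c es t ≡ just c
    accept⇐ c es t p q with List.≡-dec _≟_ es (map (entry c) (pairs c)) | t ≟ total c
    ... | yes _ | yes _ = refl
    ... | no ¬p | _     = ⊥-elim (¬p p)
    ... | yes _ | no ¬q = ⊥-elim (¬q q)

    audit : (Subset n → Subset n → Prog n ℕ) → NMat n → Prog n (Maybe (NMat n))
    audit rq c = mapP (readEntry rq) (pairs c) >>= λ es → fmap (accept c es) (rq full full)

    check : (Subset n → Subset n → Prog n ℕ) → NMat n → Prog n (Maybe (NMat n))
    check rq c with supp c ≤? M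
    ... | no _  = ret nothing
    ... | yes _ = audit rq c

    entries : (Subset n → Subset n → Prog n ℕ) → (I J : Σ (Subset n) (λ I → card I ≤ M)) → Prog n (NMat n)
    entries rq I J = fmap (decode (proj₁ I) (proj₁ J) M (entryQs I J)) (mapP (λ q → rq (proj₁ q) (proj₂ q)) (entryQs I J))

    attempt : (Subset n → Subset n → Prog n ℕ) → Prog n (Maybe (NMat n))
    attempt rq = active rq >>= λ I → active (λ A B → rq B A) >>= λ J → entries rq I J >>= check rq

  module Correct (G : SimpleGraph n) where

    Reads : (Subset n → Subset n → Prog n ℕ) → NMat n → Set
    Reads rq X = ∀ A B → val G (rq A B) ≡ rect X A B

    Cheap : (Subset n → Subset n → Prog n ℕ) → Set
    Cheap rq = ∀ A B → cost G (rq A B) ≤ 4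

    module _ (M : ℕ) (1≤M : 1 ≤ M) where

      private Qs = colQs M 1≤M

      active-spec : ∀ rq X → Reads rq X → Bounded′ n X → supp X ≤ M → let I = proj₁ (val G (active M 1≤M rq)) in ZeroOutside I (λ i j → X j i)
      active-spec rq X rd bd s = subst (λ I → ZeroOutside (proj₁ I) (λ i j → X j i)) (sym veq) zero-out
        where
        r : Fin n → ℕ
        r i = ∑ (fins n) (X i)
        R : NMat n
        R i j = ⟦ j₀ == j ⟧ * r i
        r≤ : ∀ i → r i ≤ n * n
        r≤ i = ≤-trans (∑-mono (fins n) (bd i)) (≤-reflexive (∑ᶠ-const n n))
        Rj₀ : ∀ i → R i j₀ ≡ r i
        Rj₀ i = trans (cong (λ b → ⟦ b ⟧ * r i) (==-refl j₀)) (+-identityʳ (r i))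
        RJ : ZeroOutside J₀ R
        RJ i j e = cong (λ b → ⟦ b ⟧ * r i) (trans (sym (lookup∘tabulate (j₀ ==_) j)) e)
        Rfull : ZeroOutside full (λ i j → R j i)
        Rfull i j e with trans (sym (lookup-replicate j true)) e
        ... | ()
        Rbd : Bounded′ (n * n) R
        Rbd i j = ≤-trans (*-monoˡ-≤ (r i) (⟦⟧≤1 (j₀ == j))) (≤-trans (≤-reflexive (+-identityʳ _)) (r≤ i))
        one≤ : ∀ (f : Fin n → ℕ) → ⟦ 0 <ᵇ ∑ (fins n) f ⟧ ≤ ∑ (fins n) (λ j → ⟦ 0 <ᵇ f j ⟧)
        one≤ f = go (fins n)
          where
          go : ∀ xs → ⟦ 0 <ᵇ ∑ xs f ⟧ ≤ ∑ xs (λ j → ⟦ 0 <ᵇ f j ⟧)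
          go [] = z≤n
          go (x ∷ xs) with f x
          ... | zero  = go xs
          ... | suc _ = s≤s z≤n
        Rsupp : supp R ≤ M
        Rsupp = ≤-trans (∑-mono (fins n) (λ i → ≤-trans (≤-reflexive (trans (∑-cong (fins n) (λ j → δpos (j₀ == j) (r i))) (∑-δ j₀ (λ _ → ⟦ 0 <ᵇ r i ⟧)))) (one≤ (X i)))) s
          where
          δpos : ∀ b x → ⟦ 0 <ᵇ ⟦ b ⟧ * x ⟧ ≡ ⟦ b ⟧ * ⟦ 0 <ᵇ x ⟧
          δpos true  x = trans (cong (λ y → ⟦ 0 <ᵇ y ⟧) (+-identityʳ x)) (sym (+-identityʳ _))
          δpos false x = refl
        reads : ∀ q → val G (rowSum M 1≤M rq q) ≡ rectOf R q
        reads (A , B) with lookup B j₀ in e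
        ... | true = trans (rd A full) (sumOver-cong (λ i → trans (sumOver-full (X i)) (sym (rowR i))) A)
          where
          rowR : ∀ i → sumOver (R i) B ≡ r i
          rowR i = trans (∑-cong (fins n) (λ j → arr ⟦ lookup B j ⟧ ⟦ j₀ == j ⟧ (r i))) (trans (∑-δ j₀ (λ j → ⟦ lookup B j ⟧ * r i)) (trans (cong (λ b → ⟦ b ⟧ * r i) e) (+-identityʳ _)))
            where
            arr : ∀ a b c → a * (b * c) ≡ b * (a * c)
            arr = solve-∀
        ... | false = sym (trans (sumOver-cong rowR A) (trans (∑-cong (fins n) (λ i → *-zeroʳ ⟦ lookup A i ⟧)) (∑-zero (fins n))))
          where
          rowR : ∀ i → sumOver (R i) B ≡ 0
          rowR i = trans (∑-cong (fins n) (λ j → arr ⟦ lookup B j ⟧ ⟦ j₀ == j ⟧ (r i))) (trans (∑-δ j₀ (λ j → ⟦ lookup B j ⟧ * r i)) (cong (λ b → ⟦ b ⟧ * r i) e))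
            where
            arr : ∀ a b c → a * (b * c) ≡ b * (a * c)
            arr = solve-∀
        ĉ = decode full J₀ M Qs (map (rectOf R) Qs)
        fit = decode-fits full J₀ M Qs R RJ Rfull Rbd Rsupp
        ĉ≡R : ∀ i j → ĉ i j ≡ R i j
        ĉ≡R = identify-column J₀ M (J₀≤M M 1≤M) (card-single j₀) ĉ R (proj₁ fit) RJ (proj₁ (proj₂ (proj₂ fit))) Rbd
                (proj₁ (proj₂ (proj₂ (proj₂ fit)))) Rsupp (λ q → map-≡ (rectOf ĉ) (rectOf R) (proj₂ (proj₂ (proj₂ (proj₂ fit)))) q)
        I = activeOf M 1≤M ĉ
        lI : ∀ i → lookup I i ≡ (0 <ᵇ r i)
        lI i = trans (lookup∘tabulate (λ i → 0 <ᵇ ĉ i j₀) i) (cong (0 <ᵇ_) (trans (ĉ≡R i j₀) (Rj₀ i)))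
        I≤M : card I ≤ M
        I≤M = ≤-trans (≤-reflexive (card-∑ I)) (≤-trans (∑-mono (fins n) (λ i → ≤-trans (≤-reflexive (cong ⟦_⟧ (lI i))) (one≤ (X i)))) s)
        veq : val G (active M 1≤M rq) ≡ clamp M I
        veq = trans (val-fmap G _ (mapP (rowSum M 1≤M rq) Qs)) (cong (λ as → clamp M (activeOf M 1≤M (decode full J₀ M Qs as))) (val-mapP G (rowSum M 1≤M rq) (rectOf R) reads Qs))
        zero-out : ZeroOutside (proj₁ (clamp M I)) (λ i j → X j i)
        zero-out i j e = n≤0⇒n≡0 (≤-trans (∑-pickᶠ (X j) i) (≤-reflexive (<ᵇ0 (trans (sym (lI j)) (trans (cong (λ I′ → lookup I′ j) (sym (clamp-id M I I≤M))) e)))))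

      rect-full : ∀ X → rect X full full ≡ total X
      rect-full X = trans (sumOver-full (λ i → sumOver (X i) full)) (∑-cong (fins n) (λ i → sumOver-full (X i)))

      audit-val : ∀ rq X c → Reads rq X → val G (audit M 1≤M rq c) ≡ accept M 1≤M c (map (entry X) (pairs c)) (total X)
      audit-val rq X c rd = trans (val->>= G (mapP (readEntry rq) (pairs c)) (λ es → fmap (accept M 1≤M c es) (rq full full)))
        (trans (val-fmap G (accept M 1≤M c _) (rq full full)) (cong₂ (accept M 1≤M c)
          (val-mapP G (readEntry rq) (entry X) (λ p → trans (rd _ _) (rect-single X (proj₁ p) (proj₂ p))) (pairs c))
          (trans (rd full full) (rect-full X))))

      -- Soundness holds even if the guess `M` is too small for `X`: where `c` is positive the
      -- entries have been read and agree, so `c ≤ X` entrywise, and equal totals then force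
      -- equality.
      check-sound : ∀ rq X c c′ → Reads rq X → val G (check M 1≤M rq c) ≡ just c′ → ∀ i j → c′ i j ≡ X i j
      check-sound rq X c c′ rd e with supp c ≤? M
      check-sound rq X c c′ rd () | no _
      ... | yes _ = go (accept⇒ M 1≤M c (map (entry X) (pairs c)) (total X) c′ (trans (sym (audit-val rq X c rd)) e))
        where
        go : c ≡ c′ × map (entry X) (pairs c) ≡ map (entry c) (pairs c) × total X ≡ total c → ∀ i j → c′ i j ≡ X i j
        go (refl , p , tot) i j = ∑-tight (fins n) (c i) (X i) (pt i) (≤-reflexive (sym (rowtight i))) (∈-allFin j)
          where
          pt : ∀ i j → c i j ≤ X i j
          pt i j with c i j in e
          ... | zero  = z≤n
          ... | suc m = ≤-reflexive (trans (sym e) (sym (map-≡ (entry X) (entry c) p (∈-pairs c i j (≤-trans (s≤s z≤n) (≤-reflexive (sym e)))))))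
          rowtight : ∀ i → ∑ (fins n) (c i) ≡ ∑ (fins n) (X i)
          rowtight i = ∑-tight (fins n) (λ i → ∑ (fins n) (c i)) (λ i → ∑ (fins n) (X i)) (λ i → ∑-mono (fins n) (pt i)) (≤-reflexive tot) (∈-allFin i)

      check-complete : ∀ rq X c → Reads rq X → (∀ i j → c i j ≡ X i j) → supp X ≤ M → val G (check M 1≤M rq c) ≡ just c
      check-complete rq X c rd pt s with supp c ≤? M
      ... | no ¬p = ⊥-elim (¬p (subst (_≤ M) (sym (supp-cong pt)) s))
      ... | yes _ = trans (audit-val rq X c rd) (accept⇐ M 1≤M c _ _ (List.map-cong (λ p → sym (pt (proj₁ p) (proj₂ p))) (pairs c))
                      (∑-cong (fins n) (λ i → ∑-cong (fins n) (λ j → sym (pt i j)))))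

      check-cost : ∀ rq c → Cheap rq → cost G (check M 1≤M rq c) ≤ M * 4 + 4
      check-cost rq c ch with supp c ≤? M
      ... | no _ = z≤n
      ... | yes s = ≤-trans (≤-reflexive (trans (cost->>= G (mapP (readEntry rq) (pairs c)) (λ es → fmap (accept M 1≤M c es) (rq full full)))
                                                (cong (cost G (mapP (readEntry rq) (pairs c)) +_) (cost-fmap G _ (rq full full)))))
                      (+-mono-≤ (≤-trans (cost-mapP G (readEntry rq) 4 (λ p → ch _ _) (pairs c)) (*-monoˡ-≤ 4 (subst (_≤ M) (sym (length-pairs c)) s)))
                                (ch full full))

-- Learning a matrix of unknown support by doubling the guess

m<2^m : ∀ m → m < 2 ^ m
m<2^m zero    = s≤s z≤n
m<2^m (suc m) = +-mono-≤ (m^n>0 2 m) (≤-trans (m<2^m m) (≤-reflexive (sym (+-identityʳ _))))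

-- Vectors instead of functions: matrices that agree entrywise become equal tables, and a program
-- run on a learned table can be rewritten to a run on the true one.
Table : ℕ → Set
Table n = Vec (Vec ℕ n) n

toTable : ∀ {n} → NMat n → Table n
toTable c = tabulate (λ i → tabulate (c i))

toTable-cong : ∀ {n} {c d : NMat n} → (∀ i j → c i j ≡ d i j) → toTable c ≡ toTable d
toTable-cong e = tabulate-cong (λ i → tabulate-cong (e i))

_⟨_,_⟩ : ∀ {n} → Table n → Fin n → Fin n → ℕ
t ⟨ i , j ⟩ = lookup (lookup t i) j

toTable-at : ∀ {n} (c : NMat n) i j → toTable c ⟨ i , j ⟩ ≡ c i j
toTable-at c i j = trans (cong (λ r → lookup r j) (lookup∘tabulate (λ i → tabulate (c i)) i)) (lookup∘tabulate (c i) j)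

private
  double : ∀ M x → M * (x + (x + 0)) ≡ (M + M) * x
  double = solve-∀
  quadruple : ∀ C M → C * M + C * (M + M) + C * M ≡ C * (4 * M)
  quadruple = solve-∀
  regroup : ∀ C M L → C * M + L + C * M ≡ L + C * (M + M)
  regroup = solve-∀
  twice : ∀ C M → C * M + 0 + C * M ≡ C * (2 * M)
  twice = solve-∀

module Doubling {n} (sc : Scale n) (j₀ : Fin n) where
  open Scale sc
  open Identify sc
  open Learn sc j₀

  RQ = Subset n → Subset n → Prog n ℕ

  mutual
    loop : RQ → ℕ → (M : ℕ) → 1 ≤ M → Prog n (Table n)
    loop rq zero    M p = ret (toTable (λ _ _ → 0))
    loop rq (suc f) M p = attempt M p rq >>= retry rq f M p

    retry : RQ → ℕ → (M : ℕ) → 1 ≤ M → Maybe (NMat n) → Prog n (Table n)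
    retry rq f M p (just c) = ret (toTable c)
    retry rq f M p nothing  = loop rq f (M + M) (≤-trans p (m≤m+n M M))

  -- Starting at `b³` absorbs the term `a * D₀`, so that an attempt costs `O(M)` from the first
  -- round on.
  M₀ : ℕ
  M₀ = b * b * b

  1≤M₀ : 1 ≤ M₀
  1≤M₀ = *-mono-≤ {1} {b * b} {1} {b} (*-mono-≤ {1} {b} {1} {b} 1≤b 1≤b) 1≤b
    where 1≤b = ≤-trans (s≤s z≤n) 2≤b

  aD₀ : a * D₀ ≤ 400 * M₀
  aD₀ = ≤-trans (*-monoˡ-≤ D₀ (<⇒≤ (m<2^m a))) (≤-reflexive (arr b))
    where
    arr : ∀ b → b * ((20 * b) * (20 * b)) ≡ 400 * (b * b * b)
    arr b = trans (cong (b *_) (trans (*-assoc 20 b (20 * b)) (trans (cong (20 *_) (trans (sym (*-assoc b 20 b)) (trans (cong (_* b) (*-comm b 20)) (*-assoc 20 b b)))) (sym (*-assoc 20 20 (b * b))))))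
                  (trans (sym (*-assoc b 400 (b * b))) (trans (cong (_* (b * b)) (*-comm b 400)) (trans (*-assoc 400 b (b * b)) (cong (400 *_) (sym (*-assoc b b b))))))

  abstract
    learn : RQ → Prog n (Table n)
    learn rq = loop rq (suc (n * n)) M₀ 1≤M₀

  module _ (G : SimpleGraph n) (rq : RQ) (X : NMat n) (rd : ∀ A B → val G (rq A B) ≡ rect X A B) (ch : ∀ A B → cost G (rq A B) ≤ 4)
           (bd : Bounded′ n X) where
    open Correct G

    private
      rqᵀ : RQ
      rqᵀ A B = rq B A
      Xᵀ : NMat n
      Xᵀ i j = X j i
      rdᵀ : ∀ A B → val G (rqᵀ A B) ≡ rect Xᵀ A B
      rdᵀ A B = trans (rd B A) (sym (rect-transpose X A B))
      suppᵀ : supp Xᵀ ≡ supp X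
      suppᵀ = ∑-swap (fins n) (fins n) _
      bd² : Bounded′ (n * n) X
      bd² i j = ≤-trans (bd i j) (≤-trans (≤-reflexive (sym (*-identityʳ n))) (*-monoʳ-≤ n (≤-trans (s≤s z≤n) 2≤n)))

    module _ (M : ℕ) (p : 1 ≤ M) where
      private
        I = val G (active M p rq)
        J = val G (active M p rqᵀ)
        Qs = entryQs M p I J
        ĉ = decode (proj₁ I) (proj₁ J) M Qs (map (rectOf X) Qs)

      entries-val : val G (entries M p rq I J) ≡ ĉ
      entries-val = trans (val-fmap G _ (mapP (λ q → rq (proj₁ q) (proj₂ q)) Qs))
        (cong (decode (proj₁ I) (proj₁ J) M Qs) (val-mapP G (λ q → rq (proj₁ q) (proj₂ q)) (rectOf X) (λ q → rd (proj₁ q) (proj₂ q)) Qs))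

      attempt-val : val G (attempt M p rq) ≡ val G (check M p rq ĉ)
      attempt-val = trans (val->>= G (active M p rq) (λ I → active M p rqᵀ >>= λ J → entries M p rq I J >>= check M p rq))
        (trans (val->>= G (active M p rqᵀ) (λ J → entries M p rq I J >>= check M p rq))
        (trans (val->>= G (entries M p rq I J) (check M p rq)) (cong (λ c → val G (check M p rq c)) entries-val)))

      attempt-sound : ∀ c → val G (attempt M p rq) ≡ just c → ∀ i j → c i j ≡ X i j
      attempt-sound c e = check-sound M p rq X ĉ c rd (trans (sym attempt-val) e)

      attempt-complete : supp X ≤ M → val G (attempt M p rq) ≡ just ĉ
      attempt-complete s = trans attempt-val (check-complete M p rq X ĉ rd ĉ≡X s)
        where
        wI : ZeroOutside (proj₁ I) Xᵀ
        wI = active-spec M p rq X rd bd s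
        zJ : ZeroOutside (proj₁ J) X
        zJ = active-spec M p rqᵀ Xᵀ rdᵀ (λ i j → bd j i) (subst (_≤ M) (sym suppᵀ) s)
        fit = decode-fits (proj₁ I) (proj₁ J) M Qs X zJ wI bd² s
        ĉ≡X : ∀ i j → ĉ i j ≡ X i j
        ĉ≡X = identify (proj₁ I) (proj₁ J) M (proj₂ I) (proj₂ J) ĉ X (proj₁ fit) zJ (proj₁ (proj₂ fit)) wI
                (proj₁ (proj₂ (proj₂ fit))) bd² (proj₁ (proj₂ (proj₂ (proj₂ fit)))) s
                (λ q → map-≡ (rectOf ĉ) (rectOf X) (proj₂ (proj₂ (proj₂ (proj₂ fit)))) q)

      attempt-cost : a * D₀ ≤ 400 * M → cost G (attempt M p rq) ≤ learnFactor * M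
      attempt-cost aD = begin
        cost G (attempt M p rq)
          ≡⟨ trans (cost->>= G (active M p rq) (λ I → active M p rqᵀ >>= λ J → entries M p rq I J >>= check M p rq)) (cong (cost G (active M p rq) +_)
             (trans (cost->>= G (active M p rqᵀ) (λ J → entries M p rq I J >>= check M p rq)) (cong (cost G (active M p rqᵀ) +_)
              (cost->>= G (entries M p rq I J) (check M p rq))))) ⟩
        cost G (active M p rq) + (cost G (active M p rqᵀ) + (cost G (entries M p rq I J) + cost G (check M p rq _)))
          ≤⟨ +-mono-≤ (act rq ch) (+-mono-≤ (act rqᵀ (λ A B → ch B A)) (+-mono-≤ ent (check-cost M p rq _ ch))) ⟩
        q * 4 + (q * 4 + ((q + q) * 4 + (M * 4 + 4)))
          ≤⟨ learnFactor-bound M (a * D₀) p aD ⟩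
        learnFactor * M ∎
        where
        open ≤-Reasoning
        q = 5 * kBig M + 5 * kSmall M
        act : ∀ r → (∀ A B → cost G (r A B) ≤ 4) → cost G (active M p r) ≤ q * 4
        act r ch = ≤-trans (≤-reflexive (cost-fmap G _ (mapP (rowSum M p r) (colQs M p))))
          (≤-trans (cost-mapP G (rowSum M p r) 4 each (colQs M p)) (≤-reflexive (cong (_* 4) (killers-length _ M _))))
          where
          each : ∀ q → cost G (rowSum M p r q) ≤ 4
          each (A , B) with lookup B j₀
          ... | Data.Bool.true  = ch A full
          ... | Data.Bool.false = z≤n
        ent : cost G (entries M p rq I J) ≤ (q + q) * 4
        ent = ≤-trans (≤-reflexive (cost-fmap G _ (mapP (λ q → rq (proj₁ q) (proj₂ q)) Qs)))
          (≤-trans (cost-mapP G (λ q → rq (proj₁ q) (proj₂ q)) 4 (λ q → ch (proj₁ q) (proj₂ q)) Qs)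
            (≤-reflexive (cong (_* 4) (trans (List.length-++ (killers (proj₁ J) M (proj₂ J)))
              (cong₂ _+_ (killers-length (proj₁ J) M (proj₂ J)) (trans (List.length-map swap (killers (proj₁ I) M (proj₂ I))) (killers-length (proj₁ I) M (proj₂ I))))))))

    loop-val : ∀ f M p → supp X ≤ M * 2 ^ f → val G (loop rq (suc f) M p) ≡ toTable X
    loop-val f M p s = trans (val->>= G (attempt M p rq) (retry rq f M p)) (go f s (val G (attempt M p rq)) refl)
      where
      go : ∀ f → supp X ≤ M * 2 ^ f → ∀ r → val G (attempt M p rq) ≡ r → val G (retry rq f M p r) ≡ toTable X
      go f       s (just c) e = toTable-cong (attempt-sound M p c e)
      go zero    s nothing  e = ⊥-elim (contra (trans (sym e) (attempt-complete M p (≤-trans s (≤-reflexive (*-identityʳ M))))))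
        where
        contra : ∀ {A : Set} {x : A} → nothing ≡ just x → ⊥
        contra ()
      go (suc f) s nothing  e = loop-val f (M + M) _ (≤-trans s (≤-reflexive (double M (2 ^ f))))

    loop-cost₁ : ∀ f M p → a * D₀ ≤ 400 * M → supp X ≤ M → cost G (loop rq (suc f) M p) ≤ learnFactor * M
    loop-cost₁ f M p aD s = ≤-trans (≤-reflexive (trans (cost->>= G (attempt M p rq) (retry rq f M p))
      (trans (cong (λ r → cost G (attempt M p rq) + cost G (retry rq f M p r)) (attempt-complete M p s)) (+-identityʳ _)))) (attempt-cost M p aD)

    -- The added term `learnFactor * M` is a telescoping potential: together with the cost of an
    -- attempt at `M` it becomes the potential for `M + M`. At the last doubling `M` is still at
    -- most `supp X`, so the geometric sum stays within four times the support.
    loop-cost₂ : ∀ f M p → a * D₀ ≤ 400 * M → supp X ≤ M * 2 ^ f → M ≤ supp X → cost G (loop rq (suc f) M p) + learnFactor * M ≤ learnFactor * (4 * supp X)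
    loop-cost₂ f M p aD s lt = ≤-trans (≤-reflexive (cong (_+ C * M) (cost->>= G (attempt M p rq) (retry rq f M p)))) (go f s (val G (attempt M p rq)) refl)
      where
      open ≤-Reasoning
      C = learnFactor
      att = cost G (attempt M p rq)
      aD′ : a * D₀ ≤ 400 * (M + M)
      aD′ = ≤-trans aD (*-monoʳ-≤ 400 (m≤m+n M M))
      go : ∀ f → supp X ≤ M * 2 ^ f → ∀ r → val G (attempt M p rq) ≡ r → att + cost G (retry rq f M p r) + C * M ≤ C * (4 * supp X)
      go f s (just c) e = begin
        att + 0 + C * M        ≤⟨ +-monoˡ-≤ (C * M) (+-monoˡ-≤ 0 (attempt-cost M p aD)) ⟩
        C * M + 0 + C * M      ≡⟨ twice C M ⟩
        C * (2 * M)            ≤⟨ *-monoʳ-≤ C (*-mono-≤ {2} {4} (s≤s (s≤s z≤n)) lt) ⟩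
        C * (4 * supp X) ∎
      go zero s nothing e = ⊥-elim (contra (trans (sym e) (attempt-complete M p (≤-trans s (≤-reflexive (*-identityʳ M))))))
        where
        contra : ∀ {A : Set} {x : A} → nothing ≡ just x → ⊥
        contra ()
      go (suc f) s nothing e = byCases (≤-total (supp X) (M + M))
        where
        M′ = M + M
        1≤M′ : 1 ≤ M′
        1≤M′ = ≤-trans p (m≤m+n M M)
        L = cost G (loop rq (suc f) M′ 1≤M′)
        byCases : supp X ≤ M′ ⊎ M′ ≤ supp X → att + L + C * M ≤ C * (4 * supp X)
        byCases (inj₁ le) = begin
          att + L + C * M                 ≤⟨ +-monoˡ-≤ (C * M) (+-mono-≤ (attempt-cost M p aD) (loop-cost₁ f M′ 1≤M′ aD′ le)) ⟩
          C * M + C * (M + M) + C * M     ≡⟨ quadruple C M ⟩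
          C * (4 * M)                     ≤⟨ *-monoʳ-≤ C (*-monoʳ-≤ 4 lt) ⟩
          C * (4 * supp X) ∎
        byCases (inj₂ ge) = begin
          att + L + C * M              ≤⟨ +-monoˡ-≤ (C * M) (+-monoˡ-≤ L (attempt-cost M p aD)) ⟩
          C * M + L + C * M            ≡⟨ regroup C M L ⟩
          L + C * (M + M)              ≤⟨ loop-cost₂ f M′ 1≤M′ aD′ (≤-trans s (≤-reflexive (double M (2 ^ f)))) ge ⟩
          C * (4 * supp X) ∎

    supp≤ : supp X ≤ M₀ * 2 ^ (n * n)
    supp≤ = begin
      supp X                       ≤⟨ ∑-mono (fins n) (λ i → ∑-mono (fins n) (λ j → ⟦⟧≤1 (0 <ᵇ X i j))) ⟩
      ∑ (fins n) (λ _ → ∑ (fins n) (λ _ → 1)) ≡⟨ trans (∑ᶠ-const n _) (cong (n *_) (trans (∑ᶠ-const n 1) (*-identityʳ n))) ⟩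
      n * n                        ≤⟨ <⇒≤ (m<2^m (n * n)) ⟩
      2 ^ (n * n)                  ≤⟨ ≤-trans (≤-reflexive (sym (+-identityʳ _))) (*-monoˡ-≤ (2 ^ (n * n)) 1≤M₀) ⟩
      M₀ * 2 ^ (n * n) ∎
      where open ≤-Reasoning

    abstract
      learn-val : val G (learn rq) ≡ toTable X
      learn-val = loop-val (n * n) M₀ 1≤M₀ supp≤

      learn-cost : cost G (learn rq) ≤ learnFactor * (M₀ + 4 * supp X)
      learn-cost = byCases (≤-total (supp X) M₀)
        where
        byCases : supp X ≤ M₀ ⊎ M₀ ≤ supp X → cost G (learn rq) ≤ learnFactor * (M₀ + 4 * supp X)
        byCases (inj₁ le) = ≤-trans (loop-cost₁ (n * n) M₀ 1≤M₀ aD₀ le) (*-monoʳ-≤ learnFactor (m≤m+n M₀ _))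
        byCases (inj₂ ge) = ≤-trans (m≤m+n _ (learnFactor * M₀)) (≤-trans (loop-cost₂ (n * n) M₀ 1≤M₀ aD₀ supp≤ ge) (*-monoʳ-≤ learnFactor (m≤n+m _ M₀)))

-- Cut queries as rectangle sums

module Edges {n} (G : SimpleGraph n) where
  open SimpleGraph G using (adj; irrefl) renaming (sym to adj-sym)

  A⟦_,_⟧ : Fin n → Fin n → ℕ
  A⟦ i , j ⟧ = ⟦ adj i j ⟧

  -- Edges inside S ∩ T are counted twice.
  E : (S T : Fin n → Bool) → ℕ
  E S T = ∑ (fins n) (λ i → ⟦ S i ⟧ * ∑ (fins n) (λ j → ⟦ T j ⟧ * A⟦ i , j ⟧))

  deg : Fin n → ℕ
  deg i = ∑ (fins n) (λ j → A⟦ i , j ⟧)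

  cut : (Fin n → Bool) → ℕ
  cut S = ∑ (fins n) (λ i → ∑ (fins n) (λ j → ⟦ adj i j ∧ S i ∧ not (S j) ⟧))

  cutSize≡ : ∀ S → cutSize G S ≡ cut (lookup S)
  cutSize≡ S = trans (sum-map (fins n) _) (∑-cong (fins n) (λ i → sum-map (fins n) _))

  cut-cong : ∀ {S T : Fin n → Bool} → (∀ i → S i ≡ T i) → cut S ≡ cut T
  cut-cong e = ∑-cong (fins n) (λ i → ∑-cong (fins n) (λ j → cong₂ (λ a b → ⟦ adj i j ∧ a ∧ not b ⟧) (e i) (e j)))

  E-∑∑ : ∀ S T → E S T ≡ ∑ (fins n) (λ i → ∑ (fins n) (λ j → ⟦ S i ⟧ * (⟦ T j ⟧ * A⟦ i , j ⟧)))
  E-∑∑ S T = ∑-cong (fins n) (λ i → sym (∑-*ˡ (fins n) ⟦ S i ⟧ _))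

  E-sym : ∀ S T → E S T ≡ E T S
  E-sym S T = trans (E-∑∑ S T) (trans (∑-swap (fins n) (fins n) _)
    (trans (∑-cong (fins n) (λ j → ∑-cong (fins n) (λ i → trans (cong (λ b → ⟦ S i ⟧ * (⟦ T j ⟧ * ⟦ b ⟧)) (adj-sym i j)) (arr ⟦ S i ⟧ ⟦ T j ⟧ A⟦ j , i ⟧)))) (sym (E-∑∑ T S))))
    where
    arr : ∀ a b c → a * (b * c) ≡ b * (a * c)
    arr = solve-∀

  degOf : (Fin n → ℕ) → (Fin n → Bool) → ℕ
  degOf d S = ∑ (fins n) (λ i → ⟦ S i ⟧ * d i)

  cut+E : ∀ S → cut S + E S S ≡ degOf deg S
  cut+E S = trans (cong (cut S +_) (E-∑∑ S S)) (trans (sym (∑-+ (fins n) _ _))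
    (∑-cong (fins n) (λ i → trans (sym (∑-+ (fins n) _ _)) (trans (∑-cong (fins n) (λ j → pt (adj i j) (S i) (S j))) (∑-*ˡ (fins n) ⟦ S i ⟧ _)))))
    where
    pt : ∀ a s t → ⟦ a ∧ s ∧ not t ⟧ + ⟦ s ⟧ * (⟦ t ⟧ * ⟦ a ⟧) ≡ ⟦ s ⟧ * ⟦ a ⟧
    pt true  true  true  = refl
    pt true  true  false = refl
    pt true  false true  = refl
    pt true  false false = refl
    pt false true  true  = refl
    pt false true  false = refl
    pt false false true  = refl
    pt false false false = refl

  cut-single : ∀ v → cut (v ==_) ≡ deg v
  cut-single v = trans (∑-cong (fins n) (λ i → trans (∑-cong (fins n) (λ j → pt i j)) (∑-*ˡ (fins n) ⟦ v == i ⟧ _))) (∑-δ v deg)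
    where
    pt : ∀ i j → ⟦ adj i j ∧ (v == i) ∧ not (v == j) ⟧ ≡ ⟦ v == i ⟧ * A⟦ i , j ⟧
    pt i j with v == i in e | v == j in e′
    ... | false | b = cong ⟦_⟧ (c (adj i j))
      where
      c : ∀ a → a ∧ false ≡ false
      c true = refl
      c false = refl
    ... | true | false = trans (cong ⟦_⟧ (c (adj i j))) (sym (+-identityʳ _))
      where
      c : ∀ a → a ∧ true ≡ a
      c true = refl
      c false = refl
    ... | true | true rewrite trans (sym (==⇒≡ {i = v} {i} e)) (==⇒≡ {i = v} {j} e′) | irrefl j = refl

  -- Polarization of the quadratic form `E Q Q`. The sum of the indicators of `S` and `T` is not an
  -- indicator when the sets overlap, so four sets are used: union, intersection and the two
  -- differences.
  polar : ∀ S T → E (λ i → S i ∨ T i) (λ i → S i ∨ T i) + E (λ i → S i ∧ T i) (λ i → S i ∧ T i)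
                ≡ E (λ i → S i ∧ not (T i)) (λ i → S i ∧ not (T i)) + E (λ i → T i ∧ not (S i)) (λ i → T i ∧ not (S i)) + E S T * 2
  polar S T = begin
    E P P + E Q Q                                ≡⟨ cong₂ _+_ (E-∑∑ P P) (E-∑∑ Q Q) ⟩
    H P P + H Q Q                                ≡⟨ H+ P P Q Q ⟩
    ∑ (fins n) (λ i → ∑ (fins n) (λ j → h P P i j + h Q Q i j))
      ≡⟨ ∑-cong (fins n) (λ i → ∑-cong (fins n) (λ j → trans (pt (adj i j) (S i) (T i) (S j) (T j)) refl)) ⟩
    ∑ (fins n) (λ i → ∑ (fins n) (λ j → (h V V i j + h W W i j) + (h S T i j + h T S i j)))
      ≡⟨ trans (∑-cong (fins n) (λ i → trans (∑-+ (fins n) _ _) (cong₂ _+_ (∑-+ (fins n) _ _) (∑-+ (fins n) _ _))))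
         (trans (∑-+ (fins n) _ _) (cong₂ _+_ (∑-+ (fins n) _ _) (∑-+ (fins n) _ _))) ⟩
    (H V V + H W W) + (H S T + H T S)
      ≡⟨ cong₂ _+_ (cong₂ _+_ (sym (E-∑∑ V V)) (sym (E-∑∑ W W))) (cong₂ _+_ (sym (E-∑∑ S T)) (trans (sym (E-∑∑ T S)) (E-sym T S))) ⟩
    (E V V + E W W) + (E S T + E S T)            ≡⟨ cong (E V V + E W W +_) (arr (E S T)) ⟩
    E V V + E W W + E S T * 2 ∎
    where
    open ≡-Reasoning
    P Q V W : Fin n → Bool
    P i = S i ∨ T i
    Q i = S i ∧ T i
    V i = S i ∧ not (T i)
    W i = T i ∧ not (S i)
    h : (S T : Fin n → Bool) → Fin n → Fin n → ℕ
    h S T i j = ⟦ S i ⟧ * (⟦ T j ⟧ * A⟦ i , j ⟧)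
    H : (S T : Fin n → Bool) → ℕ
    H S T = ∑ (fins n) (λ i → ∑ (fins n) (h S T i))
    H+ : ∀ S T S′ T′ → H S T + H S′ T′ ≡ ∑ (fins n) (λ i → ∑ (fins n) (λ j → h S T i j + h S′ T′ i j))
    H+ S T S′ T′ = sym (trans (∑-cong (fins n) (λ i → ∑-+ (fins n) _ _)) (∑-+ (fins n) _ _))
    arr : ∀ x → x + x ≡ x * 2
    arr = solve-∀
    pt : ∀ a s t s′ t′ → ⟦ s ∨ t ⟧ * (⟦ s′ ∨ t′ ⟧ * ⟦ a ⟧) + ⟦ s ∧ t ⟧ * (⟦ s′ ∧ t′ ⟧ * ⟦ a ⟧)
       ≡ (⟦ s ∧ not t ⟧ * (⟦ s′ ∧ not t′ ⟧ * ⟦ a ⟧) + ⟦ t ∧ not s ⟧ * (⟦ t′ ∧ not s′ ⟧ * ⟦ a ⟧)) + (⟦ s ⟧ * (⟦ t′ ⟧ * ⟦ a ⟧) + ⟦ t ⟧ * (⟦ s′ ⟧ * ⟦ a ⟧))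
    pt false s t s′ t′ = trans (cong₂ _+_ (z ⟦ s ∨ t ⟧ ⟦ s′ ∨ t′ ⟧) (z ⟦ s ∧ t ⟧ ⟦ s′ ∧ t′ ⟧))
      (sym (cong₂ _+_ (cong₂ _+_ (z ⟦ s ∧ not t ⟧ ⟦ s′ ∧ not t′ ⟧) (z ⟦ t ∧ not s ⟧ ⟦ t′ ∧ not s′ ⟧)) (cong₂ _+_ (z ⟦ s ⟧ ⟦ t′ ⟧) (z ⟦ t ⟧ ⟦ s′ ⟧))))
      where
      z : ∀ x y → x * (y * 0) ≡ 0
      z x y = trans (cong (x *_) (*-zeroʳ y)) (*-zeroʳ x)
    pt true true  true  true  true  = refl
    pt true true  true  true  false = refl
    pt true true  true  false true  = refl
    pt true true  true  false false = refl
    pt true true  false true  true  = refl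
    pt true true  false true  false = refl
    pt true true  false false true  = refl
    pt true true  false false false = refl
    pt true false true  true  true  = refl
    pt true false true  true  false = refl
    pt true false true  false true  = refl
    pt true false true  false false = refl
    pt true false false true  true  = refl
    pt true false false true  false = refl
    pt true false false false true  = refl
    pt true false false false false = refl

-- 2 E(S,T) is a signed sum of four values E(Q,Q), and E(Q,Q) = deg(Q) - |cut(Q)|.
module _ {n} (d : Fin n → ℕ) where

  quad : (Fin n → Bool) → (ℕ → Prog n ℕ) → Prog n ℕ
  quad S k = ask (tabulate S) (λ c → k (∑ (fins n) (λ i → ⟦ S i ⟧ * d i) ∸ c))

  edges : (S T : Fin n → Bool) → Prog n ℕ
  edges S T = quad (λ i → S i ∨ T i) λ x → quad (λ i → S i ∧ T i) λ y →
              quad (λ i → S i ∧ not (T i)) λ z → quad (λ i → T i ∧ not (S i)) λ w → ret ((x + y ∸ (z + w)) / 2)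

module _ {n} (G : SimpleGraph n) (d : Fin n → ℕ) (d≡ : ∀ i → d i ≡ Edges.deg G i) where
  open Edges G

  private
    quad-value : ∀ S → ∑ (fins n) (λ i → ⟦ S i ⟧ * d i) ∸ cutSize G (tabulate S) ≡ E S S
    quad-value S = begin
      ∑ (fins n) (λ i → ⟦ S i ⟧ * d i) ∸ cutSize G (tabulate S)
        ≡⟨ cong₂ _∸_ (∑-cong (fins n) (λ i → cong (⟦ S i ⟧ *_) (d≡ i))) (trans (cutSize≡ (tabulate S)) (cut-cong (lookup∘tabulate S))) ⟩
      degOf deg S ∸ cut S        ≡⟨ cong (_∸ cut S) (sym (cut+E S)) ⟩
      cut S + E S S ∸ cut S      ≡⟨ m+n∸m≡n (cut S) (E S S) ⟩
      E S S ∎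
      where open ≡-Reasoning

  edges-val : ∀ S T → val G (edges d S T) ≡ E S T
  edges-val S T = begin
    (q P + q Q ∸ (q V + q W)) / 2        ≡⟨ cong (_/ 2) (cong₂ _∸_ (cong₂ _+_ (quad-value P) (quad-value Q)) (cong₂ _+_ (quad-value V) (quad-value W))) ⟩
    (E P P + E Q Q ∸ (E V V + E W W)) / 2 ≡⟨ cong (λ x → (x ∸ (E V V + E W W)) / 2) (polar S T) ⟩
    (E V V + E W W + E S T * 2 ∸ (E V V + E W W)) / 2 ≡⟨ cong (_/ 2) (m+n∸m≡n (E V V + E W W) (E S T * 2)) ⟩
    E S T * 2 / 2                        ≡⟨ m*n/n≡m (E S T) 2 ⟩
    E S T ∎
    where
    open ≡-Reasoning
    P Q V W : Fin n → Bool
    P i = S i ∨ T i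
    Q i = S i ∧ T i
    V i = S i ∧ not (T i)
    W i = T i ∧ not (S i)
    q : (Fin n → Bool) → ℕ
    q S = ∑ (fins n) (λ i → ⟦ S i ⟧ * d i) ∸ cutSize G (tabulate S)

-- Rows R, columns the labels in U; the entry counts the edges from a vertex to a cluster.
module _ {n} (G : SimpleGraph n) where
  open Edges G

  clusterMatrix : (Fin n → Fin n) → (R U : Fin n → Bool) → NMat n
  clusterMatrix π R U w Y = ⟦ R w ⟧ * (⟦ U Y ⟧ * ∑ (fins n) (λ u → ⟦ π u == Y ⟧ * A⟦ w , u ⟧))

  clusterMatrix≤ : ∀ π R U → Bounded′ n (clusterMatrix π R U)
  clusterMatrix≤ π R U w Y = ≤-trans (*-mono-≤ (⟦⟧≤1 (R w)) (*-mono-≤ (⟦⟧≤1 (U Y)) (∑-mono (fins n) (λ u → *-mono-≤ (⟦⟧≤1 (π u == Y)) (⟦⟧≤1 (SimpleGraph.adj G w u))))))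
    (≤-reflexive (trans (+-identityʳ _) (trans (+-identityʳ _) (trans (∑ᶠ-const n 1) (*-identityʳ n)))))

  rectQuery : (d : Fin n → ℕ) → (Fin n → Fin n) → (R U : Fin n → Bool) → Subset n → Subset n → Prog n ℕ
  rectQuery d π R U A B = edges d (λ w → lookup A w ∧ R w) (λ u → lookup B (π u) ∧ U (π u))

  rectQuery-val : ∀ d → (∀ i → d i ≡ deg i) → ∀ π R U A B → val G (rectQuery d π R U A B) ≡ rect (clusterMatrix π R U) A B
  rectQuery-val d d≡ π R U A B = trans (edges-val G d d≡ (λ w → lookup A w ∧ R w) (λ u → lookup B (π u) ∧ U (π u))) (∑-cong (fins n) (λ w →
      trans (cong (_* ∑ (fins n) (λ u → ⟦ lookup B (π u) ∧ U (π u) ⟧ * A⟦ w , u ⟧)) (⟦∧⟧ (lookup A w) (R w)))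
      (trans (*-assoc ⟦ lookup A w ⟧ ⟦ R w ⟧ _) (cong (⟦ lookup A w ⟧ *_) (row w)))))
    where
    open ≡-Reasoning
    row : ∀ w → ⟦ R w ⟧ * ∑ (fins n) (λ u → ⟦ lookup B (π u) ∧ U (π u) ⟧ * A⟦ w , u ⟧) ≡ sumOver (clusterMatrix π R U w) B
    row w = sym (begin
      ∑ (fins n) (λ Y → ⟦ lookup B Y ⟧ * (⟦ R w ⟧ * (⟦ U Y ⟧ * ∑ (fins n) (λ u → ⟦ π u == Y ⟧ * A⟦ w , u ⟧))))
        ≡⟨ ∑-cong (fins n) (λ Y → trans (arr ⟦ lookup B Y ⟧ ⟦ R w ⟧ ⟦ U Y ⟧ _) (cong (⟦ R w ⟧ *_) (sym (∑-*ˡ (fins n) (⟦ lookup B Y ⟧ * ⟦ U Y ⟧) _)))) ⟩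
      ∑ (fins n) (λ Y → ⟦ R w ⟧ * ∑ (fins n) (λ u → ⟦ lookup B Y ⟧ * ⟦ U Y ⟧ * (⟦ π u == Y ⟧ * A⟦ w , u ⟧)))
        ≡⟨ ∑-*ˡ (fins n) ⟦ R w ⟧ _ ⟩
      ⟦ R w ⟧ * ∑ (fins n) (λ Y → ∑ (fins n) (λ u → ⟦ lookup B Y ⟧ * ⟦ U Y ⟧ * (⟦ π u == Y ⟧ * A⟦ w , u ⟧)))
        ≡⟨ cong (⟦ R w ⟧ *_) (trans (∑-swap (fins n) (fins n) _) (∑-cong (fins n) (λ u → trans (∑-cong (fins n) (λ Y → arr′ ⟦ lookup B Y ⟧ ⟦ U Y ⟧ ⟦ π u == Y ⟧ A⟦ w , u ⟧))
            (trans (∑-δ (π u) (λ Y → ⟦ lookup B Y ⟧ * ⟦ U Y ⟧ * A⟦ w , u ⟧)) (cong (_* A⟦ w , u ⟧) (sym (⟦∧⟧ (lookup B (π u)) (U (π u))))))))) ⟩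
      ⟦ R w ⟧ * ∑ (fins n) (λ u → ⟦ lookup B (π u) ∧ U (π u) ⟧ * A⟦ w , u ⟧) ∎)
      where
      arr : ∀ a b c d → a * (b * (c * d)) ≡ b * (a * c * d)
      arr = solve-∀
      arr′ : ∀ a b c d → a * b * (c * d) ≡ c * (a * b * d)
      arr′ = solve-∀

  rectQuery-cost : ∀ d π R U A B → cost G (rectQuery d π R U A B) ≤ 4
  rectQuery-cost d π R U A B = ≤-refl

-- Weighted random walks

-- 2^e random steps, arranged so that the second half forms one batch.
Seed : Set → ℕ → Set
Seed Ω zero    = Ω
Seed Ω (suc e) = Seed Ω e × Seed Ω e

module Uniform {Ω : Set} (ωs : List Ω) where

  ∑ˢ : ∀ e → (Seed Ω e → ℕ) → ℕ
  ∑ˢ zero    φ = ∑ ωs φ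
  ∑ˢ (suc e) φ = ∑ˢ e (λ u → ∑ˢ e (λ v → φ (u , v)))

  ∑ˢ-mono : ∀ e {φ ψ} → (∀ t → φ t ≤ ψ t) → ∑ˢ e φ ≤ ∑ˢ e ψ
  ∑ˢ-mono zero    le = ∑-mono ωs le
  ∑ˢ-mono (suc e) le = ∑ˢ-mono e (λ u → ∑ˢ-mono e (λ v → le (u , v)))

  ∑ˢ-cong : ∀ e {φ ψ} → (∀ t → φ t ≡ ψ t) → ∑ˢ e φ ≡ ∑ˢ e ψ
  ∑ˢ-cong zero    eq = ∑-cong ωs eq
  ∑ˢ-cong (suc e) eq = ∑ˢ-cong e (λ u → ∑ˢ-cong e (λ v → eq (u , v)))

  ∑ˢ-+ : ∀ e φ ψ → ∑ˢ e (λ t → φ t + ψ t) ≡ ∑ˢ e φ + ∑ˢ e ψ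
  ∑ˢ-+ zero    φ ψ = ∑-+ ωs φ ψ
  ∑ˢ-+ (suc e) φ ψ = trans (∑ˢ-cong e (λ u → ∑ˢ-+ e _ _)) (∑ˢ-+ e _ _)

  ∑ˢ-* : ∀ e c φ → ∑ˢ e (λ t → c * φ t) ≡ c * ∑ˢ e φ
  ∑ˢ-* zero    c φ = ∑-*ˡ ωs c φ
  ∑ˢ-* (suc e) c φ = trans (∑ˢ-cong e (λ u → ∑ˢ-* e c _)) (∑ˢ-* e c _)

-- `κ s` divided by `Q` is the law of a step from `s`, and `W e s φ` is `mass e` times the mean of
-- `φ` over `2^e` steps. In the application `Q` is the number of elements of `ωs`, so that `wt` is
-- the likelihood ratio against the uniform walk.
module Chain {Ω St : Set} (ωs : List Ω) (F : St → Ω → St) (κ : St → Ω → ℕ) (Q : ℕ)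
             (κ-mass : ∀ s → ∑ ωs (κ s) ≡ Q) where
  open Uniform ωs public

  fin : ∀ e → St → Seed Ω e → St
  fin zero    s ω       = F s ω
  fin (suc e) s (u , v) = fin e (fin e s u) v

  wt : ∀ e → St → Seed Ω e → ℕ
  wt zero    s ω       = κ s ω
  wt (suc e) s (u , v) = wt e s u * wt e (fin e s u) v

  W : ∀ e → St → (Seed Ω e → ℕ) → ℕ
  W zero    s φ = ∑ ωs (λ ω → κ s ω * φ ω)
  W (suc e) s φ = W e s (λ u → W e (fin e s u) (λ v → φ (u , v)))

  mass : ℕ → ℕ
  mass zero    = Q
  mass (suc e) = mass e * mass e

  W≡∑ˢ : ∀ e s φ → W e s φ ≡ ∑ˢ e (λ t → wt e s t * φ t)
  W≡∑ˢ zero    s φ = refl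
  W≡∑ˢ (suc e) s φ = trans (W≡∑ˢ e s _) (∑ˢ-cong e (λ u → trans (cong (wt e s u *_) (W≡∑ˢ e (fin e s u) _))
    (trans (sym (∑ˢ-* e (wt e s u) _)) (∑ˢ-cong e (λ v → sym (*-assoc (wt e s u) _ _))))))

  -- The comparison is asked for only where the weight is positive, so invariants of the conditioned
  -- walk may be assumed in it.
  W-mono : ∀ e s {φ ψ} → (∀ t → wt e s t ≢ 0 → φ t ≤ ψ t) → W e s φ ≤ W e s ψ
  W-mono e s {φ} {ψ} le = subst₂ _≤_ (sym (W≡∑ˢ e s φ)) (sym (W≡∑ˢ e s ψ)) (∑ˢ-mono e each)
    where
    each : ∀ t → wt e s t * φ t ≤ wt e s t * ψ t
    each t with wt e s t in eq
    ... | zero  = z≤n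
    ... | suc m = *-monoʳ-≤ (suc m) (le t (λ z → 0≢1+n (trans (sym z) eq)))

  W-+ : ∀ e s φ ψ → W e s (λ t → φ t + ψ t) ≡ W e s φ + W e s ψ
  W-+ e s φ ψ = trans (W≡∑ˢ e s _) (trans (trans (∑ˢ-cong e (λ t → *-distribˡ-+ (wt e s t) _ _)) (∑ˢ-+ e _ _)) (sym (cong₂ _+_ (W≡∑ˢ e s φ) (W≡∑ˢ e s ψ))))

  W-* : ∀ e s c φ → W e s (λ t → c * φ t) ≡ c * W e s φ
  W-* e s c φ = trans (W≡∑ˢ e s _) (trans (trans (∑ˢ-cong e (λ t → arr (wt e s t) c (φ t))) (∑ˢ-* e c _)) (cong (c *_) (sym (W≡∑ˢ e s φ))))
    where
    arr : ∀ a b c → a * (b * c) ≡ b * (a * c)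
    arr = solve-∀

  W-cong : ∀ e s {φ ψ} → (∀ t → φ t ≡ ψ t) → W e s φ ≡ W e s ψ
  W-cong e s {φ} {ψ} eq = trans (W≡∑ˢ e s φ) (trans (∑ˢ-cong e (λ t → cong (wt e s t *_) (eq t))) (sym (W≡∑ˢ e s ψ)))

  W-const : ∀ e s c → W e s (λ _ → c) ≡ mass e * c
  W-const zero    s c = trans (∑-*ʳ ωs c (κ s)) (cong (_* c) (κ-mass s))
  W-const (suc e) s c = trans (W-cong e s (λ u → W-const e (fin e s u) c)) (trans (W-const e s (mass e * c)) (sym (*-assoc (mass e) _ _)))

  pathSum : (St → ℕ) → ∀ e → St → Seed Ω e → ℕ
  pathSum f zero    s ω       = f s
  pathSum f (suc e) s (u , v) = pathSum f e s u + pathSum f e (fin e s u) v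

  -- Learning a whole batch is charged according to the state before the batch.
  stale : (St → Ω → ℕ) → ∀ e → St → Seed Ω e → ℕ
  stale α zero    s ω       = α s ω
  stale α (suc e) s (u , v) = stale α e s u + stale α e s v

  batched : (St → Ω → ℕ) → ∀ e → St → Seed Ω e → ℕ
  batched α zero    s ω       = α s ω
  batched α (suc e) s (u , v) = batched α e s u + stale α e (fin e s u) v

  stepSum : (St → Ω → ℕ) → ∀ e → St → Seed Ω e → ℕ
  stepSum β zero    s ω       = β s ω
  stepSum β (suc e) s (u , v) = stepSum β e s u + stepSum β e (fin e s u) v

  wt≤2^ : ∀ (β : St → Ω → ℕ) → (∀ s ω → κ s ω ≤ 2 ^ β s ω) → ∀ e s t → wt e s t ≤ 2 ^ stepSum β e s t
  wt≤2^ β h zero    s ω       = h s ω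
  wt≤2^ β h (suc e) s (u , v) = ≤-trans (*-mono-≤ (wt≤2^ β h e s u) (wt≤2^ β h e (fin e s u) v)) (≤-reflexive (sym (^-distribˡ-+-* 2 (stepSum β e s u) _)))

  module _ (Inv : St → Set) (inv : ∀ {s ω} → Inv s → κ s ω ≢ 0 → Inv (F s ω)) where

    wtˡ : ∀ e s u v → wt (suc e) s (u , v) ≢ 0 → wt e s u ≢ 0
    wtˡ e s u v ne z = ne (cong (_* wt e (fin e s u) v) z)

    wtʳ : ∀ e s u v → wt (suc e) s (u , v) ≢ 0 → wt e (fin e s u) v ≢ 0
    wtʳ e s u v ne z = ne (trans (cong (wt e s u *_) z) (*-zeroʳ (wt e s u)))

    fin-inv : ∀ e {s} → Inv s → ∀ t → wt e s t ≢ 0 → Inv (fin e s t)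
    fin-inv zero    i ω       ne = inv i ne
    fin-inv (suc e) {s} i (u , v) ne = fin-inv e (fin-inv e i u (wtˡ e s u v ne)) v (wtʳ e s u v ne)

    -- Drift argument: the mean of `V` drops by at least `f s / Q` in each step, so the initial
    -- potential pays for the total of `f` along the walk, whatever the number of steps.
    potential : ∀ (V f : St → ℕ) → (∀ s → Inv s → ∑ ωs (λ ω → κ s ω * V (F s ω)) + f s ≤ Q * V s) →
                ∀ e s → Inv s → Q * W e s (V ∘ fin e s) + W e s (pathSum f e s) ≤ Q * (mass e * V s)
    potential V f h zero s i = begin
      Q * X + ∑ ωs (λ ω → κ s ω * f s)   ≡⟨ cong (Q * X +_) (trans (∑-*ʳ ωs (f s) (κ s)) (cong (_* f s) (κ-mass s))) ⟩
      Q * X + Q * f s                    ≡⟨ sym (*-distribˡ-+ Q X (f s)) ⟩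
      Q * (X + f s)                      ≤⟨ *-monoʳ-≤ Q (h s i) ⟩
      Q * (Q * V s) ∎
      where
      open ≤-Reasoning
      X = ∑ ωs (λ ω → κ s ω * V (F s ω))
    potential V f h (suc e) s i = begin
      Q * W e s (λ u → Wv u (V ∘ fin e (fin e s u))) + W e s (λ u → Wv u (λ v → pathSum f e s u + pathSum f e (fin e s u) v))
        ≡⟨ cong₂ _+_ (sym (W-* e s Q _)) (W-cong e s (λ u → trans (W-+ e (fin e s u) _ _) (cong (_+ Wv u (pathSum f e (fin e s u))) (W-const e (fin e s u) (pathSum f e s u))))) ⟩
      W e s (λ u → Q * Wv u (V ∘ fin e (fin e s u))) + W e s (λ u → M * pathSum f e s u + Wv u (pathSum f e (fin e s u)))
        ≡⟨ sym (W-+ e s _ _) ⟩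
      W e s (λ u → Q * Wv u (V ∘ fin e (fin e s u)) + (M * pathSum f e s u + Wv u (pathSum f e (fin e s u))))
        ≤⟨ W-mono e s (λ u ne → ≤-trans (≤-reflexive (arr₁ (Q * Wv u (V ∘ fin e (fin e s u))) (M * pathSum f e s u) _)) (+-monoˡ-≤ (M * pathSum f e s u) (potential V f h e (fin e s u) (fin-inv e i u ne)))) ⟩
      W e s (λ u → Q * (M * V (fin e s u)) + M * pathSum f e s u)
        ≡⟨ W-cong e s (λ u → arr₂ Q M (V (fin e s u)) (pathSum f e s u)) ⟩
      W e s (λ u → M * (Q * V (fin e s u) + pathSum f e s u))
        ≡⟨ trans (W-* e s M _) (cong (M *_) (trans (W-+ e s _ _) (cong (_+ W e s (pathSum f e s)) (W-* e s Q _)))) ⟩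
      M * (Q * W e s (V ∘ fin e s) + W e s (pathSum f e s))
        ≤⟨ *-monoʳ-≤ M (potential V f h e s i) ⟩
      M * (Q * (M * V s))      ≡⟨ arr₃ M Q (V s) ⟩
      Q * (M * M * V s) ∎
      where
      open ≤-Reasoning
      M = mass e
      Wv : ∀ u → (Seed Ω e → ℕ) → ℕ
      Wv u = W e (fin e s u)
      arr₁ : ∀ x y z → x + (y + z) ≡ x + z + y
      arr₁ = solve-∀
      arr₂ : ∀ Q M V p → Q * (M * V) + M * p ≡ M * (Q * V + p)
      arr₂ = solve-∀
      arr₃ : ∀ M Q V → M * (Q * (M * V)) ≡ Q * (M * M * V)
      arr₃ = solve-∀

    stepSum-bound : ∀ (β : St → Ω → ℕ) (g : St → ℕ) → (∀ s → Inv s → ∑ ωs (λ ω → κ s ω * β s ω) ≤ g s) →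
                    ∀ e s → Inv s → Q * W e s (stepSum β e s) ≤ W e s (pathSum g e s)
    stepSum-bound β g h zero s i = ≤-trans (*-monoʳ-≤ Q (h s i)) (≤-reflexive (sym (trans (∑-*ʳ ωs (g s) (κ s)) (cong (_* g s) (κ-mass s)))))
    stepSum-bound β g h (suc e) s i = begin
      Q * W e s (λ u → Wv u (λ v → stepSum β e s u + stepSum β e (fin e s u) v))
        ≡⟨ trans (cong (Q *_) (W-cong e s (λ u → trans (W-+ e (fin e s u) _ _) (cong (_+ Wv u (stepSum β e (fin e s u))) (W-const e (fin e s u) (stepSum β e s u))))))
           (trans (sym (W-* e s Q _)) (trans (W-cong e s (λ u → arr Q M (stepSum β e s u) _)) (trans (W-+ e s _ _) (cong (_+ W e s (λ u → Q * Wv u (stepSum β e (fin e s u)))) (trans (W-* e s M _) (cong (M *_) (W-* e s Q _))))))) ⟩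
      M * (Q * W e s (stepSum β e s)) + W e s (λ u → Q * Wv u (stepSum β e (fin e s u)))
        ≤⟨ +-mono-≤ (*-monoʳ-≤ M (stepSum-bound β g h e s i)) (W-mono e s (λ u ne → stepSum-bound β g h e (fin e s u) (fin-inv e i u ne))) ⟩
      M * W e s (pathSum g e s) + W e s (λ u → Wv u (pathSum g e (fin e s u)))
        ≡⟨ sym (trans (W-cong e s (λ u → trans (W-+ e (fin e s u) _ _) (cong (_+ Wv u (pathSum g e (fin e s u))) (W-const e (fin e s u) (pathSum g e s u)))))
             (trans (W-+ e s _ _) (cong (_+ W e s (λ u → Wv u (pathSum g e (fin e s u)))) (W-* e s M _)))) ⟩
      W e s (λ u → Wv u (λ v → pathSum g e s u + pathSum g e (fin e s u) v)) ∎
      where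
      open ≤-Reasoning
      M = mass e
      Wv : ∀ u → (Seed Ω e → ℕ) → ℕ
      Wv u = W e (fin e s u)
      arr : ∀ Q M x y → Q * (M * x + y) ≡ M * (Q * x) + Q * y
      arr = solve-∀

    module _ (α : St → Ω → ℕ) (f : St → ℕ) (α-mean : ∀ s₀ s → Inv s₀ → ∑ ωs (λ ω → κ s ω * α s₀ ω) ≤ f s₀)
             (f-mono : ∀ {s ω} → Inv s → κ s ω ≢ 0 → f (F s ω) ≤ f s) where

      f-fin : ∀ e s → Inv s → ∀ t → wt e s t ≢ 0 → f (fin e s t) ≤ f s
      f-fin zero    s i ω       ne = f-mono i ne
      f-fin (suc e) s i (u , v) ne = ≤-trans (f-fin e (fin e s u) (fin-inv e i u (wtˡ e s u v ne)) v (wtʳ e s u v ne)) (f-fin e s i u (wtˡ e s u v ne))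

      f-path : ∀ e s → Inv s → ∀ t → wt e s t ≢ 0 → 2 ^ e * f (fin e s t) ≤ pathSum f e s t
      f-path zero    s i ω       ne = ≤-trans (≤-reflexive (+-identityʳ _)) (f-mono i ne)
      f-path (suc e) s i (u , v) ne = ≤-trans (≤-reflexive (arr (2 ^ e) _)) (+-mono-≤
          (≤-trans (*-monoʳ-≤ (2 ^ e) (f-fin e (fin e s u) (fin-inv e i u (wtˡ e s u v ne)) v (wtʳ e s u v ne))) (f-path e s i u (wtˡ e s u v ne)))
          (f-path e (fin e s u) (fin-inv e i u (wtˡ e s u v ne)) v (wtʳ e s u v ne)))
        where
        arr : ∀ p x → (p + (p + 0)) * x ≡ p * x + p * x
        arr = solve-∀

      -- The batch is walked from `s`, but its charge refers to the state `s₀` at its start.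
      -- Therefore `α-mean` is required for every pair of states; the application grants it because
      -- the conditioned step picks its vertex uniformly in every state.
      stale-mean : ∀ e s₀ s → Inv s₀ → Q * W e s (stale α e s₀) ≤ 2 ^ e * (mass e * f s₀)
      stale-mean zero    s₀ s i₀ = ≤-trans (*-monoʳ-≤ Q (α-mean s₀ s i₀)) (≤-reflexive (sym (+-identityʳ _)))
      stale-mean (suc e) s₀ s i₀ = begin
        Q * W e s (λ u → Wv u (λ v → stale α e s₀ u + stale α e s₀ v))
          ≡⟨ trans (cong (Q *_) (W-cong e s (λ u → trans (W-+ e (fin e s u) _ _) (cong (_+ Wv u (stale α e s₀)) (W-const e (fin e s u) (stale α e s₀ u))))))
             (trans (sym (W-* e s Q _)) (trans (W-cong e s (λ u → arr Q M (stale α e s₀ u) _)) (trans (W-+ e s _ _) (cong (_+ W e s (λ u → Q * Wv u (stale α e s₀))) (trans (W-* e s M _) (cong (M *_) (W-* e s Q _))))))) ⟩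
        M * (Q * W e s (stale α e s₀)) + W e s (λ u → Q * Wv u (stale α e s₀))
          ≤⟨ +-mono-≤ (*-monoʳ-≤ M (stale-mean e s₀ s i₀)) (≤-trans (W-mono e s (λ u _ → stale-mean e s₀ (fin e s u) i₀)) (≤-reflexive (W-const e s _))) ⟩
        M * (2 ^ e * (M * f s₀)) + M * (2 ^ e * (M * f s₀))
          ≡⟨ arr′ M (2 ^ e) (f s₀) ⟩
        2 ^ suc e * (M * M * f s₀) ∎
        where
        open ≤-Reasoning
        M = mass e
        Wv : ∀ u → (Seed Ω e → ℕ) → ℕ
        Wv u = W e (fin e s u)
        arr : ∀ Q M x y → Q * (M * x + y) ≡ M * (Q * x) + Q * y
        arr = solve-∀
        arr′ : ∀ M p f → M * (p * (M * f)) + M * (p * (M * f)) ≡ (p + (p + 0)) * (M * M * f)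
        arr′ = solve-∀

      -- The second summand carries the induction: it pays for the next batch of `2^e` steps, all
      -- charged at the state reached. Since `f` never increases, the path sum of that batch in turn
      -- pays for the doubled summand at its end.
      batched-mean : ∀ e s → Inv s → Q * W e s (batched α e s) + 2 ^ e * W e s (f ∘ fin e s) ≤ 2 * W e s (pathSum f e s)
      batched-mean zero s i = begin
        Q * ∑ ωs (λ ω → κ s ω * α s ω) + 1 * W zero s (f ∘ fin zero s)
          ≤⟨ +-mono-≤ (*-monoʳ-≤ Q (α-mean s s i)) (≤-trans (≤-reflexive (+-identityʳ _)) (≤-trans (W-mono zero s (λ ω ne → f-mono i ne)) (≤-reflexive (W-const zero s (f s))))) ⟩
        Q * f s + Q * f s             ≡⟨ cong (Q * f s +_) (sym (+-identityʳ _)) ⟩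
        2 * (Q * f s)                 ≡⟨ cong (2 *_) (sym (W-const zero s (f s))) ⟩
        2 * W zero s (pathSum f zero s) ∎
        where open ≤-Reasoning
      batched-mean (suc e) s i = begin
        Q * W e s (λ u → Wv u (λ v → batched α e s u + stale α e (fin e s u) v)) + 2 ^ suc e * W (suc e) s (f ∘ fin (suc e) s)
          ≡⟨ cong (_+ 2 ^ suc e * X) (trans (cong (Q *_) (W-cong e s (λ u → trans (W-+ e (fin e s u) _ _) (cong (_+ Wv u (stale α e (fin e s u))) (W-const e (fin e s u) (batched α e s u))))))
             (trans (sym (W-* e s Q _)) (trans (W-cong e s (λ u → arr Q M (batched α e s u) _)) (trans (W-+ e s _ _) (cong (_+ W e s (λ u → Q * Wv u (stale α e (fin e s u)))) (trans (W-* e s M _) (cong (M *_) (W-* e s Q _)))))))) ⟩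
        M * (Q * W e s (batched α e s)) + W e s (λ u → Q * Wv u (stale α e (fin e s u))) + 2 ^ suc e * X
          ≤⟨ +-mono-≤ (+-monoʳ-≤ (M * (Q * W e s (batched α e s))) (W-mono e s (λ u ne → stale-mean e (fin e s u) (fin e s u) (fin-inv e i u ne)))) end ⟩
        M * (Q * W e s (batched α e s)) + W e s (λ u → 2 ^ e * (M * f (fin e s u))) + 2 * W e s (λ u → Wv u (pathSum f e (fin e s u)))
          ≡⟨ cong (λ x → M * (Q * W e s (batched α e s)) + x + 2 * W e s (λ u → Wv u (pathSum f e (fin e s u)))) (trans (W-cong e s (λ u → arr₂ (2 ^ e) M (f (fin e s u)))) (trans (W-* e s M _) (cong (M *_) (W-* e s (2 ^ e) _)))) ⟩
        M * (Q * W e s (batched α e s)) + M * (2 ^ e * W e s (f ∘ fin e s)) + 2 * W e s (λ u → Wv u (pathSum f e (fin e s u)))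
          ≡⟨ cong (_+ 2 * W e s (λ u → Wv u (pathSum f e (fin e s u)))) (sym (*-distribˡ-+ M _ _)) ⟩
        M * (Q * W e s (batched α e s) + 2 ^ e * W e s (f ∘ fin e s)) + 2 * W e s (λ u → Wv u (pathSum f e (fin e s u)))
          ≤⟨ +-monoˡ-≤ _ (*-monoʳ-≤ M (batched-mean e s i)) ⟩
        M * (2 * W e s (pathSum f e s)) + 2 * W e s (λ u → Wv u (pathSum f e (fin e s u)))
          ≡⟨ arr₃ M (W e s (pathSum f e s)) _ ⟩
        2 * (M * W e s (pathSum f e s) + W e s (λ u → Wv u (pathSum f e (fin e s u))))
          ≡⟨ cong (2 *_) (sym (trans (W-cong e s (λ u → trans (W-+ e (fin e s u) _ _) (cong (_+ Wv u (pathSum f e (fin e s u))) (W-const e (fin e s u) (pathSum f e s u)))))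
             (trans (W-+ e s _ _) (cong (_+ W e s (λ u → Wv u (pathSum f e (fin e s u)))) (W-* e s M _))))) ⟩
        2 * W (suc e) s (pathSum f (suc e) s) ∎
        where
        open ≤-Reasoning
        M = mass e
        Wv : ∀ u → (Seed Ω e → ℕ) → ℕ
        Wv u = W e (fin e s u)
        X = W (suc e) s (f ∘ fin (suc e) s)
        arr : ∀ Q M x y → Q * (M * x + y) ≡ M * (Q * x) + Q * y
        arr = solve-∀
        arr₂ : ∀ p M x → p * (M * x) ≡ M * (p * x)
        arr₂ = solve-∀
        arr₃ : ∀ M x y → M * (2 * x) + 2 * y ≡ 2 * (M * x + y)
        arr₃ = solve-∀
        end : 2 ^ suc e * X ≤ 2 * W e s (λ u → Wv u (pathSum f e (fin e s u)))
        end = begin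
          2 ^ suc e * X          ≡⟨ *-assoc 2 (2 ^ e) X ⟩
          2 * (2 ^ e * X)        ≡⟨ cong (2 *_) (trans (sym (W-* e s (2 ^ e) _)) (W-cong e s (λ u → sym (W-* e (fin e s u) (2 ^ e) _)))) ⟩
          2 * W e s (λ u → Wv u (λ v → 2 ^ e * f (fin e (fin e s u) v)))
            ≤⟨ *-monoʳ-≤ 2 (W-mono e s (λ u ne → W-mono e (fin e s u) (λ v ne′ → f-path e (fin e s u) (fin-inv e i u ne) v ne′))) ⟩
          2 * W e s (λ u → Wv u (pathSum f e (fin e s u))) ∎

-- Random contraction

-- Clusters are represented by labels; U holds the labels that may still be absorbed, K the centres chosen so far.
record St (n : ℕ) : Set where
  constructor ⟪_,_,_⟫
  field
    π : Vec (Fin n) n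
    U K : Subset n

open St

Step : ℕ → Set
Step n = Fin n × Subset n

steps : ∀ n → List (Step n)
steps n = concatMap (λ w → map (w ,_) (subsets n)) (fins n)

∑-steps : ∀ n (f : Step n → ℕ) → ∑ (steps n) f ≡ ∑ (fins n) (λ w → ∑ (subsets n) (λ H → f (w , H)))
∑-steps n f = trans (∑-concatMap (λ w → map (w ,_) (subsets n)) (fins n) f) (∑-cong (fins n) (λ w → ∑-map (w ,_) (subsets n) f))

data Phase : Set where
  stars clusters : Phase

-- In the star phase the label of `w` leaves `U`: a centre, once chosen, is never absorbed, and live
-- labels remain untouched vertices.
keeps : Phase → Bool → Bool
keeps stars    b = not b
keeps clusters b = true

module _ {n : ℕ} where

  lab : St n → Fin n → Fin n
  lab s = lookup (π s)

  absorbed : (Fin n → ℕ) → St n → Step n → Fin n → Bool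
  absorbed row s (w , H) Y = lookup (U s) Y ∧ (lookup H Y ∧ (not (lab s w == Y) ∧ (0 <ᵇ row Y)))

  absorb : Phase → St n → Fin n → (Fin n → Bool) → St n
  absorb ph s w J = ⟪ tabulate (λ v → if J (lab s v) then lab s w else lab s v)
                    , tabulate (λ Y → lookup (U s) Y ∧ (not (J Y) ∧ keeps ph (lab s w == Y)))
                    , tabulate (λ Y → lookup (K s) Y ∨ (lab s w == Y)) ⟫

  absorb-cong : ∀ ph s w {J J′} → (∀ Y → J Y ≡ J′ Y) → absorb ph s w J ≡ absorb ph s w J′
  absorb-cong ph s w e rewrite tabulate-cong (λ v → cong (λ b → if b then lab s w else lab s v) (e (lab s v)))
    | tabulate-cong (λ Y → cong (λ b → lookup (U s) Y ∧ (not b ∧ keeps ph (lab s w == Y))) (e Y)) = refl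

  -- The row of w in a table learned in an earlier state, regrouped by the current labels.
  tableRow : Table n → St n → Fin n → Fin n → ℕ
  tableRow X s w Y = ∑ (fins n) (λ Z → ⟦ lab s Z == Y ⟧ * X ⟨ w , Z ⟩)

  tableStep : Phase → Table n → St n → Step n → St n
  tableStep ph X s ω = absorb ph s (proj₁ ω) (absorbed (tableRow X s (proj₁ ω)) s ω)

  tableRun : Phase → Table n → ∀ e → St n → Seed (Step n) e → St n
  tableRun ph X zero    s ω       = tableStep ph X s ω
  tableRun ph X (suc e) s (u , v) = tableRun ph X e (tableRun ph X e s u) v

  sampled : ∀ e → Seed (Step n) e → Fin n → Bool
  sampled zero    ω       w = proj₁ ω == w
  sampled (suc e) (u , v) w = sampled e u w ∨ sampled e v w

module Process {n : ℕ} (G : SimpleGraph n) where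
  open Edges G

  row : St n → Fin n → Fin n → ℕ
  row s w Y = ∑ (fins n) (λ u → ⟦ lab s u == Y ⟧ * A⟦ w , u ⟧)

  step : Phase → St n → Step n → St n
  step ph s ω = absorb ph s (proj₁ ω) (absorbed (row s (proj₁ ω)) s ω)

  evolve : Phase → ∀ e → St n → Seed (Step n) e → St n
  evolve ph zero    s ω       = step ph s ω
  evolve ph (suc e) s (u , v) = evolve ph e (evolve ph e s u) v

  rowSupport : St n → Fin n → ℕ
  rowSupport s w = ∑ (fins n) (λ Y → ⟦ lookup (U s) Y ⟧ * ⟦ 0 <ᵇ row s w Y ⟧)

  Idempotent : St n → Set
  Idempotent s = ∀ u → lab s (lab s u) ≡ lab s u

  -- s′ arises from s by merging clusters.
  record Coarser (s s′ : St n) : Set where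
    field
      through : ∀ u → lab s′ (lab s u) ≡ lab s′ u
      live    : ∀ u → lookup (U s′) (lab s′ u) ≡ true → lookup (U s) (lab s u) ≡ true

  module _ (ph : Phase) (s : St n) (w : Fin n) (J : Fin n → Bool) where

    lab-absorb : ∀ v → lab (absorb ph s w J) v ≡ (if J (lab s v) then lab s w else lab s v)
    lab-absorb = lookup∘tabulate _

    U-absorb : ∀ Y → lookup (U (absorb ph s w J)) Y ≡ lookup (U s) Y ∧ (not (J Y) ∧ keeps ph (lab s w == Y))
    U-absorb = lookup∘tabulate _

    K-absorb : ∀ Y → lookup (K (absorb ph s w J)) Y ≡ lookup (K s) Y ∨ (lab s w == Y)
    K-absorb = lookup∘tabulate _

    idempotent-absorb : J (lab s w) ≡ false → Idempotent s → Idempotent (absorb ph s w J)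
    idempotent-absorb Jw id u with J (lab s u) in e
    ... | true  rewrite lab-absorb u | e | lab-absorb (lab s w) | id w | Jw = refl
    ... | false rewrite lab-absorb u | e | lab-absorb (lab s u) | id u | e = refl

    coarser-absorb : (∀ Y → J Y ≡ true → lookup (U s) Y ≡ true) → Idempotent s → Coarser s (absorb ph s w J)
    coarser-absorb JU id = record { through = thr ; live = liv }
      where
      thr : ∀ u → lab (absorb ph s w J) (lab s u) ≡ lab (absorb ph s w J) u
      thr u = trans (lab-absorb (lab s u)) (trans (cong (λ x → if J x then lab s w else x) (id u)) (sym (lab-absorb u)))
      ∧-left : ∀ {a b} → a ∧ b ≡ true → a ≡ true
      ∧-left {true} _ = refl
      liv : ∀ u → lookup (U (absorb ph s w J)) (lab (absorb ph s w J) u) ≡ true → lookup (U s) (lab s u) ≡ true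
      liv u h with J (lab s u) in e
      ... | true  = JU (lab s u) e
      ... | false = ∧-left (trans (sym (U-absorb (lab s u))) (trans (cong (lookup (U (absorb ph s w J))) (sym (trans (lab-absorb u) (cong (λ b → if b then lab s w else lab s u) e)))) h))

  coarser-trans : ∀ {s s′ s″} → Coarser s s′ → Coarser s′ s″ → Coarser s s″
  coarser-trans {s} {s′} {s″} c d = record
    { through = λ u → trans (sym (D.through (lab s u))) (trans (cong (lab s″) (C.through u)) (D.through u))
    ; live = λ u h → C.live u (D.live u h) }
    where
    module C = Coarser c
    module D = Coarser d

  coarser-refl : ∀ s → Idempotent s → Coarser s s
  coarser-refl s id = record { through = id ; live = λ u h → h }

  absorbed-self : ∀ (r : Fin n → ℕ) (s : St n) w H → absorbed r s (w , H) (lab s w) ≡ false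
  absorbed-self r s w H rewrite ==-refl (lab s w) = f (lookup (U s) (lab s w)) (lookup H (lab s w))
    where
    f : ∀ a b → a ∧ (b ∧ false) ≡ false
    f true  true  = refl
    f true  false = refl
    f false b     = refl

  absorbed-U : ∀ (r : Fin n → ℕ) (s : St n) ω Y → absorbed r s ω Y ≡ true → lookup (U s) Y ≡ true
  absorbed-U r s ω Y e with lookup (U s) Y
  ... | true = refl

  idempotent-step : ∀ ph s ω → Idempotent s → Idempotent (step ph s ω)
  idempotent-step ph s (w , H) = idempotent-absorb ph s w (absorbed (row s w) s (w , H)) (absorbed-self (row s w) s w H)

  coarser-step : ∀ ph s ω → Idempotent s → Coarser s (step ph s ω)
  coarser-step ph s ω = coarser-absorb ph s (proj₁ ω) (absorbed (row s (proj₁ ω)) s ω) (absorbed-U (row s (proj₁ ω)) s ω)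

  idempotent-evolve : ∀ ph e s t → Idempotent s → Idempotent (evolve ph e s t)
  idempotent-evolve ph zero    s ω       id = idempotent-step ph s ω id
  idempotent-evolve ph (suc e) s (u , v) id = idempotent-evolve ph e (evolve ph e s u) v (idempotent-evolve ph e s u id)

  module _ (s₀ : St n) (R : Fin n → Bool) where

    abstract
      learned : Table n
      learned = toTable (clusterMatrix G (lab s₀) R (lookup (U s₀)))

      learned≡ : learned ≡ toTable (clusterMatrix G (lab s₀) R (lookup (U s₀)))
      learned≡ = refl

    learned-at : ∀ w Y → learned ⟨ w , Y ⟩ ≡ clusterMatrix G (lab s₀) R (lookup (U s₀)) w Y
    learned-at w Y = trans (cong (_⟨ w , Y ⟩) learned≡) (toTable-at (clusterMatrix G (lab s₀) R (lookup (U s₀))) w Y)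

    -- The table omits the labels that were dead at `s₀`. By `Coarser.live` no vertex with such a
    -- label belongs to a cluster that is live at `s`, so regrouping the old columns gives the
    -- current row.
    tableRow-correct : ∀ s w Y → Coarser s₀ s → R w ≡ true → lookup (U s) Y ≡ true → tableRow learned s w Y ≡ row s w Y
    tableRow-correct s w Y c Rw UY = begin
      ∑ (fins n) (λ Z → ⟦ lab s Z == Y ⟧ * learned ⟨ w , Z ⟩)
        ≡⟨ ∑-cong (fins n) (λ Z → trans (cong (⟦ lab s Z == Y ⟧ *_) (trans (learned-at w Z)
             (trans (cong (λ b → ⟦ b ⟧ * _) Rw) (+-identityʳ _)))) (sym (trans (∑-*ˡ (fins n) (⟦ lab s Z == Y ⟧ * ⟦ lookup (U s₀) Z ⟧) _) (*-assoc ⟦ lab s Z == Y ⟧ _ _)))) ⟩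
      ∑ (fins n) (λ Z → ∑ (fins n) (λ u → ⟦ lab s Z == Y ⟧ * ⟦ lookup (U s₀) Z ⟧ * (⟦ lab s₀ u == Z ⟧ * A⟦ w , u ⟧)))
        ≡⟨ ∑-swap (fins n) (fins n) _ ⟩
      ∑ (fins n) (λ u → ∑ (fins n) (λ Z → ⟦ lab s Z == Y ⟧ * ⟦ lookup (U s₀) Z ⟧ * (⟦ lab s₀ u == Z ⟧ * A⟦ w , u ⟧)))
        ≡⟨ ∑-cong (fins n) (λ u → trans (∑-cong (fins n) (λ Z → arr ⟦ lab s Z == Y ⟧ ⟦ lookup (U s₀) Z ⟧ ⟦ lab s₀ u == Z ⟧ A⟦ w , u ⟧))
             (∑-δ (lab s₀ u) (λ Z → ⟦ lab s Z == Y ⟧ * ⟦ lookup (U s₀) Z ⟧ * A⟦ w , u ⟧))) ⟩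
      ∑ (fins n) (λ u → ⟦ lab s (lab s₀ u) == Y ⟧ * ⟦ lookup (U s₀) (lab s₀ u) ⟧ * A⟦ w , u ⟧)
        ≡⟨ ∑-cong (fins n) (λ u → cong (_* A⟦ w , u ⟧) (pt u)) ⟩
      row s w Y ∎
      where
      open ≡-Reasoning
      arr : ∀ a b c d → a * b * (c * d) ≡ c * (a * b * d)
      arr = solve-∀
      pt : ∀ u → ⟦ lab s (lab s₀ u) == Y ⟧ * ⟦ lookup (U s₀) (lab s₀ u) ⟧ ≡ ⟦ lab s u == Y ⟧
      pt u rewrite Coarser.through c u with lab s u == Y in e
      ... | false = refl
      ... | true rewrite Coarser.live c u (trans (cong (lookup (U s)) (==⇒≡ {i = lab s u} {Y} e)) UY) = refl

    tableStep-correct : ∀ ph s ω → Coarser s₀ s → R (proj₁ ω) ≡ true → tableStep ph learned s ω ≡ step ph s ω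
    tableStep-correct ph s (w , H) c Rw = absorb-cong ph s w pt
      where
      pt : ∀ Y → absorbed (tableRow learned s w) s (w , H) Y ≡ absorbed (row s w) s (w , H) Y
      pt Y with lookup (U s) Y in e
      ... | false = refl
      ... | true = cong (λ x → lookup H Y ∧ (not (lab s w == Y) ∧ (0 <ᵇ x))) (tableRow-correct s w Y c Rw e)

    tableRun-correct : ∀ ph e s t → Idempotent s → Coarser s₀ s → (∀ w → sampled e t w ≡ true → R w ≡ true) →
                       tableRun ph learned e s t ≡ evolve ph e s t × Coarser s₀ (evolve ph e s t)
    tableRun-correct ph zero    s ω       id c h = tableStep-correct ph s ω c (h (proj₁ ω) (==-refl (proj₁ ω))) , coarser-trans c (coarser-step ph s ω id)
    tableRun-correct ph (suc e) s (u , v) id c h =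
      trans (cong (λ x → tableRun ph learned e x v) (proj₁ fst)) (proj₁ snd) , proj₂ snd
      where
      ∨ˡ : ∀ {a b} → a ≡ true → a ∨ b ≡ true
      ∨ˡ refl = refl
      ∨ʳ : ∀ {a b} → b ≡ true → a ∨ b ≡ true
      ∨ʳ {true} _ = refl
      ∨ʳ {false} e = e
      fst = tableRun-correct ph e s u id c (λ w p → h w (∨ˡ p))
      snd = tableRun-correct ph e (evolve ph e s u) v (idempotent-evolve ph e s u id) (proj₂ fst) (λ w p → h w (∨ʳ {sampled e u w} p))

  staleSupport : ∀ e → St n → Seed (Step n) e → ℕ
  staleSupport zero    s ω       = rowSupport s (proj₁ ω)
  staleSupport (suc e) s (u , v) = staleSupport e s u + staleSupport e s v

  batchedSupport : Phase → ∀ e → St n → Seed (Step n) e → ℕ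
  batchedSupport ph zero    s ω       = rowSupport s (proj₁ ω)
  batchedSupport ph (suc e) s (u , v) = batchedSupport ph e s u + staleSupport e (evolve ph e s u) v

  supp-learned : ∀ s R → supp (clusterMatrix G (lab s) R (lookup (U s))) ≡ ∑ (fins n) (λ w → ⟦ R w ⟧ * rowSupport s w)
  supp-learned s R = ∑-cong (fins n) (λ w → trans (∑-cong (fins n) (λ Y → pt (R w) (lookup (U s) Y) (row s w Y))) (∑-*ˡ (fins n) ⟦ R w ⟧ _))
    where
    pt : ∀ a b x → ⟦ 0 <ᵇ ⟦ a ⟧ * (⟦ b ⟧ * x) ⟧ ≡ ⟦ a ⟧ * (⟦ b ⟧ * ⟦ 0 <ᵇ x ⟧)
    pt true  true  x rewrite +-identityʳ x | +-identityʳ x | +-identityʳ ⟦ 0 <ᵇ x ⟧ | +-identityʳ ⟦ 0 <ᵇ x ⟧ = refl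
    pt true  false x = refl
    pt false b     x = refl

  -- An inequality, because a vertex drawn several times within a batch is learned once but charged
  -- each time.
  supp-sampled : ∀ e s t → ∑ (fins n) (λ w → ⟦ sampled e t w ⟧ * rowSupport s w) ≤ staleSupport e s t
  supp-sampled zero    s ω       = ≤-reflexive (∑-δ (proj₁ ω) (rowSupport s))
  supp-sampled (suc e) s (u , v) = ≤-trans (∑-mono (fins n) (λ w → ≤-trans (*-monoˡ-≤ (rowSupport s w) (or (sampled e u w) (sampled e v w)))
      (≤-reflexive (*-distribʳ-+ (rowSupport s w) ⟦ sampled e u w ⟧ _)))) (≤-trans (≤-reflexive (∑-+ (fins n) _ _)) (+-mono-≤ (supp-sampled e s u) (supp-sampled e s v)))
    where
    or : ∀ a b → ⟦ a ∨ b ⟧ ≤ ⟦ a ⟧ + ⟦ b ⟧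
    or true  b = s≤s z≤n
    or false b = ≤-refl

-- The contraction as a query program

module Algorithm {n} (sc : Scale n) (j₀ : Fin n) where
  open Doubling sc j₀

  -- This is `rectQuery` written out without `G`: a program may depend on the graph only through the
  -- degrees and the answers.
  learnRows : (Fin n → ℕ) → St n → (Fin n → Bool) → Prog n (Table n)
  learnRows d s R = learn (λ A B → edges d (λ w → lookup A w ∧ R w) (λ u → lookup B (lab s u) ∧ lookup (U s) (lab s u)))

  batch : (Fin n → ℕ) → Phase → ∀ e → St n → Seed (Step n) e → Prog n (St n)
  batch d ph e s t = fmap (λ X → tableRun ph X e s t) (learnRows d s (sampled e t))

  -- Batches of lengths 1, 1, 2, 4, ...: `2^e` steps take `e + 1` calls of `learn`, each with
  -- overhead `M₀`.
  phase : (Fin n → ℕ) → Phase → ∀ e → St n → Seed (Step n) e → Prog n (St n)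
  phase d ph zero    s ω       = batch d ph zero s ω
  phase d ph (suc e) s (u , v) = phase d ph e s u >>= λ s′ → batch d ph e s′ v

  module _ (G : SimpleGraph n) (d : Fin n → ℕ) (d≡ : ∀ i → d i ≡ Edges.deg G i) where
    open Process G

    learnRows-val : ∀ s R → val G (learnRows d s R) ≡ learned s R
    learnRows-val s R = trans (learn-val G (rectQuery G d (lab s) R (lookup (U s))) (clusterMatrix G (lab s) R (lookup (U s)))
      (rectQuery-val G d d≡ (lab s) R (lookup (U s))) (rectQuery-cost G d (lab s) R (lookup (U s))) (clusterMatrix≤ G (lab s) R (lookup (U s)))) (sym (learned≡ s R))

    learnRows-cost : ∀ s R → cost G (learnRows d s R) ≤ learnFactor * (M₀ + 4 * ∑ (fins n) (λ w → ⟦ R w ⟧ * rowSupport s w))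
    learnRows-cost s R = subst (λ x → cost G (learnRows d s R) ≤ learnFactor * (M₀ + 4 * x)) (supp-learned s R)
      (learn-cost G (rectQuery G d (lab s) R (lookup (U s))) (clusterMatrix G (lab s) R (lookup (U s)))
        (rectQuery-val G d d≡ (lab s) R (lookup (U s))) (rectQuery-cost G d (lab s) R (lookup (U s))) (clusterMatrix≤ G (lab s) R (lookup (U s))))

    batch-val : ∀ ph e s t → Idempotent s → val G (batch d ph e s t) ≡ evolve ph e s t
    batch-val ph e s t id = trans (val-fmap G (λ X → tableRun ph X e s t) (learnRows d s (sampled e t)))
      (trans (cong (λ X → tableRun ph X e s t) (learnRows-val s (sampled e t)))
        (proj₁ (tableRun-correct s (sampled e t) ph e s t id (coarser-refl s id) (λ w p → p))))

    batch-cost : ∀ ph e s t → cost G (batch d ph e s t) ≤ learnFactor * (M₀ + 4 * staleSupport e s t)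
    batch-cost ph e s t = ≤-trans (≤-reflexive (cost-fmap G (λ X → tableRun ph X e s t) (learnRows d s (sampled e t))))
      (≤-trans (learnRows-cost s (sampled e t)) (*-monoʳ-≤ learnFactor (+-monoʳ-≤ M₀ (*-monoʳ-≤ 4 (supp-sampled e s t)))))

    phase-val : ∀ ph e s t → Idempotent s → val G (phase d ph e s t) ≡ evolve ph e s t
    phase-val ph zero    s ω       id = batch-val ph zero s ω id
    phase-val ph (suc e) s (u , v) id = trans (val->>= G (phase d ph e s u) (λ s′ → batch d ph e s′ v))
      (trans (cong (λ s′ → val G (batch d ph e s′ v)) (phase-val ph e s u id)) (batch-val ph e (evolve ph e s u) v (idempotent-evolve ph e s u id)))

    phase-cost : ∀ ph e s t → Idempotent s → cost G (phase d ph e s t) ≤ learnFactor * (suc e * M₀ + 4 * batchedSupport ph e s t)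
    phase-cost ph zero    s ω       id = ≤-trans (batch-cost ph zero s ω) (≤-reflexive (cong (λ x → learnFactor * (x + 4 * rowSupport s (proj₁ ω))) (sym (+-identityʳ M₀))))
    phase-cost ph (suc e) s (u , v) id = begin
      cost G (phase d ph (suc e) s (u , v))
        ≡⟨ trans (cost->>= G (phase d ph e s u) (λ s′ → batch d ph e s′ v)) (cong (λ s′ → cost G (phase d ph e s u) + cost G (batch d ph e s′ v)) (phase-val ph e s u id)) ⟩
      cost G (phase d ph e s u) + cost G (batch d ph e (evolve ph e s u) v)
        ≤⟨ +-mono-≤ (phase-cost ph e s u id) (batch-cost ph e (evolve ph e s u) v) ⟩
      learnFactor * (suc e * M₀ + 4 * b) + learnFactor * (M₀ + 4 * c)
        ≡⟨ arr learnFactor M₀ (suc e * M₀) b c ⟩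
      learnFactor * (suc (suc e) * M₀ + 4 * (b + c)) ∎
      where
      open ≤-Reasoning
      b = batchedSupport ph e s u
      c = staleSupport e (evolve ph e s u) v
      arr : ∀ L M x b c → L * (x + 4 * b) + L * (M + 4 * c) ≡ L * (M + x + 4 * (b + c))
      arr = solve-∀

-- Conditioning on a fixed cut

gate : Bool → Bool → ℕ
gate false h     = 1
gate true  true  = 0
gate true  false = 2

-- The uniform distribution of H conditioned on H ∩ D = ∅ (times 2^n).
avoid : ∀ {n} → Subset n → Subset n → ℕ
avoid []ᵛ      []ᵛ      = 1
avoid (d ∷ᵛ D) (h ∷ᵛ H) = gate d h * avoid D H

∑-avoid : ∀ {n} (D : Subset n) → ∑ (subsets n) (avoid D) ≡ 2 ^ n
∑-avoid []ᵛ = refl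
∑-avoid {suc n} (d ∷ᵛ D) = trans (∑-subsets n (avoid (d ∷ᵛ D))) (trans (cong₂ _+_ (∑-*ˡ (subsets n) (gate d true) (avoid D)) (∑-*ˡ (subsets n) (gate d false) (avoid D)))
  (trans (cong (λ x → gate d true * x + gate d false * x) (∑-avoid D)) (two d)))
  where
  two : ∀ d → gate d true * 2 ^ n + gate d false * 2 ^ n ≡ 2 ^ suc n
  two false = cong (_+ (2 ^ n + 0)) (+-identityʳ (2 ^ n))
  two true  = refl

-- Conditioning on the positions in `D` leaves the other positions of `H` independent fair bits.
∑-avoid-at : ∀ {n} (D : Subset n) Y → lookup D Y ≡ false → 2 * ∑ (subsets n) (λ H → avoid D H * ⟦ lookup H Y ⟧) ≡ 2 ^ n
∑-avoid-at {suc n} (false ∷ᵛ D) zero e = cong (2 *_) (trans (∑-subsets n (λ H → avoid (false ∷ᵛ D) H * ⟦ lookup H zero ⟧))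
  (trans (cong₂ _+_ (trans (∑-cong (subsets n) (λ H → trans (*-identityʳ _) (+-identityʳ _))) (∑-avoid D)) (trans (∑-cong (subsets n) (λ H → *-zeroʳ (1 * avoid D H))) (∑-zero (subsets n)))) (+-identityʳ _)))
∑-avoid-at {suc n} (d ∷ᵛ D) (suc Y) e = trans (cong (2 *_) (trans (∑-subsets n (λ H → avoid (d ∷ᵛ D) H * ⟦ lookup H (suc Y) ⟧))
    (cong₂ _+_ (half true) (half false)))) (trans (arr (gate d true) (gate d false) X) (trans (cong (λ x → gate d true * x + gate d false * x) (∑-avoid-at D Y e)) (two d)))
  where
  X = ∑ (subsets n) (λ H → avoid D H * ⟦ lookup H Y ⟧)
  half : ∀ h → ∑ (subsets n) (λ H → gate d h * avoid D H * ⟦ lookup H Y ⟧) ≡ gate d h * X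
  half h = trans (∑-cong (subsets n) (λ H → *-assoc (gate d h) (avoid D H) _)) (∑-*ˡ (subsets n) (gate d h) _)
  arr : ∀ a b x → 2 * (a * x + b * x) ≡ a * (2 * x) + b * (2 * x)
  arr = solve-∀
  two : ∀ d → gate d true * 2 ^ n + gate d false * 2 ^ n ≡ 2 ^ suc n
  two false = cong (_+ (2 ^ n + 0)) (+-identityʳ (2 ^ n))
  two true  = refl

avoid≤ : ∀ {n} (D H : Subset n) → avoid D H ≤ 2 ^ card D
avoid≤ []ᵛ []ᵛ = ≤-refl
avoid≤ (false ∷ᵛ D) (h ∷ᵛ H) = ≤-trans (≤-reflexive (+-identityʳ _)) (avoid≤ D H)
avoid≤ (true ∷ᵛ D) (true ∷ᵛ H) = z≤n
avoid≤ (true ∷ᵛ D) (false ∷ᵛ H) = *-monoʳ-≤ 2 (avoid≤ D H)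

avoid≢0 : ∀ {n} (D H : Subset n) → avoid D H ≢ 0 → ∀ Y → lookup D Y ≡ true → lookup H Y ≡ false
avoid≢0 (true ∷ᵛ D) (true ∷ᵛ H)  ne zero e = ⊥-elim (ne refl)
avoid≢0 (true ∷ᵛ D) (false ∷ᵛ H) ne zero e = refl
avoid≢0 (d ∷ᵛ D) (h ∷ᵛ H) ne (suc Y) e = avoid≢0 D H (λ z → ne (trans (cong (gate d h *_) z) (*-zeroʳ (gate d h)))) Y e

∧-true : ∀ {a b} → a ∧ b ≡ true → a ≡ true × b ≡ true
∧-true {true} e = refl , e

true-∧ : ∀ {a b} → a ≡ true → b ≡ true → a ∧ b ≡ true
true-∧ refl refl = refl

not-true : ∀ {a} → not a ≡ true → a ≡ false
not-true {false} _ = refl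

bool-≤ : ∀ {a b} → (a ≡ true → b ≡ true) → ⟦ a ⟧ ≤ ⟦ b ⟧
bool-≤ {true}  h rewrite h refl = ≤-refl
bool-≤ {false} h = z≤n

bool-≡ : ∀ {a b} → (a ≡ true → b ≡ true) → (b ≡ true → a ≡ true) → a ≡ b
bool-≡ {true}  f g = sym (f refl)
bool-≡ {false} {false} f g = refl
bool-≡ {false} {true}  f g = g refl

pos-∑ : ∀ {n} (f : Fin n → ℕ) → (0 <ᵇ ∑ (fins n) f) ≡ true → ∃ λ u → (0 <ᵇ f u) ≡ true
pos-∑ {n} f e = go (fins n) e
  where
  go : ∀ xs → (0 <ᵇ ∑ xs f) ≡ true → ∃ λ u → (0 <ᵇ f u) ≡ true
  go (x ∷ xs) e with f x in eq
  ... | zero  = go xs e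
  ... | suc m = x , cong (0 <ᵇ_) eq

∑-pos : ∀ {n} (f : Fin n → ℕ) u → (0 <ᵇ f u) ≡ true → (0 <ᵇ ∑ (fins n) f) ≡ true
∑-pos {n} f u e = pos (≤-trans (one (f u) e) (∑-pickᶠ f u))
  where
  one : ∀ x → (0 <ᵇ x) ≡ true → 1 ≤ x
  one (suc x) _ = s≤s z≤n
  pos : ∀ {x} → 1 ≤ x → (0 <ᵇ x) ≡ true
  pos (s≤s _) = refl

module Kernel {n : ℕ} (G : SimpleGraph n) (side : Fin n → Bool) where
  open Edges G
  open Process G

  apart : Fin n → Fin n → Bool
  apart v w = side v xor side w

  apart-sym : ∀ v w → apart v w ≡ apart w v
  apart-sym v w with side v | side w
  ... | true  | true  = refl
  ... | true  | false = refl
  ... | false | true  = refl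
  ... | false | false = refl

  same⇒≡ : ∀ {v w} → apart v w ≡ false → side v ≡ side w
  same⇒≡ {v} {w} e with side v | side w
  ... | true  | true  = refl
  ... | false | false = refl

  ≡⇒same : ∀ {v w} → side v ≡ side w → apart v w ≡ false
  ≡⇒same {v} {w} e rewrite e with side w
  ... | true  = refl
  ... | false = refl

  touches : St n → Fin n → Fin n → Bool
  touches s w Y = not (lab s w == Y) ∧ (0 <ᵇ row s w Y)

  -- The side of a cluster is read off its label; this is justified by `Sided`, which the
  -- conditioned walk preserves.
  good bad : St n → Fin n → Fin n → Bool
  good s w Y = touches s w Y ∧ not (apart w Y)
  bad  s w Y = lookup (U s) Y ∧ (touches s w Y ∧ apart w Y)

  badSet : St n → Fin n → Subset n
  badSet s w = tabulate (bad s w)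

  κ : St n → Step n → ℕ
  κ s ω = avoid (badSet s (proj₁ ω)) (proj₂ ω)

  Q : ℕ
  Q = n * 2 ^ n

  -- For every vertex the weights of the sets `H` sum to `2^n`, so the conditioning leaves the
  -- vertex of a step uniform.
  κ-vertex : ∀ s (f : Fin n → ℕ) → ∑ (steps n) (λ ω → κ s ω * f (proj₁ ω)) ≡ 2 ^ n * ∑ (fins n) f
  κ-vertex s f = trans (∑-steps n _) (trans (∑-cong (fins n) (λ w → trans (∑-*ʳ (subsets n) (f w) _) (cong (_* f w) (∑-avoid (badSet s w))))) (∑-*ˡ (fins n) (2 ^ n) f))

  κ-mass : ∀ s → ∑ (steps n) (κ s) ≡ Q
  κ-mass s = trans (∑-cong (steps n) (λ ω → sym (*-identityʳ _))) (trans (κ-vertex s (λ _ → 1)) (trans (cong (2 ^ n *_) (trans (∑ᶠ-const n 1) (*-identityʳ n))) (*-comm (2 ^ n) n)))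

  hits : St n → Step n → ℕ
  hits s ω = card (badSet s (proj₁ ω))

  κ≤2^ : ∀ s ω → κ s ω ≤ 2 ^ hits s ω
  κ≤2^ s ω = avoid≤ (badSet s (proj₁ ω)) (proj₂ ω)

  goodDeg : St n → Fin n → ℕ
  goodDeg s Y = ∑ (fins n) (λ w → ⟦ good s w Y ⟧)

  live : St n → Fin n → ℕ
  live s Y = ⟦ lookup (U s) Y ⟧

  U-step⇒ : ∀ ph s ω Y → lookup (U (step ph s ω)) Y ≡ true →
            lookup (U s) Y ≡ true × absorbed (row s (proj₁ ω)) s ω Y ≡ false × keeps ph (lab s (proj₁ ω) == Y) ≡ true
  U-step⇒ ph s ω Y e with ∧-true {lookup (U s) Y} (trans (sym (U-absorb ph s (proj₁ ω) (absorbed (row s (proj₁ ω)) s ω) Y)) e)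
  ... | u , r with ∧-true {not (absorbed (row s (proj₁ ω)) s ω Y)} r
  ...   | j , k = u , not-true j , k

  live-step : ∀ ph s ω Y → live (step ph s ω) Y ≤ live s Y
  live-step ph s ω Y = bool-≤ (λ e → proj₁ (U-step⇒ ph s ω Y e))

  -- A live label adjacent to w from its own side is absorbed with conditional probability 1/2.
  decay : ∀ ph s Y → 2 * ∑ (steps n) (λ ω → κ s ω * live (step ph s ω) Y) + 2 ^ n * (live s Y * goodDeg s Y) ≤ 2 * (Q * live s Y)
  decay ph s Y with lookup (U s) Y in eU
  ... | false = ≤-trans (≤-reflexive (cong₂ _+_ (cong (2 *_) (trans (∑-cong (steps n) (λ ω → trans (cong (κ s ω *_) (zero′ ω)) (*-zeroʳ (κ s ω)))) (∑-zero (steps n)))) (*-zeroʳ (2 ^ n)))) z≤n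
    where
    zero′ : ∀ ω → live (step ph s ω) Y ≡ 0
    zero′ ω = n≤0⇒n≡0 (≤-trans (live-step ph s ω Y) (≤-reflexive (cong ⟦_⟧ eU)))
  ... | true = begin
    2 * ∑ (steps n) (λ ω → κ s ω * live (step ph s ω) Y) + 2 ^ n * (1 * goodDeg s Y)
      ≡⟨ cong₂ _+_ (trans (cong (2 *_) (∑-steps n _)) (sym (∑-*ˡ (fins n) 2 _))) (trans (cong (2 ^ n *_) (+-identityʳ _)) (sym (∑-*ˡ (fins n) (2 ^ n) _))) ⟩
    ∑ (fins n) (λ w → 2 * ∑ (subsets n) (λ H → κ s (w , H) * live (step ph s (w , H)) Y)) + ∑ (fins n) (λ w → 2 ^ n * ⟦ good s w Y ⟧)
      ≡⟨ sym (∑-+ (fins n) _ _) ⟩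
    ∑ (fins n) (λ w → 2 * ∑ (subsets n) (λ H → κ s (w , H) * live (step ph s (w , H)) Y) + 2 ^ n * ⟦ good s w Y ⟧)
      ≤⟨ ∑-mono (fins n) each ⟩
    ∑ (fins n) (λ _ → 2 * 2 ^ n)
      ≡⟨ trans (∑ᶠ-const n _) (arr n (2 ^ n)) ⟩
    2 * (Q * 1) ∎
    where
    open ≤-Reasoning
    arr : ∀ n x → n * (2 * x) ≡ 2 * (n * x * 1)
    arr = solve-∀
    each : ∀ w → 2 * ∑ (subsets n) (λ H → κ s (w , H) * live (step ph s (w , H)) Y) + 2 ^ n * ⟦ good s w Y ⟧ ≤ 2 * 2 ^ n
    each w with good s w Y in eg
    ... | false = ≤-trans (≤-reflexive (trans (cong₂ _+_ refl (*-zeroʳ (2 ^ n))) (+-identityʳ _))) (*-monoʳ-≤ 2 (≤-trans (∑-mono (subsets n) (λ H → ≤-trans (*-monoʳ-≤ (κ s (w , H)) (⟦⟧≤1 (lookup (U (step ph s (w , H))) Y))) (≤-reflexive (*-identityʳ _)))) (≤-reflexive (∑-avoid (badSet s w)))))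
    ... | true = begin
      2 * ∑ (subsets n) (λ H → κ s (w , H) * live (step ph s (w , H)) Y) + 2 ^ n * 1
        ≡⟨ cong (2 * ∑ (subsets n) (λ H → κ s (w , H) * live (step ph s (w , H)) Y) +_) (trans (*-identityʳ _) (sym (∑-avoid-at (badSet s w) Y nbad))) ⟩
      2 * ∑ (subsets n) (λ H → κ s (w , H) * live (step ph s (w , H)) Y) + 2 * ∑ (subsets n) (λ H → κ s (w , H) * ⟦ lookup H Y ⟧)
        ≡⟨ trans (sym (*-distribˡ-+ 2 (∑ (subsets n) (λ H → κ s (w , H) * live (step ph s (w , H)) Y)) (∑ (subsets n) (λ H → κ s (w , H) * ⟦ lookup H Y ⟧))))
             (cong (2 *_) (sym (∑-+ (subsets n) (λ H → κ s (w , H) * live (step ph s (w , H)) Y) (λ H → κ s (w , H) * ⟦ lookup H Y ⟧)))) ⟩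
      2 * ∑ (subsets n) (λ H → κ s (w , H) * live (step ph s (w , H)) Y + κ s (w , H) * ⟦ lookup H Y ⟧)
        ≤⟨ *-monoʳ-≤ 2 (∑-mono (subsets n) (λ H → ≤-trans (≤-reflexive (sym (*-distribˡ-+ (κ s (w , H)) _ _))) (≤-trans (*-monoʳ-≤ (κ s (w , H)) (excl H)) (≤-reflexive (*-identityʳ _))))) ⟩
      2 * ∑ (subsets n) (λ H → κ s (w , H))
        ≡⟨ cong (2 *_) (∑-avoid (badSet s w)) ⟩
      2 * 2 ^ n ∎
      where
      tg = ∧-true {touches s w Y} eg
      nbad : lookup (badSet s w) Y ≡ false
      nbad = trans (lookup∘tabulate (bad s w) Y) (trans (cong (λ b → lookup (U s) Y ∧ (touches s w Y ∧ b)) (not-true (proj₂ tg))) (ff (lookup (U s) Y) (touches s w Y)))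
        where
        ff : ∀ a b → a ∧ (b ∧ false) ≡ false
        ff true  true  = refl
        ff true  false = refl
        ff false b     = refl
      excl : ∀ H → live (step ph s (w , H)) Y + ⟦ lookup H Y ⟧ ≤ 1
      excl H with lookup (U (step ph s (w , H))) Y in e′ | lookup H Y in eH
      ... | false | b     = ⟦⟧≤1 b
      ... | true  | false = s≤s z≤n
      ... | true  | true with trans (sym (proj₁ (proj₂ (U-step⇒ ph s (w , H) Y e′)))) (true-∧ eU (true-∧ eH (proj₁ tg)))
      ...   | ()

  weighted : (Fin n → ℕ) → St n → ℕ
  weighted a s = ∑ (fins n) (λ Y → a Y * live s Y)

  weighted-decay : ∀ ph a s → 2 * ∑ (steps n) (λ ω → κ s ω * weighted a (step ph s ω)) + 2 ^ n * ∑ (fins n) (λ Y → a Y * (live s Y * goodDeg s Y)) ≤ 2 * (Q * weighted a s)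
  weighted-decay ph a s = begin
    2 * ∑ (steps n) (λ ω → κ s ω * weighted a (step ph s ω)) + 2 ^ n * ∑ (fins n) (λ Y → a Y * (live s Y * goodDeg s Y))
      ≡⟨ cong₂ _+_ lhs (trans (sym (∑-*ˡ (fins n) (2 ^ n) _)) (∑-cong (fins n) (λ Y → arr (2 ^ n) (a Y) _))) ⟩
    ∑ (fins n) (λ Y → a Y * (2 * ∑ (steps n) (λ ω → κ s ω * live (step ph s ω) Y))) + ∑ (fins n) (λ Y → a Y * (2 ^ n * (live s Y * goodDeg s Y)))
      ≡⟨ trans (sym (∑-+ (fins n) _ _)) (∑-cong (fins n) (λ Y → sym (*-distribˡ-+ (a Y) _ _))) ⟩
    ∑ (fins n) (λ Y → a Y * (2 * ∑ (steps n) (λ ω → κ s ω * live (step ph s ω) Y) + 2 ^ n * (live s Y * goodDeg s Y)))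
      ≤⟨ ∑-mono (fins n) (λ Y → *-monoʳ-≤ (a Y) (decay ph s Y)) ⟩
    ∑ (fins n) (λ Y → a Y * (2 * (Q * live s Y)))
      ≡⟨ trans (∑-cong (fins n) (λ Y → arr₂ (a Y) Q (live s Y))) (trans (∑-*ˡ (fins n) (2 * Q) _) (*-assoc 2 Q _)) ⟩
    2 * (Q * weighted a s) ∎
    where
    open ≤-Reasoning
    arr : ∀ a b c → a * (b * c) ≡ b * (a * c)
    arr = solve-∀
    arr₂ : ∀ a q l → a * (2 * (q * l)) ≡ 2 * q * (a * l)
    arr₂ = solve-∀
    lhs : 2 * ∑ (steps n) (λ ω → κ s ω * weighted a (step ph s ω)) ≡ ∑ (fins n) (λ Y → a Y * (2 * ∑ (steps n) (λ ω → κ s ω * live (step ph s ω) Y)))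
    lhs = trans (cong (2 *_) (trans (∑-cong (steps n) (λ ω → sym (∑-*ˡ (fins n) (κ s ω) _))) (trans (∑-swap (steps n) (fins n) _)
            (∑-cong (fins n) (λ Y → trans (∑-cong (steps n) (λ ω → arr (κ s ω) (a Y) _)) (∑-*ˡ (steps n) (a Y) _))))))
          (trans (sym (∑-*ˡ (fins n) 2 _)) (∑-cong (fins n) (λ Y → arr 2 (a Y) _)))

  Sided : St n → Set
  Sided s = ∀ v → side (lab s v) ≡ side v

  absorbed-same : ∀ s ω → κ s ω ≢ 0 → ∀ Y → absorbed (row s (proj₁ ω)) s ω Y ≡ true → side (proj₁ ω) ≡ side Y
  absorbed-same s (w , H) ne Y e with ∧-true {lookup (U s) Y} e
  ... | u , r with ∧-true {lookup H Y} r
  ...   | h , t with apart w Y in ea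
  ...     | false = same⇒≡ {w} {Y} ea
  ...     | true with trans (sym h) (avoid≢0 (badSet s w) H ne Y (trans (lookup∘tabulate (bad s w) Y) (true-∧ u (true-∧ t ea))))
  ...       | ()

  sided-step : ∀ ph s ω → Sided s → κ s ω ≢ 0 → Sided (step ph s ω)
  sided-step ph s ω sd ne v with absorbed (row s (proj₁ ω)) s ω (lab s v) in e
  ... | true  = trans (cong side (trans (lab-absorb ph s (proj₁ ω) (absorbed (row s (proj₁ ω)) s ω) v) (cong (λ b → if b then lab s (proj₁ ω) else lab s v) e)))
                  (trans (sd (proj₁ ω)) (trans (absorbed-same s ω ne (lab s v) e) (sd v)))
  ... | false = trans (cong side (trans (lab-absorb ph s (proj₁ ω) (absorbed (row s (proj₁ ω)) s ω) v) (cong (λ b → if b then lab s (proj₁ ω) else lab s v) e))) (sd v)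

  hits-mean : ∀ s → ∑ (steps n) (λ ω → κ s ω * hits s ω) ≡ 2 ^ n * ∑ (fins n) (λ w → ∑ (fins n) (λ Y → ⟦ bad s w Y ⟧))
  hits-mean s = trans (κ-vertex s (λ w → card (badSet s w))) (cong (2 ^ n *_) (∑-cong (fins n) (λ w → trans (card-∑ (badSet s w)) (∑-cong (fins n) (λ Y → cong ⟦_⟧ (lookup∘tabulate (bad s w) Y))))))

-- Invariants of the two phases

module Phases {n : ℕ} (G : SimpleGraph n) (side : Fin n → Bool) where
  open Edges G
  open SimpleGraph G using (adj; irrefl) renaming (sym to adj-sym)
  open Process G
  open Kernel G side

  cutDeg : Fin n → ℕ
  cutDeg v = ∑ (fins n) (λ w → ⟦ adj w v ∧ apart w v ⟧)

  sameDeg : Fin n → ℕ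
  sameDeg v = ∑ (fins n) (λ w → ⟦ adj w v ∧ not (apart w v) ⟧)

  cutTotal : ℕ
  cutTotal = ∑ (fins n) cutDeg

  deg-split : ∀ v → sameDeg v + cutDeg v ≡ deg v
  deg-split v = trans (sym (∑-+ (fins n) _ _)) (∑-cong (fins n) (λ w → trans (pt (adj w v) (apart w v)) (cong ⟦_⟧ (adj-sym w v))))
    where
    pt : ∀ a b → ⟦ a ∧ not b ⟧ + ⟦ a ∧ b ⟧ ≡ ⟦ a ⟧
    pt true  true  = refl
    pt true  false = refl
    pt false b     = refl

  row-pos : ∀ s w Y u → lab s u ≡ Y → adj w u ≡ true → (0 <ᵇ row s w Y) ≡ true
  row-pos s w Y u e a = ∑-pos (λ u → ⟦ lab s u == Y ⟧ * A⟦ w , u ⟧) u (cong (0 <ᵇ_) (cong₂ (λ b c → ⟦ b ⟧ * ⟦ c ⟧) (trans (cong (_== Y) e) (==-refl Y)) a))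

  pos-row : ∀ s w Y → (0 <ᵇ row s w Y) ≡ true → ∃ λ u → lab s u ≡ Y × adj w u ≡ true
  pos-row s w Y e with pos-∑ (λ u → ⟦ lab s u == Y ⟧ * A⟦ w , u ⟧) e
  ... | u , p with lab s u == Y in el | adj w u in ea
  ... | true | true = u , ==⇒≡ {i = lab s u} {Y} el , ea

  -- Live labels stand for untouched vertices (`alone`, `fixed`), every other label in use for a
  -- centre (`placed`). Adjacency to a live label is then adjacency in the graph, so the relevant
  -- degrees stay constant throughout the phase.
  record Stars (s : St n) : Set where
    field
      idem   : Idempotent s
      sided  : Sided s
      alone  : ∀ Y → lookup (U s) Y ≡ true → ∀ u → lab s u ≡ Y → u ≡ Y
      fixed  : ∀ Y → lookup (U s) Y ≡ true → lab s Y ≡ Y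
      placed : ∀ u → (lookup (U s) (lab s u) ∨ lookup (K s) (lab s u)) ≡ true

  stars-step : ∀ {s ω} → Stars s → κ s ω ≢ 0 → Stars (step stars s ω)
  stars-step {s} {ω} inv ne = record
    { idem = idempotent-step stars s ω idem ; sided = sided-step stars s ω sided ne
    ; alone = alone′ ; fixed = fixed′ ; placed = placed′ }
    where
    open Stars inv
    w = proj₁ ω
    J : Fin n → Bool
    J = absorbed (row s w) s ω
    s′ = step stars s ω
    lab′ : ∀ v → lab s′ v ≡ (if J (lab s v) then lab s w else lab s v)
    lab′ = lab-absorb stars s w J
    not-self : ∀ Y → lookup (U s′) Y ≡ true → (lab s w == Y) ≡ false
    not-self Y e = not-true (proj₂ (proj₂ (U-step⇒ stars s ω Y e)))
    alone′ : ∀ Y → lookup (U s′) Y ≡ true → ∀ u → lab s′ u ≡ Y → u ≡ Y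
    alone′ Y e u q with J (lab s u) | lab′ u
    ... | true | l with trans (sym (not-self Y e)) (trans (cong (_== Y) (trans (sym l) q)) (==-refl Y))
    ...   | ()
    alone′ Y e u q | false | l = alone Y (proj₁ (U-step⇒ stars s ω Y e)) u (trans (sym l) q)
    fixed′ : ∀ Y → lookup (U s′) Y ≡ true → lab s′ Y ≡ Y
    fixed′ Y e with U-step⇒ stars s ω Y e
    ... | u , j , _ = trans (lab′ Y) (trans (cong (λ x → if J x then lab s w else x) (fixed Y u)) (cong (λ b → if b then lab s w else Y) j))
    placed′ : ∀ u → (lookup (U s′) (lab s′ u) ∨ lookup (K s′) (lab s′ u)) ≡ true
    placed′ u = subst (λ x → (lookup (U s′) x ∨ lookup (K s′) x) ≡ true) (sym (lab′ u)) (go (J (lab s u)) refl)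
      where
      K′ : ∀ Y → lookup (K s′) Y ≡ lookup (K s) Y ∨ (lab s w == Y)
      K′ = K-absorb stars s w J
      ∨ʳ : ∀ {a b} → b ≡ true → a ∨ b ≡ true
      ∨ʳ {true} _ = refl
      ∨ʳ {false} e = e
      ∨ˡ : ∀ {a b} → a ≡ true → a ∨ b ≡ true
      ∨ˡ refl = refl
      go : ∀ b → J (lab s u) ≡ b → (lookup (U s′) (if b then lab s w else lab s u) ∨ lookup (K s′) (if b then lab s w else lab s u)) ≡ true
      go true e = ∨ʳ {lookup (U s′) (lab s w)} (trans (K′ (lab s w)) (∨ʳ {lookup (K s) (lab s w)} (==-refl (lab s w))))
      go false e = cases (lab s w == lab s u) refl (lookup (K s) (lab s u)) refl
        where
        live-u : lookup (K s) (lab s u) ≡ false → lookup (U s) (lab s u) ≡ true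
        live-u ek with lookup (U s) (lab s u) | placed u
        ... | true  | _ = refl
        ... | false | p = ⊥-elim (contra (trans (sym ek) p))
          where
          contra : false ≡ true → ⊥
          contra ()
        cases : ∀ a → (lab s w == lab s u) ≡ a → ∀ c → lookup (K s) (lab s u) ≡ c → (lookup (U s′) (lab s u) ∨ lookup (K s′) (lab s u)) ≡ true
        cases true  es c     ek = ∨ʳ {lookup (U s′) (lab s u)} (trans (K′ (lab s u)) (∨ʳ {lookup (K s) (lab s u)} es))
        cases false es true  ek = ∨ʳ {lookup (U s′) (lab s u)} (trans (K′ (lab s u)) (∨ˡ ek))
        cases false es false ek = ∨ˡ (trans (U-absorb stars s w J (lab s u)) (true-∧ (live-u ek) (true-∧ (cong not e) (cong not es))))

  module _ {s : St n} (inv : Stars s) where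
    open Stars inv

    stars-row : ∀ w Y → lookup (U s) Y ≡ true → (0 <ᵇ row s w Y) ≡ adj w Y
    stars-row w Y e = bool-≡ (λ p → let (u , l , a) = pos-row s w Y p in subst (λ x → adj w x ≡ true) (alone Y e u l) a)
                             (λ a → row-pos s w Y Y (fixed Y e) a)

    stars-touches : ∀ w Y → lookup (U s) Y ≡ true → touches s w Y ≡ adj w Y
    stars-touches w Y e = trans (cong (not (lab s w == Y) ∧_) (stars-row w Y e)) (bool-≡ (λ p → proj₂ (∧-true {not (lab s w == Y)} p)) (λ a → true-∧ (cong not (≢⇒== (neq a))) a))
      where
      neq : adj w Y ≡ true → lab s w ≢ Y
      neq a l = contra (trans (sym a) (trans (cong (λ x → adj x Y) (alone Y e w l)) (irrefl Y)))
        where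
        contra : true ≡ false → ⊥
        contra ()

    stars-goodDeg : ∀ Y → lookup (U s) Y ≡ true → goodDeg s Y ≡ sameDeg Y
    stars-goodDeg Y e = ∑-cong (fins n) (λ w → cong (λ b → ⟦ b ∧ not (apart w Y) ⟧) (stars-touches w Y e))

    stars-bad : ∀ w Y → ⟦ bad s w Y ⟧ ≡ live s Y * ⟦ adj w Y ∧ apart w Y ⟧
    stars-bad w Y with lookup (U s) Y in e
    ... | false = refl
    ... | true  = trans (cong (λ b → ⟦ b ∧ apart w Y ⟧) (stars-touches w Y e)) (sym (+-identityʳ _))

    stars-hits : ∑ (fins n) (λ w → ∑ (fins n) (λ Y → ⟦ bad s w Y ⟧)) ≡ weighted cutDeg s
    stars-hits = trans (∑-swap (fins n) (fins n) _) (∑-cong (fins n) (λ Y → trans (∑-cong (fins n) (λ w → stars-bad w Y)) (trans (∑-*ˡ (fins n) (live s Y) _) (*-comm (live s Y) _))))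

    stars-support : ∑ (fins n) (rowSupport s) ≡ weighted deg s
    stars-support = trans (∑-swap (fins n) (fins n) _) (∑-cong (fins n) (λ Y → trans (∑-cong (fins n) (λ w → pt w Y)) (trans (∑-*ˡ (fins n) (live s Y) _) (*-comm (live s Y) _))))
      where
      pt : ∀ w Y → ⟦ lookup (U s) Y ⟧ * ⟦ 0 <ᵇ row s w Y ⟧ ≡ live s Y * A⟦ Y , w ⟧
      pt w Y with lookup (U s) Y in e
      ... | false = refl
      ... | true  = cong (λ b → ⟦ b ⟧ + 0) (trans (stars-row w Y e) (adj-sym w Y))

    stars-centres : ∑ (fins n) (λ w → ⟦ lookup (U s) (lab s w) ⟧) ≤ weighted (λ _ → 1) s
    stars-centres = ∑-mono (fins n) (λ w → ≤-trans (bool-≤ (λ e → subst (λ x → lookup (U s) x ≡ true) (sym (alone (lab s w) e w refl)) e)) (≤-reflexive (sym (+-identityʳ _))))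

    stars-decay : ∀ a → 2 * ∑ (steps n) (λ ω → κ s ω * weighted a (step stars s ω)) + 2 ^ n * ∑ (fins n) (λ Y → a Y * (live s Y * sameDeg Y)) ≤ 2 * (Q * weighted a s)
    stars-decay a = ≤-trans (≤-reflexive (cong (λ x → 2 * ∑ (steps n) (λ ω → κ s ω * weighted a (step stars s ω)) + 2 ^ n * x) (∑-cong (fins n) (λ Y → cong (a Y *_) (pt Y)))))
                            (weighted-decay stars a s)
      where
      pt : ∀ Y → live s Y * sameDeg Y ≡ live s Y * goodDeg s Y
      pt Y with lookup (U s) Y in e
      ... | false = refl
      ... | true  = cong (_+ 0) (sym (stars-goodDeg Y e))

    -- A new centre arises only if the drawn vertex is untouched: by `placed`, any other vertex
    -- carries the label of a centre that is already in `K`.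
    centres-step : ∀ ω → card (K (step stars s ω)) ≤ card (K s) + ⟦ lookup (U s) (lab s (proj₁ ω)) ⟧
    centres-step ω = ≤-trans (≤-reflexive (card-∑ (K (step stars s ω)))) (≤-trans (∑-mono (fins n) each) (≤-reflexive (trans (∑-+ (fins n) _ _) (cong₂ _+_ (sym (card-∑ (K s))) (∑-δ (lab s w) (λ _ → ⟦ lookup (U s) (lab s w) ⟧))))))
      where
      w = proj₁ ω
      each : ∀ Y → ⟦ lookup (K (step stars s ω)) Y ⟧ ≤ ⟦ lookup (K s) Y ⟧ + ⟦ lab s w == Y ⟧ * ⟦ lookup (U s) (lab s w) ⟧
      each Y rewrite K-absorb stars s w (absorbed (row s w) s ω) Y with lookup (K s) Y in ek | lab s w == Y in el
      ... | true  | _     = s≤s z≤n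
      ... | false | false = z≤n
      ... | false | true with lookup (U s) (lab s w) | placed w
      ...   | true  | _ = s≤s z≤n
      ...   | false | p = ⊥-elim (contra (trans (sym ek) (trans (cong (lookup (K s)) (sym (==⇒≡ {i = lab s w} {Y} el))) p)))
        where
        contra : false ≡ true → ⊥
        contra ()

  record Clusters (s : St n) : Set where
    field
      idem  : Idempotent s
      sided : Sided s
      all   : ∀ u → lookup (U s) (lab s u) ≡ true

  goodTotal : St n → ℕ
  goodTotal s = ∑ (fins n) (λ w → ∑ (fins n) (λ Y → live s Y * ⟦ good s w Y ⟧))

  goodTotal≡ : ∀ s → ∑ (fins n) (λ Y → 1 * (live s Y * goodDeg s Y)) ≡ goodTotal s
  goodTotal≡ s = trans (∑-cong (fins n) (λ Y → trans (+-identityʳ _) (sym (∑-*ˡ (fins n) (live s Y) _)))) (∑-swap (fins n) (fins n) _)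

  clusters-step : ∀ {s ω} → Clusters s → κ s ω ≢ 0 → Clusters (step clusters s ω)
  clusters-step {s} {ω} inv ne = record { idem = idempotent-step clusters s ω idem ; sided = sided-step clusters s ω sided ne ; all = all′ }
    where
    open Clusters inv
    w = proj₁ ω
    J : Fin n → Bool
    J = absorbed (row s w) s ω
    s′ = step clusters s ω
    U′ : ∀ Y → lookup (U s) Y ≡ true → J Y ≡ false → lookup (U s′) Y ≡ true
    U′ Y u j = trans (U-absorb clusters s w J Y) (true-∧ u (true-∧ (cong not j) refl))
    all′ : ∀ u → lookup (U s′) (lab s′ u) ≡ true
    all′ u = subst (λ x → lookup (U s′) x ≡ true) (sym (lab-absorb clusters s w J u)) (go (J (lab s u)) refl)
      where
      go : ∀ b → J (lab s u) ≡ b → lookup (U s′) (if b then lab s w else lab s u) ≡ true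
      go true  e = U′ (lab s w) (all w) (absorbed-self (row s w) s w (proj₂ ω))
      go false e = U′ (lab s u) (all u) e

  -- Each cluster to be avoided contains a neighbour of `w` across the cut, and distinct clusters
  -- contain distinct ones.
  clusters-bad : ∀ {s} → Clusters s → ∀ w → ∑ (fins n) (λ Y → ⟦ bad s w Y ⟧) ≤ cutDeg w
  clusters-bad {s} inv w = begin
    ∑ (fins n) (λ Y → ⟦ bad s w Y ⟧)
      ≤⟨ ∑-mono (fins n) each ⟩
    ∑ (fins n) (λ Y → ∑ (fins n) (λ u → ⟦ lab s u == Y ⟧ * ⟦ adj u w ∧ apart u w ⟧))
      ≡⟨ ∑-swap (fins n) (fins n) _ ⟩
    ∑ (fins n) (λ u → ∑ (fins n) (λ Y → ⟦ lab s u == Y ⟧ * ⟦ adj u w ∧ apart u w ⟧))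
      ≡⟨ ∑-cong (fins n) (λ u → ∑-δ (lab s u) (λ _ → ⟦ adj u w ∧ apart u w ⟧)) ⟩
    cutDeg w ∎
    where
    open ≤-Reasoning
    open Clusters inv
    each : ∀ Y → ⟦ bad s w Y ⟧ ≤ ∑ (fins n) (λ u → ⟦ lab s u == Y ⟧ * ⟦ adj u w ∧ apart u w ⟧)
    each Y with bad s w Y in eb
    ... | false = z≤n
    ... | true with ∧-true {lookup (U s) Y} eb
    ...   | _ , r with ∧-true {touches s w Y} r
    ...     | t , ap with pos-row s w Y (proj₂ (∧-true {not (lab s w == Y)} t))
    ...       | u , l , a = ≤-trans (≤-reflexive (sym (cong₂ (λ b c → ⟦ b ⟧ * ⟦ c ⟧) (trans (cong (_== Y) l) (==-refl Y)) (true-∧ (trans (adj-sym u w) a) ap′))))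
                              (∑-pickᶠ (λ u → ⟦ lab s u == Y ⟧ * ⟦ adj u w ∧ apart u w ⟧) u)
      where
      ap′ : apart u w ≡ true
      ap′ = trans (apart-sym u w) (trans (cong (side w xor_) (trans (sym (sided u)) (cong side l))) ap)

  -- The three terms stand for the adjacent clusters on the side of the vertex, those across the
  -- cut, and its own cluster.
  clusters-support : ∀ {s} → Clusters s → ∑ (fins n) (rowSupport s) ≤ goodTotal s + (cutTotal + n)
  clusters-support {s} inv = begin
    ∑ (fins n) (rowSupport s)
      ≤⟨ ∑-mono (fins n) (λ w → ≤-trans (∑-mono (fins n) (each w)) (≤-reflexive (trans (∑-+ (fins n) _ _) (cong (∑ (fins n) (λ Y → live s Y * ⟦ good s w Y ⟧) +_) (∑-+ (fins n) _ _))))) ⟩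
    ∑ (fins n) (λ w → ∑ (fins n) (λ Y → live s Y * ⟦ good s w Y ⟧) + (∑ (fins n) (λ Y → ⟦ bad s w Y ⟧) + ∑ (fins n) (λ Y → ⟦ lab s w == Y ⟧ * 1)))
      ≡⟨ trans (∑-+ (fins n) _ _) (cong (goodTotal s +_) (∑-+ (fins n) _ _)) ⟩
    goodTotal s + (∑ (fins n) (λ w → ∑ (fins n) (λ Y → ⟦ bad s w Y ⟧)) + ∑ (fins n) (λ w → ∑ (fins n) (λ Y → ⟦ lab s w == Y ⟧ * 1)))
      ≤⟨ +-monoʳ-≤ (goodTotal s) (+-mono-≤ (∑-mono (fins n) (clusters-bad inv)) (≤-reflexive (trans (∑-cong (fins n) (λ w → ∑-δ (lab s w) (λ _ → 1))) (trans (∑ᶠ-const n 1) (*-identityʳ n))))) ⟩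
    goodTotal s + (cutTotal + n) ∎
    where
    open ≤-Reasoning
    each : ∀ w Y → ⟦ lookup (U s) Y ⟧ * ⟦ 0 <ᵇ row s w Y ⟧ ≤ live s Y * ⟦ good s w Y ⟧ + (⟦ bad s w Y ⟧ + ⟦ lab s w == Y ⟧ * 1)
    each w Y with lookup (U s) Y | 0 <ᵇ row s w Y | lab s w == Y | apart w Y
    ... | false | _     | _     | _     = z≤n
    ... | true  | false | _     | _     = z≤n
    ... | true  | true  | true  | _     = ≤-refl
    ... | true  | true  | false | true  = ≤-refl
    ... | true  | true  | false | false = ≤-refl

  -- A merge can make only the label of the drawn vertex newly good for `x`, and then an absorbed
  -- label that was good for `x` disappears in exchange; positive weight puts both on the same side.
  -- Monotonicity is what allows a batch to be charged to its initial state.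
  goodTotal-mono : ∀ {s ω} → Clusters s → κ s ω ≢ 0 → goodTotal (step clusters s ω) ≤ goodTotal s
  goodTotal-mono {s} {ω} inv ne = ∑-mono (fins n) per
    where
    open Clusters inv
    w = proj₁ ω
    J : Fin n → Bool
    J = absorbed (row s w) s ω
    s′ = step clusters s ω
    lab′ : ∀ v → lab s′ v ≡ (if J (lab s v) then lab s w else lab s v)
    lab′ = lab-absorb clusters s w J
    true≢false : true ≡ false → ⊥
    true≢false ()
    per : ∀ x → ∑ (fins n) (λ Y → live s′ Y * ⟦ good s′ x Y ⟧) ≤ ∑ (fins n) (λ Y → live s Y * ⟦ good s x Y ⟧)
    per x = begin
      ∑ (fins n) (λ Y → live s′ Y * ⟦ good s′ x Y ⟧)
        ≤⟨ ∑-mono (fins n) each ⟩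
      ∑ (fins n) (λ Y → ⟦ not (J Y) ⟧ * t Y + ⟦ lab s w == Y ⟧ * M)
        ≡⟨ trans (∑-+ (fins n) _ _) (cong (∑ (fins n) (λ Y → ⟦ not (J Y) ⟧ * t Y) +_) (∑-δ (lab s w) (λ _ → M))) ⟩
      ∑ (fins n) (λ Y → ⟦ not (J Y) ⟧ * t Y) + M
        ≡⟨ sym (∑-+ (fins n) _ _) ⟩
      ∑ (fins n) (λ Y → ⟦ not (J Y) ⟧ * t Y + ⟦ J Y ⟧ * t Y)
        ≡⟨ ∑-cong (fins n) (λ Y → pt (J Y) (t Y)) ⟩
      ∑ (fins n) t ∎
      where
      open ≤-Reasoning
      t : Fin n → ℕ
      t Y = live s Y * ⟦ good s x Y ⟧
      M = ∑ (fins n) (λ Z → ⟦ J Z ⟧ * t Z)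
      pt : ∀ b y → ⟦ not b ⟧ * y + ⟦ b ⟧ * y ≡ y
      pt true  y = +-identityʳ y
      pt false y = trans (+-identityʳ _) (+-identityʳ y)
      t-one : ∀ Y → lookup (U s) Y ≡ true → lab s x ≢ Y → (0 <ᵇ row s x Y) ≡ true → apart x Y ≡ false → t Y ≡ 1
      t-one Y u l r a rewrite u | ≢⇒== l | r | a = refl
      each : ∀ Y → live s′ Y * ⟦ good s′ x Y ⟧ ≤ ⟦ not (J Y) ⟧ * t Y + ⟦ lab s w == Y ⟧ * M
      each Y with lookup (U s′) Y in eu | good s′ x Y in eg
      ... | false | _     = z≤n
      ... | true  | false = z≤n
      ... | true  | true with U-step⇒ clusters s ω Y eu | ∧-true {touches s′ x Y} eg
      ...   | u , j , _ | tch , ap with ∧-true {not (lab s′ x == Y)} tch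
      ...     | nl , rp with pos-row s′ x Y rp
      ...       | v , lv , a = go (J (lab s v)) refl
        where
        lx : lab s′ x ≢ Y
        lx l = true≢false (trans (sym (trans (cong (_== Y) l) (==-refl Y))) (not-true nl))
        aY : apart x Y ≡ false
        aY = not-true ap
        -- If v was just absorbed, its old label accounts for the pair (x, Y).
        go : ∀ b → J (lab s v) ≡ b → 1 ≤ ⟦ not (J Y) ⟧ * t Y + ⟦ lab s w == Y ⟧ * M
        go false e = ≤-trans (≤-reflexive (sym (trans (cong₂ (λ b y → ⟦ not b ⟧ * y) j (t-one Y u lx′ (row-pos s x Y v lvY a) aY)) refl))) (m≤m+n _ _)
          where
          lvY : lab s v ≡ Y
          lvY = trans (sym (trans (lab′ v) (cong (λ b → if b then lab s w else lab s v) e))) lv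
          lx′ : lab s x ≢ Y
          lx′ l = lx (trans (lab′ x) (trans (cong (λ z → if J z then lab s w else z) l) (cong (λ b → if b then lab s w else Y) j)))
        go true e = ≤-trans (≤-trans (≤-reflexive (sym (cong₂ (λ b y → ⟦ b ⟧ * y) e (t-one Z (absorbed-U (row s w) s ω Z e) lxZ (row-pos s x Z v refl a) aZ))))
                       (≤-trans (∑-pickᶠ (λ Z → ⟦ J Z ⟧ * t Z) Z) (≤-reflexive (sym (trans (cong (λ b → ⟦ b ⟧ * M) (trans (cong (lab s w ==_) (sym wY)) (==-refl (lab s w)))) (+-identityʳ M)))))) (m≤n+m _ _)
          where
          Z = lab s v
          wY : lab s w ≡ Y
          wY = trans (sym (trans (lab′ v) (cong (λ b → if b then lab s w else lab s v) e))) lv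
          lxZ : lab s x ≢ Z
          lxZ l = lx (trans (lab′ x) (trans (cong (λ z → if J z then lab s w else z) l) (trans (cong (λ b → if b then lab s w else Z) e) wY)))
          aZ : apart x Z ≡ false
          aZ = ≡⇒same {x} {Z} (trans (same⇒≡ {x} {Y} aY) (trans (cong side (sym wY)) (trans (sided w) (absorbed-same s ω ne Z e))))

-- Expectations

module Means {n : ℕ} (G : SimpleGraph n) (side : Fin n → Bool) (1≤n : 1 ≤ n) where
  open Edges G
  open Process G
  open Kernel G side
  open Phases G side

  module C (ph : Phase) = Chain (steps n) (step ph) κ Q κ-mass

  α : St n → Step n → ℕ
  α s ω = rowSupport s (proj₁ ω)

  evolve≡fin : ∀ ph e s t → evolve ph e s t ≡ C.fin ph e s t
  evolve≡fin ph zero    s ω       = refl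
  evolve≡fin ph (suc e) s (u , v) = trans (evolve≡fin ph e (evolve ph e s u) v) (cong (λ x → C.fin ph e x v) (evolve≡fin ph e s u))

  stale≡ : ∀ ph e s t → staleSupport e s t ≡ C.stale ph α e s t
  stale≡ ph zero    s ω       = refl
  stale≡ ph (suc e) s (u , v) = cong₂ _+_ (stale≡ ph e s u) (stale≡ ph e s v)

  batched≡ : ∀ ph e s t → batchedSupport ph e s t ≡ C.batched ph α e s t
  batched≡ ph zero    s ω       = refl
  batched≡ ph (suc e) s (u , v) = cong₂ _+_ (batched≡ ph e s u) (trans (cong (λ x → staleSupport e x v) (evolve≡fin ph e s u)) (stale≡ ph e (C.fin ph e s u) v))

  p : ℕ
  p = 2 ^ n

  instance
    p≢0 : NonZero p
    p≢0 = m^n≢0 2 n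
    n≢0 : NonZero n
    n≢0 = >-nonZero 1≤n
    Q≢0 : NonZero Q
    Q≢0 = m*n≢0 n p

  α-mean : ∀ s₀ s → ∑ (steps n) (λ ω → κ s ω * α s₀ ω) ≡ p * ∑ (fins n) (rowSupport s₀)
  α-mean s₀ s = κ-vertex s (rowSupport s₀)

  mass : ℕ → ℕ
  mass = C.mass stars

  mass≡ : ∀ e → C.mass clusters e ≡ mass e
  mass≡ zero    = refl
  mass≡ (suc e) = cong₂ _*_ (mass≡ e) (mass≡ e)

  module StarPhase (δ : ℕ) (half : ∀ v → deg v ≤ 2 * sameDeg v) (δ≤ : ∀ v → δ ≤ deg v) where
    open C stars hiding (mass)

    SInv : ∀ {s ω} → Stars s → κ s ω ≢ 0 → Stars (step stars s ω)
    SInv = stars-step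

    -- The factor 4 consists of 2 for the absorption probability 1/2 and 2 from the hypothesis on
    -- `f`, which makes room for the fact that only half of each neighbourhood is known to lie on
    -- its own side.
    star-path : ∀ a f → (∀ s → Stars s → f s ≤ 2 * (p * ∑ (fins n) (λ Y → a Y * (live s Y * sameDeg Y)))) →
                ∀ e s → Stars s → W e s (pathSum f e s) ≤ Q * (mass e * (4 * weighted a s))
    star-path a f fh e s i = m+n≤o⇒n≤o _ (potential Stars SInv (λ s → 4 * weighted a s) f hyp e s i)
      where
      open ≤-Reasoning
      hyp : ∀ s → Stars s → ∑ (steps n) (λ ω → κ s ω * (4 * weighted a (step stars s ω))) + f s ≤ Q * (4 * weighted a s)
      hyp s i = begin
        ∑ (steps n) (λ ω → κ s ω * (4 * weighted a (step stars s ω))) + f s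
          ≤⟨ +-mono-≤ (≤-reflexive (trans (∑-cong (steps n) (λ ω → arr (κ s ω) _)) (∑-*ˡ (steps n) 4 _))) (fh s i) ⟩
        4 * X + 2 * Y                ≡⟨ arr₂ X Y ⟩
        2 * (2 * X + Y)              ≤⟨ *-monoʳ-≤ 2 (stars-decay i a) ⟩
        2 * (2 * (Q * weighted a s)) ≡⟨ arr₃ Q (weighted a s) ⟩
        Q * (4 * weighted a s) ∎
        where
        X = ∑ (steps n) (λ ω → κ s ω * weighted a (step stars s ω))
        Y = p * ∑ (fins n) (λ Y → a Y * (live s Y * sameDeg Y))
        arr : ∀ k w → k * (4 * w) ≡ 4 * (k * w)
        arr = solve-∀
        arr₂ : ∀ x y → 4 * x + 2 * y ≡ 2 * (2 * x + y)
        arr₂ = solve-∀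
        arr₃ : ∀ q w → 2 * (2 * (q * w)) ≡ q * (4 * w)
        arr₃ = solve-∀

    δ≤2same : ∀ v → δ ≤ 2 * sameDeg v
    δ≤2same v = ≤-trans (δ≤ v) (half v)

    weighted-bound : ∀ a c s → (∀ v → c ≤ 2 * sameDeg v) → p * (c * weighted a s) ≤ 2 * (p * ∑ (fins n) (λ Y → a Y * (live s Y * sameDeg Y)))
    weighted-bound a c s h = ≤-trans (*-monoʳ-≤ p (≤-trans (≤-reflexive (sym (∑-*ˡ (fins n) c _)))
        (≤-trans (∑-mono (fins n) (λ Y → ≤-trans (≤-reflexive (arr c (a Y) (live s Y))) (≤-trans (*-monoʳ-≤ (a Y * live s Y) (h Y)) (≤-reflexive (arr₂ (a Y) (live s Y) (sameDeg Y))))))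
          (≤-reflexive (∑-*ˡ (fins n) 2 _))))) (≤-reflexive (arr₃ p _))
      where
      arr : ∀ c a l → c * (a * l) ≡ a * l * c
      arr = solve-∀
      arr₂ : ∀ a l g → a * l * (2 * g) ≡ 2 * (a * (l * g))
      arr₂ = solve-∀
      arr₃ : ∀ p x → p * (2 * x) ≡ 2 * (p * x)
      arr₃ = solve-∀

    supp-f count-f hits-f : St n → ℕ
    supp-f s = p * ∑ (fins n) (rowSupport s)
    count-f s = p * (δ * weighted (λ _ → 1) s)
    hits-f s = p * (δ * weighted cutDeg s)

    supp-path : ∀ e s → Stars s → W e s (pathSum supp-f e s) ≤ Q * (mass e * (4 * weighted (λ _ → 1) s))
    supp-path = star-path (λ _ → 1) supp-f (λ s i → ≤-trans (≤-reflexive (cong (p *_) (stars-support i)))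
      (≤-trans (*-monoʳ-≤ p (≤-trans (∑-mono (fins n) (λ Y → ≤-trans (*-monoˡ-≤ (live s Y) (half Y)) (≤-reflexive (arr (sameDeg Y) (live s Y))))) (≤-reflexive (∑-*ˡ (fins n) 2 _))))
        (≤-reflexive (arr₃ p _))))
      where
      arr : ∀ g l → 2 * g * l ≡ 2 * (1 * (l * g))
      arr = solve-∀
      arr₃ : ∀ p x → p * (2 * x) ≡ 2 * (p * x)
      arr₃ = solve-∀

    weighted-mono : ∀ a ph s ω → weighted a (step ph s ω) ≤ weighted a s
    weighted-mono a ph s ω = ∑-mono (fins n) (λ Y → *-monoʳ-≤ (a Y) (live-step ph s ω Y))

    supp-mean : ∀ e s → Stars s → W e s (batched α e s) ≤ mass e * (8 * weighted (λ _ → 1) s)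
    supp-mean e s i = *-cancelˡ-≤ Q (≤-trans (m+n≤o⇒m≤o _ (batched-mean Stars SInv α supp-f (λ s₀ s _ → ≤-reflexive (α-mean s₀ s)) mono e s i))
      (≤-trans (*-monoʳ-≤ 2 (supp-path e s i)) (≤-reflexive (arr Q (mass e) (weighted (λ _ → 1) s)))))
      where
      arr : ∀ q m w → 2 * (q * (m * (4 * w))) ≡ q * (m * (8 * w))
      arr = solve-∀
      mono : ∀ {s ω} → Stars s → κ s ω ≢ 0 → supp-f (step stars s ω) ≤ supp-f s
      mono {s} {ω} i ne = *-monoʳ-≤ p (≤-trans (≤-reflexive (stars-support (stars-step i ne))) (≤-trans (weighted-mono deg stars s ω) (≤-reflexive (sym (stars-support i)))))

    count-path : ∀ e s → Stars s → W e s (pathSum count-f e s) ≤ Q * (mass e * (4 * weighted (λ _ → 1) s))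
    count-path = star-path (λ _ → 1) count-f (λ s i → weighted-bound (λ _ → 1) δ s δ≤2same)

    isNew : St n → Step n → ℕ
    isNew s ω = δ * ⟦ lookup (U s) (lab s (proj₁ ω)) ⟧

    new-mean : ∀ e s → Stars s → W e s (stepSum isNew e s) ≤ mass e * (4 * weighted (λ _ → 1) s)
    new-mean e s i = *-cancelˡ-≤ Q (≤-trans (stepSum-bound Stars SInv isNew count-f hyp e s i) (count-path e s i))
      where
      hyp : ∀ s → Stars s → ∑ (steps n) (λ ω → κ s ω * isNew s ω) ≤ count-f s
      hyp s i = ≤-trans (≤-reflexive (κ-vertex s (λ w → δ * ⟦ lookup (U s) (lab s w) ⟧))) (*-monoʳ-≤ p (≤-trans (≤-reflexive (∑-*ˡ (fins n) δ _)) (*-monoʳ-≤ δ (stars-centres i))))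

    -- The number of live labels never increases, so `2^e` times its final value is at most its path
    -- sum; `n ≤ 2^e` then cancels the probability `1/n` of drawing a given vertex.
    undone-mean : ∀ e s → n ≤ 2 ^ e → Stars s → W e s (λ t → δ * weighted (λ _ → 1) (fin e s t)) ≤ mass e * (4 * weighted (λ _ → 1) s)
    undone-mean e s ne i = *-cancelˡ-≤ Q (begin
      Q * W e s (λ t → δ * weighted (λ _ → 1) (fin e s t))           ≡⟨ trans (*-assoc n p _) (cong (n *_) (sym (W-* e s p _))) ⟩
      n * W e s (count-f ∘ fin e s)                                  ≤⟨ *-monoˡ-≤ _ ne ⟩
      2 ^ e * W e s (count-f ∘ fin e s)                              ≡⟨ sym (W-* e s (2 ^ e) _) ⟩
      W e s (λ t → 2 ^ e * count-f (fin e s t))                      ≤⟨ W-mono e s (λ t tn → f-path Stars SInv zero-α count-f zero-mean mono e s i t tn) ⟩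
      W e s (pathSum count-f e s)                                    ≤⟨ count-path e s i ⟩
      Q * (mass e * (4 * weighted (λ _ → 1) s)) ∎)
      where
      open ≤-Reasoning
      -- `f-path` comes with a charge as parameter; the zero charge instantiates it.
      zero-α : St n → Step n → ℕ
      zero-α _ _ = 0
      zero-mean : ∀ s₀ s → Stars s₀ → ∑ (steps n) (λ ω → κ s ω * zero-α s₀ ω) ≤ count-f s₀
      zero-mean s₀ s _ = ≤-trans (≤-reflexive (trans (∑-cong (steps n) (λ ω → *-zeroʳ (κ s ω))) (∑-zero (steps n)))) z≤n
      mono : ∀ {s ω} → Stars s → κ s ω ≢ 0 → count-f (step stars s ω) ≤ count-f s
      mono {s} {ω} _ _ = *-monoʳ-≤ p (*-monoʳ-≤ δ (weighted-mono (λ _ → 1) stars s ω))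

    -- The bound 8: the cut has at most `2 δ` edge ends, each counts only while its vertex is live,
    -- which by `star-path` lasts at most `4 n / δ` steps when averaged with weights `cutDeg`, and
    -- it is met with probability `1/n` per step. Multiplying by `δ` replaces the division.
    hits-mean-stars : 1 ≤ δ → ∀ e s → Stars s → weighted cutDeg s ≤ 2 * δ → W e s (stepSum hits e s) ≤ mass e * 8
    hits-mean-stars 1≤δ e s i cd = *-cancelˡ-≤ (δ * Q) {{m*n≢0 δ Q {{>-nonZero 1≤δ}}}} (begin
      δ * Q * W e s (stepSum hits e s)           ≡⟨ trans (*-assoc δ Q _) (trans (arr δ Q _) (cong (Q *_) (sym (W-* e s δ _)))) ⟩
      Q * W e s (λ t → δ * stepSum hits e s t)   ≡⟨ cong (Q *_) (W-cong e s (scale e s)) ⟩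
      Q * W e s (stepSum β e s)                  ≤⟨ stepSum-bound Stars SInv β hits-f hyp e s i ⟩
      W e s (pathSum hits-f e s)                 ≤⟨ star-path cutDeg hits-f (λ s i → weighted-bound cutDeg δ s δ≤2same) e s i ⟩
      Q * (mass e * (4 * weighted cutDeg s))     ≤⟨ *-monoʳ-≤ Q (*-monoʳ-≤ (mass e) (*-monoʳ-≤ 4 cd)) ⟩
      Q * (mass e * (4 * (2 * δ)))               ≡⟨ arr₂ Q (mass e) δ ⟩
      δ * Q * (mass e * 8) ∎)
      where
      open ≤-Reasoning
      β : St n → Step n → ℕ
      β s ω = δ * hits s ω
      scale : ∀ e s t → δ * stepSum hits e s t ≡ stepSum β e s t
      scale zero    s ω       = refl
      scale (suc e) s (u , v) = trans (*-distribˡ-+ δ _ _) (cong₂ _+_ (scale e s u) (scale e (fin e s u) v))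
      arr : ∀ d q x → d * (q * x) ≡ q * (d * x)
      arr = solve-∀
      arr₂ : ∀ q m d → q * (m * (4 * (2 * d))) ≡ d * q * (m * 8)
      arr₂ = solve-∀
      hyp : ∀ s → Stars s → ∑ (steps n) (λ ω → κ s ω * β s ω) ≤ hits-f s
      hyp s i = ≤-reflexive (trans (∑-cong (steps n) (λ ω → arr (κ s ω) δ _)) (trans (∑-*ˡ (steps n) δ _)
        (trans (cong (δ *_) (trans (hits-mean s) (cong (p *_) (stars-hits i)))) (arr δ p _))))

    centres-path : ∀ e s → Stars s → ∀ t → wt e s t ≢ 0 → δ * card (K (fin e s t)) ≤ δ * card (K s) + stepSum isNew e s t
    centres-path zero    s i ω       ne = ≤-trans (*-monoʳ-≤ δ (centres-step i ω)) (≤-reflexive (*-distribˡ-+ δ _ _))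
    centres-path (suc e) s i (u , v) ne = ≤-trans (centres-path e (fin e s u) (fin-inv Stars SInv e i u (wtˡ Stars SInv e s u v ne)) v (wtʳ Stars SInv e s u v ne))
      (≤-trans (+-monoˡ-≤ _ (centres-path e s i u (wtˡ Stars SInv e s u v ne))) (≤-reflexive (+-assoc (δ * card (K s)) _ _)))

  module ClusterPhase where
    open C clusters hiding (mass)

    CInv : ∀ {s ω} → Clusters s → κ s ω ≢ 0 → Clusters (step clusters s ω)
    CInv = clusters-step

    size : St n → ℕ
    size = weighted (λ _ → 1)

    final-f : St n → ℕ
    final-f s = goodTotal s + (cutTotal + n)

    good-path : ∀ e s → Clusters s → W e s (pathSum (λ s → p * goodTotal s) e s) ≤ Q * (mass e * (2 * size s))
    good-path e s i = subst (λ m → W e s (pathSum (λ s → p * goodTotal s) e s) ≤ Q * (m * (2 * size s))) (mass≡ e)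
      (m+n≤o⇒n≤o _ (potential Clusters CInv (λ s → 2 * size s) (λ s → p * goodTotal s) hyp e s i))
      where
      hyp : ∀ s → Clusters s → ∑ (steps n) (λ ω → κ s ω * (2 * size (step clusters s ω))) + p * goodTotal s ≤ Q * (2 * size s)
      hyp s _ = ≤-trans (≤-reflexive (cong₂ _+_ (trans (∑-cong (steps n) (λ ω → arr (κ s ω) 2 (size (step clusters s ω)))) (∑-*ˡ (steps n) 2 (λ ω → κ s ω * size (step clusters s ω)))) (cong (p *_) (sym (goodTotal≡ s)))))
        (≤-trans (weighted-decay clusters (λ _ → 1) s) (≤-reflexive (arr 2 Q (size s))))
        where
        arr : ∀ k q w → k * (q * w) ≡ q * (k * w)
        arr = solve-∀

    path-split : ∀ c e s t → pathSum (λ s → p * (goodTotal s + c)) e s t ≡ pathSum (λ s → p * goodTotal s) e s t + 2 ^ e * (p * c)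
    path-split c zero    s ω       = trans (*-distribˡ-+ p _ c) (cong (p * goodTotal s +_) (sym (+-identityʳ _)))
    path-split c (suc e) s (u , v) = trans (cong₂ _+_ (path-split c e s u) (path-split c e (fin e s u) v)) (arr (pathSum (λ s → p * goodTotal s) e s u) (pathSum (λ s → p * goodTotal s) e (fin e s u) v) (2 ^ e) (p * c))
      where
      arr : ∀ a b x y → a + x * y + (b + x * y) ≡ a + b + (x + (x + 0)) * y
      arr = solve-∀

    final-path : ∀ e s → Clusters s → W e s (pathSum (λ s → p * final-f s) e s) ≤ mass e * (Q * (2 * size s) + 2 ^ e * (p * (cutTotal + n)))
    final-path e s i = begin
      W e s (pathSum (λ s → p * final-f s) e s)
        ≡⟨ trans (W-cong e s (path-split (cutTotal + n) e s)) (trans (W-+ e s _ _) (cong (W e s (pathSum (λ s → p * goodTotal s) e s) +_) (trans (W-const e s _) (cong (_* (2 ^ e * (p * (cutTotal + n)))) (mass≡ e))))) ⟩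
      W e s (pathSum (λ s → p * goodTotal s) e s) + mass e * (2 ^ e * (p * (cutTotal + n)))
        ≤⟨ +-monoˡ-≤ _ (good-path e s i) ⟩
      Q * (mass e * (2 * size s)) + mass e * (2 ^ e * (p * (cutTotal + n)))
        ≡⟨ arr Q (mass e) (2 * size s) _ ⟩
      mass e * (Q * (2 * size s) + 2 ^ e * (p * (cutTotal + n))) ∎
      where
      open ≤-Reasoning
      arr : ∀ q m x y → q * (m * x) + m * y ≡ m * (q * x + y)
      arr = solve-∀

    -- Both summands of `batched-mean` are kept: the first bounds the pairs learned during the
    -- phase, the second those left at its end.
    batch-all : ∀ e s → Clusters s → Q * W e s (batched α e s) + 2 ^ e * W e s (λ t → p * final-f (fin e s t)) ≤ 2 * (mass e * (Q * (2 * size s) + 2 ^ e * (p * (cutTotal + n))))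
    batch-all e s i = ≤-trans (batched-mean Clusters CInv α (λ s → p * final-f s)
        (λ s₀ s i₀ → ≤-trans (≤-reflexive (α-mean s₀ s)) (*-monoʳ-≤ p (clusters-support i₀)))
        (λ {s} {ω} i ne → *-monoʳ-≤ p (+-monoˡ-≤ (cutTotal + n) (goodTotal-mono {s} {ω} i ne))) e s i) (*-monoʳ-≤ 2 (final-path e s i))

    module _ (δ : ℕ) (1≤δ : 1 ≤ δ) (δ≤n : δ ≤ n) (cut≤ : cutTotal ≤ 2 * δ) (e : ℕ) (lo : n ≤ 2 ^ e * δ) (hi : 2 ^ e * δ ≤ 2 * n) where
      open ≤-Reasoning

      2^e≤ : 2 ^ e ≤ 2 * n
      2^e≤ = ≤-trans (≤-trans (≤-reflexive (sym (*-identityʳ _))) (*-monoʳ-≤ (2 ^ e) 1≤δ)) hi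

      overhead : 2 ^ e * (cutTotal + n) ≤ n * (6 * n)
      overhead = begin
        2 ^ e * (cutTotal + n)      ≡⟨ *-distribˡ-+ (2 ^ e) cutTotal n ⟩
        2 ^ e * cutTotal + 2 ^ e * n ≤⟨ +-mono-≤ (≤-trans (*-monoʳ-≤ (2 ^ e) cut≤) (≤-trans (≤-reflexive (arr (2 ^ e) δ)) (*-monoʳ-≤ 2 hi))) (*-monoˡ-≤ n 2^e≤) ⟩
        2 * (2 * n) + 2 * n * n     ≤⟨ +-monoˡ-≤ (2 * n * n) (*-monoʳ-≤ 2 (*-monoʳ-≤ 2 (≤-trans (≤-reflexive (sym (*-identityʳ n))) (*-monoʳ-≤ n 1≤n)))) ⟩
        2 * (2 * (n * n)) + 2 * n * n ≡⟨ arr₂ n ⟩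
        n * (6 * n) ∎
        where
        arr : ∀ e d → e * (2 * d) ≡ 2 * (e * d)
        arr = solve-∀
        arr₂ : ∀ n → 2 * (2 * (n * n)) + 2 * n * n ≡ n * (6 * n)
        arr₂ = solve-∀

      batched-bound : ∀ s → Clusters s → W e s (batched α e s) ≤ mass e * (4 * size s + 12 * n)
      batched-bound s i = *-cancelˡ-≤ Q (begin
        Q * W e s (batched α e s)      ≤⟨ m+n≤o⇒m≤o _ (batch-all e s i) ⟩
        2 * (mass e * (Q * (2 * size s) + 2 ^ e * (p * (cutTotal + n))))
          ≡⟨ cong (λ x → 2 * (mass e * (Q * (2 * size s) + x))) (arr (2 ^ e) p _) ⟩
        2 * (mass e * (Q * (2 * size s) + p * (2 ^ e * (cutTotal + n))))
          ≤⟨ *-monoʳ-≤ 2 (*-monoʳ-≤ (mass e) (+-monoʳ-≤ (Q * (2 * size s)) (*-monoʳ-≤ p overhead))) ⟩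
        2 * (mass e * (n * p * (2 * size s) + p * (n * (6 * n))))
          ≡⟨ arr₂ (mass e) n p (size s) ⟩
        Q * (mass e * (4 * size s + 12 * n)) ∎)
        where
        arr : ∀ a b c → a * (b * c) ≡ b * (a * c)
        arr = solve-∀
        arr₂ : ∀ m n p s → 2 * (m * (n * p * (2 * s) + p * (n * (6 * n)))) ≡ n * p * (m * (4 * s + 12 * n))
        arr₂ = solve-∀

      -- Since `final-f` never increases, the bound for the whole phase, divided by its number of
      -- steps, bounds the last state; by `lo` there are at least `n / δ` steps.
      final-bound : ∀ s → Clusters s → W e s (λ t → final-f (fin e s t)) ≤ mass e * (4 * (δ * size s) + 6 * n)
      final-bound s i = *-cancelˡ-≤ (2 ^ e * δ * p) {{m*n≢0 (2 ^ e * δ) p {{m*n≢0 (2 ^ e) δ {{m^n≢0 2 e}} {{>-nonZero 1≤δ}}}}}} (begin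
        2 ^ e * δ * p * W e s (λ t → final-f (fin e s t))
          ≡⟨ trans (arr (2 ^ e) δ p _) (cong (λ x → δ * (2 ^ e * x)) (sym (W-* e s p _))) ⟩
        δ * (2 ^ e * W e s (λ t → p * final-f (fin e s t)))
          ≤⟨ *-monoʳ-≤ δ (m+n≤o⇒n≤o _ (batch-all e s i)) ⟩
        δ * (2 * (mass e * (n * p * (2 * size s) + 2 ^ e * (p * (cutTotal + n)))))
          ≤⟨ *-monoʳ-≤ δ (*-monoʳ-≤ 2 (*-monoʳ-≤ (mass e) (+-mono-≤ (*-monoˡ-≤ (2 * size s) (*-monoˡ-≤ p lo)) (*-monoʳ-≤ (2 ^ e) (*-monoʳ-≤ p (+-monoˡ-≤ n (≤-trans cut≤ (*-monoʳ-≤ 2 δ≤n)))))))) ⟩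
        δ * (2 * (mass e * (2 ^ e * δ * p * (2 * size s) + 2 ^ e * (p * (2 * n + n)))))
          ≡⟨ arr₂ δ (mass e) (2 ^ e) p (size s) n ⟩
        2 ^ e * δ * p * (mass e * (4 * (δ * size s) + 6 * n)) ∎)
        where
        arr : ∀ x d p w → x * d * p * w ≡ d * (x * (p * w))
        arr = solve-∀
        arr₂ : ∀ d m x p s n → d * (2 * (m * (x * d * p * (2 * s) + x * (p * (2 * n + n))))) ≡ x * d * p * (m * (4 * (d * s) + 6 * n))
        arr₂ = solve-∀

      hits-bound : ∀ s → Clusters s → W e s (stepSum hits e s) ≤ mass e * 4
      hits-bound s i = *-cancelˡ-≤ Q (begin
        Q * W e s (stepSum hits e s)           ≤⟨ stepSum-bound Clusters CInv hits (λ _ → p * cutTotal) hyp e s i ⟩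
        W e s (pathSum (λ _ → p * cutTotal) e s) ≡⟨ trans (W-cong e s (const-path e s)) (trans (W-const e s _) (cong (_* (2 ^ e * (p * cutTotal))) (mass≡ e))) ⟩
        mass e * (2 ^ e * (p * cutTotal))      ≤⟨ *-monoʳ-≤ (mass e) (*-monoʳ-≤ (2 ^ e) (*-monoʳ-≤ p cut≤)) ⟩
        mass e * (2 ^ e * (p * (2 * δ)))       ≡⟨ arr (mass e) (2 ^ e) p δ ⟩
        2 * mass e * p * (2 ^ e * δ)           ≤⟨ *-monoʳ-≤ (2 * mass e * p) hi ⟩
        2 * mass e * p * (2 * n)               ≡⟨ arr₂ (mass e) p n ⟩
        Q * (mass e * 4) ∎)
        where
        arr : ∀ m x p d → m * (x * (p * (2 * d))) ≡ 2 * m * p * (x * d)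
        arr = solve-∀
        arr₂ : ∀ m p n → 2 * m * p * (2 * n) ≡ n * p * (m * 4)
        arr₂ = solve-∀
        const-path : ∀ e s t → pathSum (λ _ → p * cutTotal) e s t ≡ 2 ^ e * (p * cutTotal)
        const-path zero    s ω       = sym (+-identityʳ _)
        const-path (suc e) s (u , v) = trans (cong₂ _+_ (const-path e s u) (const-path e (fin e s u) v)) (arr₃ (2 ^ e) (p * cutTotal))
          where
          arr₃ : ∀ x y → x * y + x * y ≡ (x + (x + 0)) * y
          arr₃ = solve-∀
        hyp : ∀ s → Clusters s → ∑ (steps n) (λ ω → κ s ω * hits s ω) ≤ p * cutTotal
        hyp s i = ≤-trans (≤-reflexive (hits-mean s)) (*-monoʳ-≤ p (∑-mono (fins n) (λ w → clusters-bad i w)))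

-- Joining the phases and removing the conditioning

abstract
  -- In multiples of `n`: 8 for the rows learned in the star phase, 32 each for the untouched
  -- vertices and the centres that enter the second phase, 8 for the hits of the star phase, and 22
  -- = 12 + 6 + 4 for the constant terms of `batched-bound`, `final-bound` and `hits-bound`.
  meanFactor : ℕ
  meanFactor = 102

  meanFactor-sum : ∀ n → 8 * n + (8 * (4 * n) + (8 * (4 * n) + (8 * n + 22 * n))) ≡ meanFactor * n
  meanFactor-sum n = trans (cong (λ x → 8 * n + (x + (x + (8 * n + 22 * n)))) (sym (*-assoc 8 4 n)))
    (trans (cong (λ x → 8 * n + (32 * n + (32 * n + x))) (sym (*-distribʳ-+ n 8 22)))
    (trans (cong (λ x → 8 * n + (32 * n + x)) (sym (*-distribʳ-+ n 32 30)))
    (trans (cong (8 * n +_) (sym (*-distribʳ-+ n 32 62))) (sym (*-distribʳ-+ n 8 94)))))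

  meanFactor≢0 : NonZero meanFactor
  meanFactor≢0 = _

instance
  meanFactor-nonZero : NonZero meanFactor
  meanFactor-nonZero = meanFactor≢0

initial : ∀ n → St n
initial n = ⟪ tabulate id , full , replicate n false ⟫

-- In the second phase the centres may be absorbed as well.
revive : ∀ {n} → St n → St n
revive s = ⟪ π s , tabulate (λ Y → lookup (U s) Y ∨ lookup (K s) Y) , K s ⟫

module Total {n : ℕ} (G : SimpleGraph n) (side : Fin n → Bool) (1≤n : 1 ≤ n) (δ : ℕ) (1≤δ : 1 ≤ δ) (δ≤n : δ ≤ n)
             (half : ∀ v → Edges.deg G v ≤ 2 * Phases.sameDeg G side v) (δ≤ : ∀ v → δ ≤ Edges.deg G v)
             (cut≤ : Phases.cutTotal G side ≤ 2 * δ)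
             (eB eC : ℕ) (nB : n ≤ 2 ^ eB) (lo : n ≤ 2 ^ eC * δ) (hi : 2 ^ eC * δ ≤ 2 * n) where
  open Edges G
  open Process G
  open Kernel G side
  open Phases G side
  open Means G side 1≤n
  open StarPhase δ half δ≤
  open ClusterPhase using (size; final-f; batched-bound; final-bound; hits-bound)
  module B = C stars
  module D = C clusters

  one : St n → ℕ
  one = weighted (λ _ → 1)

  initial-stars : Stars (initial n)
  initial-stars = record
    { idem   = λ u → cong (lookup (tabulate id)) (l u)
    ; sided  = λ v → cong side (l v)
    ; alone  = λ Y _ u e → trans (sym (l u)) e
    ; fixed  = λ Y _ → l Y
    ; placed = λ u → cong (_∨ lookup (replicate n false) (lab (initial n) u)) (lookup-replicate (lab (initial n) u) true) }
    where
    l : ∀ u → lab (initial n) u ≡ u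
    l = lookup∘tabulate id

  initial-live : ∀ Y → live (initial n) Y ≡ 1
  initial-live Y = cong ⟦_⟧ (lookup-replicate Y true)

  initial-weighted : ∀ a → weighted a (initial n) ≡ ∑ (fins n) a
  initial-weighted a = ∑-cong (fins n) (λ Y → trans (cong (a Y *_) (initial-live Y)) (*-identityʳ (a Y)))

  initial-one : one (initial n) ≡ n
  initial-one = trans (initial-weighted (λ _ → 1)) (trans (∑ᶠ-const n 1) (*-identityʳ n))

  revive-clusters : ∀ {s} → Stars s → Clusters (revive s)
  revive-clusters {s} i = record { idem = Stars.idem i ; sided = Stars.sided i ; all = λ u → trans (lookup∘tabulate _ (lab s u)) (Stars.placed i u) }

  revive-size : ∀ s → size (revive s) ≤ one s + card (K s)
  revive-size s = ≤-trans (∑-mono (fins n) each) (≤-reflexive (trans (∑-+ (fins n) _ _) (cong (one s +_) (sym (card-∑ (K s))))))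
    where
    each : ∀ Y → 1 * live (revive s) Y ≤ 1 * live s Y + ⟦ lookup (K s) Y ⟧
    each Y rewrite lookup∘tabulate (λ Y → lookup (U s) Y ∨ lookup (K s) Y) Y with lookup (U s) Y
    ... | true  = s≤s z≤n
    ... | false = ≤-reflexive (+-identityʳ _)

  middle : Seed (Step n) eB → St n
  middle u = revive (B.fin eB (initial n) u)

  weight : Seed (Step n) eB → Seed (Step n) eC → ℕ
  weight u v = B.wt eB (initial n) u * D.wt eC (middle u) v

  bits : Seed (Step n) eB → Seed (Step n) eC → ℕ
  bits u v = B.stepSum hits eB (initial n) u + D.stepSum hits eC (middle u) v

  support : Seed (Step n) eB → Seed (Step n) eC → ℕ
  support u v = B.batched α eB (initial n) u + (D.batched α eC (middle u) v + final-f (D.fin eC (middle u) v))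

  -- The potential to which Markov's inequality is applied.
  Z : Seed (Step n) eB → Seed (Step n) eC → ℕ
  Z u v = support u v + n * bits u v

  WB : (Seed (Step n) eB → ℕ) → ℕ
  WB = B.W eB (initial n)

  WC : Seed (Step n) eB → (Seed (Step n) eC → ℕ) → ℕ
  WC u = D.W eC (middle u)

  mB mC : ℕ
  mB = mass eB
  mC = mass eC

  WC-const : ∀ u c → WC u (λ _ → c) ≡ mC * c
  WC-const u c = trans (D.W-const eC (middle u) c) (cong (_* c) (mass≡ eC))

  -- The bounds for the second phase involve `δ` times the number of clusters it starts from. By
  -- `revive-size` and `centres-path` these are untouched vertices and newly chosen centres, whose
  -- means over the first phase are known.
  expected : WB (λ u → WC u (Z u)) ≤ mB * (mC * (meanFactor * n))
  expected = begin
    WB (λ u → WC u (Z u))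
      ≤⟨ B.W-mono eB (initial n) inner ⟩
    WB (λ u → mC * (b u + (8 * (δ * one (f u)) + (8 * new u + (n * h u + 22 * n)))))
      ≡⟨ trans (B.W-* eB (initial n) mC _) (cong (mC *_) split) ⟩
    mC * (WB b + (8 * WB (λ u → δ * one (f u)) + (8 * WB new + (n * WB h + mB * (22 * n)))))
      ≤⟨ *-monoʳ-≤ mC (+-mono-≤ (supp-mean eB (initial n) initial-stars) (+-mono-≤ (*-monoʳ-≤ 8 (undone-mean eB (initial n) nB initial-stars))
          (+-mono-≤ (*-monoʳ-≤ 8 (new-mean eB (initial n) initial-stars)) (+-monoˡ-≤ (mB * (22 * n)) (*-monoʳ-≤ n (hits-mean-stars 1≤δ eB (initial n) initial-stars cd)))))) ⟩
    mC * (mB * (8 * one (initial n)) + (8 * (mB * (4 * one (initial n))) + (8 * (mB * (4 * one (initial n))) + (n * (mB * 8) + mB * (22 * n)))))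
      ≡⟨ cong (λ x → mC * (mB * (8 * x) + (8 * (mB * (4 * x)) + (8 * (mB * (4 * x)) + (n * (mB * 8) + mB * (22 * n)))))) initial-one ⟩
    mC * (mB * (8 * n) + (8 * (mB * (4 * n)) + (8 * (mB * (4 * n)) + (n * (mB * 8) + mB * (22 * n)))))
      ≡⟨ arr mC mB n (8 * n) (4 * n) (22 * n) ⟩
    mB * (mC * (8 * n + (8 * (4 * n) + (8 * (4 * n) + (8 * n + 22 * n)))))
      ≡⟨ cong (λ x → mB * (mC * x)) (meanFactor-sum n) ⟩
    mB * (mC * (meanFactor * n)) ∎
    where
    open ≤-Reasoning
    f : Seed (Step n) eB → St n
    f u = B.fin eB (initial n) u
    b new h : Seed (Step n) eB → ℕ
    b u = B.batched α eB (initial n) u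
    new u = B.stepSum isNew eB (initial n) u
    h u = B.stepSum hits eB (initial n) u
    arr : ∀ c b n p q r → c * (b * p + (8 * (b * q) + (8 * (b * q) + (n * (b * 8) + b * r)))) ≡ b * (c * (p + (8 * q + (8 * q + (8 * n + r)))))
    arr = solve-∀
    cd : weighted cutDeg (initial n) ≤ 2 * δ
    cd = ≤-trans (≤-reflexive (initial-weighted cutDeg)) cut≤
    split : WB (λ u → b u + (8 * (δ * one (f u)) + (8 * new u + (n * h u + 22 * n))))
          ≡ WB b + (8 * WB (λ u → δ * one (f u)) + (8 * WB new + (n * WB h + mB * (22 * n))))
    split = trans (B.W-+ eB (initial n) _ _) (cong (WB b +_) (trans (B.W-+ eB (initial n) _ _) (cong₂ _+_ (B.W-* eB (initial n) 8 _)
      (trans (B.W-+ eB (initial n) _ _) (cong₂ _+_ (B.W-* eB (initial n) 8 _) (trans (B.W-+ eB (initial n) _ _) (cong₂ _+_ (B.W-* eB (initial n) n _) (B.W-const eB (initial n) (22 * n)))))))))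
    inner : ∀ u → B.wt eB (initial n) u ≢ 0 → WC u (Z u) ≤ mC * (b u + (8 * (δ * one (f u)) + (8 * new u + (n * h u + 22 * n))))
    inner u ne = begin
      WC u (Z u)
        ≡⟨ trans (D.W-+ eC (middle u) _ _) (cong₂ _+_ (trans (D.W-+ eC (middle u) _ _) (cong₂ _+_ (WC-const u (b u)) (D.W-+ eC (middle u) _ _)))
             (trans (D.W-* eC (middle u) n _) (cong (n *_) (trans (D.W-+ eC (middle u) _ _) (cong (_+ WC u (D.stepSum hits eC (middle u))) (WC-const u (h u))))))) ⟩
      mC * b u + (WC u (D.batched α eC (middle u)) + WC u (λ v → final-f (D.fin eC (middle u) v))) + n * (mC * h u + WC u (D.stepSum hits eC (middle u)))
        ≤⟨ +-mono-≤ (+-monoʳ-≤ (mC * b u) (+-mono-≤ (batched-bound δ 1≤δ δ≤n cut≤ eC lo hi (middle u) ci) (final-bound δ 1≤δ δ≤n cut≤ eC lo hi (middle u) ci)))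
             (*-monoʳ-≤ n (+-monoʳ-≤ (mC * h u) (hits-bound δ 1≤δ δ≤n cut≤ eC lo hi (middle u) ci))) ⟩
      mC * b u + (mC * (4 * N + 12 * n) + mC * (4 * (δ * N) + 6 * n)) + n * (mC * h u + mC * 4)
        ≡⟨ arr₂ mC (b u) N n (δ * N) (h u) ⟩
      mC * (b u + ((4 * N + 4 * (δ * N)) + (n * h u + 22 * n)))
        ≤⟨ *-monoʳ-≤ mC (+-monoʳ-≤ (b u) (+-monoˡ-≤ (n * h u + 22 * n) (+-monoˡ-≤ (4 * (δ * N)) (*-monoʳ-≤ 4 (≤-trans (≤-reflexive (sym (+-identityʳ N))) (*-monoˡ-≤ N 1≤δ)))))) ⟩
      mC * (b u + ((4 * (δ * N) + 4 * (δ * N)) + (n * h u + 22 * n)))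
        ≤⟨ *-monoʳ-≤ mC (+-monoʳ-≤ (b u) (+-monoˡ-≤ (n * h u + 22 * n) (+-mono-≤ (*-monoʳ-≤ 4 δN) (*-monoʳ-≤ 4 δN)))) ⟩
      mC * (b u + ((4 * (δ * one (f u) + new u) + 4 * (δ * one (f u) + new u)) + (n * h u + 22 * n)))
        ≡⟨ arr₃ mC (b u) (δ * one (f u)) (new u) (n * h u + 22 * n) ⟩
      mC * (b u + (8 * (δ * one (f u)) + (8 * new u + (n * h u + 22 * n)))) ∎
      where
      fi : Stars (f u)
      fi = B.fin-inv Stars SInv eB initial-stars u ne
      ci : Clusters (middle u)
      ci = revive-clusters fi
      N = size (middle u)
      δN : δ * N ≤ δ * one (f u) + new u
      δN = ≤-trans (*-monoʳ-≤ δ (revive-size (f u))) (≤-trans (≤-reflexive (*-distribˡ-+ δ _ _)) (+-monoʳ-≤ (δ * one (f u))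
             (≤-trans (centres-path eB (initial n) initial-stars u ne) (≤-reflexive (cong (_+ new u) (trans (cong (δ *_) (card-empty n)) (*-zeroʳ δ)))))))
      arr₂ : ∀ m b N n d h → m * b + (m * (4 * N + 12 * n) + m * (4 * d + 6 * n)) + n * (m * h + m * 4) ≡ m * (b + ((4 * N + 4 * d) + (n * h + 22 * n)))
      arr₂ = solve-∀
      arr₃ : ∀ m b x y z → m * (b + ((4 * (x + y) + 4 * (x + y)) + z)) ≡ m * (b + (8 * x + (8 * y + z)))
      arr₃ = solve-∀

  big : Seed (Step n) eB → Seed (Step n) eC → ℕ
  big u v = ⟦ 2 * meanFactor * n <ᵇ Z u v ⟧

  small : Seed (Step n) eB → Seed (Step n) eC → ℕ
  small u v = ⟦ Z u v ≤ᵇ 2 * meanFactor * n ⟧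

  J : (Seed (Step n) eB → Seed (Step n) eC → ℕ) → ℕ
  J φ = WB (λ u → WC u (φ u))

  J-mono : ∀ {φ ψ} → (∀ u v → φ u v ≤ ψ u v) → J φ ≤ J ψ
  J-mono h = B.W-mono eB (initial n) (λ u _ → D.W-mono eC (middle u) (λ v _ → h u v))

  J-* : ∀ c φ → J (λ u v → c * φ u v) ≡ c * J φ
  J-* c φ = trans (B.W-cong eB (initial n) (λ u → D.W-* eC (middle u) c _)) (B.W-* eB (initial n) c _)

  J-+ : ∀ φ ψ → J (λ u v → φ u v + ψ u v) ≡ J φ + J ψ
  J-+ φ ψ = trans (B.W-cong eB (initial n) (λ u → D.W-+ eC (middle u) _ _)) (B.W-+ eB (initial n) _ _)

  J-one : J (λ _ _ → 1) ≡ mB * mC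
  J-one = trans (B.W-cong eB (initial n) (λ u → trans (WC-const u 1) (*-identityʳ mC))) (B.W-const eB (initial n) mC)

  markov : mB * mC ≤ 2 * J small
  markov = +-cancelˡ-≤ (2 * J big) _ _ (begin
    2 * J big + mB * mC             ≤⟨ +-monoˡ-≤ (mB * mC) big≤ ⟩
    mB * mC + mB * mC               ≡⟨ cong (mB * mC +_) (sym (+-identityʳ _)) ⟩
    2 * (mB * mC)                   ≡⟨ cong (2 *_) (sym J-one) ⟩
    2 * J (λ _ _ → 1)               ≤⟨ *-monoʳ-≤ 2 (≤-trans (J-mono (λ u v → cover (Z u v) (2 * meanFactor * n))) (≤-reflexive (J-+ big small))) ⟩
    2 * (J big + J small)           ≡⟨ *-distribˡ-+ 2 (J big) (J small) ⟩
    2 * J big + 2 * J small ∎)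
    where
    open ≤-Reasoning
    cover : ∀ x y → 1 ≤ ⟦ y <ᵇ x ⟧ + ⟦ x ≤ᵇ y ⟧
    cover zero    y = m≤n+m 1 ⟦ y <ᵇ 0 ⟧
    cover (suc x) zero = s≤s z≤n
    cover (suc x) (suc y) = ≤-trans (cover x y) (+-monoʳ-≤ ⟦ y <ᵇ x ⟧ (≤-reflexive (cong ⟦_⟧ (same x y))))
      where
      same : ∀ x y → (x ≤ᵇ y) ≡ (x <ᵇ suc y)
      same zero    y = refl
      same (suc x) y = refl
    big≤ : 2 * J big ≤ mB * mC
    big≤ = *-cancelˡ-≤ (meanFactor * n) {{m*n≢0 meanFactor n}} (begin
      meanFactor * n * (2 * J big)             ≡⟨ arr meanFactor n (J big) ⟩
      2 * meanFactor * n * J big                   ≡⟨ sym (J-* (2 * meanFactor * n) big) ⟩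
      J (λ u v → 2 * meanFactor * n * big u v)     ≤⟨ J-mono (λ u v → large (Z u v) (2 * meanFactor * n)) ⟩
      J Z                               ≤⟨ expected ⟩
      mB * (mC * (meanFactor * n))             ≡⟨ trans (sym (*-assoc mB mC _)) (*-comm (mB * mC) _) ⟩
      meanFactor * n * (mB * mC) ∎)
      where
      arr : ∀ f n x → f * n * (2 * x) ≡ 2 * f * n * x
      arr = solve-∀
      large : ∀ z y → y * ⟦ y <ᵇ z ⟧ ≤ z
      large z y with y <ᵇ z in e
      ... | true  = ≤-trans (≤-reflexive (*-identityʳ y)) (<⇒≤ (<ᵇ⇒< y z (subst T (sym e) _)))
      ... | false = ≤-trans (≤-reflexive (*-zeroʳ y)) z≤n

  -- Positive weight certifies that no merge crossed the cut, and the bound on `Z` caps both the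
  -- cost and, through `bits`, the likelihood ratio.
  success : Seed (Step n) eB → Seed (Step n) eC → Bool
  success u v = (0 <ᵇ weight u v) ∧ (Z u v ≤ᵇ 2 * meanFactor * n)

  -- On success the weight is at most 2^(2·meanFactor).
  count-success : mB * mC ≤ 2 ^ suc (2 * meanFactor) * B.∑ˢ eB (λ u → B.∑ˢ eC (λ v → ⟦ success u v ⟧))
  count-success = begin
    mB * mC                          ≤⟨ markov ⟩
    2 * J small                      ≡⟨ cong (2 *_) (trans (B.W≡∑ˢ eB (initial n) _) (B.∑ˢ-cong eB (λ u → trans (cong (B.wt eB (initial n) u *_) (D.W≡∑ˢ eC (middle u) _))
                                          (trans (sym (B.∑ˢ-* eC (B.wt eB (initial n) u) _)) (B.∑ˢ-cong eC (λ v → sym (*-assoc (B.wt eB (initial n) u) _ _))))))) ⟩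
    2 * B.∑ˢ eB (λ u → B.∑ˢ eC (λ v → weight u v * small u v))
                                     ≤⟨ *-monoʳ-≤ 2 (B.∑ˢ-mono eB (λ u → B.∑ˢ-mono eC (λ v → each u v))) ⟩
    2 * B.∑ˢ eB (λ u → B.∑ˢ eC (λ v → 2 ^ (2 * meanFactor) * ⟦ success u v ⟧))
                                     ≡⟨ cong (2 *_) (trans (B.∑ˢ-cong eB (λ u → B.∑ˢ-* eC (2 ^ (2 * meanFactor)) _)) (B.∑ˢ-* eB (2 ^ (2 * meanFactor)) _)) ⟩
    2 * (2 ^ (2 * meanFactor) * X)                ≡⟨ sym (*-assoc 2 (2 ^ (2 * meanFactor)) X) ⟩
    2 ^ suc (2 * meanFactor) * X ∎
    where
    open ≤-Reasoning
    X = B.∑ˢ eB (λ u → B.∑ˢ eC (λ v → ⟦ success u v ⟧))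
    bounded : ∀ b z w k → (b ≡ true → z ≤ k * n) → (z ≤ k * n → w ≤ 2 ^ k) → w * ⟦ b ⟧ ≤ 2 ^ k * ⟦ (0 <ᵇ w) ∧ b ⟧
    bounded false z w       k f g = ≤-trans (≤-reflexive (*-zeroʳ w)) z≤n
    bounded true  z zero    k f g = z≤n
    bounded true  z (suc w) k f g = ≤-trans (≤-reflexive (*-identityʳ (suc w))) (≤-trans (g (f refl)) (≤-reflexive (sym (*-identityʳ _))))
    weight≤ : ∀ u v → Z u v ≤ 2 * meanFactor * n → weight u v ≤ 2 ^ (2 * meanFactor)
    weight≤ u v h = ≤-trans (*-mono-≤ (B.wt≤2^ hits κ≤2^ eB (initial n) u) (D.wt≤2^ hits κ≤2^ eC (middle u) v))
      (≤-trans (≤-reflexive (sym (^-distribˡ-+-* 2 (B.stepSum hits eB (initial n) u) (D.stepSum hits eC (middle u) v)))) (^-monoʳ-≤ 2 bits≤))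
      where
      bits≤ : bits u v ≤ 2 * meanFactor
      bits≤ = *-cancelˡ-≤ n (≤-trans (m≤n+m (n * bits u v) (support u v)) (≤-trans h (≤-reflexive (*-comm (2 * meanFactor) n))))
    each : ∀ u v → weight u v * small u v ≤ 2 ^ (2 * meanFactor) * ⟦ success u v ⟧
    each u v = bounded (Z u v ≤ᵇ 2 * meanFactor * n) (Z u v) (weight u v) (2 * meanFactor) (λ e → ≤ᵇ⇒≤ (Z u v) (2 * meanFactor * n) (subst T (sym e) _)) (weight≤ u v)

  -- The total weight of the conditioned walk equals the number of seeds, so `count-success` becomes
  -- a statement about uniform seeds.
  ∑ˢ-all : ∀ e → B.∑ˢ e (λ _ → 1) ≡ mass e
  ∑ˢ-all zero    = trans (∑-cong (steps n) (λ _ → refl)) (trans (∑-steps n (λ _ → 1)) (trans (∑-cong (fins n) (λ w → trans (∑-const (subsets n) 1) (trans (*-identityʳ _) (length-subsets n)))) (∑ᶠ-const n p)))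
  ∑ˢ-all (suc e) = trans (B.∑ˢ-cong e (λ u → ∑ˢ-all e)) (trans (trans (B.∑ˢ-cong e (λ u → sym (*-identityʳ (mass e)))) (B.∑ˢ-* e (mass e) (λ _ → 1))) (cong (mass e *_) (∑ˢ-all e)))

-- A single trial

properᵇ : ∀ {n} → (Fin n → Bool) → Bool
properᵇ {n} S = (0 <ᵇ ∑ (fins n) (λ i → ⟦ S i ⟧)) ∧ (0 <ᵇ ∑ (fins n) (λ i → ⟦ not (S i) ⟧))

properᵇ-cong : ∀ {n} {S T : Fin n → Bool} → (∀ i → S i ≡ T i) → properᵇ S ≡ properᵇ T
properᵇ-cong {n} e = cong₂ (λ x y → (0 <ᵇ x) ∧ (0 <ᵇ y)) (∑-cong (fins n) (λ i → cong ⟦_⟧ (e i))) (∑-cong (fins n) (λ i → cong (⟦_⟧ ∘ not) (e i)))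

properᵇ-sound : ∀ {n} (S : Subset n) → properᵇ (lookup S) ≡ true → NonemptyProper S
properᵇ-sound S e with ∧-true e
... | p , q with pos-∑ (λ i → ⟦ lookup S i ⟧) p | pos-∑ (λ i → ⟦ not (lookup S i) ⟧) q
... | i , r | j , t = (i , lookup⇒[]= i S (one r)) , (j , λ m → contra (trans (sym ([]=⇒lookup m)) (zer t)))
  where
  one : ∀ {b} → (0 <ᵇ ⟦ b ⟧) ≡ true → b ≡ true
  one {true} _ = refl
  zer : ∀ {b} → (0 <ᵇ ⟦ not b ⟧) ≡ true → b ≡ false
  zer {false} _ = refl
  contra : true ≡ false → ⊥
  contra ()

properᵇ-complete : ∀ {n} (S : Subset n) → NonemptyProper S → properᵇ (lookup S) ≡ true
properᵇ-complete S ((i , m) , (j , m′)) = true-∧ (∑-pos (λ i → ⟦ lookup S i ⟧) i (cong (λ b → 0 <ᵇ ⟦ b ⟧) ([]=⇒lookup m)))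
  (∑-pos (λ i → ⟦ not (lookup S i) ⟧) j (cong (λ b → 0 <ᵇ ⟦ not b ⟧) (out (lookup S j) refl)))
  where
  out : ∀ b → lookup S j ≡ b → lookup S j ≡ false
  out true  e = ⊥-elim (m′ (lookup⇒[]= j S e))
  out false e = e

module _ {n : ℕ} where

  union : St n → Subset n → Fin n → Bool
  union s 𝒴 v = lookup 𝒴 (lab s v)

  unionCut : St n → Table n → Subset n → ℕ
  unionCut s table 𝒴 = ∑ (fins n) (λ w → ∑ (fins n) (λ Y → ⟦ union s 𝒴 w ∧ not (lookup 𝒴 Y) ⟧ * table ⟨ w , Y ⟩))

  -- Improper unions get a value above `n * n`, which no cut exceeds; hence the minimizer is proper
  -- as soon as some union of clusters is.
  score : St n → Table n → Subset n → ℕ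
  score s table 𝒴 = if properᵇ (union s 𝒴) then unionCut s table 𝒴 else suc (n * n)

  best : St n → Table n → Subset n
  best s table = argmin (score s table) full (subsets n)

  abstract
    bestUnion : St n → Table n → Subset n
    bestUnion s table = tabulate (union s (best s table))

    lookup-bestUnion : ∀ s table v → lookup (bestUnion s table) v ≡ union s (best s table) v
    lookup-bestUnion s table = lookup∘tabulate (union s (best s table))

module _ {n : ℕ} (G : SimpleGraph n) where
  open Edges G
  open Process G

  cut≤n² : ∀ S → cut S ≤ n * n
  cut≤n² S = ≤-trans (∑-mono (fins n) (λ i → ≤-trans (∑-mono (fins n) (λ j → ⟦⟧≤1 (SimpleGraph.adj G i j ∧ S i ∧ not (S j)))) (≤-reflexive (trans (∑ᶠ-const n 1) (*-identityʳ n)))))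
               (≤-reflexive (∑ᶠ-const n n))

  module _ (s : St n) (all : ∀ u → lookup (U s) (lab s u) ≡ true) where
    table : Table n
    table = learned s (λ _ → true)

    table-row : ∀ w Y → table ⟨ w , Y ⟩ ≡ row s w Y
    table-row w Y = trans (learned-at s (λ _ → true) w Y) (trans (+-identityʳ _)
      (trans (sym (∑-*ˡ (fins n) ⟦ lookup (U s) Y ⟧ _)) (∑-cong (fins n) each)))
      where
      each : ∀ u → ⟦ lookup (U s) Y ⟧ * (⟦ lab s u == Y ⟧ * A⟦ w , u ⟧) ≡ ⟦ lab s u == Y ⟧ * A⟦ w , u ⟧
      each u with lab s u == Y in e
      ... | false = *-zeroʳ ⟦ lookup (U s) Y ⟧
      ... | true  rewrite sym (==⇒≡ {i = lab s u} {Y} e) | all u = +-identityʳ _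

    unionCut≡ : ∀ 𝒴 → unionCut s table 𝒴 ≡ cut (union s 𝒴)
    unionCut≡ 𝒴 = ∑-cong (fins n) inner
      where
      f : Fin n → Fin n → ℕ
      f w Y = ⟦ union s 𝒴 w ∧ not (lookup 𝒴 Y) ⟧
      arr : ∀ a b c → a * (b * c) ≡ b * (a * c)
      arr = solve-∀
      pt : ∀ a b c → ⟦ b ∧ c ⟧ * ⟦ a ⟧ ≡ ⟦ a ∧ b ∧ c ⟧
      pt true  b c = *-identityʳ _
      pt false b c = *-zeroʳ ⟦ b ∧ c ⟧
      inner : ∀ w → ∑ (fins n) (λ Y → f w Y * table ⟨ w , Y ⟩) ≡ ∑ (fins n) (λ u → ⟦ SimpleGraph.adj G w u ∧ union s 𝒴 w ∧ not (union s 𝒴 u) ⟧)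
      inner w = trans (∑-cong (fins n) (λ Y → trans (cong (f w Y *_) (table-row w Y)) (sym (∑-*ˡ (fins n) (f w Y) _))))
        (trans (∑-swap (fins n) (fins n) _) (∑-cong (fins n) (λ u → trans (∑-cong (fins n) (λ Y → arr (f w Y) ⟦ lab s u == Y ⟧ A⟦ w , u ⟧))
          (trans (∑-δ (lab s u) (λ Y → f w Y * A⟦ w , u ⟧)) (pt (SimpleGraph.adj G w u) (union s 𝒴 w) (not (union s 𝒴 u)))))))

    choose-spec : ∀ 𝒴 → properᵇ (union s 𝒴) ≡ true → NonemptyProper (bestUnion s table) × cutSize G (bestUnion s table) ≤ cut (union s 𝒴)
    choose-spec 𝒴 pr = go (properᵇ (union s B)) refl
      where
      B = best s table
      score≡ : ∀ 𝒵 b → properᵇ (union s 𝒵) ≡ b → score s table 𝒵 ≡ (if b then cut (union s 𝒵) else suc (n * n))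
      score≡ 𝒵 true  e = trans (cong (λ b → if b then unionCut s table 𝒵 else suc (n * n)) e) (unionCut≡ 𝒵)
      score≡ 𝒵 false e = cong (λ b → if b then unionCut s table 𝒵 else suc (n * n)) e
      le : score s table B ≤ cut (union s 𝒴)
      le = ≤-trans (All.lookup (f[argmin]≤f[xs] {f = score s table} full (subsets n)) (∈-subsets 𝒴)) (≤-reflexive (score≡ 𝒴 true pr))
      go : ∀ b → properᵇ (union s B) ≡ b → NonemptyProper (bestUnion s table) × cutSize G (bestUnion s table) ≤ cut (union s 𝒴)
      go true e = properᵇ-sound (bestUnion s table) (trans (properᵇ-cong (lookup-bestUnion s table)) e)
        , ≤-trans (≤-reflexive (trans (cutSize≡ (bestUnion s table)) (trans (cut-cong {lookup (bestUnion s table)} (lookup-bestUnion s table)) (sym (score≡ B true e))))) le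
      go false e = ⊥-elim (<-irrefl refl (≤-trans (≤-trans (≤-reflexive (sym (score≡ B false e))) le) (cut≤n² (union s 𝒴))))

module Trial {n : ℕ} (sc : Scale n) (j₀ : Fin n) where
  open Doubling sc j₀
  open Algorithm sc j₀

  afterClusters : (Fin n → ℕ) → St n → Prog n (Subset n)
  afterClusters d s = fmap (bestUnion s) (learnRows d s (λ _ → true))

  afterStars : (Fin n → ℕ) → ∀ e → Seed (Step n) e → St n → Prog n (Subset n)
  afterStars d e v s = phase d clusters e (revive s) v >>= afterClusters d

  trial : (Fin n → ℕ) → ∀ ℓ e → Seed (Step n) ℓ → Seed (Step n) e → Prog n (Subset n)
  trial d ℓ e u v = phase d stars ℓ (initial n) u >>= afterStars d e v

  module _ (G : SimpleGraph n) (d : Fin n → ℕ) (d≡ : ∀ i → d i ≡ Edges.deg G i) where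
    open Process G

    module _ (ℓ e : ℕ) (u : Seed (Step n) ℓ) (v : Seed (Step n) e) where
      s₁ s₂ : St n
      s₁ = evolve stars ℓ (initial n) u
      s₂ = evolve clusters e (revive s₁) v

      initial-idem : Idempotent (initial n)
      initial-idem u = cong (lookup (tabulate id)) (lookup∘tabulate id u)

      s₁-idem : Idempotent s₁
      s₁-idem = idempotent-evolve stars ℓ (initial n) u initial-idem

      val₁ : val G (phase d stars ℓ (initial n) u) ≡ s₁
      val₁ = phase-val G d d≡ stars ℓ (initial n) u initial-idem

      val₂ : val G (phase d clusters e (revive s₁) v) ≡ s₂
      val₂ = phase-val G d d≡ clusters e (revive s₁) v s₁-idem

      trial-val : val G (trial d ℓ e u v) ≡ bestUnion s₂ (learned s₂ (λ _ → true))
      trial-val = trans (val->>= G (phase d stars ℓ (initial n) u) (afterStars d e v))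
        (trans (cong (λ s → val G (afterStars d e v s)) val₁)
        (trans (val->>= G (phase d clusters e (revive s₁) v) (afterClusters d))
        (trans (cong (λ s → val G (afterClusters d s)) val₂)
        (trans (val-fmap G (bestUnion s₂) (learnRows d s₂ (λ _ → true))) (cong (bestUnion s₂) (learnRows-val G d d≡ s₂ (λ _ → true)))))))

      trial-cost : cost G (trial d ℓ e u v) ≤ learnFactor * ((suc ℓ + (suc e + 1)) * M₀ + 4 * (batchedSupport stars ℓ (initial n) u
                     + (batchedSupport clusters e (revive s₁) v + ∑ (fins n) (rowSupport s₂))))
      trial-cost = begin
        cost G (trial d ℓ e u v)
          ≡⟨ trans (cost->>= G (phase d stars ℓ (initial n) u) (afterStars d e v)) (cong (λ s → cost G (phase d stars ℓ (initial n) u) + cost G (afterStars d e v s)) val₁) ⟩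
        cost G (phase d stars ℓ (initial n) u) + cost G (afterStars d e v s₁)
          ≡⟨ cong (cost G (phase d stars ℓ (initial n) u) +_) (trans (cost->>= G (phase d clusters e (revive s₁) v) (afterClusters d))
               (cong (λ s → cost G (phase d clusters e (revive s₁) v) + cost G (afterClusters d s)) val₂)) ⟩
        cost G (phase d stars ℓ (initial n) u) + (cost G (phase d clusters e (revive s₁) v) + cost G (afterClusters d s₂))
          ≤⟨ +-mono-≤ (phase-cost G d d≡ stars ℓ (initial n) u initial-idem) (+-mono-≤ (phase-cost G d d≡ clusters e (revive s₁) v s₁-idem)
               (≤-trans (≤-reflexive (cost-fmap G (bestUnion s₂) (learnRows d s₂ (λ _ → true)))) (≤-trans (learnRows-cost G d d≡ s₂ (λ _ → true))
                 (≤-reflexive (cong (λ x → learnFactor * (M₀ + 4 * x)) (∑-cong (fins n) (λ w → +-identityʳ (rowSupport s₂ w)))))))) ⟩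
        learnFactor * (suc ℓ * M₀ + 4 * x) + (learnFactor * (suc e * M₀ + 4 * y) + learnFactor * (M₀ + 4 * z))
          ≡⟨ arr learnFactor ℓ e M₀ x y z ⟩
        learnFactor * ((suc ℓ + (suc e + 1)) * M₀ + 4 * (x + (y + z))) ∎
        where
        open ≤-Reasoning
        x = batchedSupport stars ℓ (initial n) u
        y = batchedSupport clusters e (revive s₁) v
        z = ∑ (fins n) (rowSupport s₂)
        arr : ∀ L ℓ e M x y z → L * (suc ℓ * M + 4 * x) + (L * (suc e * M + 4 * y) + L * (M + 4 * z)) ≡ L * ((suc ℓ + (suc e + 1)) * M + 4 * (x + (y + z)))
        arr = solve-∀

module Succeed {n : ℕ} (sc : Scale n) (j₀ : Fin n) (G : SimpleGraph n) (d : Fin n → ℕ) (d≡ : ∀ i → d i ≡ Edges.deg G i)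
             (side : Fin n → Bool) (1≤n : 1 ≤ n) (δ : ℕ) (1≤δ : 1 ≤ δ) (δ≤n : δ ≤ n)
             (half : ∀ v → Edges.deg G v ≤ 2 * Phases.sameDeg G side v) (δ≤ : ∀ v → δ ≤ Edges.deg G v)
             (cut≤ : Phases.cutTotal G side ≤ 2 * δ)
             (ℓ e : ℕ) (nB : n ≤ 2 ^ ℓ) (lo : n ≤ 2 ^ e * δ) (hi : 2 ^ e * δ ≤ 2 * n) (e≤ℓ : e ≤ ℓ)
             (proper : properᵇ side ≡ true) where
  open Doubling sc j₀ using (M₀)
  open Trial sc j₀
  open Process G
  open Edges G
  open Kernel G side
  open Phases G side
  open Means G side 1≤n
  open ClusterPhase using (final-f; CInv)
  open StarPhase δ half δ≤ using (SInv)
  open Total G side 1≤n δ 1≤δ δ≤n half δ≤ cut≤ ℓ e nB lo hi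

  budget : ℕ
  budget = learnFactor * ((2 * ℓ + 3) * M₀ + 4 * (2 * meanFactor * n))

  module _ (u : Seed (Step n) ℓ) (v : Seed (Step n) e) (ok : success u v ≡ true) where
    private
      s₁≡ : s₁ G d d≡ ℓ e u v ≡ B.fin ℓ (initial n) u
      s₁≡ = evolve≡fin stars ℓ (initial n) u
      s₂′ = D.fin e (middle u) v
      s₂≡ : s₂ G d d≡ ℓ e u v ≡ s₂′
      s₂≡ = trans (cong (λ s → evolve clusters e (revive s) v) s₁≡) (evolve≡fin clusters e (middle u) v)

      weight≢0 : weight u v ≢ 0
      weight≢0 z = contra (trans (sym (proj₁ (∧-true {0 <ᵇ weight u v} ok))) (cong (0 <ᵇ_) z))
        where
        contra : true ≡ false → ⊥
        contra ()

      final : Clusters s₂′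
      final = D.fin-inv Clusters CInv e (revive-clusters (B.fin-inv Stars SInv ℓ initial-stars u (λ z → weight≢0 (cong (_* D.wt e (middle u) v) z)))) v
                (λ z → weight≢0 (trans (cong (B.wt ℓ (initial n) u *_) z) (*-zeroʳ (B.wt ℓ (initial n) u))))

      -- The labels on the `true` side; as no merge crossed the cut, their clusters make up exactly
      -- that side.
      𝒴 : Subset n
      𝒴 = tabulate side

      union≡ : ∀ w → union s₂′ 𝒴 w ≡ side w
      union≡ w = trans (lookup∘tabulate side (lab s₂′ w)) (Clusters.sided final w)

    trial-cut : NonemptyProper (val G (trial d ℓ e u v)) × cutSize G (val G (trial d ℓ e u v)) ≤ cut side
    trial-cut = subst (λ S → NonemptyProper S × cutSize G S ≤ cut side) (sym (trans (trial-val G d d≡ ℓ e u v) (cong (λ s → bestUnion s (learned s (λ _ → true))) s₂≡)))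
      (proj₁ spec , ≤-trans (proj₂ spec) (≤-reflexive (cut-cong union≡)))
      where
      spec = choose-spec G s₂′ (Clusters.all final) 𝒴 (trans (properᵇ-cong union≡) proper)

    trial-budget : cost G (trial d ℓ e u v) ≤ budget
    trial-budget = ≤-trans (trial-cost G d d≡ ℓ e u v) (*-monoʳ-≤ learnFactor (+-mono-≤ (*-monoˡ-≤ M₀ steps≤) (*-monoʳ-≤ 4 support≤)))
      where
      steps≤ : suc ℓ + (suc e + 1) ≤ 2 * ℓ + 3
      steps≤ = ≤-trans (≤-reflexive (arr ℓ e)) (+-monoˡ-≤ 3 (+-monoʳ-≤ ℓ (≤-trans e≤ℓ (≤-reflexive (sym (+-identityʳ ℓ))))))
        where
        arr : ∀ l e → suc l + (suc e + 1) ≡ l + e + 3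
        arr = solve-∀
      support≤ : batchedSupport stars ℓ (initial n) u + (batchedSupport clusters e (revive (s₁ G d d≡ ℓ e u v)) v + ∑ (fins n) (rowSupport (s₂ G d d≡ ℓ e u v))) ≤ 2 * meanFactor * n
      support≤ = ≤-trans (+-mono-≤ (≤-reflexive (batched≡ stars ℓ (initial n) u)) (+-mono-≤
          (≤-reflexive (trans (cong (λ s → batchedSupport clusters e (revive s) v) s₁≡) (batched≡ clusters e (middle u) v)))
          (≤-trans (≤-reflexive (cong (λ s → ∑ (fins n) (rowSupport s)) s₂≡)) (clusters-support final))))
        (≤-trans (m≤m+n (support u v) (n * bits u v)) (≤ᵇ⇒≤ (Z u v) (2 * meanFactor * n) (subst T (sym (proj₂ (∧-true {0 <ᵇ weight u v} ok))) _)))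

-- Scales and prefixes of seeds

power-above : ∀ n → 1 ≤ n → ∃ λ ℓ → n ≤ 2 ^ ℓ × 2 ^ ℓ ≤ 2 * n
power-above (suc zero)    _ = 0 , ≤-refl , s≤s z≤n
power-above (suc (suc n)) _ with power-above (suc n) (s≤s z≤n)
... | ℓ , lo , hi with suc (suc n) ≤? 2 ^ ℓ
...   | yes le = ℓ , le , ≤-trans hi (*-monoʳ-≤ 2 (n≤1+n (suc n)))
...   | no gt  = suc ℓ , ≤-trans (+-mono-≤ (s≤s z≤n) lo′) (+-mono-≤ lo (≤-reflexive (sym (+-identityʳ _)))) , *-monoʳ-≤ 2 (<⇒≤ (≰⇒> gt))
  where
  lo′ : suc n ≤ 2 ^ ℓ
  lo′ = lo

-- At most `2 * ℓ + 3` calls of `learn` occur in a trial, each with overhead `b³`. As `ℓ` is at most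
-- `16 b`, the total is of order `b⁴`, which the choice of scale keeps at `O(n)`.
log-cubic : ∀ ℓ b x → ℓ ≤ 16 * b → 2 ≤ b → b ^ 4 ≤ x → (2 * ℓ + 3) * (b * b * b) ≤ 34 * x
log-cubic ℓ b x ℓ≤ 2≤b b⁴≤ = begin
  (2 * ℓ + 3) * (b * b * b)      ≤⟨ *-monoˡ-≤ (b * b * b) linear ⟩
  34 * b * (b * b * b)           ≡⟨ trans (*-assoc 34 b (b * b * b)) (cong (34 *_) (arr b)) ⟩
  34 * b ^ 4                     ≤⟨ *-monoʳ-≤ 34 b⁴≤ ⟩
  34 * x ∎
  where
  open ≤-Reasoning
  arr : ∀ b → b * (b * b * b) ≡ b * (b * (b * (b * 1)))
  arr = solve-∀
  linear : 2 * ℓ + 3 ≤ 34 * b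
  linear = begin
    2 * ℓ + 3                  ≤⟨ +-mono-≤ (*-monoʳ-≤ 2 ℓ≤) (≤-trans (n≤1+n 3) (*-monoʳ-≤ 2 2≤b)) ⟩
    2 * (16 * b) + 2 * b       ≡⟨ cong (_+ 2 * b) (sym (*-assoc 2 16 b)) ⟩
    32 * b + 2 * b             ≡⟨ sym (*-distribʳ-+ b 32 2) ⟩
    34 * b ∎

power-bound : ∀ a k j ℓ n → a * k ≤ k + ℓ → j ≤ k → 2 ^ ℓ ≤ 2 * n → (2 ^ a) ^ j ≤ 2 ^ suc k * n
power-bound a k j ℓ n ak jk hi = begin
  (2 ^ a) ^ j          ≤⟨ ^-monoʳ-≤ (2 ^ a) {{m^n≢0 2 a}} jk ⟩
  (2 ^ a) ^ k          ≡⟨ ^-*-assoc 2 a k ⟩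
  2 ^ (a * k)          ≤⟨ ^-monoʳ-≤ 2 ak ⟩
  2 ^ (k + ℓ)          ≡⟨ ^-distribˡ-+-* 2 k ℓ ⟩
  2 ^ k * 2 ^ ℓ        ≤⟨ *-monoʳ-≤ (2 ^ k) hi ⟩
  2 ^ k * (2 * n)      ≡⟨ arr (2 ^ k) n ⟩
  2 ^ suc k * n ∎
  where
  open ≤-Reasoning
  arr : ∀ x n → x * (2 * n) ≡ 2 * x * n
  arr = solve-∀

log≤ : ∀ ℓ k .{{_ : NonZero k}} → ℓ ≤ suc (ℓ / k) * k
log≤ ℓ k = ≤-trans (≤-reflexive (m≡m%n+[m/n]*n ℓ k)) (+-monoˡ-≤ (ℓ / k * k) (<⇒≤ (m%n<n ℓ k)))

abstract
  -- For `b = 2^(⌊ℓ/16⌋ + 1)` one has `b^4 ≤ b^16 ≤ 2^(16 + ℓ) ≤ 2^17 * n`; the 34 comes from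
  -- `log-cubic`.
  scaleFactor : ℕ
  scaleFactor = 34 * 2 ^ 17

  log-cost : ∀ ℓ n → 2 ^ ℓ ≤ 2 * n → let b = 2 ^ suc (ℓ / 16) in (2 * ℓ + 3) * (b * b * b) ≤ scaleFactor * n
  log-cost ℓ n hi = ≤-trans (log-cubic ℓ (2 ^ a) (2 ^ 17 * n)
      (≤-trans (log≤ ℓ 16) (≤-trans (≤-reflexive (*-comm a 16)) (*-monoʳ-≤ 16 (<⇒≤ (m<2^m a))))) (^-monoʳ-≤ 2 {1} {a} (s≤s z≤n))
      (power-bound a 16 4 ℓ n (+-monoʳ-≤ 16 (m/n*n≤m ℓ 16)) (≤ᵇ⇒≤ 4 16 _) hi))
    (≤-reflexive (sym (*-assoc 34 (2 ^ 17) n)))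
    where
    a : ℕ
    a = suc (ℓ / 16)

scale : ∀ n ℓ → 2 ≤ n → n ≤ 2 ^ ℓ → Scale n
scale n ℓ 2≤n lo = record { a = suc (ℓ / 16) ; 1≤a = s≤s z≤n ; n≤b^16 = bound ; 2≤n = 2≤n }
  where
  bound : n ≤ (2 ^ suc (ℓ / 16)) ^ 16
  bound = ≤-trans lo (log-power (suc (ℓ / 16)) 16 ℓ (log≤ ℓ 16))
    where
    log-power : ∀ a k ℓ → ℓ ≤ a * k → 2 ^ ℓ ≤ (2 ^ a) ^ k
    log-power a k ℓ h = ≤-trans (^-monoʳ-≤ 2 h) (≤-reflexive (sym (^-*-assoc 2 a k)))

trialFactor : ℕ
trialFactor = learnFactor * (scaleFactor + 4 * (2 * meanFactor))

budget≤ : ∀ ℓ n M → (2 * ℓ + 3) * M ≤ scaleFactor * n → learnFactor * ((2 * ℓ + 3) * M + 4 * (2 * meanFactor * n)) ≤ trialFactor * n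
budget≤ ℓ n M h = ≤-trans (*-monoʳ-≤ learnFactor (+-monoˡ-≤ (4 * (2 * meanFactor * n)) h)) (≤-reflexive (arr learnFactor scaleFactor meanFactor n))
  where
  arr : ∀ l s m n → l * (s * n + 4 * (2 * m * n)) ≡ l * (s + 4 * (2 * m)) * n
  arr = solve-∀

module _ (n δ : ℕ) where

  -- A downward scan from `ℓ` that stops before the first exponent that fails. `leastFrom` receives
  -- the decision as an argument, so that `prefix` can follow the same branches.
  least : ℕ → ℕ
  leastFrom : ∀ ℓ → Dec (n ≤ 2 ^ ℓ * δ) → ℕ
  least zero    = 0
  least (suc ℓ) = leastFrom ℓ (n ≤? 2 ^ ℓ * δ)
  leastFrom ℓ (yes _) = least ℓ
  leastFrom ℓ (no _)  = suc ℓ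

  least≤ : ∀ ℓ → least ℓ ≤ ℓ
  least≤ zero = z≤n
  least≤ (suc ℓ) with n ≤? 2 ^ ℓ * δ
  ... | yes _ = ≤-trans (least≤ ℓ) (n≤1+n ℓ)
  ... | no _  = ≤-refl

  least-lo : ∀ ℓ → n ≤ 2 ^ ℓ * δ → n ≤ 2 ^ least ℓ * δ
  least-lo zero    h = h
  least-lo (suc ℓ) h with n ≤? 2 ^ ℓ * δ
  ... | yes h′ = least-lo ℓ h′
  ... | no _   = h

  least-hi : ∀ ℓ → δ ≤ n → 2 ^ least ℓ * δ ≤ 2 * n
  least-hi zero    h = *-mono-≤ {1} {2} (s≤s z≤n) h
  least-hi (suc ℓ) h with n ≤? 2 ^ ℓ * δ
  ... | yes _ = least-hi ℓ h
  ... | no gt = ≤-trans (≤-reflexive (*-assoc 2 (2 ^ ℓ) δ)) (*-monoʳ-≤ 2 (<⇒≤ (≰⇒> gt)))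

  module _ {Ω : Set} where

    -- The length of the second phase depends on the minimum degree, but the seeds must be fixed
    -- before the graph is known. So `2^ℓ` steps are always drawn, and only an initial segment of
    -- the required length is walked.
    prefix : ∀ ℓ → Seed Ω ℓ → Seed Ω (least ℓ)
    prefixFrom : ∀ ℓ (h : Dec (n ≤ 2 ^ ℓ * δ)) → Seed Ω (suc ℓ) → Seed Ω (leastFrom ℓ h)
    prefix zero    t = t
    prefix (suc ℓ) t = prefixFrom ℓ (n ≤? 2 ^ ℓ * δ) t
    prefixFrom ℓ (yes _) (u , v) = prefix ℓ u
    prefixFrom ℓ (no _)  t       = t

    module _ (ωs : List Ω) where
      open Uniform ωs

      total : ℕ → ℕ
      total e = ∑ˢ e (λ _ → 1)

      ∑ˢ-const : ∀ e c → ∑ˢ e (λ _ → c) ≡ total e * c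
      ∑ˢ-const e c = trans (∑ˢ-cong e (λ _ → sym (*-identityʳ c))) (trans (∑ˢ-* e c (λ _ → 1)) (*-comm c (total e)))

      ∑ˢ-prefix : ∀ ℓ φ → ∑ˢ ℓ (φ ∘ prefix ℓ) * total (least ℓ) ≡ total ℓ * ∑ˢ (least ℓ) φ
      ∑ˢ-prefixFrom : ∀ ℓ h φ → ∑ˢ (suc ℓ) (φ ∘ prefixFrom ℓ h) * total (leastFrom ℓ h) ≡ total (suc ℓ) * ∑ˢ (leastFrom ℓ h) φ
      ∑ˢ-prefix zero    φ = *-comm (∑ˢ 0 φ) (total 0)
      ∑ˢ-prefix (suc ℓ) φ = ∑ˢ-prefixFrom ℓ (n ≤? 2 ^ ℓ * δ) φ
      ∑ˢ-prefixFrom ℓ (no _)  φ = *-comm (∑ˢ (suc ℓ) φ) (total (suc ℓ))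
      ∑ˢ-prefixFrom ℓ (yes _) φ = begin
        ∑ˢ ℓ (λ u → ∑ˢ ℓ (λ _ → φ (prefix ℓ u))) * total (least ℓ)
          ≡⟨ cong (_* total (least ℓ)) (trans (∑ˢ-cong ℓ (λ u → ∑ˢ-const ℓ (φ (prefix ℓ u)))) (∑ˢ-* ℓ (total ℓ) (φ ∘ prefix ℓ))) ⟩
        total ℓ * ∑ˢ ℓ (φ ∘ prefix ℓ) * total (least ℓ)   ≡⟨ *-assoc (total ℓ) _ _ ⟩
        total ℓ * (∑ˢ ℓ (φ ∘ prefix ℓ) * total (least ℓ)) ≡⟨ cong (total ℓ *_) (∑ˢ-prefix ℓ φ) ⟩
        total ℓ * (total ℓ * ∑ˢ (least ℓ) φ)              ≡⟨ sym (*-assoc (total ℓ) (total ℓ) _) ⟩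
        total ℓ * total ℓ * ∑ˢ (least ℓ) φ                ≡⟨ cong (_* ∑ˢ (least ℓ) φ) (sym (∑ˢ-const ℓ (total ℓ))) ⟩
        total (suc ℓ) * ∑ˢ (least ℓ) φ ∎
        where open ≡-Reasoning

module _ {Ω : Set} (ωs : List Ω) where
  open Uniform ωs

  -- A prefix of a uniform seed is uniform, by `∑ˢ-prefix`, so the density of successful seeds
  -- survives the passage to full-length seeds.
  pairs-prefix : ∀ n δ ℓ F (ok : Seed Ω ℓ → Seed Ω (least n δ ℓ) → ℕ) → 1 ≤ ∑ˢ (least n δ ℓ) (λ _ → 1) →
                 ∑ˢ ℓ (λ _ → 1) * ∑ˢ (least n δ ℓ) (λ _ → 1) ≤ F * ∑ˢ ℓ (λ u → ∑ˢ (least n δ ℓ) (ok u)) →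
                 ∑ˢ (suc ℓ) (λ _ → 1) ≤ F * ∑ˢ (suc ℓ) (λ t → ok (proj₁ t) (prefix n δ ℓ (proj₂ t)))
  pairs-prefix n δ ℓ F ok pos h = *-cancelʳ-≤ (∑ˢ (suc ℓ) (λ _ → 1)) (F * Y) Tₑ {{>-nonZero pos}} (begin
    ∑ˢ (suc ℓ) (λ _ → 1) * Tₑ    ≡⟨ cong (_* Tₑ) (∑ˢ-const n δ ωs ℓ Tₗ) ⟩
    Tₗ * Tₗ * Tₑ                ≡⟨ *-assoc Tₗ Tₗ Tₑ ⟩
    Tₗ * (Tₗ * Tₑ)              ≤⟨ *-monoʳ-≤ Tₗ h ⟩
    Tₗ * (F * X)                ≡⟨ arr Tₗ F X ⟩
    F * (Tₗ * X)                ≡⟨ cong (F *_) (sym (∑ˢ-* ℓ Tₗ (λ u → ∑ˢ e (ok u)))) ⟩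
    F * ∑ˢ ℓ (λ u → Tₗ * ∑ˢ e (ok u))
      ≡⟨ cong (F *_) (∑ˢ-cong ℓ (λ u → trans (sym (∑ˢ-prefix n δ ωs ℓ (ok u))) (*-comm _ Tₑ))) ⟩
    F * ∑ˢ ℓ (λ u → Tₑ * ∑ˢ ℓ (λ v → ok u (prefix n δ ℓ v)))
      ≡⟨ cong (F *_) (∑ˢ-* ℓ Tₑ (λ u → ∑ˢ ℓ (λ v → ok u (prefix n δ ℓ v)))) ⟩
    F * (Tₑ * Y)                ≡⟨ arr₂ F Tₑ Y ⟩
    F * Y * Tₑ ∎)
    where
    open ≤-Reasoning
    e = least n δ ℓ
    Tₑ Tₗ X Y : ℕ
    Tₑ = ∑ˢ e (λ _ → 1)
    Tₗ = ∑ˢ ℓ (λ _ → 1)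
    X = ∑ˢ ℓ (λ u → ∑ˢ e (ok u))
    Y = ∑ˢ (suc ℓ) (λ t → ok (proj₁ t) (prefix n δ ℓ (proj₂ t)))
    arr : ∀ a b c → a * (b * c) ≡ b * (a * c)
    arr = solve-∀
    arr₂ : ∀ a b c → a * (b * c) ≡ a * c * b
    arr₂ = solve-∀

-- Minimum cuts

properᵇ-false : ∀ {n} (S : Fin n → Bool) → properᵇ S ≡ false → ∃ λ b → ∀ u → S u ≡ b
properᵇ-false {n} S e with 0 <ᵇ ∑ (fins n) (λ i → ⟦ S i ⟧) in eq
... | false = false , λ u → out (S u) refl
  where
  out : ∀ {u} b → S u ≡ b → S u ≡ false
  out false h = h
  out {u} true h with trans (sym eq) (∑-pos (λ i → ⟦ S i ⟧) u (cong (λ b → 0 <ᵇ ⟦ b ⟧) h))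
  ... | ()
... | true = true , λ u → out (S u) refl
  where
  out : ∀ {u} b → S u ≡ b → S u ≡ true
  out true h = h
  out {u} false h with trans (sym e) (∑-pos (λ i → ⟦ not (S i) ⟧) u (cong (λ b → 0 <ᵇ ⟦ not b ⟧) h))
  ... | ()

single-proper : ∀ {n} → 2 ≤ n → ∀ (v : Fin n) → NonemptyProper (single v)
single-proper {suc zero} (s≤s ())
single-proper {suc (suc m)} _ v = properᵇ-sound (single v) (trans (properᵇ-cong {S = lookup (single v)} (lookup∘tabulate (v ==_)))
  (true-∧ (∑-pos (λ i → ⟦ v == i ⟧) v (cong (λ b → 0 <ᵇ ⟦ b ⟧) (==-refl v))) (∑-pos (λ i → ⟦ not (v == i) ⟧) (other v) (cong (λ b → 0 <ᵇ ⟦ not b ⟧) (≢⇒== {i = v} {other v} (other≢ v))))))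
  where
  other : ∀ {m} → Fin (suc (suc m)) → Fin (suc (suc m))
  other zero    = suc zero
  other (suc _) = zero
  other≢ : ∀ {m} (v : Fin (suc (suc m))) → v ≢ other v
  other≢ zero    ()
  other≢ (suc _) ()

module MinCut {n : ℕ} (G : SimpleGraph n) where
  open Edges G
  open SimpleGraph G using (adj; irrefl) renaming (sym to adj-sym)
  open Phases G using (cutDeg; sameDeg; cutTotal; deg-split)
  open Kernel G using (apart)

  cutTotal≡ : ∀ side → cutTotal side ≡ 2 * cut side
  cutTotal≡ side = begin
    ∑ (fins n) (λ v → ∑ (fins n) (λ w → ⟦ adj w v ∧ apart side w v ⟧))
      ≡⟨ ∑-cong (fins n) (λ v → trans (∑-cong (fins n) (λ w → trans (pt (adj w v) (side w) (side v)) (cong (λ b → ⟦ b ∧ side v ∧ not (side w) ⟧ + f w v) (adj-sym w v)))) (∑-+ (fins n) _ _)) ⟩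
    ∑ (fins n) (λ v → ∑ (fins n) (f v) + ∑ (fins n) (λ w → f w v))
      ≡⟨ ∑-+ (fins n) _ _ ⟩
    cut side + ∑ (fins n) (λ v → ∑ (fins n) (λ w → f w v))
      ≡⟨ cong (cut side +_) (trans (∑-swap (fins n) (fins n) (λ v w → f w v)) (sym (+-identityʳ _))) ⟩
    2 * cut side ∎
    where
    open ≡-Reasoning
    f : Fin n → Fin n → ℕ
    f i j = ⟦ adj i j ∧ side i ∧ not (side j) ⟧
    pt : ∀ a s t → ⟦ a ∧ (s xor t) ⟧ ≡ ⟦ a ∧ t ∧ not s ⟧ + ⟦ a ∧ s ∧ not t ⟧
    pt false s     t     = refl
    pt true  true  true  = refl
    pt true  true  false = refl
    pt true  false true  = refl
    pt true  false false = refl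

  move : (Fin n → Bool) → Fin n → Fin n → Bool
  move side v u = side u xor (v == u)

  -- Moving `v` exchanges its neighbours across the cut with those on its own side. Doubling turns
  -- both cuts into `cutTotal`, a sum over ordered pairs in which the change can be verified entry
  -- by entry.
  cut-move : ∀ side v → cut (move side v) + cutDeg side v ≡ cut side + sameDeg side v
  cut-move side v = *-cancelˡ-≡ _ _ 2 (begin
    2 * (cut (move side v) + cutDeg side v)
      ≡⟨ trans (*-distribˡ-+ 2 (cut (move side v)) _) (cong₂ _+_ (sym (cutTotal≡ (move side v))) (dbl (cutDeg side v))) ⟩
    cutTotal (move side v) + (cutDeg side v + cutDeg side v)
      ≡⟨ cong (cutTotal (move side v) +_) (cong₂ _+_ (sym (δδ c)) (sym (δδ′ c))) ⟩
    cutTotal (move side v) + (∑∑ (λ i j → ⟦ v == i ⟧ * c j) + ∑∑ (λ i j → ⟦ v == j ⟧ * c i))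
      ≡⟨ trans (cong (cutTotal (move side v) +_) (sym (∑∑-+ _ _))) (sym (∑∑-+ (λ i j → ⟦ adj j i ∧ apart (move side v) j i ⟧) _)) ⟩
    ∑∑ (λ i j → ⟦ adj j i ∧ apart (move side v) j i ⟧ + (⟦ v == i ⟧ * c j + ⟦ v == j ⟧ * c i))
      ≡⟨ ∑-cong (fins n) (λ i → ∑-cong (fins n) (λ j → pt i j)) ⟩
    ∑∑ (λ i j → ⟦ adj j i ∧ apart side j i ⟧ + (⟦ v == i ⟧ * s j + ⟦ v == j ⟧ * s i))
      ≡⟨ trans (∑∑-+ _ _) (cong (cutTotal side +_) (∑∑-+ _ _)) ⟩
    cutTotal side + (∑∑ (λ i j → ⟦ v == i ⟧ * s j) + ∑∑ (λ i j → ⟦ v == j ⟧ * s i))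
      ≡⟨ cong (cutTotal side +_) (cong₂ _+_ (δδ s) (δδ′ s)) ⟩
    cutTotal side + (sameDeg side v + sameDeg side v)
      ≡⟨ sym (trans (*-distribˡ-+ 2 (cut side) _) (cong₂ _+_ (sym (cutTotal≡ side)) (dbl (sameDeg side v)))) ⟩
    2 * (cut side + sameDeg side v) ∎)
    where
    open ≡-Reasoning
    ∑∑ : (Fin n → Fin n → ℕ) → ℕ
    ∑∑ f = ∑ (fins n) (λ i → ∑ (fins n) (f i))
    ∑∑-+ : ∀ f g → ∑∑ (λ i j → f i j + g i j) ≡ ∑∑ f + ∑∑ g
    ∑∑-+ f g = trans (∑-cong (fins n) (λ i → ∑-+ (fins n) (f i) (g i))) (∑-+ (fins n) _ _)
    dbl : ∀ x → 2 * x ≡ x + x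
    dbl x = cong (x +_) (+-identityʳ x)
    c s : Fin n → ℕ
    c w = ⟦ adj w v ∧ apart side w v ⟧
    s w = ⟦ adj w v ∧ not (apart side w v) ⟧
    δδ : ∀ (f : Fin n → ℕ) → ∑∑ (λ i j → ⟦ v == i ⟧ * f j) ≡ ∑ (fins n) f
    δδ f = trans (∑-cong (fins n) (λ i → ∑-*ˡ (fins n) ⟦ v == i ⟧ f)) (∑-δ v (λ _ → ∑ (fins n) f))
    δδ′ : ∀ (f : Fin n → ℕ) → ∑∑ (λ i j → ⟦ v == j ⟧ * f i) ≡ ∑ (fins n) f
    δδ′ f = ∑-cong (fins n) (λ i → ∑-δ v (λ _ → f i))
    flip₁ : ∀ a p q → ⟦ a ∧ (p xor (q xor true)) ⟧ + (⟦ a ∧ (p xor q) ⟧ + 0 + 0) ≡ ⟦ a ∧ (p xor q) ⟧ + (⟦ a ∧ not (p xor q) ⟧ + 0 + 0)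
    flip₁ false p     q     = refl
    flip₁ true  true  true  = refl
    flip₁ true  true  false = refl
    flip₁ true  false true  = refl
    flip₁ true  false false = refl
    flip₂ : ∀ a p q → ⟦ a ∧ ((p xor true) xor q) ⟧ + (⟦ a ∧ (q xor p) ⟧ + 0) ≡ ⟦ a ∧ (p xor q) ⟧ + (⟦ a ∧ not (q xor p) ⟧ + 0)
    flip₂ false p     q     = refl
    flip₂ true  true  true  = refl
    flip₂ true  true  false = refl
    flip₂ true  false true  = refl
    flip₂ true  false false = refl
    xor-false : ∀ b → (b xor false) ≡ b
    xor-false true  = refl
    xor-false false = refl
    pt : ∀ i j → ⟦ adj j i ∧ apart (move side v) j i ⟧ + (⟦ v == i ⟧ * c j + ⟦ v == j ⟧ * c i)
               ≡ ⟦ adj j i ∧ apart side j i ⟧ + (⟦ v == i ⟧ * s j + ⟦ v == j ⟧ * s i)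
    pt i j with v == i in ei | v == j in ej
    ... | false | false rewrite xor-false (side i) | xor-false (side j) = refl
    ... | true  | false rewrite xor-false (side j) | ==⇒≡ {i = v} {i} ei = flip₁ (adj j i) (side j) (side i)
    ... | false | true  rewrite xor-false (side i) | ==⇒≡ {i = v} {j} ej | adj-sym i j = flip₂ (adj j i) (side j) (side i)
    ... | true  | true  rewrite sym (==⇒≡ {i = v} {i} ei) | sym (==⇒≡ {i = v} {j} ej) | irrefl v = refl

  module _ (side : Fin n → Bool) (minimal : ∀ S → properᵇ S ≡ true → cut side ≤ cut S)
           (above : ∀ v → cut side < deg v) where

    -- Moving v to the other side yields a proper cut, as otherwise the cut would be that of the singleton v.
    cutDeg≤sameDeg : ∀ v → cutDeg side v ≤ sameDeg side v
    cutDeg≤sameDeg v = go (properᵇ (move side v)) refl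
      where
      go : ∀ b → properᵇ (move side v) ≡ b → cutDeg side v ≤ sameDeg side v
      go true  e = +-cancelˡ-≤ (cut side) _ _ (≤-trans (+-monoˡ-≤ (cutDeg side v) (minimal (move side v) e)) (≤-reflexive (cut-move side v)))
      go false e = ⊥-elim (<-irrefl refl (<-≤-trans (above v) (≤-reflexive deg≡cut)))
        where
        S = move side v
        constant = properᵇ-false S e
        b = proj₁ constant
        no-cut : cut S ≡ 0
        no-cut = trans (∑-cong (fins n) (λ i → trans (∑-cong (fins n) (λ j → trans (cong₂ (λ x y → ⟦ adj i j ∧ x ∧ not y ⟧) (proj₂ constant i) (proj₂ constant j)) (z (adj i j) b))) (∑-zero (fins n)))) (∑-zero (fins n))
          where
          z : ∀ a b → ⟦ a ∧ b ∧ not b ⟧ ≡ 0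
          z true  true  = refl
          z true  false = refl
          z false b     = refl
        no-same : sameDeg side v ≡ 0
        no-same = trans (∑-cong (fins n) (λ w → each w (v == w) refl)) (∑-zero (fins n))
          where
          z : ∀ a p q → (p xor false) ≡ (q xor true) → ⟦ a ∧ not (p xor q) ⟧ ≡ 0
          z false p     q     h = refl
          z true  true  false h = refl
          z true  false true  h = refl
          each : ∀ w c → (v == w) ≡ c → ⟦ adj w v ∧ not (apart side w v) ⟧ ≡ 0
          each w true  h rewrite sym (==⇒≡ {i = v} {w} h) | irrefl v = refl
          each w false h = z (adj w v) (side w) (side v) (trans (cong (side w xor_) (sym h)) (trans (trans (proj₂ constant w) (sym (proj₂ constant v))) (cong (side v xor_) (==-refl v))))
        deg≡cut : deg v ≡ cut side
        deg≡cut = trans (sym (deg-split side v)) (trans (+-comm (sameDeg side v) _) (trans (trans (cong (cutDeg side v +_) no-same) (+-identityʳ _))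
          (trans (cong (_+ cutDeg side v) (sym no-cut)) (trans (cut-move side v) (trans (cong (cut side +_) no-same) (+-identityʳ _))))))

    half : ∀ v → deg v ≤ 2 * sameDeg side v
    half v = ≤-trans (≤-reflexive (sym (deg-split side v))) (+-monoʳ-≤ (sameDeg side v) (≤-trans (cutDeg≤sameDeg v) (≤-reflexive (sym (+-identityʳ _)))))

  deg≤n : ∀ v → deg v ≤ n
  deg≤n v = ≤-trans (∑-mono (fins n) (λ w → ⟦⟧≤1 (adj v w))) (≤-reflexive (trans (∑ᶠ-const n 1) (*-identityʳ n)))

  cutSize-single : ∀ v → cutSize G (single v) ≡ deg v
  cutSize-single v = trans (cutSize≡ (single v)) (trans (cut-cong {lookup (single v)} (lookup∘tabulate (v ==_))) (cut-single v))

  minCut : 2 ≤ n → Fin n → ∃ λ S → NonemptyProper S × (∀ S′ → NonemptyProper S′ → cutSize G S ≤ cutSize G S′)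
  minCut 2≤n j₀ = S , go (properᵇ (lookup S)) refl
    where
    f : Subset n → ℕ
    f S = if properᵇ (lookup S) then cutSize G S else suc (n * n)
    S = argmin f full (subsets n)
    f≤ : ∀ S′ → f S ≤ f S′
    f≤ S′ = All.lookup (f[argmin]≤f[xs] {f = f} full (subsets n)) (∈-subsets S′)
    f≡ : ∀ S′ b → properᵇ (lookup S′) ≡ b → f S′ ≡ (if b then cutSize G S′ else suc (n * n))
    f≡ S′ b e = cong (λ b → if b then cutSize G S′ else suc (n * n)) e
    go : ∀ b → properᵇ (lookup S) ≡ b → NonemptyProper S × (∀ S′ → NonemptyProper S′ → cutSize G S ≤ cutSize G S′)
    go true  e = properᵇ-sound S e , λ S′ p → ≤-trans (≤-reflexive (sym (f≡ S true e))) (≤-trans (f≤ S′) (≤-reflexive (f≡ S′ true (properᵇ-complete S′ p))))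
    go false e = ⊥-elim (<-irrefl refl (≤-trans (≤-reflexive (sym (f≡ S false e))) (≤-trans (f≤ (single j₀))
      (≤-trans (≤-reflexive (f≡ (single j₀) true (properᵇ-complete (single j₀) (single-proper 2≤n j₀)))) (≤-trans (≤-reflexive (cutSize≡ (single j₀))) (cut≤n² G (lookup (single j₀))))))))

-- Amplification

data Depth {n : ℕ} {A : Set} : Prog n A → ℕ → Set where
  ret≤ : ∀ {x k} → Depth (ret x) k
  ask≤ : ∀ {S f k} → (∀ a → Depth (f a) k) → Depth (ask S f) (suc k)

Depth-mono : ∀ {n A} {p : Prog n A} {j k} → j ≤ k → Depth p j → Depth p k
Depth-mono le       ret≤     = ret≤
Depth-mono (s≤s le) (ask≤ h) = ask≤ (λ a → Depth-mono le (h a))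

Depth->>= : ∀ {n A B} {p : Prog n A} {f : A → Prog n B} {j k} → Depth p j → (∀ x → Depth (f x) k) → Depth (p >>= f) (j + k)
Depth->>= {p = ret x} {j = j} ret≤ h = Depth-mono (m≤n+m _ j) (h x)
Depth->>= (ask≤ g) h = ask≤ (λ a → Depth->>= (g a) h)

-- `Depth` quantifies over all answers, while the budget is known only for successful runs on the
-- actual graph. Cutting off at the budget gives the worst-case bound and leaves those runs
-- unchanged.
truncate : ∀ {n A} → ℕ → A → Prog n A → Prog n A
truncate k       x (ret y)   = ret y
truncate zero    x (ask S f) = ret x
truncate (suc k) x (ask S f) = ask S (λ a → truncate k x (f a))

truncate-depth : ∀ {n A} k (x : A) (p : Prog n A) → Depth (truncate k x p) k
truncate-depth zero    x (ret y)   = ret≤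
truncate-depth (suc k) x (ret y)   = ret≤
truncate-depth zero    x (ask S f) = ret≤
truncate-depth (suc k) x (ask S f) = ask≤ (λ a → truncate-depth k x (f a))

truncate-val : ∀ {n A} (G : SimpleGraph n) k (x : A) p → cost G p ≤ k → val G (truncate k x p) ≡ val G p
truncate-val G zero    x (ret y)   h       = refl
truncate-val G (suc k) x (ret y)   h       = refl
truncate-val G (suc k) x (ask S f) (s≤s h) = truncate-val G k x (f (cutSize G S)) h

compile : ∀ {n} → Prog n ℕ → QTree n
compile (ret x)   = leaf x
compile (ask S f) = query S (λ a → compile (f a))

compile-depth : ∀ {n} {p : Prog n ℕ} {k} → Depth p k → DepthAtMost (compile p) k
compile-depth ret≤     = leaf≤
compile-depth (ask≤ h) = query≤ (λ a → compile-depth (h a))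

run-compile : ∀ {n} (G : SimpleGraph n) p → run G (compile p) ≡ val G p
run-compile G (ret x)   = refl
run-compile G (ask S f) = run-compile G (f (cutSize G S))

gather : ∀ {n m} {A : Set} → (Fin m → Prog n A) → Prog n (Vec A m)
gather {m = zero}  f = ret []ᵛ
gather {m = suc m} f = f zero >>= λ x → fmap (x ∷ᵛ_) (gather (f ∘ suc))

gather-val : ∀ {n m} {A : Set} (G : SimpleGraph n) (f : Fin m → Prog n A) → val G (gather f) ≡ tabulate (λ i → val G (f i))
gather-val {m = zero}  G f = refl
gather-val {m = suc m} G f = trans (val->>= G (f zero) (λ x → fmap (x ∷ᵛ_) (gather (f ∘ suc))))
  (trans (val-fmap G (val G (f zero) ∷ᵛ_) (gather (f ∘ suc))) (cong (val G (f zero) ∷ᵛ_) (gather-val G (f ∘ suc))))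

gather-depth : ∀ {n m} {A : Set} (f : Fin m → Prog n A) k → (∀ i → Depth (f i) k) → Depth (gather f) (m * k)
gather-depth {m = zero}  f k h = ret≤
gather-depth {m = suc m} f k h = Depth->>= (h zero) (λ x → subst (Depth _) (+-identityʳ (m * k)) (Depth->>= (gather-depth (f ∘ suc) k (h ∘ suc)) (λ _ → ret≤ {k = 0})))

lowest : ∀ {m} → ℕ → Vec ℕ m → ℕ
lowest x []ᵛ       = x
lowest x (y ∷ᵛ ys) = y ⊓ lowest x ys

lowest≤head : ∀ {m} x (ys : Vec ℕ m) → lowest x ys ≤ x
lowest≤head x []ᵛ       = ≤-refl
lowest≤head x (y ∷ᵛ ys) = ≤-trans (m⊓n≤n y _) (lowest≤head x ys)

lowest≤ : ∀ {m} x (ys : Vec ℕ m) i → lowest x ys ≤ lookup ys i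
lowest≤ x (y ∷ᵛ ys) zero    = m⊓n≤m y _
lowest≤ x (y ∷ᵛ ys) (suc i) = ≤-trans (m⊓n≤n y _) (lowest≤ x ys i)

lowest-elim : ∀ (P : ℕ → Set) {m} x (ys : Vec ℕ m) → P x → (∀ i → P (lookup ys i)) → P (lowest x ys)
lowest-elim P x []ᵛ       p h = p
lowest-elim P x (y ∷ᵛ ys) p h with ⊓-sel y (lowest x ys)
... | inj₁ e = subst P (sym e) (h zero)
... | inj₂ e = subst P (sym e) (lowest-elim P x ys p (h ∘ suc))

pairings : {A B : Set} → List A → List B → List (A × B)
pairings xs ys = concatMap (λ x → map (x ,_) ys) xs

length≡∑ : ∀ {A : Set} (xs : List A) → length xs ≡ ∑ xs (λ _ → 1)
length≡∑ xs = sym (trans (∑-const xs 1) (*-identityʳ _))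

complement : ∀ {A : Set} (xs : List A) (p : A → Bool) → ∑ xs (λ x → ⟦ not (p x) ⟧) + ∑ xs (λ x → ⟦ p x ⟧) ≡ length xs
complement xs p = trans (sym (∑-+ xs _ _)) (trans (∑-cong xs (λ x → pt (p x))) (sym (length≡∑ xs)))
  where
  pt : ∀ b → ⟦ not b ⟧ + ⟦ b ⟧ ≡ 1
  pt true  = refl
  pt false = refl

module _ {Ω : Set} where

  seeds : List Ω → ∀ e → List (Seed Ω e)
  seeds ωs zero    = ωs
  seeds ωs (suc e) = pairings (seeds ωs e) (seeds ωs e)

  ∑-seeds : ∀ ωs e φ → ∑ (seeds ωs e) φ ≡ Uniform.∑ˢ ωs e φ
  ∑-seeds ωs zero    φ = refl
  ∑-seeds ωs (suc e) φ = trans (∑-concatMap (λ x → map (x ,_) (seeds ωs e)) (seeds ωs e) φ)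
    (trans (∑-cong (seeds ωs e) (λ u → trans (∑-map (u ,_) (seeds ωs e) φ) (∑-seeds ωs e (λ v → φ (u , v))))) (∑-seeds ωs e _))

  tuples : List Ω → ∀ K → List (Vec Ω K)
  tuples xs zero    = []ᵛ ∷ []
  tuples xs (suc K) = concatMap (λ x → map (x ∷ᵛ_) (tuples xs K)) xs

  ∑-tuples : ∀ xs K (φ : Vec Ω (suc K) → ℕ) → ∑ (tuples xs (suc K)) φ ≡ ∑ xs (λ x → ∑ (tuples xs K) (λ t → φ (x ∷ᵛ t)))
  ∑-tuples xs K φ = trans (∑-concatMap (λ x → map (x ∷ᵛ_) (tuples xs K)) xs φ) (∑-cong xs (λ x → ∑-map (x ∷ᵛ_) (tuples xs K) φ))

  length-tuples : ∀ xs K → length (tuples xs K) ≡ length xs ^ K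
  length-tuples xs zero    = refl
  length-tuples xs (suc K) = trans (length≡∑ (tuples xs (suc K))) (trans (∑-tuples xs K (λ _ → 1))
    (trans (∑-cong xs (λ _ → trans (sym (length≡∑ (tuples xs K))) (length-tuples xs K))) (∑-const xs _)))

  seeds-pos : ∀ ωs → 1 ≤ length ωs → ∀ e → 1 ≤ length (seeds ωs e)
  seeds-pos ωs h zero    = h
  seeds-pos ωs h (suc e) = ≤-trans (*-mono-≤ ih ih) (≤-reflexive (sym (trans (length≡∑ (seeds ωs (suc e)))
    (trans (∑-concatMap (λ x → map (x ,_) (seeds ωs e)) (seeds ωs e) (λ _ → 1)) (trans (∑-cong (seeds ωs e) (λ x → trans (∑-map (x ,_) (seeds ωs e) (λ _ → 1)) (sym (length≡∑ (seeds ωs e))))) (∑-const (seeds ωs e) _))))))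
    where
    ih = seeds-pos ωs h e

  module _ (ok : Ω → Bool) where

    some : ∀ {K} → Vec Ω K → Bool
    some []ᵛ      = false
    some (x ∷ᵛ t) = ok x ∨ some t

    some-∃ : ∀ {K} (t : Vec Ω K) → some t ≡ true → ∃ λ i → ok (lookup t i) ≡ true
    some-∃ (x ∷ᵛ t) e with ok x in eq
    ... | true  = zero , eq
    ... | false = let (i , h) = some-∃ t e in suc i , h

    all-fail : ∀ xs K → ∑ (tuples xs K) (λ t → ⟦ not (some t) ⟧) ≡ ∑ xs (λ x → ⟦ not (ok x) ⟧) ^ K
    all-fail xs zero    = refl
    all-fail xs (suc K) = trans (∑-tuples xs K _) (trans (∑-cong xs (λ x → trans (∑-cong (tuples xs K) (λ t → pt (ok x) (some t))) (∑-*ˡ (tuples xs K) ⟦ not (ok x) ⟧ _)))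
      (trans (∑-*ʳ xs _ (λ x → ⟦ not (ok x) ⟧)) (cong (∑ xs (λ x → ⟦ not (ok x) ⟧) *_) (all-fail xs K))))
      where
      pt : ∀ a b → ⟦ not (a ∨ b) ⟧ ≡ ⟦ not a ⟧ * ⟦ not b ⟧
      pt true  b = refl
      pt false b = sym (+-identityʳ _)

-- With `p = g / (f + g)` this is `(1 - p)^K * (1 + K p) ≤ 1`, cleared of denominators.
bernoulli : ∀ K f g → (f + g + K * g) * f ^ K ≤ (f + g) ^ suc K
bernoulli zero    f g = ≤-reflexive (arr f g)
  where
  arr : ∀ f g → (f + g + 0) * 1 ≡ (f + g) * 1
  arr = solve-∀
bernoulli (suc K) f g = begin
  (f + g + (g + K * g)) * (f * f ^ K)          ≡⟨ arr f g (K * g) (f ^ K) ⟩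
  ((f + g + K * g) * f + g * f) * f ^ K        ≤⟨ *-monoˡ-≤ (f ^ K) (+-monoʳ-≤ ((f + g + K * g) * f) (*-monoʳ-≤ g (≤-trans (m≤m+n f g) (m≤m+n (f + g) (K * g))))) ⟩
  ((f + g + K * g) * f + g * (f + g + K * g)) * f ^ K
                                               ≡⟨ arr₂ f g (f + g + K * g) (f ^ K) ⟩
  (f + g) * ((f + g + K * g) * f ^ K)          ≤⟨ *-monoʳ-≤ (f + g) (bernoulli K f g) ⟩
  (f + g) * (f + g) ^ suc K ∎
  where
  open ≤-Reasoning
  arr : ∀ f g k p → (f + g + (g + k)) * (f * p) ≡ ((f + g + k) * f + g * f) * p
  arr = solve-∀
  arr₂ : ∀ f g y p → (y * f + g * y) * p ≡ (f + g) * (y * p)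
  arr₂ = solve-∀

-- A success density of at least `1/F` and `K = 2 F` repetitions make the factor `1 + K p` of
-- `bernoulli` at least 3.
failure≤third : ∀ F f g → 1 ≤ f + g → f + g ≤ F * g → 3 * f ^ (2 * F) ≤ (f + g) ^ (2 * F)
failure≤third F f g pos h = *-cancelˡ-≤ (f + g) {{>-nonZero pos}} (begin
  (f + g) * (3 * f ^ k)              ≡⟨ arr (f + g) (f ^ k) ⟩
  (f + g + 2 * (f + g)) * f ^ k      ≤⟨ *-monoˡ-≤ (f ^ k) (+-monoʳ-≤ (f + g) (≤-trans (*-monoʳ-≤ 2 h) (≤-reflexive (sym (*-assoc 2 F g))))) ⟩
  (f + g + k * g) * f ^ k            ≤⟨ bernoulli k f g ⟩
  (f + g) * (f + g) ^ k ∎)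
  where
  open ≤-Reasoning
  k = 2 * F
  arr : ∀ x p → x * (3 * p) ≡ (x + 2 * x) * p
  arr = solve-∀

module _ {Ω : Set} (ok : Ω → Bool) (xs : List Ω) (F : ℕ) (pos : 1 ≤ length xs) (dense : length xs ≤ F * ∑ xs (λ x → ⟦ ok x ⟧)) where

  amplified : 2 * length (tuples xs (2 * F)) ≤ 3 * ∑ (tuples xs (2 * F)) (λ t → ⟦ some ok t ⟧)
  amplified = +-cancelʳ-≤ (3 * bad) _ _ (begin
    2 * m + 3 * bad        ≤⟨ +-monoʳ-≤ (2 * m) bad≤ ⟩
    2 * m + m              ≡⟨ arr m ⟩
    3 * m                  ≡⟨ cong (3 *_) (sym (complement (tuples xs (2 * F)) (some ok))) ⟩
    3 * (bad + fine)       ≡⟨ trans (*-distribˡ-+ 3 bad fine) (+-comm (3 * bad) (3 * fine)) ⟩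
    3 * fine + 3 * bad ∎)
    where
    open ≤-Reasoning
    m bad fine f g : ℕ
    m = length (tuples xs (2 * F))
    bad = ∑ (tuples xs (2 * F)) (λ t → ⟦ not (some ok t) ⟧)
    fine = ∑ (tuples xs (2 * F)) (λ t → ⟦ some ok t ⟧)
    f = ∑ xs (λ x → ⟦ not (ok x) ⟧)
    g = ∑ xs (λ x → ⟦ ok x ⟧)
    arr : ∀ m → 2 * m + m ≡ 3 * m
    arr = solve-∀
    f+g : f + g ≡ length xs
    f+g = complement xs ok
    bad≤ : 3 * bad ≤ m
    bad≤ = begin
      3 * bad                  ≡⟨ cong (3 *_) (all-fail ok xs (2 * F)) ⟩
      3 * f ^ (2 * F)          ≤⟨ failure≤third F f g (subst (1 ≤_) (sym f+g) pos) (subst (_≤ F * g) (sym f+g) dense) ⟩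
      (f + g) ^ (2 * F)        ≡⟨ trans (cong (_^ (2 * F)) f+g) (sym (length-tuples xs (2 * F))) ⟩
      m ∎

∣tabulate∣ : ∀ {A : Set} (xs : List A) (p : A → Bool) → ∣ tabulate (λ i → p (lookupˡ xs i)) ∣ ≡ ∑ xs (λ x → ⟦ p x ⟧)
∣tabulate∣ []       p = refl
∣tabulate∣ (x ∷ xs) p with p x
... | true  = cong suc (∣tabulate∣ xs p)
... | false = ∣tabulate∣ xs p

-- The algorithm and its success probability

oddsFactor : ℕ
oddsFactor = 2 ^ suc (2 * meanFactor)

module EdgeConnectivity (n : ℕ) (2≤n : 2 ≤ n) (ℓ : ℕ) (lo : n ≤ 2 ^ ℓ) (hi : 2 ^ ℓ ≤ 2 * n) where

  1≤n : 1 ≤ n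
  1≤n = ≤-trans (s≤s z≤n) 2≤n

  j₀ : Fin n
  j₀ = fromℕ< 1≤n

  sc : Scale n
  sc = scale n ℓ 2≤n lo

  open Doubling sc j₀ using (M₀)
  open Trial sc j₀ using (trial)

  Ω : Set
  Ω = Seed (Step n) (suc ℓ)

  limit : ℕ
  limit = trialFactor * n

  degrees : Prog n (Vec ℕ n)
  degrees = gather (λ v → ask (single v) ret)

  minDegree : Vec ℕ n → ℕ
  minDegree d = lowest (lookup d j₀) d

  candidate : Vec ℕ n → Ω → Prog n (Subset n)
  candidate d t = truncate limit (single j₀) (trial (lookup d) ℓ (least n (minDegree d) ℓ) (proj₁ t) (prefix n (minDegree d) ℓ (proj₂ t)))

  -- An improper set has cut size 0 and would spoil the minimum. A singleton is measured in its
  -- place, so that every value belongs to a proper cut.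
  orSingle : Bool → Subset n → Subset n
  orSingle b S = if b then S else single j₀

  measure : Subset n → Prog n ℕ
  measure S = ask (orSingle (properᵇ (lookup S)) S) ret

  values : ∀ {K} → Vec Ω K → Vec ℕ n → Prog n (Vec ℕ K)
  values ts d = gather (λ i → candidate d (lookup ts i) >>= measure)

  answer : ∀ {K} → Vec Ω K → Vec ℕ n → Prog n ℕ
  answer ts d = fmap (lowest (minDegree d)) (values ts d)

  algorithm : ∀ {K} → Vec Ω K → Prog n ℕ
  algorithm ts = degrees >>= answer ts

  algorithm-depth : ∀ {K} (ts : Vec Ω K) → Depth (algorithm ts) ((1 + K * (trialFactor + 1)) * n)
  algorithm-depth {K} ts = Depth-mono le (Depth->>= (gather-depth (λ v → ask (single v) ret) 1 (λ v → ask≤ (λ _ → ret≤)))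
    (λ d → Depth->>= (gather-depth (λ i → candidate d (lookup ts i) >>= measure) (limit + 1)
       (λ i → Depth->>= (truncate-depth limit (single j₀) (trial (lookup d) ℓ (least n (minDegree d) ℓ) (proj₁ (lookup ts i)) (prefix n (minDegree d) ℓ (proj₂ (lookup ts i))))) (λ S → ask≤ (λ _ → ret≤))))
       (λ _ → ret≤ {k = 0})))
    where
    open ≤-Reasoning
    le : n * 1 + (K * (limit + 1) + 0) ≤ (1 + K * (trialFactor + 1)) * n
    le = begin
      n * 1 + (K * (trialFactor * n + 1) + 0)   ≤⟨ +-monoʳ-≤ (n * 1) (+-monoˡ-≤ 0 (*-monoʳ-≤ K (+-monoʳ-≤ (trialFactor * n) 1≤n))) ⟩
      n * 1 + (K * (trialFactor * n + n) + 0)   ≡⟨ arr n K trialFactor ⟩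
      (1 + K * (trialFactor + 1)) * n ∎
      where
      arr : ∀ n K f → n * 1 + (K * (f * n + n) + 0) ≡ (1 + K * (f + 1)) * n
      arr = solve-∀

  seedList : List Ω
  seedList = seeds (steps n) (suc ℓ)

  seedList-pos : 1 ≤ length seedList
  seedList-pos = seeds-pos (steps n) (≤-trans (*-mono-≤ 1≤n (m^n>0 2 n)) (≤-reflexive (sym (trans (length≡∑ (steps n)) (trans (∑-steps n (λ _ → 1))
    (trans (∑-cong (fins n) (λ _ → trans (sym (length≡∑ (subsets n))) (length-subsets n))) (∑ᶠ-const n (2 ^ n)))))))) (suc ℓ)

  module _ (G : SimpleGraph n) where
    open Edges G
    open MinCut G

    d : Vec ℕ n
    d = tabulate (λ v → cutSize G (single v))

    d≡ : ∀ v → lookup d v ≡ deg v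
    d≡ v = trans (lookup∘tabulate _ v) (cutSize-single v)

    δ e : ℕ
    δ = minDegree d
    e = least n δ ℓ

    δ≤ : ∀ v → δ ≤ deg v
    δ≤ v = ≤-trans (lowest≤ (lookup d j₀) d v) (≤-reflexive (d≡ v))

    δ≤n : δ ≤ n
    δ≤n = ≤-trans (δ≤ j₀) (deg≤n j₀)

    Realized : ℕ → Set
    Realized k = ∃ λ S → NonemptyProper S × cutSize G S ≡ k

    δ-elim : ∀ (P : ℕ → Set) → (∀ v → P (deg v)) → P δ
    δ-elim P h = lowest-elim P (lookup d j₀) d (subst P (sym (d≡ j₀)) (h j₀)) (λ v → subst P (sym (d≡ v)) (h v))

    value : Ω → ℕ
    value t = val G (measure (val G (candidate d t)))

    algorithm-val : ∀ {K} (ts : Vec Ω K) → val G (algorithm ts) ≡ lowest δ (tabulate (value ∘ lookup ts))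
    algorithm-val ts = trans (val->>= G degrees (answer ts)) (trans (cong (λ x → val G (answer ts x)) (gather-val G (λ v → ask (single v) ret)))
      (trans (val-fmap G (lowest δ) (values ts d)) (cong (lowest δ) (trans (gather-val G (λ i → candidate d (lookup ts i) >>= measure))
        (tabulate-cong (λ i → val->>= G (candidate d (lookup ts i)) measure))))))

    value-realized : ∀ t → Realized (value t)
    value-realized t = orSingle (properᵇ (lookup S)) S , go (properᵇ (lookup S)) refl , refl
      where
      S = val G (candidate d t)
      go : ∀ b → properᵇ (lookup S) ≡ b → NonemptyProper (orSingle b S)
      go true  h = properᵇ-sound S h
      go false h = single-proper 2≤n j₀

    -- For no choice of seeds does the output fall below the edge connectivity; a single successful
    -- trial among the repetitions therefore makes the minimum correct.
    algorithm-realized : ∀ {K} (ts : Vec Ω K) → Realized (val G (algorithm ts))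
    algorithm-realized ts = subst Realized (sym (algorithm-val ts)) (lowest-elim Realized δ (tabulate (value ∘ lookup ts))
      (δ-elim Realized (λ v → single v , single-proper 2≤n v , cutSize-single v))
      (λ i → subst Realized (sym (lookup∘tabulate (value ∘ lookup ts) i)) (value-realized (lookup ts i))))

    correct : ∀ {K} (ts : Vec Ω K) S → (∀ S′ → NonemptyProper S′ → cutSize G S ≤ cutSize G S′) → val G (algorithm ts) ≤ cutSize G S →
              IsEdgeConnectivity G (run G (compile (algorithm ts)))
    correct ts S minimal le = subst (IsEdgeConnectivity G) (sym (run-compile G (algorithm ts)))
      (algorithm-realized ts , λ S′ p → ≤-trans le (minimal S′ p))

    module _ (S : Subset n) (proper : NonemptyProper S) (minimal : ∀ S′ → NonemptyProper S′ → cutSize G S ≤ cutSize G S′)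
             (above : ∀ v → cutSize G S < deg v) where

      side : Fin n → Bool
      side = lookup S

      side≡ : cutSize G S ≡ cut side
      side≡ = cutSize≡ S

      minimal′ : ∀ (T : Fin n → Bool) → properᵇ T ≡ true → cut side ≤ cut T
      minimal′ T h = subst₂ _≤_ side≡ (trans (cutSize≡ (tabulate T)) (cut-cong (lookup∘tabulate T)))
        (minimal (tabulate T) (properᵇ-sound (tabulate T) (trans (properᵇ-cong (lookup∘tabulate T)) h)))

      cut<δ : suc (cut side) ≤ δ
      cut<δ = δ-elim (suc (cut side) ≤_) (λ v → ≤-trans (≤-reflexive (cong suc (sym side≡))) (above v))

      cut≤ : Phases.cutTotal G side ≤ 2 * δ
      cut≤ = ≤-trans (≤-reflexive (cutTotal≡ side)) (*-monoʳ-≤ 2 (<⇒≤ cut<δ))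

      1≤δ : 1 ≤ δ
      1≤δ = ≤-trans (s≤s z≤n) cut<δ

      half′ : ∀ v → deg v ≤ 2 * Phases.sameDeg G side v
      half′ = half side minimal′ (λ v → ≤-trans (≤-reflexive (cong suc (sym side≡))) (above v))

      lo′ : n ≤ 2 ^ e * δ
      lo′ = least-lo n δ ℓ (≤-trans lo (≤-trans (≤-reflexive (sym (*-identityʳ _))) (*-monoʳ-≤ (2 ^ ℓ) 1≤δ)))

      hi′ : 2 ^ e * δ ≤ 2 * n
      hi′ = least-hi n δ ℓ δ≤n

      open Total G side 1≤n δ 1≤δ δ≤n half′ δ≤ cut≤ ℓ e lo lo′ hi′
      open Succeed sc j₀ G (lookup d) d≡ side 1≤n δ 1≤δ δ≤n half′ δ≤ cut≤ ℓ e lo lo′ hi′ (least≤ n δ ℓ) (properᵇ-complete S proper)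

      ok : Ω → Bool
      ok t = success (proj₁ t) (prefix n δ ℓ (proj₂ t))

      ok-value : ∀ t → ok t ≡ true → value t ≤ cutSize G S
      ok-value t h = ≤-trans (≤-reflexive measured) (≤-trans (proj₂ tc) (≤-reflexive (sym side≡)))
        where
        u = proj₁ t
        v = prefix n δ ℓ (proj₂ t)
        R = val G (trial (lookup d) ℓ e u v)
        tc : NonemptyProper R × cutSize G R ≤ cut side
        tc = trial-cut u v h
        same : val G (candidate d t) ≡ R
        same = truncate-val G limit (single j₀) (trial (lookup d) ℓ e u v)
          (≤-trans (trial-budget u v h) (budget≤ ℓ n M₀ (log-cost ℓ n hi)))
        measured : value t ≡ cutSize G R
        measured = trans (cong (λ X → val G (measure X)) same) (cong (λ b → cutSize G (orSingle b R)) (properᵇ-complete R (proj₁ tc)))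

      dense : length seedList ≤ oddsFactor * ∑ seedList (λ t → ⟦ ok t ⟧)
      dense = subst₂ _≤_ (sym (trans (length≡∑ seedList) (∑-seeds (steps n) (suc ℓ) (λ _ → 1)))) (cong (oddsFactor *_) (sym (∑-seeds (steps n) (suc ℓ) (λ t → ⟦ ok t ⟧))))
        (pairs-prefix (steps n) n δ ℓ oddsFactor (λ u v → ⟦ success u v ⟧) (≤-trans (mass-pos e) (≤-reflexive (sym (∑ˢ-all e))))
          (≤-trans (≤-reflexive (cong₂ _*_ (∑ˢ-all ℓ) (∑ˢ-all e))) count-success))
        where
        mass-pos : ∀ e → 1 ≤ Means.mass G side 1≤n e
        mass-pos zero    = *-mono-≤ 1≤n (m^n>0 2 n)
        mass-pos (suc e) = *-mono-≤ (mass-pos e) (mass-pos e)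

    runs : List (Vec Ω (2 * oddsFactor))
    runs = tuples seedList (2 * oddsFactor)

    Reliable : Set
    Reliable = ∃ λ (test : Vec Ω (2 * oddsFactor) → Bool) → 2 * length runs ≤ 3 * ∑ runs (λ t → ⟦ test t ⟧) ×
                 (∀ t → test t ≡ true → IsEdgeConnectivity G (run G (compile (algorithm t))))

    module _ (S : Subset n) (proper : NonemptyProper S) (minimal : ∀ S′ → NonemptyProper S′ → cutSize G S ≤ cutSize G S′) where

      reliable-singleton : (∃ λ v → deg v ≤ cutSize G S) → Reliable
      reliable-singleton (v , h) = (λ _ → true) , *-mono-≤ {2} {3} (s≤s (s≤s z≤n)) (≤-reflexive (length≡∑ runs)) ,
        λ t _ → correct t S minimal (≤-trans (≤-reflexive (algorithm-val t)) (≤-trans (lowest≤head δ (tabulate (value ∘ lookup t))) (≤-trans (δ≤ v) h)))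

      reliable-interior : (∀ v → cutSize G S < deg v) → Reliable
      reliable-interior above = some good-seed , amplified good-seed seedList oddsFactor seedList-pos (dense S proper minimal above) ,
        λ t h → let (i , g) = some-∃ good-seed t h in correct t S minimal (≤-trans (≤-reflexive (algorithm-val t))
          (≤-trans (lowest≤ δ (tabulate (value ∘ lookup t)) i) (≤-trans (≤-reflexive (lookup∘tabulate (value ∘ lookup t) i)) (ok-value S proper minimal above (lookup t i) g))))
        where
        good-seed : Ω → Bool
        good-seed = ok S proper minimal above

      -- If some degree is as small as the minimum cut, the degrees alone make every run correct.
      -- Otherwise the minimum cut lies strictly below all degrees, which is what the analysis of
      -- the contraction requires.
      reliable : Reliable
      reliable = go (any? (λ v → deg v ≤? cutSize G S))
        where
        go : Dec (∃ λ v → deg v ≤ cutSize G S) → Reliable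
        go (yes h) = reliable-singleton h
        go (no ¬h) = reliable-interior (λ v → ≰⇒> (λ le → ¬h (v , le)))

theorem1p1 : ∃[ c ] ∀ (n : ℕ) → 2 ≤ n →
    Σ ℕ λ m → 1 ≤ m × Σ (Fin m → QTree n) λ T →
    (∀ i → DepthAtMost (T i) (c * n)) ×
    (∀ (G : SimpleGraph n) → ∃[ good ]
    (2 * m ≤ 3 * ∣ good ∣ × (∀ i → i ∈ good → IsEdgeConnectivity G (run G (T i)))))
-- There are `n` queries for the degrees and `2 * oddsFactor` trials of at most `trialFactor * n`
-- queries, each followed by one query that measures its result. The trees are indexed by the list
-- of all tuples of seeds, so a uniform index is a uniform tuple.
theorem1p1 = 1 + 2 * oddsFactor * (trialFactor + 1) , λ n 2≤n → forSize n 2≤n (power-above n (≤-trans (s≤s z≤n) 2≤n))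
  where
  forSize : ∀ n → 2 ≤ n → (∃ λ ℓ → n ≤ 2 ^ ℓ × 2 ^ ℓ ≤ 2 * n) →
    Σ ℕ λ m → 1 ≤ m × Σ (Fin m → QTree n) λ T →
    (∀ i → DepthAtMost (T i) ((1 + 2 * oddsFactor * (trialFactor + 1)) * n)) ×
    (∀ (G : SimpleGraph n) → ∃[ good ]
    (2 * m ≤ 3 * ∣ good ∣ × (∀ i → i ∈ good → IsEdgeConnectivity G (run G (T i)))))
  forSize n 2≤n (ℓ , lo , hi) = length list , pos , (λ i → compile (algorithm (lookupˡ list i))) , (λ i → compile-depth (algorithm-depth (lookupˡ list i))) ,
    λ G → let (S , proper , minimal) = MinCut.minCut G 2≤n j₀ in subsetOf G (reliable G S proper minimal)
    where
    open EdgeConnectivity n 2≤n ℓ lo hi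
    list : List (Vec Ω (2 * oddsFactor))
    list = tuples seedList (2 * oddsFactor)
    pos : 1 ≤ length list
    pos = ≤-trans (m^n>0 (length seedList) {{>-nonZero seedList-pos}} (2 * oddsFactor)) (≤-reflexive (sym (length-tuples seedList (2 * oddsFactor))))
    subsetOf : ∀ G → Reliable G → ∃[ good ] (2 * length list ≤ 3 * ∣ good ∣ × (∀ i → i ∈ good → IsEdgeConnectivity G (run G (compile (algorithm (lookupˡ list i))))))
    subsetOf G (test , many , sound) = tabulate (λ i → test (lookupˡ list i)) ,
      ≤-trans many (≤-reflexive (cong (3 *_) (sym (∣tabulate∣ list test)))) ,
      λ i i∈ → sound (lookupˡ list i) (trans (sym (lookup∘tabulate (λ i → test (lookupˡ list i)) i)) ([]=⇒lookup i∈))
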